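{- There is a polynomial $g\in \mathbb{Z}[t;x_1,\ldots ,x_{418}]$ of degree $28$ such that, for any $t\in \mathbb{Q}$, $$t\in \mathbb{Z}\iff \text{for all } x_1,\ldots ,x_{418}\in \mathbb{Q}:\ g(t;x_1,\ldots ,x_{418})\neq 0.$$ -}

module Defs where

open import Data.Nat as ℕ using (ℕ; zero; suc; _⊔_)
open import Data.Integer as ℤ using (ℤ)
open import Data.Rational as ℚ using (ℚ; 0ℚ; 1ℚ; _/_)
open import Data.Fin using (Fin)
open import Data.Vec using (Vec; lookup; zipWith; foldr)
open import Data.List as List using (List; map)
open import Data.List.Relation.Unary.All using (All)
open import Data.List.Relation.Unary.Unique.Propositional using (Unique)
open import Data.Product using (_×_; _,_; proj₁; proj₂; ∃-syntax)
open import Relation.Binary.PropositionalEquality using (_≡_; _≢_)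

Monomial : ℕ → Set
Monomial n = ℤ × Vec ℕ n

Poly : ℕ → Set
Poly n = List (Monomial n)

-- Canonical (reduced) form: all coefficients nonzero and all exponent
-- vectors pairwise distinct.  Every polynomial of ℤ[y] has exactly one such
-- representation (up to ordering), so the total degree below is the
-- genuine total degree.
IsReduced : ∀ {n} → Poly n → Set
IsReduced p = All (λ m → proj₁ m ≢ ℤ.+ 0) p × Unique (map proj₂ p)

monoDeg : ∀ {n} → Vec ℕ n → ℕ
monoDeg = foldr _ ℕ._+_ 0

totalDegree : ∀ {n} → Poly n → ℕ
totalDegree p = List.foldr _⊔_ 0 (map (λ m → monoDeg (proj₂ m)) p)

_^ℚ_ : ℚ → ℕ → ℚ
q ^ℚ zero  = 1ℚ
q ^ℚ suc k = q ℚ.* (q ^ℚ k)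

ℤ→ℚ : ℤ → ℚ
ℤ→ℚ z = z / 1

evalMono : ∀ {n} → Monomial n → Vec ℚ n → ℚ
evalMono (c , e) v = ℤ→ℚ c ℚ.* foldr _ ℚ._*_ 1ℚ (zipWith _^ℚ_ v e)

eval : ∀ {n} → Poly n → Vec ℚ n → ℚ
eval p v = List.foldr ℚ._+_ 0ℚ (map (λ m → evalMono m v) p)

IsInteger : ℚ → Set
IsInteger t = ∃[ z ] t ≡ ℤ→ℚ z

-- The polynomial is g = f² + y²⁸ with f = (1 + a w₁² + b w₂² + a b w₃²) (1 + a)² (1 + b)² − 2¹⁰ a b (1 + t¹⁰), where a and b
-- are sums of four squares of variables; a root of g is a zero of f together with y = 0.
--
-- Let t be an integer. Clearing denominators, a zero of f becomes a relation
-- N(w) N(u)² N(v)² = 2¹⁰ (1 + t¹⁰) w₀² u₀² v₀² G(u , v), where N is the norm form of the definite quaternion algebra (−a , −b) over ℚ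
-- and G a Gram determinant on pure quaternions. Similitudes preserve this relation, so a descent on a + b finds an odd ramified
-- prime or ends at a = b = 1, which is ramified at 2. At a ramified prime the norm form is anisotropic, and comparing valuations
-- gives a contradiction; the factor 2¹⁰ is needed at the prime 2.
--
-- Let t = m / e in lowest terms and let p be a prime factor of e. For odd p take b = p / j² and a = ℓ₁ / k² with an auxiliary
-- prime ℓ₁. Then f = 0 asks that a positive integer p n g², with n squarefree and prime to p, be represented by the form
-- ⟨ℓ₁ , p , ℓ₁ p⟩ over ℚ. It is, if X² + ℓ₂ Y² = n Z² and X² + p Y² = ℓ₁ ℓ₂ Z² are solvable for some prime ℓ₂, and by Legendre's
-- theorem and quadratic reciprocity this only prescribes ℓ₁ and ℓ₂ modulo 8 and quadratic symbols of ℓ₁ and ℓ₂. For p = 2 take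
-- a = 1 and b = 2.
--
-- Primes with prescribed symbols exist without L-functions. Compose the operators W ↦ Σₑ φ(e) W(e m) for all products φ of the
-- characters involved. If no prime below N had the prescribed symbols, peeling off the primes one by one would bound the result at 1
-- from below by a sum over squares, while the cancellation in the character sums bounds it by a smaller power of N up to logarithms.
module Submission where

open import Defs

-- In (-a , -b) with basis 1 , i , j , k put u = 1 + i and v = 1 + j. Then (1 + a)² (1 + b)² = N(u)²
-- N(v)², and a b is the Gram determinant G of i and j, so f = 0 reads N(w) / w₀² = 2¹⁰ (1 + t¹⁰) ·
-- u₀² v₀² G / (N(u) N(v))². At an odd ramified prime anisotropy makes the left side of valuation at
-- most 0 and the last quotient of positive valuation, whatever a and b are; only a denominator of t
-- can restore the balance. The squares on 1 + a and 1 + b are what makes this uniform in a and b.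
-- The obstacle to the converse is the real place: the first factor of f is at least 1, so a zero
-- needs (1 + a)² (1 + b)² ≤ 2¹⁰ a b (1 + t¹⁰). Hence a and b are kept within a factor 4 of 1, where
-- the left side is at most 100 a b, and 1 + t¹⁰ stands in place of t¹⁰, which may be tiny. The
-- exponent 10 comes from the prime 2: if e is even, e⁵ is divisible by 2⁵, and e¹⁰ absorbs the 2¹⁰.
-- It also balances the degrees: the two terms of f have degrees 6 + 4 + 4 and 4 + 10, so f² has
-- degree 28.

-- Finite differences of weights and partial summation.

module Smooth where
  open import Data.Nat as ℕ using (ℕ; zero; suc; z≤n; s≤s)
  import Data.Nat.Properties as ℕP
  open import Data.Integer using (ℤ; +_; 0ℤ; ∣_∣; _+_; _*_; _-_; -_)
  import Data.Integer.Properties as ℤP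
  open import Data.Integer.Tactic.RingSolver using (solve-∀)
  import Data.Nat.Tactic.RingSolver as ℕR
  open import Relation.Binary.PropositionalEquality

  Σ : ℕ → (ℕ → ℤ) → ℤ
  Σ zero    f = 0ℤ
  Σ (suc n) f = Σ n f + f n

  Σℕ : ℕ → (ℕ → ℕ) → ℕ
  Σℕ zero    f = 0
  Σℕ (suc n) f = Σℕ n f ℕ.+ f n

  Σ-cong : ∀ n {f g : ℕ → ℤ} → (∀ i → i ℕ.< n → f i ≡ g i) → Σ n f ≡ Σ n g
  Σ-cong zero    h = refl
  Σ-cong (suc n) h = cong₂ _+_ (Σ-cong n (λ i i<n → h i (ℕP.m<n⇒m<1+n i<n))) (h n ℕP.≤-refl)

  Σ-+ : ∀ n (f g : ℕ → ℤ) → Σ n (λ i → f i + g i) ≡ Σ n f + Σ n g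
  Σ-+ zero    f g = refl
  Σ-+ (suc n) f g = trans (cong (_+ (f n + g n)) (Σ-+ n f g)) (rearr (Σ n f) (Σ n g) (f n) (g n))
    where
    rearr : ∀ a b c d → a + b + (c + d) ≡ a + c + (b + d)
    rearr = solve-∀

  Σ-* : ∀ n c (f : ℕ → ℤ) → Σ n (λ i → c * f i) ≡ c * Σ n f
  Σ-* zero    c f = sym (ℤP.*-zeroʳ c)
  Σ-* (suc n) c f = trans (cong (_+ c * f n) (Σ-* n c f)) (sym (ℤP.*-distribˡ-+ c (Σ n f) (f n)))

  Σ-neg : ∀ n (f : ℕ → ℤ) → Σ n (λ i → - f i) ≡ - Σ n f
  Σ-neg zero    f = refl
  Σ-neg (suc n) f = trans (cong (_+ - f n) (Σ-neg n f)) (sym (ℤP.neg-distrib-+ (Σ n f) (f n)))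

  Σ-- : ∀ n (f g : ℕ → ℤ) → Σ n (λ i → f i - g i) ≡ Σ n f - Σ n g
  Σ-- n f g = trans (Σ-+ n f (λ i → - g i)) (cong (λ z → Σ n f + z) (Σ-neg n g))

  ∣Σ∣≤ : ∀ n (f : ℕ → ℤ) → ∣ Σ n f ∣ ℕ.≤ Σℕ n (λ i → ∣ f i ∣)
  ∣Σ∣≤ zero    f = z≤n
  ∣Σ∣≤ (suc n) f = ℕP.≤-trans (ℤP.∣i+j∣≤∣i∣+∣j∣ (Σ n f) (f n)) (ℕP.+-monoˡ-≤ _ (∣Σ∣≤ n f))

  Σℕ-mono : ∀ n {f g : ℕ → ℕ} → (∀ i → i ℕ.< n → f i ℕ.≤ g i) → Σℕ n f ℕ.≤ Σℕ n g
  Σℕ-mono zero    h = z≤n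
  Σℕ-mono (suc n) h = ℕP.+-mono-≤ (Σℕ-mono n (λ i i<n → h i (ℕP.m<n⇒m<1+n i<n))) (h n ℕP.≤-refl)

  Σℕ-* : ∀ n c (f : ℕ → ℕ) → Σℕ n (λ i → c ℕ.* f i) ≡ c ℕ.* Σℕ n f
  Σℕ-* zero    c f = sym (ℕP.*-zeroʳ c)
  Σℕ-* (suc n) c f = trans (cong (ℕ._+ c ℕ.* f n) (Σℕ-* n c f)) (sym (ℕP.*-distribˡ-+ c (Σℕ n f) (f n)))

  Σℕ-split : ∀ m n (f : ℕ → ℕ) → Σℕ (m ℕ.+ n) f ≡ Σℕ m f ℕ.+ Σℕ n (λ i → f (m ℕ.+ i))
  Σℕ-split m zero    f = trans (cong (λ k → Σℕ k f) (ℕP.+-identityʳ m)) (sym (ℕP.+-identityʳ _))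
  Σℕ-split m (suc n) f = trans (cong (λ k → Σℕ k f) (ℕP.+-suc m n))
    (trans (cong (ℕ._+ f (m ℕ.+ n)) (Σℕ-split m n f)) (ℕP.+-assoc (Σℕ m f) _ _))

  Σℕ-const : ∀ n c → Σℕ n (λ _ → c) ≡ n ℕ.* c
  Σℕ-const zero    c = refl
  Σℕ-const (suc n) c = trans (cong (ℕ._+ c) (Σℕ-const n c)) (ℕP.+-comm (n ℕ.* c) c)

  -- The harmonic series cut at powers of 2: where f e is at most X / e, each dyadic block costs at
  -- most X, and the logarithm appears as `n` without any division.
  Σℕ-dyadic : ∀ n (f : ℕ → ℕ) X → f 0 ≡ 0 → (∀ e → e ℕ.* f e ℕ.≤ X) → Σℕ (2 ℕ.^ n) f ℕ.≤ n ℕ.* X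
  Σℕ-dyadic zero    f X f0 h rewrite f0 = z≤n
  Σℕ-dyadic (suc n) f X f0 h = begin
    Σℕ (2 ℕ.^ suc n) f                                ≡⟨ cong (λ k → Σℕ (N ℕ.+ k) f) (ℕP.+-identityʳ N) ⟩
    Σℕ (N ℕ.+ N) f                                    ≡⟨ Σℕ-split N N f ⟩
    Σℕ N f ℕ.+ Σℕ N (λ i → f (N ℕ.+ i))               ≤⟨ ℕP.+-mono-≤ (Σℕ-dyadic n f X f0 h) block ⟩
    n ℕ.* X ℕ.+ X                                     ≡⟨ ℕP.+-comm (n ℕ.* X) X ⟩
    suc n ℕ.* X                                       ∎
    where
    open ℕP.≤-Reasoning
    N = 2 ℕ.^ n
    instance
      _ : ℕ.NonZero N
      _ = ℕP.m^n≢0 2 n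
    block : Σℕ N (λ i → f (N ℕ.+ i)) ℕ.≤ X
    block = ℕP.*-cancelˡ-≤ N (begin
      N ℕ.* Σℕ N (λ i → f (N ℕ.+ i))       ≡⟨ sym (Σℕ-* N N _) ⟩
      Σℕ N (λ i → N ℕ.* f (N ℕ.+ i))       ≤⟨ Σℕ-mono N (λ i _ → ℕP.≤-trans (ℕP.*-monoˡ-≤ _ (ℕP.m≤m+n N i)) (h (N ℕ.+ i))) ⟩
      Σℕ N (λ _ → X)                       ≡⟨ Σℕ-const N X ⟩
      N ℕ.* X                              ∎)

  Δ : (ℕ → ℤ) → ℕ → ℤ
  Δ f m = f (suc m) - f m

  -- A unit step of `d` moves `e * d` by `e`, so a difference in `d` of `W (e * d)` is a difference
  -- of `W` with step `e`.
  δ : ℕ → (ℕ → ℤ) → ℕ → ℤ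
  δ e f m = f (e ℕ.+ m) - f m

  Δ^ : ℕ → (ℕ → ℤ) → ℕ → ℤ
  Δ^ zero    f = f
  Δ^ (suc j) f = Δ (Δ^ j f)

  δ^ : ℕ → ℕ → (ℕ → ℤ) → ℕ → ℤ
  δ^ e zero    f = f
  δ^ e (suc j) f = δ^ e j (δ e f)

  Δ^-cong : ∀ j {f g : ℕ → ℤ} → (∀ m → f m ≡ g m) → ∀ m → Δ^ j f m ≡ Δ^ j g m
  Δ^-cong zero    h m = h m
  Δ^-cong (suc j) h m = cong₂ _-_ (Δ^-cong j h (suc m)) (Δ^-cong j h m)

  δ^-cong : ∀ e j {f g : ℕ → ℤ} → (∀ m → f m ≡ g m) → ∀ m → δ^ e j f m ≡ δ^ e j g m
  δ^-cong e zero    h m = h m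
  δ^-cong e (suc j) h m = δ^-cong e j (λ k → cong₂ _-_ (h (e ℕ.+ k)) (h k)) m

  Δ^-Δ : ∀ j f m → Δ^ j (Δ f) m ≡ Δ^ (suc j) f m
  Δ^-Δ zero    f m = refl
  Δ^-Δ (suc j) f m = cong₂ _-_ (Δ^-Δ j f (suc m)) (Δ^-Δ j f m)

  interchange : ∀ a b c d → a - b - (c - d) ≡ a - c - (b - d)
  interchange = solve-∀

  Δ^-δ : ∀ j e f m → Δ^ j (δ e f) m ≡ δ e (Δ^ j f) m
  Δ^-δ zero    e f m = refl
  Δ^-δ (suc j) e f m = trans (cong₂ _-_ (Δ^-δ j e f (suc m)) (Δ^-δ j e f m))
    (trans (cong (λ k → Δ^ j f k - Δ^ j f (suc m) - (Δ^ j f (e ℕ.+ m) - Δ^ j f m)) (ℕP.+-suc e m))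
      (interchange (Δ^ j f (suc (e ℕ.+ m))) (Δ^ j f (suc m)) (Δ^ j f (e ℕ.+ m)) (Δ^ j f m)))

  δ-Δ : ∀ e f m → δ e (Δ f) m ≡ Δ (δ e f) m
  δ-Δ e f m = sym (Δ^-δ 1 e f m)

  δ^-Δ : ∀ e j f m → δ^ e j (Δ f) m ≡ Δ (δ^ e j f) m
  δ^-Δ e zero    f m = refl
  δ^-Δ e (suc j) f m = trans (δ^-cong e j (δ-Δ e f) m) (δ^-Δ e j (δ e f) m)

  δ^-sub : ∀ e j f g m → δ^ e j (λ k → f k - g k) m ≡ δ^ e j f m - δ^ e j g m
  δ^-sub e zero    f g m = refl
  δ^-sub e (suc j) f g m = trans
    (δ^-cong e j (λ k → interchange (f (e ℕ.+ k)) (g (e ℕ.+ k)) (f k) (g k)) m)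
    (δ^-sub e j (δ e f) (δ e g) m)

  δ-suc : ∀ e f m → δ (suc e) f m ≡ δ e f m + Δ f (e ℕ.+ m)
  δ-suc e f m = telescope (f (suc (e ℕ.+ m))) (f (e ℕ.+ m)) (f m)
    where
    telescope : ∀ a b c → a - c ≡ b - c + (a - b)
    telescope = solve-∀

  c∣i+j∣≤ : ∀ c i j {x y} → c ℕ.* ∣ i ∣ ℕ.≤ x → c ℕ.* ∣ j ∣ ℕ.≤ y → c ℕ.* ∣ i + j ∣ ℕ.≤ x ℕ.+ y
  c∣i+j∣≤ c i j p q = ℕP.≤-trans (ℕP.*-monoʳ-≤ c (ℤP.∣i+j∣≤∣i∣+∣j∣ i j))
    (ℕP.≤-trans (ℕP.≤-reflexive (ℕP.*-distribˡ-+ c ∣ i ∣ ∣ j ∣)) (ℕP.+-mono-≤ p q))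

  ≡⇒≤ˡ : ∀ c {i j : ℤ} {x} → i ≡ j → c ℕ.* ∣ j ∣ ℕ.≤ x → c ℕ.* ∣ i ∣ ℕ.≤ x
  ≡⇒≤ˡ c refl p = p

  -- A bound on Δ f beyond m₀, carried with a multiplier c so that no division is needed.
  Above : ℕ → ℕ → ℕ → (ℕ → ℤ) → Set
  Above c m₀ B f = ∀ m → m₀ ℕ.≤ m → c ℕ.* ∣ f m ∣ ℕ.≤ B

  δ-bound : ∀ c {m₀ B} e f → Above c m₀ B (Δ f) → Above c m₀ (e ℕ.* B) (δ e f)
  δ-bound c zero f h m m₀≤m = ≡⇒≤ˡ c (ℤP.+-inverseʳ (f m)) (ℕP.≤-reflexive (ℕP.*-zeroʳ c))
  δ-bound c {m₀} {B} (suc e) f h m m₀≤m = ≡⇒≤ˡ c (δ-suc e f m)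
    (ℕP.≤-trans (c∣i+j∣≤ c (δ e f m) (Δ f (e ℕ.+ m)) (δ-bound c e f h m m₀≤m) (h _ (ℕP.≤-trans m₀≤m (ℕP.m≤n+m m e))))
      (ℕP.≤-reflexive (ℕP.+-comm (e ℕ.* B) B)))

  δ^-bound : ∀ c {m₀ B} e j f → Above c m₀ B (Δ^ j f) → Above c m₀ (e ℕ.^ j ℕ.* B) (δ^ e j f)
  δ^-bound c {m₀} {B} e zero f h m p = ℕP.≤-trans (h m p) (ℕP.≤-reflexive (sym (ℕP.*-identityˡ B)))
  δ^-bound c {m₀} {B} e (suc j) f h m p = ℕP.≤-trans
    (δ^-bound c {B = e ℕ.* B} e j (δ e f) (λ k q → ≡⇒≤ˡ c (Δ^-δ j e f k) (δ-bound c e (Δ^ j f) h k q)) m p)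
    (ℕP.≤-reflexive (assoc' (e ℕ.^ j) e B))
    where
    assoc' : ∀ x y z → x ℕ.* (y ℕ.* z) ≡ y ℕ.* x ℕ.* z
    assoc' = ℕR.solve-∀

  ^-distribʳ-* : ∀ x y j → (x ℕ.* y) ℕ.^ j ≡ x ℕ.^ j ℕ.* y ℕ.^ j
  ^-distribʳ-* x y zero    = refl
  ^-distribʳ-* x y (suc j) = trans (cong (x ℕ.* y ℕ.*_) (^-distribʳ-* x y j)) (swap x y (x ℕ.^ j) (y ℕ.^ j))
    where
    swap : ∀ a b c d → a ℕ.* b ℕ.* (c ℕ.* d) ≡ a ℕ.* c ℕ.* (b ℕ.* d)
    swap = ℕR.solve-∀

  suc^≤ : ∀ e j → suc (suc e) ℕ.^ j ℕ.≤ 2 ℕ.^ j ℕ.* suc e ℕ.^ j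
  suc^≤ e j = ℕP.≤-trans (ℕP.^-monoˡ-≤ j (s≤s (ℕP.≤-trans (s≤s (ℕP.m≤m+n e (e ℕ.+ 0))) (ℕP.≤-reflexive (sym (ℕP.+-suc e (e ℕ.+ 0)))))))
    (ℕP.≤-reflexive (^-distribʳ-* 2 (suc e) j))

  -- The `j` factors of step `suc (suc e)` are exchanged for factors of step `suc e` one at a time.
  -- The difference of the two operators is a shifted unit difference, smaller than either by a
  -- factor `suc e`, which is the factor gained on the left. The `2 ^ j` pays for replacing powers
  -- of `suc (suc e)` by powers of `suc e`.
  δ^-step : ∀ c {m₀ B} e j f → Above c m₀ B (Δ^ j f) → ∀ m → m₀ ℕ.≤ m →
    c ℕ.* (suc e ℕ.* ∣ δ^ (suc (suc e)) j f m - δ^ (suc e) j f m ∣) ℕ.≤ 2 ℕ.^ j ℕ.* (suc e ℕ.^ j ℕ.* B)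
  δ^-step c {m₀} {B} e zero f h m p = ℕP.≤-trans (ℕP.≤-reflexive (trans (cong (λ i → c ℕ.* (suc e ℕ.* ∣ i ∣)) (ℤP.+-inverseʳ (f m)))
    (trans (cong (c ℕ.*_) (ℕP.*-zeroʳ (suc e))) (ℕP.*-zeroʳ c)))) z≤n
  δ^-step c {m₀} {B} e (suc j) f h m p = begin
    c ℕ.* (E ℕ.* ∣ δ^ F j (δ F f) m - δ^ E j (δ E f) m ∣)
      ≡⟨ cong (λ i → c ℕ.* (E ℕ.* ∣ i ∣)) (split (δ^ F j (δ F f) m) (δ^ F j (δ E f) m) (δ^ E j (δ E f) m)) ⟩
    c ℕ.* (E ℕ.* ∣ x + y ∣)
      ≡⟨ ℕP.*-assoc c E _ ⟨
    c ℕ.* E ℕ.* ∣ x + y ∣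
      ≤⟨ c∣i+j∣≤ (c ℕ.* E) x y xb yb ⟩
    E ℕ.* (F ℕ.^ j ℕ.* B) ℕ.+ 2 ℕ.^ j ℕ.* (E ℕ.^ j ℕ.* (E ℕ.* B))
      ≤⟨ ℕP.+-monoˡ-≤ _ (ℕP.*-monoʳ-≤ E (ℕP.*-monoˡ-≤ B (suc^≤ e j))) ⟩
    E ℕ.* (2 ℕ.^ j ℕ.* E ℕ.^ j ℕ.* B) ℕ.+ 2 ℕ.^ j ℕ.* (E ℕ.^ j ℕ.* (E ℕ.* B))
      ≡⟨ collect E (2 ℕ.^ j) (E ℕ.^ j) B ⟩
    2 ℕ.^ suc j ℕ.* (E ℕ.^ suc j ℕ.* B) ∎
    where
    open ℕP.≤-Reasoning
    E = suc e
    F = suc (suc e)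
    x = δ^ F j (δ F f) m - δ^ F j (δ E f) m
    y = δ^ F j (δ E f) m - δ^ E j (δ E f) m
    split : ∀ a b d → a - d ≡ a - b + (b - d)
    split = solve-∀
    collect : ∀ E t u B → E ℕ.* (t ℕ.* u ℕ.* B) ℕ.+ t ℕ.* (u ℕ.* (E ℕ.* B)) ≡ 2 ℕ.* t ℕ.* (E ℕ.* u ℕ.* B)
    collect = ℕR.solve-∀
    cancel : ∀ a b → a + b - a ≡ b
    cancel = solve-∀
    x' = δ^ F j (λ k → Δ f (E ℕ.+ k)) m
    x≡ : x ≡ x'
    x≡ = trans (sym (δ^-sub F j (δ F f) (δ E f) m))
      (δ^-cong F j (λ k → trans (cong (_- δ E f k) (δ-suc E f k)) (cancel (δ E f k) (Δ f (E ℕ.+ k)))) m)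
    shift : ∀ j k → Δ^ j (λ i → Δ f (E ℕ.+ i)) k ≡ Δ^ j (Δ f) (E ℕ.+ k)
    shift zero    k = refl
    shift (suc j) k = cong₂ _-_ (trans (shift j (suc k)) (cong (Δ^ j (Δ f)) (ℕP.+-suc E k))) (shift j k)
    xb : c ℕ.* E ℕ.* ∣ x ∣ ℕ.≤ E ℕ.* (F ℕ.^ j ℕ.* B)
    xb = ≡⇒≤ˡ (c ℕ.* E) x≡ (ℕP.≤-trans (ℕP.≤-reflexive (trans (cong (ℕ._* ∣ x' ∣) (ℕP.*-comm c E)) (ℕP.*-assoc E c ∣ x' ∣)))
      (ℕP.*-monoʳ-≤ E (δ^-bound c {m₀} F j (λ k → Δ f (E ℕ.+ k))
        (λ k q → ≡⇒≤ˡ c (trans (shift j k) (Δ^-Δ j f _)) (h _ (ℕP.≤-trans q (ℕP.m≤n+m k E)))) m p)))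
    yb : c ℕ.* E ℕ.* ∣ y ∣ ℕ.≤ 2 ℕ.^ j ℕ.* (E ℕ.^ j ℕ.* (E ℕ.* B))
    yb = ℕP.≤-trans (ℕP.≤-reflexive (ℕP.*-assoc c E _))
      (δ^-step c {m₀} e j (δ E f) (λ k q → ≡⇒≤ˡ c (Δ^-δ j E f k) (δ-bound c E (Δ^ j f) h k q)) m p)

  -- Discrete form of the bounds x^j W^(j)(x) = O(B). The factor `m ^ j` makes the condition scale
  -- correctly under the dilations `e * m`.
  Smooth : ℕ → ℕ → (ℕ → ℤ) → Set
  Smooth R B W = ∀ j → j ℕ.≤ R → ∀ m → 1 ℕ.≤ m → m ℕ.^ j ℕ.* ∣ Δ^ j W m ∣ ℕ.≤ B

  Vanishes : ℕ → (ℕ → ℤ) → Set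
  Vanishes N W = ∀ m → N ℕ.≤ m → W m ≡ 0ℤ

  smooth-above : ∀ {R B W} → Smooth R B W → ∀ j → j ℕ.≤ R → ∀ m → 1 ℕ.≤ m → Above (m ℕ.^ j) m B (Δ^ j W)
  smooth-above s j j≤R m 1≤m m' m≤m' = ℕP.≤-trans (ℕP.*-monoˡ-≤ _ (ℕP.^-monoˡ-≤ j m≤m')) (s j j≤R m' (ℕP.≤-trans 1≤m m≤m'))

  A : ℕ → (ℕ → ℤ) → (ℕ → ℤ) → ℕ → ℤ
  A N φ W d = Σ N (λ e → φ e * W (e ℕ.* d))

  δ^-δ : ∀ e j W m → δ^ e j (δ e W) m ≡ δ e (δ^ e j W) m
  δ^-δ e zero    W m = refl
  δ^-δ e (suc j) W m = δ^-δ e j (δ e W) m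

  *-distribˡ-- : ∀ a b c → a * b - a * c ≡ a * (b - c)
  *-distribˡ-- = solve-∀

  Δ^-A : ∀ N φ W j d → Δ^ j (A N φ W) d ≡ Σ N (λ e → φ e * δ^ e j W (e ℕ.* d))
  Δ^-A N φ W zero    d = refl
  Δ^-A N φ W (suc j) d = trans (cong₂ _-_ (Δ^-A N φ W j (suc d)) (Δ^-A N φ W j d))
    (trans (sym (Σ-- N _ _)) (Σ-cong N (λ e _ → trans (*-distribˡ-- (φ e) _ _)
      (cong (φ e *_) (trans (cong (λ k → δ^ e j W k - δ^ e j W (e ℕ.* d)) (ℕP.*-suc e d)) (sym (δ^-δ e j W (e ℕ.* d))))))))

  abel : ∀ n (φ w : ℕ → ℤ) → Σ n (λ e → φ e * w e) ≡ Σ n φ * w n - Σ n (λ e → Σ (suc e) φ * (w (suc e) - w e))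
  abel zero    φ w = refl
  abel (suc n) φ w = trans (cong (_+ φ n * w n) (abel n φ w))
    (step (Σ n φ) (φ n) (w n) (w (suc n)) (Σ n (λ e → Σ (suc e) φ * (w (suc e) - w e))))
    where
    step : ∀ s f w w' t → s * w - t + f * w ≡ (s + f) * w' - (t + (s + f) * (w' - w))
    step = solve-∀

  δ^-vanish : ∀ {N W} → Vanishes N W → ∀ e j → Vanishes N (δ^ e j W)
  δ^-vanish v e zero    = v
  δ^-vanish v e (suc j) = δ^-vanish (λ m N≤m → cong₂ _-_ (v _ (ℕP.≤-trans N≤m (ℕP.m≤n+m m e))) (v m N≤m)) e j

  A-vanishes : ∀ {N W} M φ → φ 0 ≡ 0ℤ → Vanishes N W → Vanishes N (A M φ W)
  A-vanishes {N} {W} M φ φ0 v m N≤m = trans (Σ-cong M (λ e _ → term e)) (zeros M)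
    where
    term : ∀ e → φ e * W (e ℕ.* m) ≡ 0ℤ
    term zero    = trans (cong (_* W 0) φ0) refl
    term (suc e) = trans (cong (φ (suc e) *_) (v _ (ℕP.≤-trans N≤m (ℕP.m≤m+n m (e ℕ.* m))))) (ℤP.*-zeroʳ (φ (suc e)))
    zeros : ∀ n → Σ n (λ _ → 0ℤ) ≡ 0ℤ
    zeros zero    = refl
    zeros (suc n) = trans (ℤP.+-identityʳ _) (zeros n)

  -- Partial summation replaces φ by its partial sums, bounded by `P`, and leaves the variation in
  -- `e` of `δ^ e j W (e * d)`. That variation costs one further difference of `W` and is O(1/e), so
  -- its sum costs a factor `n`. One order of smoothness and one logarithm are spent but no power of
  -- `2 ^ n`: this is the cancellation in the character sums.
  A-smooth : ∀ n φ P {R B W} → φ 0 ≡ 0ℤ → (∀ k → ∣ Σ k φ ∣ ℕ.≤ P) → Vanishes (2 ℕ.^ n) W →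
    Smooth (suc R) B W → Smooth R (P ℕ.* (n ℕ.* (2 ℕ.^ R ℕ.* B ℕ.+ B))) (A (2 ℕ.^ n) φ W)
  A-smooth n φ P {R} {B} {W} φ0 bounded v s j j≤R d 1≤d = begin
    d ℕ.^ j ℕ.* ∣ Δ^ j (A N φ W) d ∣
      ≡⟨ cong (λ i → d ℕ.^ j ℕ.* ∣ i ∣) (trans (Δ^-A N φ W j d) (trans (abel N φ w) (trans (cong (λ z → Σ N φ * z - T) wN) (drop (Σ N φ) T)))) ⟩
    d ℕ.^ j ℕ.* ∣ - T ∣
      ≡⟨ cong (d ℕ.^ j ℕ.*_) (ℤP.∣-i∣≡∣i∣ T) ⟩
    d ℕ.^ j ℕ.* ∣ T ∣
      ≤⟨ ℕP.*-monoʳ-≤ (d ℕ.^ j) (∣Σ∣≤ N _) ⟩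
    d ℕ.^ j ℕ.* Σℕ N (λ e → ∣ Σ (suc e) φ * (w (suc e) - w e) ∣)
      ≡⟨ Σℕ-* N (d ℕ.^ j) _ ⟨
    Σℕ N (λ e → d ℕ.^ j ℕ.* ∣ Σ (suc e) φ * (w (suc e) - w e) ∣)
      ≤⟨ Σℕ-mono N (λ e _ → term e) ⟩
    Σℕ N (λ e → P ℕ.* f e)
      ≡⟨ Σℕ-* N P f ⟩
    P ℕ.* Σℕ N f
      ≤⟨ ℕP.*-monoʳ-≤ P (Σℕ-dyadic n f _ refl fb) ⟩
    P ℕ.* (n ℕ.* (2 ℕ.^ R ℕ.* B ℕ.+ B)) ∎
    where
    open ℕP.≤-Reasoning
    N = 2 ℕ.^ n
    w : ℕ → ℤ
    w e = δ^ e j W (e ℕ.* d)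
    T = Σ N (λ e → Σ (suc e) φ * (w (suc e) - w e))
    instance
      d≢0 : ℕ.NonZero d
      d≢0 = ℕ.>-nonZero 1≤d
    wN : w N ≡ 0ℤ
    wN = δ^-vanish v N j (N ℕ.* d) (ℕP.m≤m*n N d)
    drop : ∀ a t → a * 0ℤ - t ≡ - t
    drop = solve-∀
    -- The value 0 at 0 suits `Σℕ-dyadic`; it is legitimate because the term `e = 0` vanishes with
    -- `φ 0`.
    f : ℕ → ℕ
    f zero    = 0
    f (suc e) = d ℕ.^ j ℕ.* ∣ w (suc (suc e)) - w (suc e) ∣
    term : ∀ e → d ℕ.^ j ℕ.* ∣ Σ (suc e) φ * (w (suc e) - w e) ∣ ℕ.≤ P ℕ.* f e
    term zero = ℕP.≤-reflexive (trans (cong (λ z → d ℕ.^ j ℕ.* ∣ z * (w 1 - w 0) ∣) (trans (ℤP.+-identityˡ (φ 0)) φ0))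
      (trans (ℕP.*-zeroʳ (d ℕ.^ j)) (sym (ℕP.*-zeroʳ P))))
    term (suc e) = begin
      d ℕ.^ j ℕ.* ∣ Σ (suc (suc e)) φ * u ∣           ≡⟨ cong (d ℕ.^ j ℕ.*_) (ℤP.abs-* (Σ (suc (suc e)) φ) u) ⟩
      d ℕ.^ j ℕ.* (∣ Σ (suc (suc e)) φ ∣ ℕ.* ∣ u ∣)    ≤⟨ ℕP.*-monoʳ-≤ (d ℕ.^ j) (ℕP.*-monoˡ-≤ ∣ u ∣ (bounded (suc (suc e)))) ⟩
      d ℕ.^ j ℕ.* (P ℕ.* ∣ u ∣)                        ≡⟨ swap (d ℕ.^ j) P ∣ u ∣ ⟩
      P ℕ.* (d ℕ.^ j ℕ.* ∣ u ∣)                        ∎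
      where
      u = w (suc (suc e)) - w (suc e)
      swap : ∀ a b c → a ℕ.* (b ℕ.* c) ≡ b ℕ.* (a ℕ.* c)
      swap = ℕR.solve-∀
    fb : ∀ e → e ℕ.* f e ℕ.≤ 2 ℕ.^ R ℕ.* B ℕ.+ B
    fb zero    = z≤n
    fb (suc e) = begin
      E ℕ.* (d ℕ.^ j ℕ.* ∣ w F - w E ∣)                    ≡⟨ ℕP.*-assoc E (d ℕ.^ j) _ ⟨
      E ℕ.* d ℕ.^ j ℕ.* ∣ w F - w E ∣                      ≡⟨ cong (λ i → E ℕ.* d ℕ.^ j ℕ.* ∣ i ∣) (split (w F) (δ^ E j W (F ℕ.* d)) (w E)) ⟩
      E ℕ.* d ℕ.^ j ℕ.* ∣ x + y ∣                          ≤⟨ c∣i+j∣≤ (E ℕ.* d ℕ.^ j) x y xb yb ⟩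
      2 ℕ.^ j ℕ.* B ℕ.+ B                                  ≤⟨ ℕP.+-monoˡ-≤ B (ℕP.*-monoˡ-≤ B (ℕP.^-monoʳ-≤ 2 j≤R)) ⟩
      2 ℕ.^ R ℕ.* B ℕ.+ B ∎
      where
      E = suc e
      F = suc (suc e)
      -- Two things change between `w E` and `w F`: the step of the difference, measured by `x` at
      -- the fixed point `F * d`, and the point, measured by `y` at the fixed step `E`. The first is
      -- `δ^-step`, the second is one more difference, of step `d`.
      x = δ^ F j W (F ℕ.* d) - δ^ E j W (F ℕ.* d)
      y = δ^ E j W (F ℕ.* d) - δ^ E j W (E ℕ.* d)
      split : ∀ a b c → a - c ≡ a - b + (b - c)
      split = solve-∀
      1≤Ed : 1 ℕ.≤ E ℕ.* d
      1≤Ed = ℕP.≤-trans 1≤d (ℕP.m≤m+n d (e ℕ.* d))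
      instance
        E^j≢0 : ℕ.NonZero (E ℕ.^ j)
        E^j≢0 = ℕP.m^n≢0 E j
        dE≢0 : ℕ.NonZero (d ℕ.* E ℕ.^ j)
        dE≢0 = ℕP.m*n≢0 d (E ℕ.^ j)
      xb : E ℕ.* d ℕ.^ j ℕ.* ∣ x ∣ ℕ.≤ 2 ℕ.^ j ℕ.* B
      xb = ℕP.*-cancelˡ-≤ (E ℕ.^ j) (begin
        E ℕ.^ j ℕ.* (E ℕ.* d ℕ.^ j ℕ.* ∣ x ∣)        ≡⟨ reorder (E ℕ.^ j) E (d ℕ.^ j) ∣ x ∣ ⟩
        E ℕ.^ j ℕ.* d ℕ.^ j ℕ.* (E ℕ.* ∣ x ∣)        ≡⟨ cong (ℕ._* (E ℕ.* ∣ x ∣)) (^-distribʳ-* E d j) ⟨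
        (E ℕ.* d) ℕ.^ j ℕ.* (E ℕ.* ∣ x ∣)            ≤⟨ δ^-step ((E ℕ.* d) ℕ.^ j) e j W (smooth-above s j (ℕP.m≤n⇒m≤1+n j≤R) (E ℕ.* d) 1≤Ed) (F ℕ.* d) (ℕP.m≤n+m (E ℕ.* d) d) ⟩
        2 ℕ.^ j ℕ.* (E ℕ.^ j ℕ.* B)                  ≡⟨ swap' (2 ℕ.^ j) (E ℕ.^ j) B ⟩
        E ℕ.^ j ℕ.* (2 ℕ.^ j ℕ.* B)                  ∎)
        where
        reorder : ∀ a b c d → a ℕ.* (b ℕ.* c ℕ.* d) ≡ a ℕ.* c ℕ.* (b ℕ.* d)
        reorder = ℕR.solve-∀
        swap' : ∀ a b c → a ℕ.* (b ℕ.* c) ≡ b ℕ.* (a ℕ.* c)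
        swap' = ℕR.solve-∀
      yb : E ℕ.* d ℕ.^ j ℕ.* ∣ y ∣ ℕ.≤ B
      yb = ℕP.*-cancelˡ-≤ (d ℕ.* E ℕ.^ j) (begin
        d ℕ.* E ℕ.^ j ℕ.* (E ℕ.* d ℕ.^ j ℕ.* ∣ y ∣)  ≡⟨ reorder d (E ℕ.^ j) E (d ℕ.^ j) ∣ y ∣ ⟩
        E ℕ.^ suc j ℕ.* d ℕ.^ suc j ℕ.* ∣ y ∣        ≡⟨ cong (ℕ._* ∣ y ∣) (^-distribʳ-* E d (suc j)) ⟨
        (E ℕ.* d) ℕ.^ suc j ℕ.* ∣ δ d (δ^ E j W) (E ℕ.* d) ∣
          ≤⟨ δ-bound c d (δ^ E j W) (λ m p → ≡⇒≤ˡ c (sym (δ^-Δ E j W m))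
               (δ^-bound c E j (Δ W) (λ k q → ≡⇒≤ˡ c (Δ^-Δ j W k) (smooth-above s (suc j) (s≤s j≤R) (E ℕ.* d) 1≤Ed k q)) m p)) (E ℕ.* d) ℕP.≤-refl ⟩
        d ℕ.* (E ℕ.^ j ℕ.* B)                        ≡⟨ ℕP.*-assoc d _ B ⟨
        d ℕ.* E ℕ.^ j ℕ.* B                          ∎)
        where
        c = (E ℕ.* d) ℕ.^ suc j
        reorder : ∀ d a E c y → d ℕ.* a ℕ.* (E ℕ.* c ℕ.* y) ≡ E ℕ.* a ℕ.* (d ℕ.* c) ℕ.* y
        reorder = ℕR.solve-∀

-- Euler factors of the composed operators, removed one prime at a time.

module Peel where
  open Smooth
  open import Data.Nat as ℕ using (ℕ; zero; suc; z≤n; s≤s)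
  import Data.Nat.Properties as ℕP
  open import Data.Nat.Divisibility using (_∣_; _∣?_; ∣-trans; divides; ∣-refl; ∣m+n∣m⇒∣n; >⇒∤)
  open import Data.Nat.Primality using (Prime; prime?; ¬prime⇒composite)
  open import Data.Integer as ℤ using (ℤ; +_; 0ℤ; 1ℤ; -1ℤ; _+_; _*_; _-_; -_; _≤_)
  import Data.Integer.Properties as ℤP
  open import Data.Integer.Tactic.RingSolver using (solve-∀)
  import Data.Nat.Tactic.RingSolver as ℕR
  open import Data.List using (List; []; _∷_; _++_; map)
  open import Data.List.Relation.Unary.Any using (Any; here; there)
  open import Data.List.Relation.Unary.All using (All; []; _∷_)
  open import Data.Product using (_×_; _,_; ∃)
  open import Data.Sum using (_⊎_; inj₁; inj₂)
  open import Data.Empty using (⊥-elim)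
  open import Relation.Nullary using (Dec; yes; no; ¬_)
  open import Relation.Binary.PropositionalEquality

  record Character : Set where
    no-eta-equality
    field
      fun  : ℕ → ℤ
      mul  : ∀ m n → fun (m ℕ.* n) ≡ fun m * fun n
      one  : fun 1 ≡ 1ℤ
      null : fun 0 ≡ 0ℤ

  open Character public

  infixl 7 _·_
  _·_ : Character → Character → Character
  fun  (χ · ψ) n = fun χ n * fun ψ n
  mul  (χ · ψ) m n = trans (cong₂ _*_ (mul χ m n) (mul ψ m n)) (swap (fun χ m) (fun χ n) (fun ψ m) (fun ψ n))
    where
    swap : ∀ a b c d → a * b * (c * d) ≡ a * c * (b * d)
    swap = solve-∀
  one  (χ · ψ) = cong₂ _*_ (one χ) (one ψ)
  null (χ · ψ) = cong₂ _*_ (null χ) (null ψ)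

  ind : ∀ {P : Set} → Dec P → ℤ
  ind (yes _) = 1ℤ
  ind (no _)  = 0ℤ

  -- rough k is the indicator of the numbers without a divisor in [2 , k].
  rough : ℕ → ℕ → ℤ
  rough zero          e = 1ℤ
  rough (suc zero)    e = 1ℤ
  rough (suc (suc k)) e = (1ℤ - ind (suc (suc k) ∣? e)) * rough (suc k) e

  ind-yes : ∀ {P : Set} (d : Dec P) → P → ind d ≡ 1ℤ
  ind-yes (yes _) p = refl
  ind-yes (no ¬p) p = ⊥-elim (¬p p)

  ind-no : ∀ {P : Set} (d : Dec P) → ¬ P → ind d ≡ 0ℤ
  ind-no (yes p) ¬p = ⊥-elim (¬p p)
  ind-no (no _)  ¬p = refl

  rough-zero : ∀ k d e → 2 ℕ.≤ d → d ℕ.≤ k → d ∣ e → rough k e ≡ 0ℤ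
  rough-zero zero .zero e () z≤n d∣e
  rough-zero (suc zero) d e 2≤d d≤1 d∣e = ⊥-elim (ℕP.<⇒≱ 2≤d d≤1)
  rough-zero (suc (suc k)) d e 2≤d d≤k d∣e = cases (d ℕ.≟ suc (suc k)) (rough-zero (suc k) d e 2≤d)
    where
    cases : Dec (d ≡ suc (suc k)) → (d ℕ.≤ suc k → d ∣ e → rough (suc k) e ≡ 0ℤ) → rough (suc (suc k)) e ≡ 0ℤ
    cases (yes refl) _  = cong (λ i → (1ℤ - i) * rough (suc k) e) (ind-yes (suc (suc k) ∣? e) d∣e)
    cases (no d≢)    ih = trans (cong ((1ℤ - ind (suc (suc k) ∣? e)) *_) (ih (ℕP.≤-pred (ℕP.≤∧≢⇒< d≤k d≢)) d∣e)) (ℤP.*-zeroʳ (1ℤ - ind (suc (suc k) ∣? e)))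

  rough-one : ∀ k → rough k 1 ≡ 1ℤ
  rough-one zero = refl
  rough-one (suc zero) = refl
  rough-one (suc (suc k)) = trans (cong (λ i → (1ℤ - i) * rough (suc k) 1) (ind-no (suc (suc k) ∣? 1) (>⇒∤ (s≤s (s≤s z≤n)))))
    (trans (ℤP.*-identityˡ _) (rough-one (suc k)))

  ind-cong : ∀ {P Q : Set} (p : Dec P) (q : Dec Q) → (P → Q) → (Q → P) → ind p ≡ ind q
  ind-cong (yes _) (yes _) f g = refl
  ind-cong (no _)  (no _)  f g = refl
  ind-cong (yes x) (no ¬y) f g = ⊥-elim (¬y (f x))
  ind-cong (no ¬x) (yes y) f g = ⊥-elim (¬x (g y))

  -- A number in [2 , k] is smaller than the prime `q`, hence coprime to it, and divides `q * e`
  -- only if it divides `e`.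
  rough-prime-* : ∀ {q} → Prime q → ∀ k → k ℕ.< q → ∀ e → rough k (q ℕ.* e) ≡ rough k e
  rough-prime-* pr zero k<q e = refl
  rough-prime-* pr (suc zero) k<q e = refl
  rough-prime-* {q} pr (suc (suc k)) k<q e = cong₂ (λ i r → (1ℤ - i) * r)
    (ind-cong (suc (suc k) ∣? q ℕ.* e) (suc (suc k) ∣? e) to (λ p → ∣-trans p (divides q refl)))
    (rough-prime-* pr (suc k) (ℕP.<-trans (ℕP.n<1+n _) k<q) e)
    where
    open import Data.Nat.Coprimality using (coprime-divisor; prime⇒coprime) renaming (sym to coprime-sym)
    to : suc (suc k) ∣ q ℕ.* e → suc (suc k) ∣ e
    to = coprime-divisor (coprime-sym (prime⇒coprime pr k<q))

  Σ-split : ∀ m n (f : ℕ → ℤ) → Σ (m ℕ.+ n) f ≡ Σ m f + Σ n (λ i → f (m ℕ.+ i))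
  Σ-split m zero    f = trans (cong (λ k → Σ k f) (ℕP.+-identityʳ m)) (sym (ℤP.+-identityʳ _))
  Σ-split m (suc n) f = trans (cong (λ k → Σ k f) (ℕP.+-suc m n))
    (trans (cong (_+ f (m ℕ.+ n)) (Σ-split m n f)) (ℤP.+-assoc (Σ m f) _ _))

  Σ-zero : ∀ n {f : ℕ → ℤ} → (∀ i → i ℕ.< n → f i ≡ 0ℤ) → Σ n f ≡ 0ℤ
  Σ-zero zero    h = refl
  Σ-zero (suc n) h = cong₂ _+_ (Σ-zero n (λ i i<n → h i (ℕP.m<n⇒m<1+n i<n))) (h n ℕP.≤-refl)

  Σ-extend : ∀ {N N' f} → N ℕ.≤ N' → Vanishes N f → Σ N' f ≡ Σ N f
  Σ-extend {N} {N'} {f} N≤N' v = begin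
    Σ N' f                                          ≡⟨ cong (λ k → Σ k f) (ℕP.m+[n∸m]≡n N≤N') ⟨
    Σ (N ℕ.+ (N' ℕ.∸ N)) f                          ≡⟨ Σ-split N (N' ℕ.∸ N) f ⟩
    Σ N f + Σ (N' ℕ.∸ N) (λ i → f (N ℕ.+ i))        ≡⟨ cong (λ z → Σ N f + z) (Σ-zero (N' ℕ.∸ N) (λ i _ → v _ (ℕP.m≤m+n N i))) ⟩
    Σ N f + 0ℤ                                      ≡⟨ ℤP.+-identityʳ _ ⟩
    Σ N f                                           ∎
    where open ≡-Reasoning

  Σ-head : ∀ n (f : ℕ → ℤ) → Σ (suc n) f ≡ f 0 + Σ n (λ i → f (suc i))
  Σ-head n f = trans (Σ-split 1 n f) (cong (_+ Σ n (λ i → f (suc i))) (ℤP.+-identityˡ (f 0)))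

  Σ-multiples : ∀ q .{{_ : ℕ.NonZero q}} n (F : ℕ → ℤ) → Σ (n ℕ.* q) (λ e → ind (q ∣? e) * F e) ≡ Σ n (λ e → F (q ℕ.* e))
  Σ-multiples q zero F = refl
  Σ-multiples q@(suc q') (suc n) F = begin
    Σ (q ℕ.+ n ℕ.* q) G                                       ≡⟨ cong (λ k → Σ k G) (ℕP.+-comm q (n ℕ.* q)) ⟩
    Σ (n ℕ.* q ℕ.+ q) G                                       ≡⟨ Σ-split (n ℕ.* q) q G ⟩
    Σ (n ℕ.* q) G + Σ q (λ i → G (n ℕ.* q ℕ.+ i))             ≡⟨ cong₂ _+_ (Σ-multiples q n F) block ⟩
    Σ n (λ e → F (q ℕ.* e)) + F (q ℕ.* n)                     ∎
    where
    open ≡-Reasoning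
    G : ℕ → ℤ
    G e = ind (q ∣? e) * F e
    first : G (n ℕ.* q ℕ.+ 0) ≡ F (q ℕ.* n)
    first with q ∣? n ℕ.* q ℕ.+ 0
    ... | yes _ = trans (ℤP.*-identityˡ _) (cong F (trans (ℕP.+-identityʳ _) (ℕP.*-comm n q)))
    ... | no ¬p = ⊥-elim (¬p (divides n (ℕP.+-identityʳ _)))
    other : ∀ i → i ℕ.< q' → G (n ℕ.* q ℕ.+ suc i) ≡ 0ℤ
    other i i<q' with q ∣? n ℕ.* q ℕ.+ suc i
    ... | yes p = ⊥-elim (>⇒∤ (s≤s i<q') (∣m+n∣m⇒∣n p (divides n refl)))
    ... | no _  = refl
    block : Σ q (λ i → G (n ℕ.* q ℕ.+ i)) ≡ F (q ℕ.* n)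
    block = trans (Σ-head q' (λ i → G (n ℕ.* q ℕ.+ i))) (trans (cong₂ _+_ first (Σ-zero q' other)) (ℤP.+-identityʳ _))

  Σ-multiples′ : ∀ q .{{_ : ℕ.NonZero q}} N (F : ℕ → ℤ) → Vanishes N F → Σ N (λ e → ind (q ∣? e) * F e) ≡ Σ N (λ e → F (q ℕ.* e))
  Σ-multiples′ q N F v = trans (sym (Σ-extend (ℕP.m≤m*n N q) (λ m p → trans (cong (ind (q ∣? m) *_) (v m p)) (ℤP.*-zeroʳ (ind (q ∣? m)))))) (Σ-multiples q N F)

  -- Local operators: L ε is 1 - ε T, where T is dilation by q.
  L : ℕ → ℤ → (ℕ → ℤ) → ℕ → ℤ
  L q ε X m = X m - ε * X (q ℕ.* m)

  Ls : ℕ → List ℤ → (ℕ → ℤ) → ℕ → ℤ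
  Ls q []       X = X
  Ls q (ε ∷ es) X = L q ε (Ls q es X)

  infix 4 _≗⁺_
  _≗⁺_ : (ℕ → ℤ) → (ℕ → ℤ) → Set
  X ≗⁺ Y = ∀ m → 0 ℕ.< m → X m ≡ Y m

  pos-* : ∀ {q m} → 0 ℕ.< q → 0 ℕ.< m → 0 ℕ.< q ℕ.* m
  pos-* {suc q} {suc m} _ _ = s≤s z≤n

  module _ (q : ℕ) (0<q : 0 ℕ.< q) where
    L-cong : ∀ ε {X Y} → X ≗⁺ Y → L q ε X ≗⁺ L q ε Y
    L-cong ε h m p = cong₂ (λ a b → a - ε * b) (h m p) (h (q ℕ.* m) (pos-* 0<q p))

    Ls-cong : ∀ es {X Y} → X ≗⁺ Y → Ls q es X ≗⁺ Ls q es Y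
    Ls-cong []       h = h
    Ls-cong (ε ∷ es) h = L-cong ε (Ls-cong es h)

    Ls-++ : ∀ es fs X → Ls q (es ++ fs) X ≗⁺ Ls q es (Ls q fs X)
    Ls-++ []       fs X m p = refl
    Ls-++ (ε ∷ es) fs X = L-cong ε (Ls-++ es fs X)

    L-comm : ∀ ε η X → L q ε (L q η X) ≗⁺ L q η (L q ε X)
    L-comm ε η X m _ = swap (X m) (X (q ℕ.* m)) (X (q ℕ.* (q ℕ.* m))) ε η
      where
      swap : ∀ a b c ε η → a - η * b - ε * (b - η * c) ≡ a - ε * b - η * (b - ε * c)
      swap = solve-∀

    Ls-L : ∀ es η X → Ls q es (L q η X) ≗⁺ L q η (Ls q es X)
    Ls-L []       η X m p = refl
    Ls-L (ε ∷ es) η X m p = trans (L-cong ε (Ls-L es η X) m p) (L-comm ε η (Ls q es X) m p)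

    L-vanishes : ∀ {N} ε {X} → Vanishes N X → Vanishes N (L q ε X)
    L-vanishes ε {X} v m p = trans (cong₂ (λ a b → a - ε * b) (v m p) (v (q ℕ.* m) (ℕP.≤-trans p (ℕP.m≤n*m m q {{ℕ.>-nonZero 0<q}})))) (zeros ε)
      where
      zeros : ∀ ε → 0ℤ - ε * 0ℤ ≡ 0ℤ
      zeros = solve-∀

    Ls-vanishes : ∀ {N} es {X} → Vanishes N X → Vanishes N (Ls q es X)
    Ls-vanishes []       v = v
    Ls-vanishes (ε ∷ es) v = L-vanishes ε (Ls-vanishes es v)

  module _ (q : ℕ) (1<q : 1 ℕ.< q) (N : ℕ) where
    private
      0<q : 0 ℕ.< q
      0<q = ℕP.<-trans (s≤s z≤n) 1<q

      q-grows : ∀ m → 0 ℕ.< m → m ℕ.< q ℕ.* m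
      q-grows m 0<m = ℕP.<-≤-trans (ℕP.m<m*n m q {{ℕ.>-nonZero 0<m}} 1<q) (ℕP.≤-reflexive (ℕP.*-comm m q))

      qq-grows : ∀ m → 0 ℕ.< m → m ℕ.< q ℕ.* (q ℕ.* m)
      qq-grows m 0<m = ℕP.<-trans (q-grows m 0<m) (q-grows (q ℕ.* m) (pos-* 0<q 0<m))

      -- Induction from above: the weights vanish from `N` on, where the claim is trivial, and the
      -- iterates of `g` climb past `N`.
      descend : (P : ℕ → Set) (g : ℕ → ℕ) → (∀ m → 0 ℕ.< m → m ℕ.< g m) → (∀ m → N ℕ.≤ m → P m) →
        (∀ m → 0 ℕ.< m → P (g m) → P m) → ∀ m → 0 ℕ.< m → P m
      descend P g grows top step m 0<m = go N m 0<m (ℕP.m≤m+n N m)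
        where
        go : ∀ fuel m → 0 ℕ.< m → N ℕ.≤ fuel ℕ.+ m → P m
        go zero       m 0<m h = top m h
        go (suc fuel) m 0<m h = step m 0<m (go fuel (g m) (ℕP.<-trans 0<m (grows m 0<m))
          (ℕP.≤-trans (ℕP.≤-trans h (ℕP.≤-reflexive (sym (ℕP.+-suc fuel m)))) (ℕP.+-monoʳ-≤ fuel (grows m 0<m))))

    -- With T the dilation by `q`, `rec` says x = (1 - T²)⁻¹ y; vanishing beyond `N` makes the
    -- series y(m) + y(q² m) + ... finite. It is applied to the sums over squares without and with
    -- the factor at `q`.
    record Step (y x : ℕ → ℤ) : Set where
      field
        van : Vanishes N x
        y≥0 : ∀ m → 0 ℕ.< m → 0ℤ ≤ y m
        x≥0 : ∀ m → 0 ℕ.< m → 0ℤ ≤ x m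
        rec : ∀ m → 0 ℕ.< m → x m ≡ y m + x (q ℕ.* (q ℕ.* m))

    -- The inverse of `Ls q es` dominates (1 - T²)⁻¹: a lower bound `y` for the operator with `q`
    -- peeled off becomes the lower bound `x` for the operator containing `q`.
    Raises : List ℤ → Set
    Raises es = ∀ {X y x} → Vanishes N X → Step y x → (∀ m → 0 ℕ.< m → y m ≤ Ls q es X m) → ∀ m → 0 ℕ.< m → x m ≤ X m

    private
      from-L : ∀ {a b : ℤ} ε c → a ≤ b - ε * c → a + ε * c ≤ b
      from-L {a} {b} ε c h = ℤP.≤-trans (ℤP.+-monoˡ-≤ (ε * c) h) (ℤP.≤-reflexive (cancel b (ε * c)))
        where
        cancel : ∀ b d → b - d + d ≡ b
        cancel = solve-∀

      vanish-≤ : ∀ {X x : ℕ → ℤ} → Vanishes N x → Vanishes N X → ∀ m → N ℕ.≤ m → x m ≤ X m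
      vanish-≤ v w m p = ℤP.≤-reflexive (trans (v m p) (sym (w m p)))

      y≤x : ∀ {y x} → Step y x → ∀ m → 0 ℕ.< m → y m ≤ x m
      y≤x {y} {x} s m p = ℤP.≤-trans (ℤP.≤-reflexive (sym (ℤP.+-identityʳ (y m))))
        (ℤP.≤-trans (ℤP.+-monoʳ-≤ (y m) (Step.x≥0 s (q ℕ.* (q ℕ.* m)) (ℕP.<-trans p (qq-grows m p)))) (ℤP.≤-reflexive (sym (Step.rec s m p))))

    -- Since y ≤ x, the conclusion x ≤ ... for the first block is again a bound of the form y ≤ ...
    -- for the second.
    raises-++ : ∀ {es fs} → Raises es → Raises fs → Raises (es ++ fs)
    raises-++ {es} {fs} re rf {X} v s h = rf v s (λ m p → ℤP.≤-trans (y≤x s m p)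
      (re (Ls-vanishes q 0<q fs v) s (λ k p' → ℤP.≤-trans (h k p') (ℤP.≤-reflexive (Ls-++ q 0<q es fs X k p'))) m p))

    -- The factor (1 - T)⁻¹ = (1 + T) (1 - T²)⁻¹ dominates (1 - T²)⁻¹. As y ≥ 0, the hypothesis
    -- makes `X` decrease along m , q m , q² m, so the steps by q² in the recursion of `x` can be
    -- compared with the steps by `q` in that of `X`.
    raises-1 : Raises (1ℤ ∷ [])
    raises-1 {X} {y} {x} v s h = descend (λ m → x m ≤ X m) (λ m → q ℕ.* (q ℕ.* m)) qq-grows (vanish-≤ (Step.van s) v)
      (λ m p ih → ℤP.≤-trans (ℤP.≤-reflexive (Step.rec s m p))
        (ℤP.≤-trans (ℤP.+-monoʳ-≤ (y m) (ℤP.≤-trans ih (down (q ℕ.* m) (pos-* 0<q p)))) (up m p)))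
      where
      up : ∀ m → 0 ℕ.< m → y m + X (q ℕ.* m) ≤ X m
      up m p = ℤP.≤-trans (ℤP.≤-reflexive (cong (λ z → y m + z) (sym (ℤP.*-identityˡ (X (q ℕ.* m)))))) (from-L 1ℤ (X (q ℕ.* m)) (h m p))
      down : ∀ m → 0 ℕ.< m → X (q ℕ.* m) ≤ X m
      down m p = ℤP.≤-trans (ℤP.≤-trans (ℤP.≤-reflexive (sym (ℤP.+-identityˡ _))) (ℤP.+-monoˡ-≤ (X (q ℕ.* m)) (Step.y≥0 s m p))) (up m p)

    -- (1 - εT)(1 + εT) = 1 - T² because ε² = 1, so one pair of opposite signs inverts exactly to
    -- the recursion of `x`. Commutation of the local factors brings the pair together.
    ±-step : ∀ ε es → ε * ε ≡ 1ℤ → ∀ {X y x} → Vanishes N X → Step y x →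
      (∀ m → 0 ℕ.< m → y m ≤ Ls q (ε ∷ es ++ - ε ∷ map -_ es) X m) →
      ∀ m → 0 ℕ.< m → x m ≤ Ls q (es ++ map -_ es) X m
    ±-step ε es ε²=1 {X} {y} {x} v s h =
      descend (λ m → x m ≤ Z m) (λ m → q ℕ.* (q ℕ.* m)) qq-grows (vanish-≤ (Step.van s) (Ls-vanishes q 0<q (es ++ map -_ es) v))
        (λ m p ih → ℤP.≤-trans (ℤP.≤-reflexive (Step.rec s m p))
          (ℤP.≤-trans (ℤP.+-mono-≤ (h m p) ih) (ℤP.≤-reflexive (trans (cong (_+ Z (q ℕ.* (q ℕ.* m))) (quad m p)) (cancel (Z m) (Z (q ℕ.* (q ℕ.* m))))))))
      where
      Z = Ls q (es ++ map -_ es) X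
      cancel : ∀ b d → b - d + d ≡ b
      cancel = solve-∀
      expand : ∀ ε a b c → a - - ε * b - ε * (b - - ε * c) ≡ a - ε * ε * c
      expand = solve-∀
      quad : ∀ m → 0 ℕ.< m → Ls q (ε ∷ es ++ - ε ∷ map -_ es) X m ≡ Z m - Z (q ℕ.* (q ℕ.* m))
      quad m p = begin
        L q ε (Ls q (es ++ - ε ∷ map -_ es) X) m
          ≡⟨ L-cong q 0<q ε (λ k r → trans (Ls-++ q 0<q es (- ε ∷ map -_ es) X k r) (trans (Ls-L q 0<q es (- ε) (Ls q (map -_ es) X) k r)
               (L-cong q 0<q (- ε) (λ k r → sym (Ls-++ q 0<q es (map -_ es) X k r)) k r))) m p ⟩
        L q ε (L q (- ε) Z) m
          ≡⟨ expand ε (Z m) (Z (q ℕ.* m)) (Z (q ℕ.* (q ℕ.* m))) ⟩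
        Z m - ε * ε * Z (q ℕ.* (q ℕ.* m))
          ≡⟨ cong (λ z → Z m - z) (trans (cong (_* Z (q ℕ.* (q ℕ.* m))) ε²=1) (ℤP.*-identityˡ _)) ⟩
        Z m - Z (q ℕ.* (q ℕ.* m)) ∎
        where open ≡-Reasoning

    -- The first pair turns `y` into `x`; each further pair may only keep the bound `x`, which it
    -- does because y ≤ x lets the same argument run again.
    raises-± : ∀ ε es → All (λ ε → ε * ε ≡ 1ℤ) (ε ∷ es) → Raises ((ε ∷ es) ++ map -_ (ε ∷ es))
    raises-± ε es (ε²=1 ∷ sq) {X} {y} {x} v s h = go es sq (±-step ε es ε²=1 v s h)
      where
      go : ∀ es → All (λ ε → ε * ε ≡ 1ℤ) es → (∀ m → 0 ℕ.< m → x m ≤ Ls q (es ++ map -_ es) X m) → ∀ m → 0 ℕ.< m → x m ≤ X m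
      go []       []          h = h
      go (η ∷ es) (η²=1 ∷ sq) h = go es sq (±-step η es η²=1 v s (λ m p → ℤP.≤-trans (y≤x s m p) (h m p)))

  module _ (N : ℕ) where
    Aᵏ : ℕ → Character → (ℕ → ℤ) → ℕ → ℤ
    Aᵏ k χ = A N (λ e → rough k e * fun χ e)

    -- Each `h` doubles the composition, so that the operators of χ times the product over every
    -- subset of `hs` all occur.
    Φ : ℕ → List Character → Character → (ℕ → ℤ) → ℕ → ℤ
    Φ k []       χ W = Aᵏ k χ W
    Φ k (h ∷ hs) χ W = Φ k hs χ (Φ k hs (χ · h) W)

    private
      coeff0 : ∀ k χ → rough k 0 * fun χ 0 ≡ 0ℤ
      coeff0 k χ = trans (cong (rough k 0 *_) (null χ)) (ℤP.*-zeroʳ (rough k 0))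

    Aᵏ-vanishes : ∀ {N'} k χ {W} → Vanishes N' W → Vanishes N' (Aᵏ k χ W)
    Aᵏ-vanishes k χ = A-vanishes N (λ e → rough k e * fun χ e) (coeff0 k χ)

    Φ-vanishes : ∀ {N'} k hs χ {W} → Vanishes N' W → Vanishes N' (Φ k hs χ W)
    Φ-vanishes k []       χ v = Aᵏ-vanishes k χ v
    Φ-vanishes k (h ∷ hs) χ v = Φ-vanishes k hs χ (Φ-vanishes k hs (χ · h) v)

    Aᵏ-cong : ∀ k χ {W W'} → W ≗⁺ W' → Aᵏ k χ W ≗⁺ Aᵏ k χ W'
    Aᵏ-cong k χ {W} {W'} h m p = Σ-cong N (λ e _ → term e)
      where
      term : ∀ e → rough k e * fun χ e * W (e ℕ.* m) ≡ rough k e * fun χ e * W' (e ℕ.* m)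
      term zero    = trans (cong (_* W 0) (coeff0 k χ)) (sym (cong (_* W' 0) (coeff0 k χ)))
      term (suc e) = cong (rough k (suc e) * fun χ (suc e) *_) (h (suc e ℕ.* m) (pos-* {suc e} (s≤s z≤n) p))

    Φ-cong : ∀ k hs χ {W W'} → W ≗⁺ W' → Φ k hs χ W ≗⁺ Φ k hs χ W'
    Φ-cong k []       χ h = Aᵏ-cong k χ h
    Φ-cong k (g ∷ hs) χ h = Φ-cong k hs χ (Φ-cong k hs (χ · g) h)

    Aᵏ-L : ∀ k χ q ε W → Aᵏ k χ (L q ε W) ≗⁺ L q ε (Aᵏ k χ W)
    Aᵏ-L k χ q ε W m p = begin
      Σ N (λ e → c e * (W (e ℕ.* m) - ε * W (q ℕ.* (e ℕ.* m))))
        ≡⟨ Σ-cong N (λ e _ → trans (dist (c e) (W (e ℕ.* m)) ε (W (q ℕ.* (e ℕ.* m)))) (cong (λ k → c e * W (e ℕ.* m) - ε * (c e * W k)) (swap q e m))) ⟩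
      Σ N (λ e → c e * W (e ℕ.* m) - ε * (c e * W (e ℕ.* (q ℕ.* m))))
        ≡⟨ Σ-- N (λ e → c e * W (e ℕ.* m)) (λ e → ε * (c e * W (e ℕ.* (q ℕ.* m)))) ⟩
      Aᵏ k χ W m - Σ N (λ e → ε * (c e * W (e ℕ.* (q ℕ.* m))))
        ≡⟨ cong (λ z → Aᵏ k χ W m - z) (Σ-* N ε _) ⟩
      L q ε (Aᵏ k χ W) m ∎
      where
      open ≡-Reasoning
      c : ℕ → ℤ
      c e = rough k e * fun χ e
      dist : ∀ c a ε b → c * (a - ε * b) ≡ c * a - ε * (c * b)
      dist = solve-∀
      swap : ∀ q e m → q ℕ.* (e ℕ.* m) ≡ e ℕ.* (q ℕ.* m)
      swap = ℕR.solve-∀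

    Φ-L : ∀ k hs χ q → 0 ℕ.< q → ∀ ε W → Φ k hs χ (L q ε W) ≗⁺ L q ε (Φ k hs χ W)
    Φ-L k []       χ q _   ε W = Aᵏ-L k χ q ε W
    Φ-L k (h ∷ hs) χ q 0<q ε W m p = trans (Φ-cong k hs χ (Φ-L k hs (χ · h) q 0<q ε W) m p) (Φ-L k hs χ q 0<q ε _ m p)

    Φ-Ls : ∀ k hs χ q → 0 ℕ.< q → ∀ es W → Φ k hs χ (Ls q es W) ≗⁺ Ls q es (Φ k hs χ W)
    Φ-Ls k hs χ q 0<q []       W m p = refl
    Φ-Ls k hs χ q 0<q (ε ∷ es) W m p = trans (Φ-L k hs χ q 0<q ε (Ls q es W) m p) (L-cong q 0<q ε (Φ-Ls k hs χ q 0<q es W) m p)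

    -- The values at `q` of all these twists, that is, the local factors of `Φ` at `q`.
    signs : ℕ → List Character → ℤ → List ℤ
    signs q []       ε = ε ∷ []
    signs q (h ∷ hs) ε = signs q hs ε ++ signs q hs (ε * fun h q)

    -- The terms with e = q e′ amount, by complete multiplicativity, to χ(q) times the same operator
    -- at `q * m`; removing them is the factor 1 - χ(q) T.
    Aᵏ-peel : ∀ k → Prime (suc (suc k)) → ∀ χ {W} → Vanishes N W →
      Aᵏ (suc (suc k)) χ W ≗⁺ L (suc (suc k)) (fun χ (suc (suc k))) (Aᵏ (suc k) χ W)
    Aᵏ-peel k pr χ {W} v m p = begin
      Σ N (λ e → (1ℤ - ind (q ∣? e)) * rough (suc k) e * fun χ e * W (e ℕ.* m))
        ≡⟨ Σ-cong N (λ e _ → dist (ind (q ∣? e)) (rough (suc k) e) (fun χ e) (W (e ℕ.* m))) ⟩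
      Σ N (λ e → c e * W (e ℕ.* m) - ind (q ∣? e) * (c e * W (e ℕ.* m)))
        ≡⟨ Σ-- N (λ e → c e * W (e ℕ.* m)) (λ e → ind (q ∣? e) * (c e * W (e ℕ.* m))) ⟩
      Aᵏ (suc k) χ W m - Σ N (λ e → ind (q ∣? e) * (c e * W (e ℕ.* m)))
        ≡⟨ cong (λ z → Aᵏ (suc k) χ W m - z) (trans (Σ-multiples′ q N (λ e → c e * W (e ℕ.* m)) van)
             (trans (Σ-cong N (λ e _ → term e)) (Σ-* N (fun χ q) _))) ⟩
      L q (fun χ q) (Aᵏ (suc k) χ W) m ∎
      where
      open ≡-Reasoning
      q = suc (suc k)
      c : ℕ → ℤ
      c e = rough (suc k) e * fun χ e
      dist : ∀ i r f w → (1ℤ - i) * r * f * w ≡ r * f * w - i * (r * f * w)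
      dist = solve-∀
      van : Vanishes N (λ e → c e * W (e ℕ.* m))
      van e N≤e = trans (cong (c e *_) (v _ (ℕP.≤-trans N≤e (ℕP.m≤m*n e m {{ℕ.>-nonZero p}})))) (ℤP.*-zeroʳ (c e))
      reassoc : ∀ q e m → q ℕ.* e ℕ.* m ≡ e ℕ.* (q ℕ.* m)
      reassoc = ℕR.solve-∀
      pull : ∀ r a b w → r * (a * b) * w ≡ a * (r * b * w)
      pull = solve-∀
      term : ∀ e → c (q ℕ.* e) * W (q ℕ.* e ℕ.* m) ≡ fun χ q * (c e * W (e ℕ.* (q ℕ.* m)))
      term e = trans (cong₂ (λ r w → r * fun χ (q ℕ.* e) * w) (rough-prime-* pr (suc k) ℕP.≤-refl e) (cong W (reassoc q e m)))
        (trans (cong (λ f → rough (suc k) e * f * W (e ℕ.* (q ℕ.* m))) (mul χ q e)) (pull (rough (suc k) e) (fun χ q) (fun χ e) (W (e ℕ.* (q ℕ.* m)))))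

    Φ-peel : ∀ k → Prime (suc (suc k)) → ∀ hs χ {W} → Vanishes N W →
      Φ (suc (suc k)) hs χ W ≗⁺ Ls (suc (suc k)) (signs (suc (suc k)) hs (fun χ (suc (suc k)))) (Φ (suc k) hs χ W)
    Φ-peel k pr [] χ v = Aᵏ-peel k pr χ v
    Φ-peel k pr (h ∷ hs) χ {W} v m p = begin
      Φ q hs χ (Φ q hs (χ · h) W) m                        ≡⟨ Φ-cong q hs χ (Φ-peel k pr hs (χ · h) v) m p ⟩
      Φ q hs χ (Ls q fs Z) m                               ≡⟨ Φ-peel k pr hs χ (Ls-vanishes q (s≤s z≤n) fs (Φ-vanishes (suc k) hs (χ · h) v)) m p ⟩
      Ls q es (Φ (suc k) hs χ (Ls q fs Z)) m               ≡⟨ Ls-cong q (s≤s z≤n) es (Φ-Ls (suc k) hs χ q (s≤s z≤n) fs Z) m p ⟩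
      Ls q es (Ls q fs (Φ (suc k) hs χ Z)) m               ≡⟨ Ls-++ q (s≤s z≤n) es fs (Φ (suc k) hs χ Z) m p ⟨
      Ls q (es ++ fs) (Φ (suc k) hs χ Z) m                 ∎
      where
      open ≡-Reasoning
      q = suc (suc k)
      es = signs q hs (fun χ q)
      fs = signs q hs (fun χ q * fun h q)
      Z = Φ (suc k) hs (χ · h) W

    rough-composite : ∀ k → ¬ Prime (suc (suc k)) → ∀ e → rough (suc (suc k)) e ≡ rough (suc k) e
    rough-composite k ¬pr e with suc (suc k) ∣? e
    ... | no _ = ℤP.*-identityˡ _
    ... | yes q∣e with ¬prime⇒composite ¬pr
    ...   | record { divisor = d ; divisor-< = d<q ; divisor-∣ = d∣q } = sym (rough-zero (suc k) d e (ℕ.nonTrivial⇒n>1 d) (ℕP.≤-pred d<q) (∣-trans d∣q q∣e))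

    Φ-composite : ∀ k → ¬ Prime (suc (suc k)) → ∀ hs χ W → Φ (suc (suc k)) hs χ W ≗⁺ Φ (suc k) hs χ W
    Φ-composite k ¬pr []       χ W m p = Σ-cong N (λ e _ → cong (λ r → r * fun χ e * W (e ℕ.* m)) (rough-composite k ¬pr e))
    Φ-composite k ¬pr (h ∷ hs) χ W m p = trans (Φ-cong (suc (suc k)) hs χ (Φ-composite k ¬pr hs (χ · h) W) m p) (Φ-composite k ¬pr hs χ _ m p)

    signs-neg : ∀ q hs ε → signs q hs (- ε) ≡ map -_ (signs q hs ε)
    signs-neg q []       ε = refl
    signs-neg q (h ∷ hs) ε = trans (cong₂ _++_ (signs-neg q hs ε) (trans (cong (signs q hs) (sym (ℤP.neg-distribˡ-* ε (fun h q)))) (signs-neg q hs (ε * fun h q))))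
      (sym (map-++ -_ (signs q hs ε) (signs q hs (ε * fun h q))))
      where open import Data.List.Properties using (map-++)

    signs-zero : ∀ q hs X m → Ls q (signs q hs 0ℤ) X m ≡ X m
    signs-zero q [] X m = drop (X m) (X (q ℕ.* m))
      where
      drop : ∀ a b → a - 0ℤ * b ≡ a
      drop = solve-∀
    signs-zero q (h ∷ hs) X m = zeros (signs q hs 0ℤ ++ signs q hs (0ℤ * fun h q)) (++⁺ (all0 hs) (all0 hs)) X m
      where
      open import Data.List.Relation.Unary.All.Properties using (++⁺)
      all0 : ∀ hs → All (_≡ 0ℤ) (signs q hs 0ℤ)
      all0 []       = refl ∷ []
      all0 (h ∷ hs) = ++⁺ (all0 hs) (all0 hs)
      zeros : ∀ es → All (_≡ 0ℤ) es → ∀ X m → Ls q es X m ≡ X m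
      zeros [] [] X m = refl
      zeros (.0ℤ ∷ es) (refl ∷ z) X m = trans (drop (Ls q es X m) (Ls q es X (q ℕ.* m))) (zeros es z X m)
        where
        drop : ∀ a b → a - 0ℤ * b ≡ a
        drop = solve-∀

    signs-square : ∀ q hs ε → ε * ε ≡ 1ℤ → All (λ h → fun h q * fun h q ≡ 1ℤ) hs → All (λ ε → ε * ε ≡ 1ℤ) (signs q hs ε)
    signs-square q []       ε sq []       = sq ∷ []
    signs-square q (h ∷ hs) ε sq (hq ∷ a) = ++⁺ (signs-square q hs ε sq a) (signs-square q hs (ε * fun h q) (trans (swap ε (fun h q)) (cong₂ _*_ sq hq)) a)
      where
      open import Data.List.Relation.Unary.All.Properties using (++⁺)
      swap : ∀ a b → a * b * (a * b) ≡ a * a * (b * b)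
      swap = solve-∀

    ∷-view : ∀ q hs ε → ∃ λ x → ∃ λ xs → signs q hs ε ≡ x ∷ xs
    ∷-view q [] ε = ε , [] , refl
    ∷-view q (h ∷ hs) ε with signs q hs ε | ∷-view q hs ε
    ... | .(x ∷ xs) | x , xs , refl = x , xs ++ signs q hs (ε * fun h q) , refl

    -- If some h(q) = -1, the signs fall into opposite pairs; if every h(q) = 1 and χ(q) = 1, all
    -- signs are 1. The one pattern left out, χ(q) = -1 with every h(q) = 1, would give powers of (1
    -- + T)⁻¹, whose coefficients change sign: it describes the primes that are wanted.
    signs-raise : ∀ q (1<q : 1 ℕ.< q) hs ε → ε * ε ≡ 1ℤ → All (λ h → fun h q ≡ 1ℤ ⊎ fun h q ≡ -1ℤ) hs →
      ε ≡ 1ℤ ⊎ Any (λ h → fun h q ≡ -1ℤ) hs → Raises q 1<q N (signs q hs ε)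
    signs-raise q 1<q [] .1ℤ sq [] (inj₁ refl) = raises-1 q 1<q N
    signs-raise q 1<q (h ∷ hs) ε sq (inj₂ h≡-1 ∷ a) _ = subst (Raises q 1<q N) eq pair
      where
      square : ∀ {hs} → All (λ h → fun h q ≡ 1ℤ ⊎ fun h q ≡ -1ℤ) hs → All (λ h → fun h q * fun h q ≡ 1ℤ) hs
      square []            = []
      square (inj₁ e ∷ a) = cong₂ _*_ e e ∷ square a
      square (inj₂ e ∷ a) = cong₂ _*_ e e ∷ square a
      eq : signs q hs ε ++ map -_ (signs q hs ε) ≡ signs q hs ε ++ signs q hs (ε * fun h q)
      eq = cong (signs q hs ε ++_) (trans (sym (signs-neg q hs ε)) (cong (signs q hs) (trans (neg ε) (cong (ε *_) (sym h≡-1)))))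
        where
        neg : ∀ ε → - ε ≡ ε * -1ℤ
        neg = solve-∀
      pair : Raises q 1<q N (signs q hs ε ++ map -_ (signs q hs ε))
      pair with signs q hs ε | ∷-view q hs ε | signs-square q hs ε sq (square a)
      ... | .(x ∷ xs) | x , xs , refl | sqs = raises-± q 1<q N x xs sqs
    signs-raise q 1<q (h ∷ hs) ε sq (inj₁ h≡1 ∷ a) c =
      subst (λ η → Raises q 1<q N (signs q hs ε ++ signs q hs η)) (sym (trans (cong (ε *_) h≡1) (ℤP.*-identityʳ ε)))
        (raises-++ q 1<q N {signs q hs ε} {signs q hs ε} r r)
      where
      c' : ε ≡ 1ℤ ⊎ Any (λ h → fun h q ≡ -1ℤ) hs → Raises q 1<q N (signs q hs ε)
      c' = signs-raise q 1<q hs ε sq a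
      1≢-1 : 1ℤ ≢ -1ℤ
      1≢-1 ()
      tail : ε ≡ 1ℤ ⊎ Any (λ h → fun h q ≡ -1ℤ) (h ∷ hs) → ε ≡ 1ℤ ⊎ Any (λ h → fun h q ≡ -1ℤ) hs
      tail (inj₁ e) = inj₁ e
      tail (inj₂ (here h≡-1)) = ⊥-elim (1≢-1 (trans (sym h≡1) h≡-1))
      tail (inj₂ (there t)) = inj₂ t
      r : Raises q 1<q N (signs q hs ε)
      r = c' (tail c)

    -- The product of the Euler factors (1 - χ(q)² T²)⁻¹, written as a sum over squares. Its
    -- coefficients are non-negative, which makes it a usable lower bound.
    S : ℕ → Character → (ℕ → ℤ) → ℕ → ℤ
    S k χ W m = Σ N (λ j → rough k j * fun (χ · χ) j * W (j ℕ.* (j ℕ.* m)))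

    private
      0≤* : ∀ {a b} → 0ℤ ≤ a → 0ℤ ≤ b → 0ℤ ≤ a * b
      0≤* {+ a} {+ b} _ _ = ℤP.≤-trans (ℤ.+≤+ z≤n) (ℤP.≤-reflexive (ℤP.pos-* a b))

      0≤square : ∀ i → 0ℤ ≤ i * i
      0≤square (+ n)        = 0≤* {+ n} {+ n} (ℤ.+≤+ z≤n) (ℤ.+≤+ z≤n)
      0≤square (ℤ.-[1+ n ]) = ℤ.+≤+ z≤n

      0≤rough : ∀ k e → 0ℤ ≤ rough k e
      0≤rough zero e = ℤ.+≤+ z≤n
      0≤rough (suc zero) e = ℤ.+≤+ z≤n
      0≤rough (suc (suc k)) e = 0≤* (0≤1-ind (suc (suc k) ∣? e)) (0≤rough (suc k) e)
        where
        0≤1-ind : ∀ {P : Set} (d : Dec P) → 0ℤ ≤ 1ℤ - ind d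
        0≤1-ind (yes _) = ℤ.+≤+ z≤n
        0≤1-ind (no _)  = ℤ.+≤+ z≤n

      0≤Σ : ∀ n {f : ℕ → ℤ} → (∀ i → 0ℤ ≤ f i) → 0ℤ ≤ Σ n f
      0≤Σ zero    h = ℤ.+≤+ z≤n
      0≤Σ (suc n) h = ℤP.+-mono-≤ (0≤Σ n h) (h n)

    module Positivity (χ : Character) {W : ℕ → ℤ} (W≥0 : ∀ m → 0ℤ ≤ W m) (v : Vanishes N W) where

      S-nonneg : ∀ k m → 0ℤ ≤ S k χ W m
      S-nonneg k m = 0≤Σ N (λ j → 0≤* (0≤* (0≤rough k j) (0≤square (fun χ j))) (W≥0 _))

      S-vanishes : ∀ k → Vanishes N (S k χ W)
      S-vanishes k m N≤m = Σ-zero N (λ j _ → term j)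
        where
        term : ∀ j → rough k j * (fun χ j * fun χ j) * W (j ℕ.* (j ℕ.* m)) ≡ 0ℤ
        term zero    = trans (cong (λ f → rough k 0 * (f * f) * W 0) (null χ)) (cong (_* W 0) (ℤP.*-zeroʳ (rough k 0)))
        term (suc j) = trans (cong (rough k (suc j) * (fun χ (suc j) * fun χ (suc j)) *_)
          (v _ (ℕP.≤-trans N≤m (ℕP.≤-trans (ℕP.m≤m+n m (j ℕ.* m)) (ℕP.m≤m+n _ (j ℕ.* (suc j ℕ.* m)))))))
          (ℤP.*-zeroʳ (rough k (suc j) * (fun χ (suc j) * fun χ (suc j))))

      S-peel : ∀ k → Prime (suc (suc k)) → ∀ m → 0 ℕ.< m →
        S (suc k) χ W m ≡ S (suc (suc k)) χ W m + fun (χ · χ) (suc (suc k)) * S (suc k) χ W (suc (suc k) ℕ.* (suc (suc k) ℕ.* m))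
      S-peel k pr m p = sym (trans (cong (_+ κq * S (suc k) χ W (q ℕ.* (q ℕ.* m))) left) (cancel (S (suc k) χ W m) (κq * S (suc k) χ W (q ℕ.* (q ℕ.* m)))))
        where
        q = suc (suc k)
        κq = fun (χ · χ) q
        c : ℕ → ℤ
        c j = rough (suc k) j * fun (χ · χ) j
        cancel : ∀ b d → b - d + d ≡ b
        cancel = solve-∀
        dist : ∀ i r f w → (1ℤ - i) * r * f * w ≡ r * f * w - i * (r * f * w)
        dist = solve-∀
        van : Vanishes N (λ j → c j * W (j ℕ.* (j ℕ.* m)))
        van j N≤j = trans (cong (c j *_) (v _ (ℕP.≤-trans N≤j (grow j)))) (ℤP.*-zeroʳ (c j))
          where
          grow : ∀ j → j ℕ.≤ j ℕ.* (j ℕ.* m)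
          grow zero    = z≤n
          grow (suc j) = ℕP.m≤m*n (suc j) (suc j ℕ.* m) {{ℕP.m*n≢0 (suc j) m {{_}} {{ℕ.>-nonZero p}}}}
        reassoc : ∀ q e m → q ℕ.* e ℕ.* (q ℕ.* e ℕ.* m) ≡ e ℕ.* (e ℕ.* (q ℕ.* (q ℕ.* m)))
        reassoc = ℕR.solve-∀
        pull : ∀ r a b w → r * (a * b) * w ≡ a * (r * b * w)
        pull = solve-∀
        term : ∀ e → c (q ℕ.* e) * W (q ℕ.* e ℕ.* (q ℕ.* e ℕ.* m)) ≡ κq * (c e * W (e ℕ.* (e ℕ.* (q ℕ.* (q ℕ.* m)))))
        term e = trans (cong₂ (λ r w → r * fun (χ · χ) (q ℕ.* e) * w) (rough-prime-* pr (suc k) ℕP.≤-refl e) (cong W (reassoc q e m)))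
          (trans (cong (λ f → rough (suc k) e * f * W (e ℕ.* (e ℕ.* (q ℕ.* (q ℕ.* m))))) (mul (χ · χ) q e)) (pull (rough (suc k) e) κq (fun (χ · χ) e) (W (e ℕ.* (e ℕ.* (q ℕ.* (q ℕ.* m)))))))
        left : S q χ W m ≡ S (suc k) χ W m - κq * S (suc k) χ W (q ℕ.* (q ℕ.* m))
        left = trans (Σ-cong N (λ e _ → dist (ind (q ∣? e)) (rough (suc k) e) (fun (χ · χ) e) (W (e ℕ.* (e ℕ.* m)))))
          (trans (Σ-- N (λ e → c e * W (e ℕ.* (e ℕ.* m))) (λ e → ind (q ∣? e) * (c e * W (e ℕ.* (e ℕ.* m)))))
            (cong (λ z → S (suc k) χ W m - z) (trans (Σ-multiples′ q N (λ e → c e * W (e ℕ.* (e ℕ.* m))) van)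
              (trans (Σ-cong N (λ e _ → term e)) (Σ-* N κq _)))))

      S-composite : ∀ k → ¬ Prime (suc (suc k)) → ∀ m → S (suc (suc k)) χ W m ≡ S (suc k) χ W m
      S-composite k ¬pr m = Σ-cong N (λ j _ → cong (λ r → r * fun (χ · χ) j * W (j ℕ.* (j ℕ.* m))) (rough-composite k ¬pr j))

    only-one : ∀ {n} → N ≡ suc (suc n) → (f : ℕ → ℤ) → (∀ e → 2 ℕ.≤ e → e ℕ.< N → f e ≡ 0ℤ) → f 0 ≡ 0ℤ → Σ N f ≡ f 1
    only-one {n} refl f z f0 = trans (Σ-head (suc n) f) (trans (cong₂ _+_ f0 (Σ-head n (λ i → f (suc i))))
      (trans (ℤP.+-identityˡ _) (trans (cong (λ z → f 1 + z) (Σ-zero n (λ i i<n → z (suc (suc i)) (s≤s (s≤s z≤n)) (s≤s (s≤s i<n))))) (ℤP.+-identityʳ (f 1)))))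

    -- For 2 ≤ e < N, `e` divides itself and is not rough, and e = 0 is killed by the character:
    -- only e = 1 survives in each operator.
    Φ-top : ∀ {n} → N ≡ suc (suc n) → ∀ hs χ W → Φ N hs χ W ≗⁺ W
    Φ-top eq (h ∷ hs) χ W m p = trans (Φ-top eq hs χ _ m p) (Φ-top eq hs (χ · h) W m p)
    Φ-top eq [] χ W m p = trans (only-one eq (λ e → rough N e * fun χ e * W (e ℕ.* m))
      (λ e 2≤e e<N → cong (λ r → r * fun χ e * W (e ℕ.* m)) (rough-zero N e e 2≤e (ℕP.<⇒≤ e<N) ∣-refl))
      (cong (_* W 0) (coeff0 N χ)))
      (trans (cong₂ (λ r f → r * f * W (1 ℕ.* m)) (rough-one N) (one χ)) (trans (ℤP.*-identityˡ _) (cong W (ℕP.*-identityˡ m))))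

    S-top : ∀ {n} → N ≡ suc (suc n) → ∀ χ W → S N χ W ≗⁺ W
    S-top eq χ W m p = trans (only-one eq (λ e → rough N e * fun (χ · χ) e * W (e ℕ.* (e ℕ.* m)))
      (λ e 2≤e e<N → cong (λ r → r * fun (χ · χ) e * W (e ℕ.* (e ℕ.* m))) (rough-zero N e e 2≤e (ℕP.<⇒≤ e<N) ∣-refl))
      (cong (_* W 0) (coeff0 N (χ · χ))))
      (trans (cong₂ (λ r f → r * f * W (1 ℕ.* (1 ℕ.* m))) (rough-one N) (one (χ · χ))) (trans (ℤP.*-identityˡ _) (cong W (trans (ℕP.*-identityˡ _) (ℕP.*-identityˡ m)))))

    -- The local patterns under which peeling preserves the inequality. For characters with values
    -- as in `Family`, failure at `q` means χ(q) = -1 with every h(q) = 1.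
    Splits : List Character → Character → ℕ → Set
    Splits hs χ q = fun χ q ≡ 0ℤ ⊎
      (fun χ q * fun χ q ≡ 1ℤ × All (λ h → fun h q ≡ 1ℤ ⊎ fun h q ≡ -1ℤ) hs × (fun χ q ≡ 1ℤ ⊎ Any (λ h → fun h q ≡ -1ℤ) hs))

    -- Primes are restored downwards from level `N`, where both sides are `W`. A composite level
    -- changes nothing, a prime with χ(q) = 0 has a trivial factor on both sides, and every other
    -- prime is a case of `signs-raise`.
    S≤Φ : ∀ {n} → N ≡ suc (suc n) → ∀ hs χ {W} → (∀ m → 0ℤ ≤ W m) → Vanishes N W →
      (∀ q → Prime q → q ℕ.≤ N → Splits hs χ q) → ∀ m → 0 ℕ.< m → S 1 χ W m ≤ Φ 1 hs χ W m
    S≤Φ {n} eq hs χ {W} W≥0 v split = go (suc n) 0 (trans eq (cong suc (sym (ℕP.+-identityʳ (suc n)))))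
      where
      open Positivity χ W≥0 v
      go : ∀ d k → N ≡ suc (d ℕ.+ k) → ∀ m → 0 ℕ.< m → S (suc k) χ W m ≤ Φ (suc k) hs χ W m
      go zero    k N≡ m p = subst (λ k → S k χ W m ≤ Φ k hs χ W m) N≡ (ℤP.≤-reflexive (trans (S-top eq χ W m p) (sym (Φ-top eq hs χ W m p))))
      go (suc d) k N≡ m p = step (prime? q) (go d (suc k) (trans N≡ (cong suc (sym (ℕP.+-suc d k))))) m p
        where
        q = suc (suc k)
        q≤N : q ℕ.≤ N
        q≤N = subst (q ℕ.≤_) (sym N≡) (s≤s (s≤s (ℕP.m≤n+m k d)))
        step : Dec (Prime q) → (∀ m → 0 ℕ.< m → S q χ W m ≤ Φ q hs χ W m) → ∀ m → 0 ℕ.< m → S (suc k) χ W m ≤ Φ (suc k) hs χ W m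
        step (no ¬pr) ih m p = ℤP.≤-trans (ℤP.≤-reflexive (sym (S-composite k ¬pr m))) (ℤP.≤-trans (ih m p) (ℤP.≤-reflexive (Φ-composite k ¬pr hs χ W m p)))
        step (yes pr) ih with split q pr q≤N
        ... | inj₁ χq≡0 = λ m p → ℤP.≤-trans (ℤP.≤-reflexive (trans (S-peel k pr m p) (trans (cong (λ f → S q χ W m + f * f * S (suc k) χ W (q ℕ.* (q ℕ.* m))) χq≡0) (ℤP.+-identityʳ _))))
              (ℤP.≤-trans (ih m p) (ℤP.≤-reflexive (trans (Φ-peel k pr hs χ v m p)
                (trans (cong (λ ε → Ls q (signs q hs ε) (Φ (suc k) hs χ W) m) χq≡0) (signs-zero q hs (Φ (suc k) hs χ W) m)))))
        ... | inj₂ (sq , units , c) = signs-raise q (s≤s (s≤s z≤n)) hs (fun χ q) sq units c (Φ-vanishes (suc k) hs χ v)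
              (record { van = S-vanishes (suc k)
                      ; y≥0 = λ m _ → S-nonneg q m
                      ; x≥0 = λ m _ → S-nonneg (suc k) m
                      ; rec = λ m p → trans (S-peel k pr m p) (cong (λ z → S q χ W m + z) (trans (cong (_* S (suc k) χ W (q ℕ.* (q ℕ.* m))) sq) (ℤP.*-identityˡ _))) })
              (λ m p → ℤP.≤-trans (ih m p) (ℤP.≤-reflexive (Φ-peel k pr hs χ v m p)))

-- A polynomial weight, and the collision of the two bounds.

module Existence where
  open Smooth
  open Peel
  open import Data.Nat as ℕ using (ℕ; zero; suc; z≤n; s≤s)
  import Data.Nat.Properties as ℕP
  open import Data.Nat.Primality using (Prime; prime?)
  open import Data.Integer as ℤ using (ℤ; +_; 0ℤ; 1ℤ; -1ℤ; ∣_∣; _+_; _*_; _-_; -_; _≤_)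
  import Data.Integer.Properties as ℤP
  open import Data.Integer.Tactic.RingSolver using (solve-∀)
  import Data.Nat.Tactic.RingSolver as ℕR
  open import Data.List using (List; []; _∷_)
  open import Data.List.Relation.Unary.Any using (Any; here; there)
  open import Data.List.Relation.Unary.All as All using (All; []; _∷_)
  open import Data.Product using (_×_; _,_; ∃; proj₁; proj₂)
  open import Data.Sum using (_⊎_; inj₁; inj₂)
  open import Data.Empty using (⊥; ⊥-elim)
  open import Relation.Nullary using (Dec; yes; no; ¬_)
  open import Relation.Nullary.Decidable using (_×-dec_)
  open import Relation.Binary.PropositionalEquality

  bin : ℕ → ℕ → ℕ
  bin n       zero    = 1
  bin zero    (suc k) = 0
  bin (suc n) (suc k) = bin n k ℕ.+ bin n (suc k)

  bin-≤-suc : ∀ n k → bin n k ℕ.≤ bin (suc n) k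
  bin-≤-suc n zero    = ℕP.≤-refl
  bin-≤-suc n (suc k) = ℕP.m≤n+m (bin n (suc k)) (bin n k)

  bin-mono : ∀ {m n} k → m ℕ.≤ n → bin m k ℕ.≤ bin n k
  bin-mono {m} {n} k m≤n = subst (λ x → bin m k ℕ.≤ bin x k) (ℕP.m∸n+n≡m m≤n) (go (n ℕ.∸ m))
    where
    go : ∀ d → bin m k ℕ.≤ bin (d ℕ.+ m) k
    go zero    = ℕP.≤-refl
    go (suc d) = ℕP.≤-trans (go d) (bin-≤-suc (d ℕ.+ m) k)

  bin-≤-^ : ∀ n k → bin n k ℕ.≤ n ℕ.^ k
  bin-≤-^ n       zero    = ℕP.≤-refl
  bin-≤-^ zero    (suc k) = z≤n
  bin-≤-^ (suc n) (suc k) = ℕP.+-mono-≤ (ℕP.≤-trans (bin-≤-^ n k) (ℕP.^-monoˡ-≤ k (ℕP.n≤1+n n)))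
    (ℕP.≤-trans (bin-≤-^ n (suc k)) (ℕP.*-monoʳ-≤ n (ℕP.^-monoˡ-≤ k (ℕP.n≤1+n n))))

  bin-+ : ∀ n m k → n ℕ.* bin m k ℕ.≤ bin (n ℕ.+ m) (suc k)
  bin-+ zero    m k = z≤n
  bin-+ (suc n) m k = ℕP.+-mono-≤ (bin-mono k (ℕP.m≤n+m m n)) (bin-+ n m k)

  -- Choosing one element from each of `k` blocks of size `n` gives n^k of the k-subsets.
  ^-≤-bin : ∀ n k → n ℕ.^ k ℕ.≤ bin (k ℕ.* n) k
  ^-≤-bin n zero    = ℕP.≤-refl
  ^-≤-bin n (suc k) = ℕP.≤-trans (ℕP.*-monoʳ-≤ n (^-≤-bin n k)) (bin-+ n (k ℕ.* n) k)

  -- An integral version of the cutoff (N - m)^R / R!. Each difference is, up to sign, again a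
  -- binomial coefficient, so smoothness comes with exact formulas and no denominators.
  weight : ℕ → ℕ → ℕ → ℤ
  weight N R m = + bin (N ℕ.∸ m) R

  weight-vanishes : ∀ N R → Vanishes N (weight N (suc R))
  weight-vanishes N R m N≤m = cong (λ x → + bin x (suc R)) (ℕP.m≤n⇒m∸n≡0 N≤m)

  sgn : ℕ → ℤ
  sgn zero    = 1ℤ
  sgn (suc j) = - sgn j

  ∣sgn∣ : ∀ j → ∣ sgn j ∣ ≡ 1
  ∣sgn∣ zero    = refl
  ∣sgn∣ (suc j) = trans (ℤP.∣-i∣≡∣i∣ (sgn j)) (∣sgn∣ j)

  Δ-weight : ∀ N R m → Δ (weight N (suc (suc R))) m ≡ - weight N (suc R) (suc m)
  Δ-weight N R m with N ℕ.≤? m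
  ... | yes N≤m = trans (cong₂ _-_ (weight-vanishes N (suc R) (suc m) (ℕP.m≤n⇒m≤1+n N≤m)) (weight-vanishes N (suc R) m N≤m))
                    (cong -_ (sym (weight-vanishes N R (suc m) (ℕP.m≤n⇒m≤1+n N≤m))))
  ... | no ¬p = trans (cong (λ x → + bin (N ℕ.∸ suc m) (suc (suc R)) - + bin x (suc (suc R))) (ℕP.+-∸-assoc 1 (ℕP.≰⇒> ¬p)))
                  (trans (cong (λ z → + bin (N ℕ.∸ suc m) (suc (suc R)) - z) (ℤP.pos-+ (bin (N ℕ.∸ suc m) (suc R)) _)) (cancel (+ bin (N ℕ.∸ suc m) (suc (suc R))) (+ bin (N ℕ.∸ suc m) (suc R))))
    where
    cancel : ∀ a b → a - (b + a) ≡ - b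
    cancel = solve-∀

  Δ^-weight : ∀ N j s m → Δ^ j (weight N (j ℕ.+ suc s)) m ≡ sgn j * weight N (suc s) (j ℕ.+ m)
  Δ^-weight N zero    s m = sym (ℤP.*-identityˡ _)
  Δ^-weight N (suc j) s m = trans (Δ^-cong (suc j) (λ k → cong (λ R → weight N R k) (sym (ℕP.+-suc j (suc s)))) m)
    (trans (cong₂ _-_ (trans (Δ^-weight N j (suc s) (suc m)) (cong (λ x → sgn j * weight N (suc (suc s)) x) (ℕP.+-suc j m))) (Δ^-weight N j (suc s) m))
      (trans (*-distribˡ-- (sgn j) _ _) (trans (cong (sgn j *_) (Δ-weight N s (j ℕ.+ m))) (neg (sgn j) (weight N (suc s) (suc (j ℕ.+ m)))))))
    where
    neg : ∀ a b → a * - b ≡ - a * b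
    neg = solve-∀

  weight-smooth : ∀ N T → Smooth T (N ℕ.^ suc T) (weight N (suc T))
  weight-smooth N T j j≤T m _ = begin
    m ℕ.^ j ℕ.* ∣ Δ^ j (weight N (suc T)) m ∣                   ≡⟨ cong (λ R → m ℕ.^ j ℕ.* ∣ Δ^ j (weight N R) m ∣) T≡ ⟩
    m ℕ.^ j ℕ.* ∣ Δ^ j (weight N (j ℕ.+ suc s)) m ∣             ≡⟨ cong (λ z → m ℕ.^ j ℕ.* ∣ z ∣) (Δ^-weight N j s m) ⟩
    m ℕ.^ j ℕ.* ∣ sgn j * weight N (suc s) (j ℕ.+ m) ∣          ≡⟨ cong (m ℕ.^ j ℕ.*_) (trans (ℤP.abs-* (sgn j) _) (trans (cong (ℕ._* bin (N ℕ.∸ (j ℕ.+ m)) (suc s)) (∣sgn∣ j)) (ℕP.*-identityˡ _))) ⟩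
    m ℕ.^ j ℕ.* bin (N ℕ.∸ (j ℕ.+ m)) (suc s)                   ≤⟨ bound ⟩
    N ℕ.^ j ℕ.* N ℕ.^ suc s                                     ≡⟨ ℕP.^-distribˡ-+-* N j (suc s) ⟨
    N ℕ.^ (j ℕ.+ suc s)                                         ≡⟨ cong (N ℕ.^_) T≡ ⟨
    N ℕ.^ suc T                                                 ∎
    where
    open ℕP.≤-Reasoning
    s = T ℕ.∸ j
    T≡ : suc T ≡ j ℕ.+ suc s
    T≡ = sym (trans (ℕP.+-suc j s) (cong suc (ℕP.m+[n∸m]≡n j≤T)))
    bound : m ℕ.^ j ℕ.* bin (N ℕ.∸ (j ℕ.+ m)) (suc s) ℕ.≤ N ℕ.^ j ℕ.* N ℕ.^ suc s
    bound with m ℕ.≤? N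
    ... | yes m≤N = ℕP.*-mono-≤ (ℕP.^-monoˡ-≤ j m≤N) (ℕP.≤-trans (bin-≤-^ (N ℕ.∸ (j ℕ.+ m)) (suc s)) (ℕP.^-monoˡ-≤ (suc s) (ℕP.m∸n≤m N (j ℕ.+ m))))
    ... | no ¬p = ℕP.≤-trans (ℕP.≤-reflexive (trans (cong (λ x → m ℕ.^ j ℕ.* bin x (suc s))
          (ℕP.m≤n⇒m∸n≡0 (ℕP.≤-trans (ℕP.<⇒≤ (ℕP.≰⇒> ¬p)) (ℕP.m≤n+m m j)))) (ℕP.*-zeroʳ (m ℕ.^ j)))) z≤n

  Bounded : ℕ → Character → Set
  Bounded P χ = ∀ k → ∣ Σ k (fun χ) ∣ ℕ.≤ P

  BoundedFamily : ℕ → List Character → Character → Set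
  BoundedFamily P []       χ = Bounded P χ
  BoundedFamily P (h ∷ hs) χ = BoundedFamily P hs χ × BoundedFamily P hs (χ · h)

  size : List Character → ℕ
  size []       = 1
  size (_ ∷ hs) = size hs ℕ.+ size hs

  module Upper (n P T : ℕ) where
    N = 2 ℕ.^ n
    c = P ℕ.* (n ℕ.* (2 ℕ.^ T ℕ.+ 1))

    smooth-≤ : ∀ {R B B' W} → B ℕ.≤ B' → Smooth R B W → Smooth R B' W
    smooth-≤ B≤B' s j j≤R m p = ℕP.≤-trans (s j j≤R m p) B≤B'

    -- `Φ` composes `size hs` operators, and each of them costs one order of smoothness and one
    -- factor `c`.
    Φ-smooth : ∀ hs χ → BoundedFamily P hs χ → ∀ R {B W} → size hs ℕ.+ R ℕ.≤ T → Vanishes N W →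
      Smooth (size hs ℕ.+ R) B W → Smooth R (c ℕ.^ size hs ℕ.* B) (Φ N 1 hs χ W)
    Φ-smooth [] χ bd R {B} {W} R<T v s = smooth-≤ {W = Φ N 1 [] χ W} le
      (A-smooth n (λ e → 1ℤ * fun χ e) P (trans (ℤP.*-identityˡ _) (null χ)) (λ k → subst (λ z → ∣ z ∣ ℕ.≤ P) (Σ-cong k (λ i _ → sym (ℤP.*-identityˡ (fun χ i)))) (bd k)) v s)
      where
      open ℕP.≤-Reasoning
      reorder : ∀ P n t B → P ℕ.* (n ℕ.* (t ℕ.* B ℕ.+ B)) ≡ P ℕ.* (n ℕ.* (t ℕ.+ 1)) ℕ.* 1 ℕ.* B
      reorder = ℕR.solve-∀
      le : P ℕ.* (n ℕ.* (2 ℕ.^ R ℕ.* B ℕ.+ B)) ℕ.≤ c ℕ.* 1 ℕ.* B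
      le = begin
        P ℕ.* (n ℕ.* (2 ℕ.^ R ℕ.* B ℕ.+ B))   ≤⟨ ℕP.*-monoʳ-≤ P (ℕP.*-monoʳ-≤ n (ℕP.+-monoˡ-≤ B (ℕP.*-monoˡ-≤ B (ℕP.^-monoʳ-≤ 2 (ℕP.<⇒≤ R<T))))) ⟩
        P ℕ.* (n ℕ.* (2 ℕ.^ T ℕ.* B ℕ.+ B))   ≡⟨ reorder P n (2 ℕ.^ T) B ⟩
        c ℕ.* 1 ℕ.* B                          ∎
    Φ-smooth (h ∷ hs) χ (bd , bd') R {B} {W} le v s = smooth-≤ {W = Φ N 1 (h ∷ hs) χ W} (ℕP.≤-reflexive eq)
      (Φ-smooth hs χ bd R (ℕP.≤-trans (ℕP.≤-trans (ℕP.m≤n+m _ (size hs)) (ℕP.≤-reflexive (sym (ℕP.+-assoc (size hs) (size hs) R)))) le) (Φ-vanishes N 1 hs (χ · h) v)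
        (Φ-smooth hs (χ · h) bd' (size hs ℕ.+ R) (subst (ℕ._≤ T) (ℕP.+-assoc (size hs) (size hs) R) le) v (subst (λ k → Smooth k B W) (ℕP.+-assoc (size hs) (size hs) R) s)))
      where
      eq : c ℕ.^ size hs ℕ.* (c ℕ.^ size hs ℕ.* B) ≡ c ℕ.^ (size hs ℕ.+ size hs) ℕ.* B
      eq = trans (sym (ℕP.*-assoc (c ℕ.^ size hs) (c ℕ.^ size hs) B)) (cong (ℕ._* B) (sym (ℕP.^-distribˡ-+-* c (size hs) (size hs))))

  n<2^n : ∀ n → n ℕ.< 2 ℕ.^ n
  n<2^n zero    = s≤s z≤n
  n<2^n (suc n) = ℕP.≤-trans (s≤s (n<2^n n)) (ℕP.≤-trans (ℕP.+-monoˡ-≤ (2 ℕ.^ n) (ℕP.m^n>0 2 n)) (ℕP.≤-reflexive (cong (2 ℕ.^ n ℕ.+_) (sym (ℕP.+-identityʳ (2 ℕ.^ n))))))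

  linear<exponential : ∀ K r → ∃ λ v → K ℕ.+ v ℕ.* r ℕ.< 2 ℕ.^ v
  linear<exponential K r = x ℕ.+ x , (begin-strict
    K ℕ.+ (x ℕ.+ x) ℕ.* r              ≤⟨ ℕP.+-monoˡ-≤ ((x ℕ.+ x) ℕ.* r) (ℕP.m≤m+n K (r ℕ.+ r)) ⟩
    x ℕ.+ (x ℕ.+ x) ℕ.* r              ≤⟨ ℕP.+-monoʳ-≤ x (ℕP.≤-trans (ℕP.≤-reflexive (double x r)) (ℕP.*-monoʳ-≤ x (ℕP.m≤n+m (r ℕ.+ r) K))) ⟩
    x ℕ.+ x ℕ.* x                      ≡⟨ ℕP.*-suc x x ⟨
    x ℕ.* suc x                        <⟨ ℕP.*-monoˡ-< (suc x) (ℕP.n<1+n x) ⟩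
    suc x ℕ.* suc x                    ≤⟨ ℕP.*-mono-≤ (n<2^n x) (n<2^n x) ⟩
    2 ℕ.^ x ℕ.* 2 ℕ.^ x                ≡⟨ ℕP.^-distribˡ-+-* 2 x x ⟨
    2 ℕ.^ (x ℕ.+ x)                    ∎)
    where
    open ℕP.≤-Reasoning
    x = K ℕ.+ (r ℕ.+ r)
    double : ∀ x r → (x ℕ.+ x) ℕ.* r ≡ x ℕ.* (r ℕ.+ r)
    double = ℕR.solve-∀

  -- With w = 2^v both sides are bounded by powers of 2, and the exponents reduce the claim to a
  -- linear function of `v` against 2^v.
  polynomial<exponential : ∀ C d r → ∃ λ w → C ℕ.* (2 ℕ.* w ℕ.+ d) ℕ.^ r ℕ.< 2 ℕ.^ w
  polynomial<exponential C d r with linear<exponential (C ℕ.+ (d ℕ.+ 1) ℕ.* r) r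
  ... | v , lt = 2 ℕ.^ v , (begin-strict
    C ℕ.* (2 ℕ.* 2 ℕ.^ v ℕ.+ d) ℕ.^ r
      ≤⟨ ℕP.*-mono-≤ (ℕP.<⇒≤ (n<2^n C)) (ℕP.^-monoˡ-≤ r base) ⟩
    2 ℕ.^ C ℕ.* (2 ℕ.^ (v ℕ.+ (d ℕ.+ 1))) ℕ.^ r
      ≡⟨ cong (2 ℕ.^ C ℕ.*_) (ℕP.^-*-assoc 2 (v ℕ.+ (d ℕ.+ 1)) r) ⟩
    2 ℕ.^ C ℕ.* 2 ℕ.^ ((v ℕ.+ (d ℕ.+ 1)) ℕ.* r)
      ≡⟨ ℕP.^-distribˡ-+-* 2 C ((v ℕ.+ (d ℕ.+ 1)) ℕ.* r) ⟨
    2 ℕ.^ (C ℕ.+ (v ℕ.+ (d ℕ.+ 1)) ℕ.* r)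
      ≡⟨ cong (2 ℕ.^_) (regroup C v (d ℕ.+ 1) r) ⟩
    2 ℕ.^ (C ℕ.+ (d ℕ.+ 1) ℕ.* r ℕ.+ v ℕ.* r)
      <⟨ ℕP.^-monoʳ-< 2 (s≤s (s≤s z≤n)) lt ⟩
    2 ℕ.^ (2 ℕ.^ v) ∎)
    where
    open ℕP.≤-Reasoning
    regroup : ∀ C v e r → C ℕ.+ (v ℕ.+ e) ℕ.* r ≡ C ℕ.+ e ℕ.* r ℕ.+ v ℕ.* r
    regroup = ℕR.solve-∀
    t = 2 ℕ.^ v
    expand : ∀ t u → t ℕ.* (u ℕ.* 2) ≡ 2 ℕ.* t ℕ.* u
    expand = ℕR.solve-∀
    grow : ∀ d → 2 ℕ.* t ℕ.+ d ℕ.≤ 2 ℕ.* t ℕ.* 2 ℕ.^ d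
    grow zero    = ℕP.≤-reflexive (trans (ℕP.+-identityʳ _) (sym (ℕP.*-identityʳ _)))
    grow (suc d) = begin
      2 ℕ.* t ℕ.+ suc d                        ≡⟨ ℕP.+-suc (2 ℕ.* t) d ⟩
      suc (2 ℕ.* t ℕ.+ d)                      ≤⟨ ℕP.+-mono-≤ {1} (ℕP.*-mono-≤ {1} {2 ℕ.* t} (ℕP.*-mono-≤ {1} {2} (s≤s z≤n) (ℕP.m^n>0 2 v)) (ℕP.m^n>0 2 d)) (grow d) ⟩
      2 ℕ.* t ℕ.* 2 ℕ.^ d ℕ.+ 2 ℕ.* t ℕ.* 2 ℕ.^ d   ≡⟨ dbl (2 ℕ.* t) (2 ℕ.^ d) ⟩
      2 ℕ.* t ℕ.* 2 ℕ.^ suc d                  ∎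
      where
      dbl : ∀ a b → a ℕ.* b ℕ.+ a ℕ.* b ≡ a ℕ.* (2 ℕ.* b)
      dbl = ℕR.solve-∀
    base : 2 ℕ.* 2 ℕ.^ v ℕ.+ d ℕ.≤ 2 ℕ.^ (v ℕ.+ (d ℕ.+ 1))
    base = ℕP.≤-trans (grow d) (ℕP.≤-reflexive (trans (sym (expand t (2 ℕ.^ d))) (sym (trans (ℕP.^-distribˡ-+-* 2 v (d ℕ.+ 1)) (cong (t ℕ.*_) (ℕP.^-distribˡ-+-* 2 d 1))))))

  Σ-mono : ∀ n {f g : ℕ → ℤ} → (∀ i → i ℕ.< n → f i ≤ g i) → Σ n f ≤ Σ n g
  Σ-mono zero    h = ℤP.≤-refl
  Σ-mono (suc n) h = ℤP.+-mono-≤ (Σ-mono n (λ i i<n → h i (ℕP.m<n⇒m<1+n i<n))) (h n ℕP.≤-refl)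

  Σ-nonneg : ∀ n {f : ℕ → ℤ} → (∀ i → 0ℤ ≤ f i) → 0ℤ ≤ Σ n f
  Σ-nonneg zero    h = ℤP.≤-refl
  Σ-nonneg (suc n) h = ℤP.+-mono-≤ (Σ-nonneg n h) (h n)

  ≤-+ʳ : ∀ {a b} → 0ℤ ≤ b → a ≤ a + b
  ≤-+ʳ {a} 0≤b = ℤP.≤-trans (ℤP.≤-reflexive (sym (ℤP.+-identityʳ a))) (ℤP.+-monoʳ-≤ a 0≤b)

  ≤-+ˡ : ∀ {a b} → 0ℤ ≤ b → a ≤ b + a
  ≤-+ˡ {a} {b} 0≤b = ℤP.≤-trans (≤-+ʳ 0≤b) (ℤP.≤-reflexive (ℤP.+-comm a b))

  Σ-≤-longer : ∀ {m n} {f : ℕ → ℤ} → m ℕ.≤ n → (∀ i → 0ℤ ≤ f i) → Σ m f ≤ Σ n f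
  Σ-≤-longer {m} {n} {f} m≤n h = ℤP.≤-trans (≤-+ʳ (Σ-nonneg (n ℕ.∸ m) (λ i → h (m ℕ.+ i))))
    (ℤP.≤-reflexive (trans (sym (Σ-split m (n ℕ.∸ m) f)) (cong (λ k → Σ k f) (ℕP.m+[n∸m]≡n m≤n))))

  square-nonneg : ∀ i → 0ℤ ≤ i * i
  square-nonneg (+ n)        = ℤP.≤-trans (ℤ.+≤+ z≤n) (ℤP.≤-reflexive (ℤP.pos-* n n))
  square-nonneg (ℤ.-[1+ n ]) = ℤ.+≤+ z≤n

  *-nonneg : ∀ {a b} → 0ℤ ≤ a → 0ℤ ≤ b → 0ℤ ≤ a * b
  *-nonneg {+ a} {+ b} _ _ = ℤP.≤-trans (ℤ.+≤+ z≤n) (ℤP.≤-reflexive (ℤP.pos-* a b))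

  -- Every block of length M + 2 contains one number of the progression 1 mod M + 2, where `f` is 1.
  Σ-blocks : ∀ M {f : ℕ → ℤ} → (∀ i → 0ℤ ≤ f i) → (∀ i → f (1 ℕ.+ suc (suc M) ℕ.* i) ≡ 1ℤ) → ∀ v → + v ≤ Σ (v ℕ.* suc (suc M)) f
  Σ-blocks M h one zero    = ℤP.≤-refl
  Σ-blocks M {f} h one (suc v) = ℤP.≤-trans (ℤP.≤-reflexive (trans (cong +_ (sym (ℕP.+-comm v 1))) (ℤP.pos-+ v 1)))
    (ℤP.≤-trans (ℤP.+-mono-≤ (Σ-blocks M h one v) block)
      (ℤP.≤-reflexive (trans (sym (Σ-split (v ℕ.* suc (suc M)) (suc (suc M)) f)) (cong (λ k → Σ k f) (ℕP.+-comm (v ℕ.* suc (suc M)) (suc (suc M)))))))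
    where
    g : ℕ → ℤ
    g i = f (v ℕ.* suc (suc M) ℕ.+ i)
    g1 : g 1 ≡ 1ℤ
    g1 = trans (cong f (trans (ℕP.+-comm (v ℕ.* suc (suc M)) 1) (cong suc (ℕP.*-comm v (suc (suc M)))))) (one v)
    block : 1ℤ ≤ Σ (suc (suc M)) g
    block = ℤP.≤-trans (ℤP.≤-reflexive (sym g1)) (ℤP.≤-trans (≤-+ˡ {g 1} {0ℤ + g 0} (ℤP.+-mono-≤ (ℤP.≤-refl {0ℤ}) (h _))) (Σ-≤-longer {2} {suc (suc M)} {g} (s≤s (s≤s z≤n)) (λ i → h _)))

  -- The period is `modulus` + 2, which builds in that it is at least 2. `values` asks the members
  -- of `hs` to be ±1 wherever χ is not 0, so that all twists vanish at the same primes as χ.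
  record Family (hs : List Character) (χ : Character) : Set where
    field
      modulus period-bound : ℕ
      bounded : BoundedFamily period-bound hs χ
      units   : ∀ i → fun χ (1 ℕ.+ suc (suc modulus) ℕ.* i) ≡ 1ℤ
      values  : ∀ q → fun χ q ≡ 0ℤ ⊎ ((fun χ q ≡ 1ℤ ⊎ fun χ q ≡ -1ℤ) × All (λ h → fun h q ≡ 1ℤ ⊎ fun h q ≡ -1ℤ) hs)

  module _ (hs : List Character) (χ : Character) (F : Family hs χ) where
    open Family F renaming (modulus to M; period-bound to P)
    private
      -- With N = 2^n = 2H and j < 2^u, j² ≤ H, so the weight at j² is at least Q = (2^e)^k because
      -- H ≥ k 2^e. The range j < 2^u holds 2^w blocks of length `M₂`, each with a j for which χ(j)²
      -- = 1: the lower bound is 2^w Q, about √N above N^k. The upper bound is c^r N^k = C n^r Q,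
      -- with only logarithms above N^k. Since `n` is linear in `w`, a suitable `w` separates them.
      r = size hs
      k = suc r
      M₂ = suc (suc M)
      b = M₂ ℕ.+ r
      C = (P ℕ.* (2 ℕ.^ r ℕ.+ 1)) ℕ.^ r ℕ.* 2 ℕ.^ (suc r ℕ.* k)
      w = proj₁ (polynomial<exponential C (2 ℕ.* b ℕ.+ 1) r)
      n = 2 ℕ.* w ℕ.+ (2 ℕ.* b ℕ.+ 1)
      C-small : C ℕ.* n ℕ.^ r ℕ.< 2 ℕ.^ w
      C-small = proj₂ (polynomial<exponential C (2 ℕ.* b ℕ.+ 1) r)
      N = 2 ℕ.^ n
      u = w ℕ.+ b
      e = 2 ℕ.* w ℕ.+ (2 ℕ.* M₂ ℕ.+ r)
      H = 2 ℕ.^ (e ℕ.+ r)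

      n≡ : n ≡ suc (e ℕ.+ r)
      n≡ = lemma w M₂ r
        where
        lemma : ∀ w m r → 2 ℕ.* w ℕ.+ (2 ℕ.* (m ℕ.+ r) ℕ.+ 1) ≡ suc (2 ℕ.* w ℕ.+ (2 ℕ.* m ℕ.+ r) ℕ.+ r)
        lemma = ℕR.solve-∀

      N≡H+H : N ≡ H ℕ.+ H
      N≡H+H = trans (cong (2 ℕ.^_) n≡) (cong (H ℕ.+_) (ℕP.+-identityʳ H))

      2^u²≡H : 2 ℕ.^ u ℕ.* 2 ℕ.^ u ≡ H
      2^u²≡H = trans (sym (ℕP.^-distribˡ-+-* 2 u u)) (cong (2 ℕ.^_) (lemma w M₂ r))
        where
        lemma : ∀ w m r → w ℕ.+ (m ℕ.+ r) ℕ.+ (w ℕ.+ (m ℕ.+ r)) ≡ 2 ℕ.* w ℕ.+ (2 ℕ.* m ℕ.+ r) ℕ.+ r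
        lemma = ℕR.solve-∀

      W = weight N k
      Q = (2 ℕ.^ e) ℕ.^ k

      W-large : ∀ j → j ℕ.< 2 ℕ.^ u → + Q ≤ W (j ℕ.* (j ℕ.* 1))
      W-large j j<2^u = ℤ.+≤+ (ℕP.≤-trans (^-≤-bin (2 ℕ.^ e) k) (bin-mono k (begin
        k ℕ.* 2 ℕ.^ e                    ≤⟨ ℕP.*-monoˡ-≤ (2 ℕ.^ e) (n<2^n r) ⟩
        2 ℕ.^ r ℕ.* 2 ℕ.^ e              ≡⟨ trans (ℕP.*-comm (2 ℕ.^ r) _) (sym (ℕP.^-distribˡ-+-* 2 e r)) ⟩
        H                                ≡⟨ ℕP.m+n∸n≡m H H ⟨
        H ℕ.+ H ℕ.∸ H                    ≡⟨ cong (ℕ._∸ H) N≡H+H ⟨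
        N ℕ.∸ H                          ≤⟨ ℕP.∸-monoʳ-≤ N j²≤H ⟩
        N ℕ.∸ j ℕ.* (j ℕ.* 1)            ∎)))
        where
        open ℕP.≤-Reasoning
        j²≤H : j ℕ.* (j ℕ.* 1) ℕ.≤ H
        j²≤H = ℕP.≤-trans (ℕP.*-mono-≤ (ℕP.<⇒≤ j<2^u) (ℕP.≤-trans (ℕP.≤-reflexive (ℕP.*-identityʳ j)) (ℕP.<⇒≤ j<2^u))) (ℕP.≤-reflexive 2^u²≡H)

      κ : ℕ → ℤ
      κ = fun (χ · χ)

      κ-count : + (2 ℕ.^ w) ≤ Σ (2 ℕ.^ u) κ
      κ-count = ℤP.≤-trans (Σ-blocks M (λ i → square-nonneg (fun χ i)) (λ i → cong₂ _*_ (units i) (units i)) (2 ℕ.^ w))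
        (Σ-≤-longer (begin
          2 ℕ.^ w ℕ.* M₂                 ≤⟨ ℕP.*-monoʳ-≤ (2 ℕ.^ w) (ℕP.≤-trans (ℕP.<⇒≤ (n<2^n M₂)) (ℕP.^-monoʳ-≤ 2 (ℕP.m≤m+n M₂ r))) ⟩
          2 ℕ.^ w ℕ.* 2 ℕ.^ b            ≡⟨ ℕP.^-distribˡ-+-* 2 w b ⟨
          2 ℕ.^ u                        ∎) (λ i → square-nonneg (fun χ i)))
        where open ℕP.≤-Reasoning

      2^u≤N : 2 ℕ.^ u ℕ.≤ N
      2^u≤N = ℕP.^-monoʳ-≤ 2 (ℕP.+-mono-≤ (ℕP.m≤m+n w (w ℕ.+ 0)) (ℕP.≤-trans (ℕP.m≤m+n b (b ℕ.+ 0)) (ℕP.m≤m+n _ 1)))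

      lower : + (2 ℕ.^ w ℕ.* Q) ≤ S N 1 χ W 1
      lower = ℤP.≤-trans (ℤP.≤-reflexive (trans (ℤP.pos-* (2 ℕ.^ w) Q) (ℤP.*-comm (+ (2 ℕ.^ w)) (+ Q))))
        (ℤP.≤-trans (ℤP.*-monoˡ-≤-nonNeg (+ Q) κ-count)
          (ℤP.≤-trans (ℤP.≤-reflexive (sym (Σ-* (2 ℕ.^ u) (+ Q) κ)))
            (ℤP.≤-trans (Σ-mono (2 ℕ.^ u) (λ j j< → term j j<))
              (Σ-≤-longer 2^u≤N (λ j → *-nonneg (*-nonneg {1ℤ} (ℤ.+≤+ z≤n) (square-nonneg (fun χ j))) (ℤ.+≤+ z≤n))))))
        where
        term : ∀ j → j ℕ.< 2 ℕ.^ u → + Q * κ j ≤ 1ℤ * κ j * W (j ℕ.* (j ℕ.* 1))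
        term j j< = ℤP.≤-trans (ℤP.≤-reflexive (trans (ℤP.*-comm (+ Q) (κ j)) (cong (_* + Q) (sym (ℤP.*-identityˡ (κ j))))))
          (ℤP.*-monoˡ-≤-nonNeg (1ℤ * κ j) {{ℤ.nonNegative (*-nonneg {1ℤ} (ℤ.+≤+ z≤n) (square-nonneg (fun χ j)))}} (W-large j j<))

      c = P ℕ.* (n ℕ.* (2 ℕ.^ r ℕ.+ 1))

      upper : ∣ Φ N 1 hs χ W 1 ∣ ℕ.≤ c ℕ.^ r ℕ.* N ℕ.^ k
      upper = ℕP.≤-trans (ℕP.≤-reflexive (sym (ℕP.*-identityˡ _)))
        (Upper.Φ-smooth n P r hs χ bounded 0 (ℕP.≤-reflexive (ℕP.+-identityʳ r)) (weight-vanishes N r)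
          (subst (λ T → Smooth T (N ℕ.^ k) W) (sym (ℕP.+-identityʳ r)) (weight-smooth N r)) 0 z≤n 1 (s≤s z≤n))

      i≤+∣i∣ : ∀ i → i ≤ + ∣ i ∣
      i≤+∣i∣ (+ n)        = ℤP.≤-refl
      i≤+∣i∣ (ℤ.-[1+ n ]) = ℤ.-≤+

      -- Both bounds contain the factor `Q`; once it is cancelled, 2^w ≤ C n^r contradicts the
      -- choice of `w`.
      contradiction : S N 1 χ W 1 ≤ Φ N 1 hs χ W 1 → ⊥
      contradiction h = ℕP.<⇒≱ C-small (ℕP.*-cancelʳ-≤ (2 ℕ.^ w) (C ℕ.* n ℕ.^ r) Q {{ℕP.m^n≢0 (2 ℕ.^ e) k {{ℕP.m^n≢0 2 e}}}} (begin
        2 ℕ.^ w ℕ.* Q                              ≤⟨ ℤP.drop‿+≤+ (ℤP.≤-trans lower (ℤP.≤-trans h (i≤+∣i∣ _))) ⟩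
        ∣ Φ N 1 hs χ W 1 ∣                         ≤⟨ upper ⟩
        c ℕ.^ r ℕ.* N ℕ.^ k                        ≡⟨ cong₂ ℕ._*_ c^r N^k ⟩
        ((P ℕ.* (2 ℕ.^ r ℕ.+ 1)) ℕ.^ r ℕ.* n ℕ.^ r) ℕ.* (2 ℕ.^ (suc r ℕ.* k) ℕ.* Q)
                                                   ≡⟨ regroup ((P ℕ.* (2 ℕ.^ r ℕ.+ 1)) ℕ.^ r) (n ℕ.^ r) (2 ℕ.^ (suc r ℕ.* k)) Q ⟩
        C ℕ.* n ℕ.^ r ℕ.* Q                        ∎))
        where
        open ℕP.≤-Reasoning
        regroup : ∀ a b c d → a ℕ.* b ℕ.* (c ℕ.* d) ≡ a ℕ.* c ℕ.* b ℕ.* d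
        regroup = ℕR.solve-∀
        swap : ∀ P n t → P ℕ.* (n ℕ.* t) ≡ P ℕ.* t ℕ.* n
        swap = ℕR.solve-∀
        c^r : c ℕ.^ r ≡ (P ℕ.* (2 ℕ.^ r ℕ.+ 1)) ℕ.^ r ℕ.* n ℕ.^ r
        c^r = trans (cong (ℕ._^ r) (swap P n (2 ℕ.^ r ℕ.+ 1))) (^-distribʳ-* (P ℕ.* (2 ℕ.^ r ℕ.+ 1)) n r)
        N^k : N ℕ.^ k ≡ 2 ℕ.^ (suc r ℕ.* k) ℕ.* Q
        N^k = trans (cong (ℕ._^ k) (trans (cong (2 ℕ.^_) (trans n≡ (trans (sym (ℕP.+-suc e r)) (ℕP.+-comm e (suc r))))) (ℕP.^-distribˡ-+-* 2 (suc r) e)))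
          (trans (^-distribʳ-* (2 ℕ.^ suc r) (2 ℕ.^ e) k) (cong (ℕ._* Q) (ℕP.^-*-assoc 2 (suc r) k)))

      Wanted : ℕ → Set
      Wanted q = Prime q × fun χ q ≡ -1ℤ × All (λ h → fun h q ≡ 1ℤ) hs

      wanted? : ∀ q → Dec (Wanted q)
      wanted? q = prime? q ×-dec (fun χ q ℤ.≟ -1ℤ) ×-dec All.all? (λ h → fun h q ℤ.≟ 1ℤ) hs

      N≡2+ : ∃ λ m → N ≡ suc (suc m)
      N≡2+ = helper N (ℕP.≤-trans (ℕP.*-monoʳ-≤ 2 (ℕP.m^n>0 2 (e ℕ.+ r))) (ℕP.≤-reflexive (sym (cong (2 ℕ.^_) n≡))))
        where
        helper : ∀ N → 2 ℕ.≤ N → ∃ λ m → N ≡ suc (suc m)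
        helper (suc (suc m)) _ = m , refl
        helper (suc zero) (s≤s ())

      split : (∀ q → q ℕ.< suc N → ¬ Wanted q) → ∀ q → Prime q → q ℕ.≤ N → Splits N hs χ q
      split none q pr q≤N with values q
      ... | inj₁ z = inj₁ z
      ... | inj₂ (inj₁ χ≡1 , hv) = inj₂ (cong₂ _*_ χ≡1 χ≡1 , hv , inj₁ χ≡1)
      ... | inj₂ (inj₂ χ≡-1 , hv) = inj₂ (cong₂ _*_ χ≡-1 χ≡-1 , hv , inj₂ (some hs hv (λ a → none q (s≤s q≤N) (pr , χ≡-1 , a))))
        where
        some : ∀ hs → All (λ h → fun h q ≡ 1ℤ ⊎ fun h q ≡ -1ℤ) hs → ¬ All (λ h → fun h q ≡ 1ℤ) hs → Any (λ h → fun h q ≡ -1ℤ) hs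
        some []       []            ¬a = ⊥-elim (¬a [])
        some (h ∷ hs) (inj₂ e ∷ v) ¬a = here e
        some (h ∷ hs) (inj₁ e ∷ v) ¬a = there (some hs v (λ a → ¬a (e ∷ a)))

    -- The search up to `N` is decidable, and its failure supplies `Splits` at every prime, hence
    -- the impossible inequality.
    prime-exists : ∃ λ q → Prime q × fun χ q ≡ -1ℤ × All (λ h → fun h q ≡ 1ℤ) hs
    prime-exists with ℕP.anyUpTo? wanted? (suc N)
    ... | yes (q , _ , w) = q , w
    ... | no none = ⊥-elim (contradiction (S≤Φ N (proj₂ N≡2+) hs χ (λ _ → ℤ.+≤+ z≤n) (weight-vanishes N r) (split (λ q q< w → none (q , q< , w))) 1 (s≤s z≤n)))

-- Congruences of integers.

module Mod where
  open import Data.Nat as ℕ using (ℕ; zero; suc)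
  import Data.Nat.Properties as ℕP
  import Data.Nat.Divisibility as ℕD
  open import Data.Nat.DivMod using (m≡m%n+[m/n]*n; _%_; _/_)
  open import Data.Nat.Primality using (Prime; euclidsLemma)
  open import Data.Integer using (ℤ; +_; 0ℤ; ∣_∣; _+_; _*_; _-_; -_)
  import Data.Integer.Properties as ℤP
  open import Data.Integer.Divisibility.Signed using (∣ᵤ⇒∣; divides)
  open import Data.Integer.Tactic.RingSolver using (solve-∀)
  open import Data.Sum using (_⊎_; inj₁; inj₂)
  open import Data.Empty using (⊥-elim)
  open import Relation.Binary.PropositionalEquality

  infix 4 _≈_[_]
  -- The quotient is stored, so each closure property is a ring identity with an explicit new
  -- quotient.
  data _≈_[_] (a b : ℤ) (n : ℕ) : Set where
    mod : (k : ℤ) → a ≡ b + k * + n → a ≈ b [ n ]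

  module _ {n : ℕ} where
    ≈-refl : ∀ {a} → a ≈ a [ n ]
    ≈-refl {a} = mod 0ℤ (sym (ℤP.+-identityʳ a))

    ≈-reflexive : ∀ {a b} → a ≡ b → a ≈ b [ n ]
    ≈-reflexive refl = ≈-refl

    ≈-sym : ∀ {a b} → a ≈ b [ n ] → b ≈ a [ n ]
    ≈-sym {a} {b} (mod k refl) = mod (- k) (lemma b k (+ n))
      where
      lemma : ∀ b k n → b ≡ b + k * n + - k * n
      lemma = solve-∀

    ≈-trans : ∀ {a b c} → a ≈ b [ n ] → b ≈ c [ n ] → a ≈ c [ n ]
    ≈-trans {c = c} (mod k refl) (mod l refl) = mod (l + k) (lemma c l k (+ n))
      where
      lemma : ∀ c l k n → c + l * n + k * n ≡ c + (l + k) * n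
      lemma = solve-∀

    ≈-+ : ∀ {a b c d} → a ≈ b [ n ] → c ≈ d [ n ] → a + c ≈ b + d [ n ]
    ≈-+ {b = b} {d = d} (mod k refl) (mod l refl) = mod (k + l) (lemma b d k l (+ n))
      where
      lemma : ∀ b d k l n → b + k * n + (d + l * n) ≡ b + d + (k + l) * n
      lemma = solve-∀

    ≈-* : ∀ {a b c d} → a ≈ b [ n ] → c ≈ d [ n ] → a * c ≈ b * d [ n ]
    ≈-* {b = b} {d = d} (mod k refl) (mod l refl) = mod (b * l + k * d + k * l * + n) (lemma b d k l (+ n))
      where
      lemma : ∀ b d k l n → (b + k * n) * (d + l * n) ≡ b * d + (b * l + k * d + k * l * n) * n
      lemma = solve-∀

    ≈-neg : ∀ {a b} → a ≈ b [ n ] → - a ≈ - b [ n ]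
    ≈-neg {b = b} (mod k refl) = mod (- k) (lemma b k (+ n))
      where
      lemma : ∀ b k n → - (b + k * n) ≡ - b + - k * n
      lemma = solve-∀

    ≈-- : ∀ {a b c d} → a ≈ b [ n ] → c ≈ d [ n ] → a - c ≈ b - d [ n ]
    ≈-- p q = ≈-+ p (≈-neg q)

    ≈⇒-≈0 : ∀ {a b} → a ≈ b [ n ] → a - b ≈ 0ℤ [ n ]
    ≈⇒-≈0 {b = b} (mod k refl) = mod (k) (lemma b k (+ n))
      where
      lemma : ∀ b k n → b + k * n - b ≡ 0ℤ + k * n
      lemma = solve-∀

    -≈0⇒≈ : ∀ {a b} → a - b ≈ 0ℤ [ n ] → a ≈ b [ n ]
    -≈0⇒≈ {a} {b} (mod k e) = mod k (trans (lemma a b) (cong (λ z → b + z) (trans e (ℤP.+-identityˡ _))))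
      where
      lemma : ∀ a b → a ≡ b + (a - b)
      lemma = solve-∀

    n≈0 : ∀ k → k * + n ≈ 0ℤ [ n ]
    n≈0 k = mod k (sym (ℤP.+-identityˡ _))

    ≈0⇒∣ : ∀ {a} → a ≈ 0ℤ [ n ] → n ℕD.∣ ∣ a ∣
    ≈0⇒∣ (mod k refl) = ℕD.divides ∣ k ∣ (trans (cong ∣_∣ (ℤP.+-identityˡ (k * + n))) (ℤP.abs-* k (+ n)))

    ∣⇒≈0 : ∀ {a} → n ℕD.∣ ∣ a ∣ → a ≈ 0ℤ [ n ]
    ∣⇒≈0 {a} n∣a with ∣ᵤ⇒∣ {+ n} {a} n∣a
    ... | divides q e = mod q (trans e (sym (ℤP.+-identityˡ _)))

    ≈-% : ∀ x .{{_ : ℕ.NonZero n}} → + x ≈ + (x % n) [ n ]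
    ≈-% x = mod (+ (x / n)) (trans (cong +_ (m≡m%n+[m/n]*n x n)) (trans (ℤP.pos-+ (x % n) _) (cong (λ z → + (x % n) + z) (ℤP.pos-* (x / n) n))))

    small⇒≡ : ∀ {a b} → a ≈ b [ n ] → ∣ a - b ∣ ℕ.< n → a ≡ b
    small⇒≡ {a} {b} (mod k refl) lt = trans (cong (λ z → b + z * + n) (k≡0 k (subst (λ z → ∣ z ∣ ℕ.< n) (lemma b k (+ n)) lt))) (ℤP.+-identityʳ b)
      where
      lemma : ∀ b k n → b + k * n - b ≡ k * n
      lemma = solve-∀
      k≡0 : ∀ k → ∣ k * + n ∣ ℕ.< n → k ≡ 0ℤ
      k≡0 k lt = ℤP.∣i∣≡0⇒i≡0 (go ∣ k ∣ (subst (ℕ._< n) (ℤP.abs-* k (+ n)) lt))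
        where
        go : ∀ a → a ℕ.* n ℕ.< n → a ≡ 0
        go zero    _ = refl
        go (suc a) l = ⊥-elim (ℕP.<⇒≱ l (ℕP.m≤m+n n (a ℕ.* n)))

    prime-≈0 : Prime n → ∀ {a b} → a * b ≈ 0ℤ [ n ] → a ≈ 0ℤ [ n ] ⊎ b ≈ 0ℤ [ n ]
    prime-≈0 pr {a} {b} ab≈0 with euclidsLemma ∣ a ∣ ∣ b ∣ pr (subst (n ℕD.∣_) (ℤP.abs-* a b) (≈0⇒∣ ab≈0))
    ... | inj₁ p = inj₁ (∣⇒≈0 p)
    ... | inj₂ p = inj₂ (∣⇒≈0 p)

    prime-□≈0 : Prime n → ∀ {a} → a * a ≈ 0ℤ [ n ] → a ≈ 0ℤ [ n ]
    prime-□≈0 pr e with prime-≈0 pr e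
    ... | inj₁ z = z
    ... | inj₂ z = z

  *-≢0 : ∀ {x y} → x ≢ 0ℤ → y ≢ 0ℤ → x * y ≢ 0ℤ
  *-≢0 {x} nx ny e with ℤP.i*j≡0⇒i≡0∨j≡0 x e
  ... | inj₁ z = nx z
  ... | inj₂ z = ny z

-- Reindexing finite sums and products.

module FinPerm where
  open import Algebra.Structures using (IsCommutativeMonoid)
  open import Algebra.Bundles using (CommutativeMonoid)
  open import Data.Nat as ℕ using (ℕ; zero; suc)
  import Data.Nat.Properties as ℕP
  open import Data.Fin using (Fin; toℕ; fromℕ<; punchOut) renaming (zero to fzero; suc to fsuc)
  import Data.Fin.Properties as FP
  open import Data.Fin.Permutation using (Permutation; permutation)
  open import Data.Product using (_,_; ∃; proj₁; proj₂)
  open import Data.Empty using (⊥-elim)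
  open import Function.Definitions using (Injective)
  open import Relation.Nullary using (yes; no)
  open import Relation.Binary.PropositionalEquality

  injective⇒surjective : ∀ {n} {f : Fin n → Fin n} → Injective _≡_ _≡_ f → ∀ v → ∃ λ i → f i ≡ v
  injective⇒surjective {suc n} {f} inj v with FP.any? (λ i → f i FP.≟ v)
  ... | yes p = p
  ... | no ¬p = ⊥-elim (ℕP.<⇒≱ (ℕP.n<1+n n) (FP.injective⇒≤ {f = λ i → punchOut (λ v≡fi → ¬p (i , sym v≡fi))}
                  (λ {i} {j} eq → inj (FP.punchOut-injective (λ e → ¬p (i , sym e)) (λ e → ¬p (j , sym e)) eq))))

  injective⇒permutation : ∀ {n} (f : Fin n → Fin n) → Injective _≡_ _≡_ f → Permutation n n
  injective⇒permutation f inj = permutation f g fg (λ i → inj (fg (f i)))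
    where
    g : _ → _
    g v = proj₁ (injective⇒surjective inj v)
    fg : ∀ v → f (g v) ≡ v
    fg v = proj₂ (injective⇒surjective inj v)

  module Fold {C : Set} {_∙_ : C → C → C} {ε : C} (isCM : IsCommutativeMonoid _≡_ _∙_ ε) where
    M : CommutativeMonoid _ _
    M = record { isCommutativeMonoid = isCM }
    open import Algebra.Properties.CommutativeMonoid.Sum M using (sum; sum-permute; sum-cong-≗)
    open IsCommutativeMonoid isCM using (assoc; identityˡ; identityʳ; comm)

    fold : ℕ → (ℕ → C) → C
    fold zero    f = ε
    fold (suc n) f = fold n f ∙ f n

    fold-head : ∀ n f → fold (suc n) f ≡ f 0 ∙ fold n (λ i → f (suc i))
    fold-head zero    f = trans (identityˡ _) (sym (identityʳ _))
    fold-head (suc n) f = trans (cong (_∙ f (suc n)) (fold-head n f)) (assoc _ _ _)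

    fold≡sum : ∀ n f → fold n f ≡ sum {n} (λ i → f (toℕ i))
    fold≡sum zero    f = refl
    fold≡sum (suc n) f = trans (fold-head n f) (cong (f 0 ∙_) (fold≡sum n (λ i → f (suc i))))

    fold-cong : ∀ n {f g : ℕ → C} → (∀ i → i ℕ.< n → f i ≡ g i) → fold n f ≡ fold n g
    fold-cong zero    h = refl
    fold-cong (suc n) h = cong₂ _∙_ (fold-cong n (λ i i<n → h i (ℕP.m<n⇒m<1+n i<n))) (h n ℕP.≤-refl)

    fold-∙ : ∀ n (f g : ℕ → C) → fold n (λ i → f i ∙ g i) ≡ fold n f ∙ fold n g
    fold-∙ zero    f g = sym (identityˡ ε)
    fold-∙ (suc n) f g = trans (cong (_∙ (f n ∙ g n)) (fold-∙ n f g))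
      (trans (assoc _ _ _) (trans (cong (fold n f ∙_) (trans (sym (assoc _ _ _)) (trans (cong (_∙ g n) (comm _ _)) (assoc _ _ _)))) (sym (assoc _ _ _))))

    fold-ε : ∀ n → fold n (λ _ → ε) ≡ ε
    fold-ε zero    = refl
    fold-ε (suc n) = trans (identityʳ _) (fold-ε n)

    fold-swap : ∀ m n (f : ℕ → ℕ → C) → fold m (λ i → fold n (f i)) ≡ fold n (λ j → fold m (λ i → f i j))
    fold-swap zero    n f = sym (fold-ε n)
    fold-swap (suc m) n f = trans (cong (_∙ fold n (f m)) (fold-swap m n f)) (sym (fold-∙ n (λ j → fold m (λ i → f i j)) (f m)))

    -- An injective self-map of a finite segment is a permutation. Stating this on natural numbers
    -- allows residues to serve as indices.
    fold-permute : ∀ n (π : ℕ → ℕ) → (∀ i → i ℕ.< n → π i ℕ.< n) → (∀ i j → i ℕ.< n → j ℕ.< n → π i ≡ π j → i ≡ j) →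
      ∀ g → fold n (λ i → g (π i)) ≡ fold n g
    fold-permute n π π< inj g = begin
      fold n (λ i → g (π i))               ≡⟨ fold≡sum n _ ⟩
      sum {n} (λ i → g (π (toℕ i)))        ≡⟨ sum-cong-≗ {n} (λ i → cong g (sym (FP.toℕ-fromℕ< (π< (toℕ i) (FP.toℕ<n i))))) ⟩
      sum {n} (λ i → g (toℕ (σ i)))        ≡⟨ sum-permute {n} {n} (λ i → g (toℕ i)) (injective⇒permutation σ σ-inj) ⟨
      sum {n} (λ i → g (toℕ i))            ≡⟨ fold≡sum n g ⟨
      fold n g                             ∎
      where
      open ≡-Reasoning
      σ : Fin n → Fin n
      σ i = fromℕ< (π< (toℕ i) (FP.toℕ<n i))
      σ-inj : Injective _≡_ _≡_ σ
      σ-inj {i} {j} e = FP.toℕ-injective (inj (toℕ i) (toℕ j) (FP.toℕ<n i) (FP.toℕ<n j)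
        (FP.fromℕ<-injective _ _ (π< (toℕ i) (FP.toℕ<n i)) (π< (toℕ j) (FP.toℕ<n j)) e))

-- Quadratic residues: Gauss's lemma and Euler's criterion.

module Residue where
  open Mod
  open FinPerm
  open import Data.Nat as ℕ using (ℕ; zero; suc; z≤n; s≤s)
  import Data.Nat.Properties as ℕP
  open import Data.Nat.Divisibility as ℕD using (_∣_; _∤_; _∣?_)
  open import Data.Nat.DivMod as DM using (_%_)
  open import Data.Nat.Primality using (Prime; euclidsLemma)
  open import Data.Integer as ℤ using (ℤ; +_; 0ℤ; 1ℤ; -1ℤ; ∣_∣; _+_; _*_; _-_; -_)
  import Data.Integer.Properties as ℤP
  open import Data.Integer.Tactic.RingSolver using (solve-∀)
  open import Data.Vec using (Vec; []; _∷_; replicate)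
  open import Data.List using ([]; _∷_; length; map; applyUpTo)
  open import Data.List.Relation.Unary.All as All using (All; []; _∷_)
  open import Data.List.Relation.Unary.AllPairs using (AllPairs; []; _∷_)
  open import Data.Product using (_×_; _,_; ∃; proj₁; proj₂)
  open import Data.Sum using (_⊎_; inj₁; inj₂)
  open import Data.Empty using (⊥; ⊥-elim)
  open import Relation.Nullary using (Dec; yes; no; ¬_)
  open import Relation.Binary.PropositionalEquality

  IsUnit : ℤ → Set
  IsUnit ε = ε ≡ 1ℤ ⊎ ε ≡ -1ℤ

  unit-* : ∀ {ε η} → IsUnit ε → IsUnit η → IsUnit (ε * η)
  unit-* (inj₁ refl) (inj₁ refl) = inj₁ refl
  unit-* (inj₁ refl) (inj₂ refl) = inj₂ refl
  unit-* (inj₂ refl) (inj₁ refl) = inj₂ refl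
  unit-* (inj₂ refl) (inj₂ refl) = inj₁ refl

  unit-square : ∀ {ε} → IsUnit ε → ε * ε ≡ 1ℤ
  unit-square (inj₁ refl) = refl
  unit-square (inj₂ refl) = refl

  module Product = Fold ℤP.*-1-isCommutativeMonoid
  open Product using () renaming (fold to Π) public

  Π-unit : ∀ n {f : ℕ → ℤ} → (∀ i → i ℕ.< n → IsUnit (f i)) → IsUnit (Π n f)
  Π-unit zero    h = inj₁ refl
  Π-unit (suc n) h = unit-* (Π-unit n (λ i i<n → h i (ℕP.m<n⇒m<1+n i<n))) (h n ℕP.≤-refl)

  Π-≈ : ∀ {p} n {f g : ℕ → ℤ} → (∀ i → i ℕ.< n → f i ≈ g i [ p ]) → Π n f ≈ Π n g [ p ]
  Π-≈ zero    h = ≈-refl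
  Π-≈ (suc n) h = ≈-* (Π-≈ n (λ i i<n → h i (ℕP.m<n⇒m<1+n i<n))) (h n ℕP.≤-refl)

  parity : ℕ → ℤ
  parity zero    = 1ℤ
  parity (suc n) = - parity n

  parity-unit : ∀ n → IsUnit (parity n)
  parity-unit zero = inj₁ refl
  parity-unit (suc n) with parity-unit n
  ... | inj₁ e = inj₂ (cong -_ e)
  ... | inj₂ e = inj₁ (cong -_ e)

  parity-+ : ∀ m n → parity (m ℕ.+ n) ≡ parity m * parity n
  parity-+ zero    n = sym (ℤP.*-identityˡ _)
  parity-+ (suc m) n = trans (cong -_ (parity-+ m n)) (ℤP.neg-distribˡ-* (parity m) (parity n))

  parity-double : ∀ n → parity (n ℕ.+ n) ≡ 1ℤ
  parity-double n = trans (parity-+ n n) (unit-square (parity-unit n))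

  parity-odd* : ∀ h n → parity (suc (h ℕ.+ h) ℕ.* n) ≡ parity n
  parity-odd* h n = trans (parity-+ n ((h ℕ.+ h) ℕ.* n)) (trans (cong (parity n *_) (trans (cong parity (ℕP.*-distribʳ-+ n h h)) (parity-double (h ℕ.* n)))) (ℤP.*-identityʳ _))

  module Gauss (h : ℕ) where
    p = suc (h ℕ.+ h)

    sgn′ : ∀ {ρ} → Dec (ρ ℕ.≤ h) → ℤ
    sgn′ (yes _) = 1ℤ
    sgn′ (no _)  = -1ℤ

    abs′ : ∀ {ρ} → Dec (ρ ℕ.≤ h) → ℕ
    abs′ {ρ} (yes _) = ρ
    abs′ {ρ} (no _)  = p ℕ.∸ ρ

    -- x is congruent to σ x * v x with 1 ≤ v x ≤ h.
    σ : ℕ → ℤ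
    σ x = sgn′ (x % p ℕ.≤? h)

    v : ℕ → ℕ
    v x = abs′ (x % p ℕ.≤? h)

    σ-unit : ∀ x → IsUnit (σ x)
    σ-unit x with x % p ℕ.≤? h
    ... | yes _ = inj₁ refl
    ... | no _  = inj₂ refl

    private
      spec′ : ∀ {ρ} (d : Dec (ρ ℕ.≤ h)) → ρ ℕ.≤ p → + ρ ≈ sgn′ d * + abs′ d [ p ]
      spec′ {ρ} (yes _) _   = ≈-reflexive (sym (ℤP.*-identityˡ (+ ρ)))
      spec′ {ρ} (no _)  ρ≤p = mod 1ℤ (trans (lemma (+ ρ) (+ (p ℕ.∸ ρ))) (cong (λ z → -1ℤ * + (p ℕ.∸ ρ) + 1ℤ * z) (trans (sym (ℤP.pos-+ (p ℕ.∸ ρ) ρ)) (cong +_ (ℕP.m∸n+n≡m ρ≤p)))))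
        where
        lemma : ∀ a b → a ≡ -1ℤ * b + 1ℤ * (b + a)
        lemma = solve-∀

      range′ : ∀ {ρ} (d : Dec (ρ ℕ.≤ h)) → 0 ℕ.< ρ → ρ ℕ.< p → 0 ℕ.< abs′ d × abs′ d ℕ.≤ h
      range′ (yes ρ≤h) 0<ρ ρ<p = 0<ρ , ρ≤h
      range′ {ρ} (no ρ≰h) 0<ρ ρ<p = ℕP.m<n⇒0<n∸m ρ<p , ℕP.≤-trans (ℕP.∸-monoʳ-≤ p (ℕP.≰⇒> ρ≰h)) (ℕP.≤-reflexive (ℕP.m+n∸m≡n h h))

    spec : ∀ x → + x ≈ σ x * + v x [ p ]
    spec x = ≈-trans (≈-% x) (spec′ (x % p ℕ.≤? h) (ℕP.<⇒≤ (DM.m%n<n x p)))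

    range : ∀ {x} → p ∤ x → 0 ℕ.< v x × v x ℕ.≤ h
    range {x} p∤x = range′ (x % p ℕ.≤? h) (ℕP.n≢0⇒n>0 (λ e → p∤x (ℕD.m%n≡0⇒n∣m x p e))) (DM.m%n<n x p)

    -- Both sides have absolute value at most `h`, so they differ by less than p = 2h + 1 and the
    -- congruence is an equality; 0 < u then fixes the sign.
    unique : ∀ {ε η u w} → IsUnit ε → IsUnit η → 0 ℕ.< u → u ℕ.≤ h → w ℕ.≤ h → ε * + u ≈ η * + w [ p ] → ε ≡ η × u ≡ w
    unique {ε} {η} {u} {w} ue uη 0<u u≤h w≤h e = finish ue uη (small⇒≡ e (s≤s (ℕP.≤-trans (ℤP.∣i-j∣≤∣i∣+∣j∣ (ε * + u) (η * + w))
        (ℕP.+-mono-≤ (ℕP.≤-trans (ℕP.≤-reflexive (∣unit*∣ ue u)) u≤h) (ℕP.≤-trans (ℕP.≤-reflexive (∣unit*∣ uη w)) w≤h)))))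
      where
      ∣unit*∣ : ∀ {ε} → IsUnit ε → ∀ u → ∣ ε * + u ∣ ≡ u
      ∣unit*∣ (inj₁ refl) u = cong ∣_∣ (ℤP.*-identityˡ (+ u))
      ∣unit*∣ (inj₂ refl) u = trans (cong ∣_∣ (ℤP.-1*i≡-i (+ u))) (ℤP.∣-i∣≡∣i∣ (+ u))
      ∣≡ : ∀ {ε η} → IsUnit ε → IsUnit η → ε * + u ≡ η * + w → u ≡ w
      ∣≡ ue uη e = trans (sym (∣unit*∣ ue u)) (trans (cong ∣_∣ e) (∣unit*∣ uη w))
      clash : ∀ {u w} → 0 ℕ.< u → + u ≡ - (+ w) → ⊥
      clash {suc u} {zero}  _ ()
      clash {suc u} {suc w} _ ()
      finish : IsUnit ε → IsUnit η → ε * + u ≡ η * + w → ε ≡ η × u ≡ w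
      finish a@(inj₁ refl) b@(inj₁ refl) e = refl , ∣≡ a b e
      finish a@(inj₂ refl) b@(inj₂ refl) e = refl , ∣≡ a b e
      finish (inj₁ refl) (inj₂ refl) e = ⊥-elim (clash 0<u (trans (sym (ℤP.*-identityˡ (+ u))) (trans e (ℤP.-1*i≡-i (+ w)))))
      finish (inj₂ refl) (inj₁ refl) e = ⊥-elim (clash 0<u (trans (sym (ℤP.neg-involutive (+ u))) (cong -_ (trans (sym (ℤP.-1*i≡-i (+ u))) (trans e (ℤP.*-identityˡ (+ w)))))))

    σv-unique : ∀ {x ε u} → p ∤ x → IsUnit ε → u ℕ.≤ h → + x ≈ ε * + u [ p ] → σ x ≡ ε × v x ≡ u
    σv-unique {x} p∤x uε u≤h e = unique (σ-unit x) uε (proj₁ (range p∤x)) (proj₂ (range p∤x)) u≤h (≈-trans (≈-sym (spec x)) e)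

    σv-cong : ∀ {x y ε} → p ∤ x → p ∤ y → IsUnit ε → + x ≈ ε * + y [ p ] → σ x ≡ ε * σ y × v x ≡ v y
    σv-cong {x} {y} {ε} p∤x p∤y uε e = σv-unique p∤x (unit-* uε (σ-unit y)) (proj₂ (range p∤y))
      (≈-trans e (≈-trans (≈-* (≈-refl {a = ε}) (spec y)) (≈-reflexive (sym (ℤP.*-assoc ε (σ y) (+ v y))))))

    -- Gauss's lemma taken as the definition of the Legendre symbol (a / p). Its meaning for squares
    -- becomes the theorem `residue`, and reciprocity becomes a count of signs.
    s : ℕ → ℤ
    s a = Π h (λ i → σ (a ℕ.* suc i))

    s-unit : ∀ a → IsUnit (s a)
    s-unit a = Π-unit h (λ i _ → σ-unit (a ℕ.* suc i))

    module _ (pr : Prime p) where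
      ∤-small : ∀ {u} → 0 ℕ.< u → u ℕ.≤ h → p ∤ u
      ∤-small {suc u} _ u≤h = ℕD.>⇒∤ (s≤s (ℕP.≤-trans u≤h (ℕP.m≤m+n h h)))

      ∤-* : ∀ {a b} → p ∤ a → p ∤ b → p ∤ a ℕ.* b
      ∤-* {a} {b} p∤a p∤b d with euclidsLemma a b pr d
      ... | inj₁ x = p∤a x
      ... | inj₂ x = p∤b x

      ≈0⇒∣ℕ : ∀ {x} → + x ≈ 0ℤ [ p ] → p ∣ x
      ≈0⇒∣ℕ = ≈0⇒∣

      cancelˡ : ∀ {a x y} → p ∤ a → + a * x ≈ + a * y [ p ] → x ≈ y [ p ]
      cancelˡ {a} {x} {y} p∤a e with prime-≈0 pr {+ a} {x - y} (≈-trans (≈-reflexive (distr (+ a) x y)) (≈⇒-≈0 e))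
        where
        distr : ∀ a x y → a * (x - y) ≡ a * x - a * y
        distr = solve-∀
      ... | inj₁ z = ⊥-elim (p∤a (≈0⇒∣ z))
      ... | inj₂ z = -≈0⇒≈ z

      -- Multiplication by `a` permutes the classes of 1 , ... , h up to sign.
      Π-v : ∀ {a} → p ∤ a → (g : ℕ → ℤ) → Π h (λ i → g (v (a ℕ.* suc i))) ≡ Π h (λ i → g (suc i))
      Π-v {a} p∤a g = trans (Product.fold-cong h (λ i i<h → cong g (sym (ℕP.suc-pred (v (a ℕ.* suc i)) {{ℕ.>-nonZero (proj₁ (rng i i<h))}}))))
        (Product.fold-permute h (λ i → ℕ.pred (v (a ℕ.* suc i)))
          (λ i i<h → ℕP.≤-trans (ℕP.≤-reflexive (ℕP.suc-pred (v (a ℕ.* suc i)) {{ℕ.>-nonZero (proj₁ (rng i i<h))}})) (proj₂ (rng i i<h)))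
          inj (λ i → g (suc i)))
        where
        nd : ∀ i → i ℕ.< h → p ∤ a ℕ.* suc i
        nd i i<h = ∤-* p∤a (∤-small (s≤s z≤n) i<h)
        rng : ∀ i → i ℕ.< h → 0 ℕ.< v (a ℕ.* suc i) × v (a ℕ.* suc i) ℕ.≤ h
        rng i i<h = range (nd i i<h)
        inj : ∀ i j → i ℕ.< h → j ℕ.< h → ℕ.pred (v (a ℕ.* suc i)) ≡ ℕ.pred (v (a ℕ.* suc j)) → i ≡ j
        inj i j i<h j<h e = ℕP.suc-injective (proj₂ (unique {1ℤ} {εi * εj} {suc i} {suc j} (inj₁ refl) (unit-* (σ-unit x) (σ-unit y)) (s≤s z≤n) i<h j<h
          (≈-trans (≈-reflexive (ℤP.*-identityˡ (+ suc i))) (cancelˡ p∤a (≈-trans (≈-reflexive (sym (ℤP.pos-* a (suc i)))) (≈-trans (spec x)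
            (≈-trans (≈-reflexive (trans (cong (λ k → εi * + k) v≡) (sym (trans (assoc' εi εj (+ v y)) (cong (εi *_) (trans (cong (_* + v y) (unit-square (σ-unit y))) (ℤP.*-identityˡ (+ v y))))))))
              (≈-trans (≈-* (≈-refl {a = εi * εj}) (≈-sym (spec y))) (≈-reflexive (trans (cong (εi * εj *_) (ℤP.pos-* a (suc j))) (swap (εi * εj) (+ a) (+ suc j))))))))))))
          where
          x = a ℕ.* suc i
          y = a ℕ.* suc j
          εi = σ x
          εj = σ y
          v≡ : v x ≡ v y
          v≡ = trans (sym (ℕP.suc-pred (v x) {{ℕ.>-nonZero (proj₁ (rng i i<h))}})) (trans (cong suc e) (ℕP.suc-pred (v y) {{ℕ.>-nonZero (proj₁ (rng j j<h))}}))
          assoc' : ∀ a b c → a * b * (b * c) ≡ a * (b * b * c)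
          assoc' = solve-∀
          swap : ∀ a b c → a * (b * c) ≡ b * (a * c)
          swap = solve-∀

      -- Modulo p, a b i is σ(b i) times a v(b i), and the numbers v(b i) run through 1 , ... , h
      -- again.
      s-* : ∀ {a b} → p ∤ a → p ∤ b → s (a ℕ.* b) ≡ s a * s b
      s-* {a} {b} p∤a p∤b = begin
        Π h (λ i → σ (a ℕ.* b ℕ.* suc i))                                     ≡⟨ Product.fold-cong h term ⟩
        Π h (λ i → σ (b ℕ.* suc i) * σ (a ℕ.* v (b ℕ.* suc i)))               ≡⟨ Product.fold-∙ h _ _ ⟩
        s b * Π h (λ i → σ (a ℕ.* v (b ℕ.* suc i)))                           ≡⟨ cong (s b *_) (Π-v p∤b (λ k → σ (a ℕ.* k))) ⟩
        s b * s a                                                             ≡⟨ ℤP.*-comm (s b) (s a) ⟩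
        s a * s b                                                             ∎
        where
        open ≡-Reasoning
        term : ∀ i → i ℕ.< h → σ (a ℕ.* b ℕ.* suc i) ≡ σ (b ℕ.* suc i) * σ (a ℕ.* v (b ℕ.* suc i))
        term i i<h = proj₁ (σv-cong {a ℕ.* b ℕ.* suc i} {a ℕ.* k} (∤-* (∤-* p∤a p∤b) (∤-small (s≤s z≤n) i<h)) (∤-* p∤a (∤-small (proj₁ r) (proj₂ r))) (σ-unit (b ℕ.* suc i))
          (≈-trans (≈-reflexive (trans (cong +_ (ℕP.*-assoc a b (suc i))) (ℤP.pos-* a (b ℕ.* suc i)))) (≈-trans (≈-* (≈-refl {a = + a}) (spec (b ℕ.* suc i)))
            (≈-reflexive (trans (swap (+ a) (σ (b ℕ.* suc i)) (+ k)) (cong (σ (b ℕ.* suc i) *_) (sym (ℤP.pos-* a k))))))))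
          where
          k = v (b ℕ.* suc i)
          r = range (∤-* p∤b (∤-small (s≤s z≤n) i<h))
          swap : ∀ a b c → a * (b * c) ≡ b * (a * c)
          swap = solve-∀

      s-≈ : ∀ {a b ε} → p ∤ a → p ∤ b → IsUnit ε → + a ≈ ε * + b [ p ] → s a ≡ Π h (λ _ → ε) * s b
      s-≈ {a} {b} {ε} p∤a p∤b uε e = trans (Product.fold-cong h (λ i i<h → proj₁ (σv-cong {a ℕ.* suc i} {b ℕ.* suc i} (∤-* p∤a (∤-small (s≤s z≤n) i<h)) (∤-* p∤b (∤-small (s≤s z≤n) i<h)) uε
        (≈-trans (≈-reflexive (ℤP.pos-* a (suc i))) (≈-trans (≈-* e (≈-refl {a = + suc i})) (≈-reflexive (trans (ℤP.*-assoc ε (+ b) (+ suc i)) (cong (ε *_) (sym (ℤP.pos-* b (suc i))))))))))) (Product.fold-∙ h _ _)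

      s-periodic : ∀ {a b} → p ∤ a → p ∤ b → + a ≈ + b [ p ] → s a ≡ s b
      s-periodic {a} {b} p∤a p∤b e = trans (s-≈ p∤a p∤b (inj₁ refl) (≈-trans e (≈-reflexive (sym (ℤP.*-identityˡ _))))) (trans (cong (_* s b) (Product.fold-ε h)) (ℤP.*-identityˡ _))

      power : ℕ → ℤ → ℤ
      power n a = Π n (λ _ → a)

      -- Multiplying the congruences a i ≡ σ(a i) v(a i) over all `i` gives a^h h! ≡ s(a) h!; the
      -- factorial is cancelled one factor at a time.
      euler : ∀ {a} → p ∤ a → power h (+ a) ≈ s a [ p ]
      euler {a} p∤a = cancelΠ h (ℕP.≤-refl) (≈-trans (≈-reflexive (sym (Product.fold-∙ h (λ i → + suc i) (λ _ → + a))))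
        (≈-trans (Π-≈ h (λ i _ → ≈-trans (≈-reflexive (trans (ℤP.*-comm (+ suc i) (+ a)) (sym (ℤP.pos-* a (suc i))))) (spec (a ℕ.* suc i))))
          (≈-reflexive (trans (Product.fold-∙ h _ _) (trans (cong (s a *_) (Π-v p∤a (λ k → + k))) (ℤP.*-comm (s a) _))))))
        where
        cancelΠ : ∀ n → n ℕ.≤ h → ∀ {x y} → Π n (λ i → + suc i) * x ≈ Π n (λ i → + suc i) * y [ p ] → x ≈ y [ p ]
        cancelΠ zero    _   {x} {y} e = ≈-trans (≈-reflexive (sym (ℤP.*-identityˡ x))) (≈-trans e (≈-reflexive (ℤP.*-identityˡ y)))
        cancelΠ (suc n) n<h {x} {y} e = cancelˡ (∤-small (s≤s z≤n) n<h) (cancelΠ n (ℕP.<⇒≤ n<h) (≈-trans (≈-reflexive (sym (ℤP.*-assoc (Π n (λ i → + suc i)) (+ suc n) x))) (≈-trans e (≈-reflexive (ℤP.*-assoc (Π n (λ i → + suc i)) (+ suc n) y)))))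

      -- Monic polynomials, given by their lower coefficients.
      evm : ∀ {n} → Vec ℤ n → ℤ → ℤ
      evm []       x = 1ℤ
      evm (c ∷ cs) x = c + x * evm cs x

      addm : ∀ {n} → ℤ → Vec ℤ (suc n) → Vec ℤ n → Vec ℤ (suc n)
      addm a (c ∷ [])         []       = (c + a) ∷ []
      addm a (c ∷ cs@(_ ∷ _)) (d ∷ ds) = (c + a * d) ∷ addm a cs ds

      evm-addm : ∀ {n} a (f : Vec ℤ (suc n)) g x → evm (addm a f g) x ≡ evm f x + a * evm g x
      evm-addm a (c ∷ []) [] x = lemma c a x
        where
        lemma : ∀ c a x → c + a + x * 1ℤ ≡ c + x * 1ℤ + a * 1ℤ
        lemma = solve-∀
      evm-addm a (c ∷ cs@(_ ∷ _)) (d ∷ ds) x = trans (cong (λ z → c + a * d + x * z) (evm-addm a cs ds x)) (lemma a c d x (evm cs x) (evm ds x))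
        where
        lemma : ∀ a c d x u w → c + a * d + x * (u + a * w) ≡ c + x * u + a * (d + x * w)
        lemma = solve-∀

      -- Synthetic division: the quotient of f(x) - f(a) by x - a, which is monic again.
      quo : ∀ {n} → Vec ℤ (suc n) → ℤ → Vec ℤ n
      quo (c ∷ [])         a = []
      quo (c ∷ cs@(_ ∷ _)) a = addm a cs (quo cs a)

      quo-spec : ∀ {n} (f : Vec ℤ (suc n)) a x → evm f x - evm f a ≡ (x - a) * evm (quo f a) x
      quo-spec (c ∷ []) a x = lemma c a x
        where
        lemma : ∀ c a x → c + x * 1ℤ - (c + a * 1ℤ) ≡ (x - a) * 1ℤ
        lemma = solve-∀
      quo-spec (c ∷ cs@(_ ∷ _)) a x = trans (split c a x (evm cs x) (evm cs a))
        (trans (cong (λ z → (x - a) * evm cs x + a * z) (quo-spec cs a x))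
          (trans (join a x (evm cs x) (evm (quo cs a) x)) (cong ((x - a) *_) (sym (evm-addm a cs (quo cs a) x)))))
        where
        split : ∀ c a x u w → c + x * u - (c + a * w) ≡ (x - a) * u + a * (u - w)
        split = solve-∀
        join : ∀ a x u q → (x - a) * u + a * ((x - a) * q) ≡ (x - a) * (u + a * q)
        join = solve-∀

      -- Each root is divided out and the others remain roots of the quotient, as p is prime. In
      -- degree 0 the monic polynomial is the constant 1.
      roots-bound : ∀ {n} (f : Vec ℤ n) rs → length rs ≡ suc n → AllPairs (λ a b → ¬ b ≈ a [ p ]) rs → All (λ r → evm f r ≈ 0ℤ [ p ]) rs → ⊥
      roots-bound [] (r ∷ _) _ _ (1≈0 ∷ _) = ℕP.<⇒≱ (s≤s 0<h+h) (ℕD.∣⇒≤ (≈0⇒∣ℕ 1≈0))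
        where
        open import Data.Nat.Primality using (prime⇒nonTrivial)
        0<h+h : 0 ℕ.< h ℕ.+ h
        0<h+h = ℕP.≤-pred (ℕ.nonTrivial⇒n>1 p {{prime⇒nonTrivial pr}})
      roots-bound f@(_ ∷ _) (a ∷ rs) len (a≉ ∷ ap) (fa≈0 ∷ all) = roots-bound (quo f a) rs (ℕP.suc-injective len) ap (go rs a≉ all)
        where
        go : ∀ rs → All (λ b → ¬ b ≈ a [ p ]) rs → All (λ r → evm f r ≈ 0ℤ [ p ]) rs → All (λ r → evm (quo f a) r ≈ 0ℤ [ p ]) rs
        go []       []         []          = []
        go (b ∷ rs) (b≉a ∷ ns) (fb≈0 ∷ zs) with prime-≈0 pr {b - a} {evm (quo f a) b} (≈-trans (≈-reflexive (sym (quo-spec f a b))) (≈-- fb≈0 fa≈0))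
        ... | inj₁ z = ⊥-elim (b≉a (-≈0⇒≈ z))
        ... | inj₂ z = z ∷ go rs ns zs

      power-1 : ∀ n x → ∃ λ (f : Vec ℤ (suc n)) → evm f x ≡ power (suc n) x - 1ℤ × (∀ y → evm f y ≡ power (suc n) y - 1ℤ)
      power-1 n x = f , eq x , eq
        where
        f = -1ℤ ∷ replicate n 0ℤ
        mono : ∀ n y → evm (replicate n 0ℤ) y ≡ power n y
        mono zero    y = refl
        mono (suc n) y = trans (ℤP.+-identityˡ _) (trans (ℤP.*-comm y _) (cong (_* y) (mono n y)))
        eq : ∀ y → evm f y ≡ power (suc n) y - 1ℤ
        eq y = trans (cong (λ z → -1ℤ + y * z) (mono n y)) (comm' y (power n y))
          where
          comm' : ∀ y z → -1ℤ + y * z ≡ z * y - 1ℤ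
          comm' = solve-∀

      h≢0 : ∃ λ n → h ≡ suc n
      h≢0 = go h (ℕ.nonTrivial⇒n>1 p {{prime⇒nonTrivial pr}})
        where
        open import Data.Nat.Primality using (prime⇒nonTrivial)
        go : ∀ h → 1 ℕ.< suc (h ℕ.+ h) → ∃ λ n → h ≡ suc n
        go (suc n) _ = n , refl
        go zero (s≤s ())

      few-roots : ∀ rs → length rs ≡ suc h → AllPairs (λ a b → ¬ b ≈ a [ p ]) rs → All (λ r → power h r ≈ 1ℤ [ p ]) rs → ⊥
      few-roots rs len ap all with h≢0
      ... | n , h≡ = roots-bound f rs (trans len (cong suc h≡)) ap (All.map (λ {r} e → ≈-trans (≈-reflexive (trans (proj₂ (proj₂ (power-1 n 0ℤ)) r) (cong (λ k → power k r - 1ℤ) (sym h≡)))) (≈⇒-≈0 e)) all)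
        where
        f = proj₁ (power-1 n 0ℤ)

      ≈? : ∀ a b → Dec (a ≈ b [ p ])
      ≈? a b with p ∣? ∣ a - b ∣
      ... | yes d = yes (-≈0⇒≈ (∣⇒≈0 d))
      ... | no ¬d = no (λ e → ¬d (≈0⇒∣ (≈⇒-≈0 e)))

      -- By Euler's criterion `a` is a root of x^h = 1. The squares of 1 , ... , h are already `h`
      -- distinct roots, so `a` must be one of them.
      residue : ∀ {a} → p ∤ a → s a ≡ 1ℤ → ∃ λ x → + (x ℕ.* x) ≈ + a [ p ]
      residue {a} p∤a sa≡1 with ℕP.anyUpTo? (λ j → ≈? (+ (suc j ℕ.* suc j)) (+ a)) h
      ... | yes (j , _ , e) = suc j , e
      ... | no none = ⊥-elim (few-roots (+ a ∷ applyUpTo sq h) (cong suc (length-applyUpTo sq h))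
              (AllP.applyUpTo⁺₁ sq h (λ {i} i<h e → none (i , i<h , e)) ∷ distinct) (≈-trans (euler p∤a) (≈-reflexive sa≡1) ∷ AllP.applyUpTo⁺₁ sq h root))
        where
        open import Data.List.Properties using (length-applyUpTo)
        import Data.List.Relation.Unary.All.Properties as AllP
        import Data.List.Relation.Unary.AllPairs.Properties as APP
        sq : ℕ → ℤ
        sq j = + (suc j ℕ.* suc j)
        root : ∀ {i} → i ℕ.< h → power h (sq i) ≈ 1ℤ [ p ]
        root {i} i<h = ≈-trans (euler (∤-* nd nd)) (≈-reflexive (trans (s-* nd nd) (unit-square (s-unit (suc i)))))
          where nd = ∤-small (s≤s z≤n) i<h
        distinct : AllPairs (λ a b → ¬ b ≈ a [ p ]) (applyUpTo sq h)
        distinct = APP.applyUpTo⁺₁ sq h apart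
          where
          apart : ∀ {i j} → i ℕ.< j → j ℕ.< h → ¬ sq j ≈ sq i [ p ]
          apart {i} {j} i<j j<h e with prime-≈0 pr {+ suc j - + suc i} {+ (suc j ℕ.+ suc i)} (≈-trans (≈-reflexive factor) (≈⇒-≈0 e))
            where
            lemma : ∀ a b → (a - b) * (a + b) ≡ a * a - b * b
            lemma = solve-∀
            factor : (+ suc j - + suc i) * + (suc j ℕ.+ suc i) ≡ sq j - sq i
            factor = trans (cong ((+ suc j - + suc i) *_) (ℤP.pos-+ (suc j) (suc i))) (trans (lemma (+ suc j) (+ suc i)) (cong₂ _-_ (sym (ℤP.pos-* (suc j) (suc j))) (sym (ℤP.pos-* (suc i) (suc i)))))
          ... | inj₁ z = ℕP.<-irrefl (sym (ℕP.suc-injective (proj₂ (unique {1ℤ} {1ℤ} (inj₁ refl) (inj₁ refl) (s≤s z≤n) j<h (ℕP.<-trans i<j j<h)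
                  (≈-trans (≈-reflexive (ℤP.*-identityˡ (+ suc j))) (≈-trans (-≈0⇒≈ z) (≈-reflexive (sym (ℤP.*-identityˡ (+ suc i)))))))))) i<j
          ... | inj₂ z = ℕD.>⇒∤ {{_}} (s≤s (ℕP.+-mono-≤ j<h (ℕP.<-trans i<j j<h))) (≈0⇒∣ℕ z)

      -- If 1 , ... , h + 1 all had symbol 1, x^h = 1 would have h + 1 roots.
      nonresidue : ∃ λ c → p ∤ c × s c ≡ -1ℤ
      nonresidue with ℕP.anyUpTo? (λ j → s (suc j) ℤ.≟ -1ℤ) (suc h)
      ... | yes (j , j<1+h , e) = suc j , small j<1+h , e
        where
        small : ∀ {j} → j ℕ.< suc h → p ∤ suc j
        small {j} j<1+h = ℕD.>⇒∤ (s≤s (ℕP.≤-trans j<1+h (ℕP.+-monoˡ-≤ h (subst (1 ℕ.≤_) (sym (proj₂ h≢0)) (s≤s z≤n)))))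
      ... | no none = ⊥-elim (few-roots (applyUpTo (λ j → + suc j) (suc h)) (length-applyUpTo (λ j → + suc j) (suc h))
              (APP.applyUpTo⁺₁ (λ j → + suc j) (suc h) apart) (AllP.applyUpTo⁺₁ (λ j → + suc j) (suc h) root))
        where
        open import Data.List.Properties using (length-applyUpTo)
        import Data.List.Relation.Unary.All.Properties as AllP
        import Data.List.Relation.Unary.AllPairs.Properties as APP
        small : ∀ {j} → j ℕ.< suc h → suc j ℕ.< p
        small {j} j<1+h = s≤s (ℕP.≤-trans j<1+h (ℕP.+-monoˡ-≤ h (subst (1 ℕ.≤_) (sym (proj₂ h≢0)) (s≤s z≤n))))
        root : ∀ {i} → i ℕ.< suc h → power h (+ suc i) ≈ 1ℤ [ p ]
        root {i} i< with s-unit (suc i)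
        ... | inj₁ e = ≈-trans (euler (ℕD.>⇒∤ (small i<))) (≈-reflexive e)
        ... | inj₂ e = ⊥-elim (none (i , i< , e))
        apart : ∀ {i j} → i ℕ.< j → j ℕ.< suc h → ¬ + suc j ≈ + suc i [ p ]
        apart {i} {j} i<j j< e = ℕP.<-irrefl (sym (ℕP.suc-injective (ℤP.+-injective (small⇒≡ e (ℕP.≤-<-trans bound (small j<)))))) i<j
          where
          bound : ∣ + suc j - + suc i ∣ ℕ.≤ suc j
          bound = ℕP.≤-trans (ℕP.≤-reflexive (trans (cong ∣_∣ (trans (ℤP.m-n≡m⊖n (suc j) (suc i)) (ℤP.⊖-≥ (ℕP.<⇒≤ (s≤s i<j))))) refl)) (ℕP.m∸n≤m (suc j) (suc i))

-- Quadratic reciprocity after Eisenstein, and the supplements.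

module Reciprocity where
  open Mod
  open FinPerm
  open Residue
  open import Data.Nat as ℕ using (ℕ; zero; suc; z≤n; s≤s)
  import Data.Nat.Properties as ℕP
  open import Data.Nat.Divisibility as ℕD using (_∤_)
  open import Data.Nat.DivMod as DM using (_%_; _/_)
  open import Data.Nat.Primality using (Prime)
  open import Data.Integer using (ℤ; +_; 1ℤ; -1ℤ; _+_; _*_; _-_; -_)
  import Data.Integer.Properties as ℤP
  open import Data.Integer.Tactic.RingSolver using (solve-∀)
  import Data.Nat.Tactic.RingSolver as ℕR
  open import Data.Product using (proj₂)
  open import Data.Sum using (inj₁; inj₂)
  open import Data.Empty using (⊥-elim)
  open import Relation.Nullary using (Dec; yes; no; ¬_)
  open import Relation.Binary.Definitions using (tri<; tri≈; tri>)
  open import Relation.Binary.PropositionalEquality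

  flip-sign : ∀ {P : Set} → Dec P → ℤ
  flip-sign (yes _) = -1ℤ
  flip-sign (no _)  = 1ℤ

  flip-cong : ∀ {P Q : Set} (p : Dec P) (q : Dec Q) → (P → Q) → (Q → P) → flip-sign p ≡ flip-sign q
  flip-cong (yes _) (yes _) f g = refl
  flip-cong (no _)  (no _)  f g = refl
  flip-cong (yes x) (no ¬y) f g = ⊥-elim (¬y (f x))
  flip-cong (no ¬x) (yes y) f g = ⊥-elim (¬x (g y))

  flip-yes : ∀ {P : Set} (p : Dec P) → P → flip-sign p ≡ -1ℤ
  flip-yes (yes _) _ = refl
  flip-yes (no ¬x) x = ⊥-elim (¬x x)

  flip-no : ∀ {P : Set} (p : Dec P) → ¬ P → flip-sign p ≡ 1ℤ
  flip-no (yes x) ¬x = ⊥-elim (¬x x)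
  flip-no (no _)  _  = refl

  Π-flip : ∀ k f → f ℕ.≤ k → Π k (λ j → flip-sign (suc j ℕ.≤? f)) ≡ parity f
  Π-flip zero    .zero z≤n = refl
  Π-flip (suc k) f f≤ with f ℕ.≤? k
  ... | yes f≤k = trans (cong₂ _*_ (Π-flip k f f≤k) (flip-no (suc k ℕ.≤? f) (ℕP.<⇒≱ (s≤s f≤k)))) (ℤP.*-identityʳ (parity f))
  ... | no f≰k with ℕP.≤-antisym f≤ (ℕP.≰⇒> f≰k)
  ...   | refl = trans (cong₂ _*_ (trans (Product.fold-cong k (λ j j<k → flip-cong (suc j ℕ.≤? suc k) (suc j ℕ.≤? k) (λ _ → j<k) (λ p → ℕP.m≤n⇒m≤1+n p))) (Π-flip k k ℕP.≤-refl)) (flip-yes (suc k ℕ.≤? suc k) ℕP.≤-refl))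
                   (trans (ℤP.*-comm (parity k) -1ℤ) (ℤP.-1*i≡-i (parity k)))

  Π--1 : ∀ k → Π k (λ _ → -1ℤ) ≡ parity k
  Π--1 zero    = refl
  Π--1 (suc k) = trans (cong (_* -1ℤ) (Π--1 k)) (trans (ℤP.*-comm (parity k) -1ℤ) (ℤP.-1*i≡-i (parity k)))

  Π-parity : ∀ h k → Π h (λ _ → parity k) ≡ parity (h ℕ.* k)
  Π-parity zero    k = refl
  Π-parity (suc h) k = trans (cong (_* parity k) (Π-parity h k)) (trans (ℤP.*-comm (parity (h ℕ.* k)) (parity k)) (sym (parity-+ k (h ℕ.* k))))

  module Half (h k : ℕ) (prp : Prime (suc (h ℕ.+ h))) (p∤q : suc (h ℕ.+ h) ∤ suc (k ℕ.+ k)) where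
    private
      p = suc (h ℕ.+ h)
      q = suc (k ℕ.+ k)
      open Gauss h using (σ; v; sgn′; abs′; s; σ-unit; s-unit; Π-v; ∤-*; ∤-small)

      nd : ∀ i → i ℕ.< h → p ∤ q ℕ.* suc i
      nd i i<h = ∤-* prp p∤q (∤-small prp (s≤s z≤n) i<h)

      parity-rem : ∀ x → parity (x % p) ≡ σ x * parity (v x)
      parity-rem x = go (x % p ℕ.≤? h) (ℕP.<⇒≤ (DM.m%n<n x p))
        where
        go : ∀ {ρ} (d : Dec (ρ ℕ.≤ h)) → ρ ℕ.≤ p → parity ρ ≡ sgn′ d * parity (abs′ d)
        go {ρ} (yes _) _   = sym (ℤP.*-identityˡ _)
        go {ρ} (no _)  ρ≤p = begin
          parity ρ                                        ≡⟨ ℤP.*-identityʳ (parity ρ) ⟨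
          parity ρ * 1ℤ                                   ≡⟨ cong (parity ρ *_) (unit-square (parity-unit (p ℕ.∸ ρ))) ⟨
          parity ρ * (parity (p ℕ.∸ ρ) * parity (p ℕ.∸ ρ))  ≡⟨ rearr (parity ρ) (parity (p ℕ.∸ ρ)) ⟩
          parity (p ℕ.∸ ρ) * parity ρ * parity (p ℕ.∸ ρ)  ≡⟨ cong (_* parity (p ℕ.∸ ρ)) (trans (sym (parity-+ (p ℕ.∸ ρ) ρ)) (trans (cong parity (ℕP.m∸n+n≡m ρ≤p)) (cong -_ (parity-double h)))) ⟩
          -1ℤ * parity (p ℕ.∸ ρ)                          ∎
          where
          open ≡-Reasoning
          rearr : ∀ a b → a * (b * b) ≡ b * a * b
          rearr = solve-∀

    -- As `p` and `q` are odd, q i = remainder + p · quotient gives an identity of parities: that of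
    -- i is that of the remainder times that of the quotient. Folding the remainder into `v`
    -- contributes σ. The product of the parities of v(q i) equals that of the parities of i, and
    -- these cancel.
    eisenstein : s q ≡ Π h (λ i → parity (q ℕ.* suc i / p))
    eisenstein = begin
      s q                              ≡⟨ ℤP.*-identityʳ _ ⟨
      s q * 1ℤ                         ≡⟨ cong (s q *_) (unit-square uF) ⟨
      s q * (F * F)                    ≡⟨ ℤP.*-identityʳ _ ⟨
      s q * (F * F) * 1ℤ               ≡⟨ cong (s q * (F * F) *_) (unit-square uU) ⟨
      s q * (F * F) * (U * U)          ≡⟨ regroup (s q) F U ⟩
      s q * U * F * U * F              ≡⟨ cong (λ z → z * U * F) total ⟨
      U * U * F                        ≡⟨ cong (_* F) (unit-square uU) ⟩
      1ℤ * F                           ≡⟨ ℤP.*-identityˡ F ⟩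
      F                                ∎
      where
      open ≡-Reasoning
      F = Π h (λ i → parity (q ℕ.* suc i / p))
      U = Π h (λ i → parity (suc i))
      uF : IsUnit F
      uF = Π-unit h (λ i _ → parity-unit (q ℕ.* suc i / p))
      uU : IsUnit U
      uU = Π-unit h (λ i _ → parity-unit (suc i))
      regroup : ∀ s F U → s * (F * F) * (U * U) ≡ s * U * F * U * F
      regroup = solve-∀
      term : ∀ i → parity (suc i) ≡ σ (q ℕ.* suc i) * parity (v (q ℕ.* suc i)) * parity (q ℕ.* suc i / p)
      term i = begin
        parity (suc i)                                       ≡⟨ parity-odd* k (suc i) ⟨
        parity x                                             ≡⟨ cong parity (DM.m≡m%n+[m/n]*n x p) ⟩
        parity (x % p ℕ.+ x / p ℕ.* p)                       ≡⟨ parity-+ (x % p) _ ⟩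
        parity (x % p) * parity (x / p ℕ.* p)                ≡⟨ cong₂ _*_ (parity-rem x) (trans (cong parity (ℕP.*-comm (x / p) p)) (parity-odd* h (x / p))) ⟩
        σ x * parity (v x) * parity (x / p)                  ∎
        where x = q ℕ.* suc i
      total : U ≡ s q * U * F
      total = trans (Product.fold-cong h (λ i _ → term i)) (trans (Product.fold-∙ h _ _) (cong (_* F) (trans (Product.fold-∙ h _ _) (cong (s q *_) (Π-v prp p∤q parity)))))

    -- The quotient of q i by p is the number of j ≤ k with p j < q i, so its parity is a product of
    -- signs over lattice points on one side of the diagonal.
    count : s q ≡ Π h (λ i → Π k (λ j → flip-sign (p ℕ.* suc j ℕ.<? q ℕ.* suc i)))
    count = trans eisenstein (Product.fold-cong h (λ i i<h → trans (sym (Π-flip k (q ℕ.* suc i / p) (f≤k i i<h)))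
      (Product.fold-cong k (λ j _ → flip-cong (suc j ℕ.≤? q ℕ.* suc i / p) (p ℕ.* suc j ℕ.<? q ℕ.* suc i) (to i i<h j) (from i j)))))
      where
      f≤k : ∀ i → i ℕ.< h → q ℕ.* suc i / p ℕ.≤ k
      f≤k i i<h = ℕP.≮⇒≥ (λ k<f → ℕP.<⇒≱ (ℕP.≤-<-trans (ℕP.≤-trans (ℕP.*-monoˡ-≤ p k<f) (ℕP.≤-trans (DM.m/n*n≤m (q ℕ.* suc i) p) (ℕP.*-monoʳ-≤ q i<h))) (lt h k)) ℕP.≤-refl)
        where
        lt : ∀ h k → suc (k ℕ.+ k) ℕ.* h ℕ.< suc k ℕ.* suc (h ℕ.+ h)
        lt h k = ℕP.≤-trans (ℕP.m≤m+n _ (h ℕ.+ k)) (ℕP.≤-reflexive (eq h k))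
          where
          eq : ∀ h k → suc (suc (k ℕ.+ k) ℕ.* h) ℕ.+ (h ℕ.+ k) ≡ suc k ℕ.* suc (h ℕ.+ h)
          eq = ℕR.solve-∀
      to : ∀ i → i ℕ.< h → ∀ j → suc j ℕ.≤ q ℕ.* suc i / p → p ℕ.* suc j ℕ.< q ℕ.* suc i
      to i i<h j le = ℕP.≤∧≢⇒< (ℕP.≤-trans (ℕP.≤-reflexive (ℕP.*-comm p (suc j))) (ℕP.≤-trans (ℕP.*-monoˡ-≤ p le) (DM.m/n*n≤m (q ℕ.* suc i) p)))
        (λ e → nd i i<h (ℕD.divides (suc j) (trans (sym e) (ℕP.*-comm p (suc j)))))
      from : ∀ i j → p ℕ.* suc j ℕ.< q ℕ.* suc i → suc j ℕ.≤ q ℕ.* suc i / p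
      from i j lt = ℕP.≤-trans (ℕP.≤-reflexive (sym (DM.m*n/n≡m (suc j) p))) (DM./-monoˡ-≤ p (ℕP.≤-trans (ℕP.≤-reflexive (ℕP.*-comm (suc j) p)) (ℕP.<⇒≤ lt)))

  module _ (h k : ℕ) (prp : Prime (suc (h ℕ.+ h))) (prq : Prime (suc (k ℕ.+ k)))
           (p∤q : suc (h ℕ.+ h) ∤ suc (k ℕ.+ k)) (q∤p : suc (k ℕ.+ k) ∤ suc (h ℕ.+ h)) where
    private
      p = suc (h ℕ.+ h)
      q = suc (k ℕ.+ k)

    -- No lattice point of the h × k rectangle lies on the diagonal, so each contributes -1 to
    -- exactly one of the two symbols.
    reciprocity : Gauss.s h q * Gauss.s k p ≡ parity (h ℕ.* k)
    reciprocity = begin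
      Gauss.s h q * Gauss.s k p
        ≡⟨ cong₂ _*_ (Half.count h k prp p∤q) (trans (Half.count k h prq q∤p) (Product.fold-swap k h _)) ⟩
      Π h (λ i → Π k (λ j → flip-sign (p ℕ.* suc j ℕ.<? q ℕ.* suc i))) * Π h (λ i → Π k (λ j → flip-sign (q ℕ.* suc i ℕ.<? p ℕ.* suc j)))
        ≡⟨ Product.fold-∙ h _ _ ⟨
      Π h (λ i → Π k (λ j → flip-sign (p ℕ.* suc j ℕ.<? q ℕ.* suc i)) * Π k (λ j → flip-sign (q ℕ.* suc i ℕ.<? p ℕ.* suc j)))
        ≡⟨ Product.fold-cong h (λ i i<h → trans (sym (Product.fold-∙ k _ _)) (trans (Product.fold-cong k (λ j _ → opposite i i<h j)) (Π--1 k))) ⟩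
      Π h (λ _ → parity k)
        ≡⟨ Π-parity h k ⟩
      parity (h ℕ.* k) ∎
      where
      open ≡-Reasoning
      opposite : ∀ i → i ℕ.< h → ∀ j → flip-sign (p ℕ.* suc j ℕ.<? q ℕ.* suc i) * flip-sign (q ℕ.* suc i ℕ.<? p ℕ.* suc j) ≡ -1ℤ
      opposite i i<h j with ℕP.<-cmp (p ℕ.* suc j) (q ℕ.* suc i)
      ... | tri< a _ c = cong₂ _*_ (flip-yes (p ℕ.* suc j ℕ.<? q ℕ.* suc i) a) (flip-no (q ℕ.* suc i ℕ.<? p ℕ.* suc j) c)

      ... | tri> a _ c = cong₂ _*_ (flip-no (p ℕ.* suc j ℕ.<? q ℕ.* suc i) a) (flip-yes (q ℕ.* suc i ℕ.<? p ℕ.* suc j) c)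
      ... | tri≈ _ b _ = ⊥-elim (Gauss.∤-* h prp p∤q (Gauss.∤-small h prp (s≤s z≤n) i<h) (ℕD.divides (suc j) (trans (sym b) (ℕP.*-comm p (suc j)))))

    -- For q ≡ 3 (mod 4) the sign is absorbed by replacing q with - q.
    reciprocity₃ : parity k ≡ -1ℤ → Gauss.s k p ≡ parity h * Gauss.s h q
    reciprocity₃ k-odd = begin
      sk                                   ≡⟨ ℤP.*-identityˡ sk ⟨
      1ℤ * sk                              ≡⟨ cong (_* sk) (unit-square (Gauss.s-unit h q)) ⟨
      sh * sh * sk                         ≡⟨ rearr sh sk ⟩
      sh * sk * sh                         ≡⟨ cong (_* sh) reciprocity ⟩
      parity (h ℕ.* k) * sh                ≡⟨ cong (_* sh) (par h) ⟩
      parity h * sh                        ∎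
      where
      open ≡-Reasoning
      sk = Gauss.s k p
      sh = Gauss.s h q
      rearr : ∀ a b → a * a * b ≡ a * b * a
      rearr = solve-∀
      par : ∀ h → parity (h ℕ.* k) ≡ parity h
      par zero    = refl
      par (suc h) = trans (parity-+ k (h ℕ.* k)) (trans (cong₂ _*_ k-odd (par h)) (ℤP.-1*i≡-i (parity h)))

  module Supplement (h : ℕ) (pr : Prime (suc (h ℕ.+ h))) where
    open Gauss h

    private
      p∤1 : p ∤ 1
      p∤1 = ∤-small pr (s≤s z≤n) (subst (1 ℕ.≤_) (sym (proj₂ (h≢0 pr))) (s≤s z≤n))

    s-1 : s 1 ≡ 1ℤ
    s-1 with s-unit 1
    ... | inj₁ e = e
    ... | inj₂ e = ⊥-elim (absurd (trans (sym e) (trans (s-* pr p∤1 p∤1) (cong₂ _*_ e e))))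
      where
      absurd : -1ℤ ≢ 1ℤ
      absurd ()

    minus-one : ∀ {a b} → p ∤ a → p ∤ b → + a ≈ - (+ b) [ p ] → s a ≡ parity h * s b
    minus-one {a} {b} p∤a p∤b e = trans (s-≈ pr p∤a p∤b (inj₂ refl) (≈-trans e (≈-reflexive (sym (ℤP.-1*i≡-i (+ b)))))) (cong (_* s b) (Π--1 h))

  -- Here h = 2m + 1 and p = 4m + 3. Among 2 , 4 , ... , 2h the last m + 1 exceed `h` and are folded
  -- with sign -1.
  two : ∀ m → let h = suc (m ℕ.+ m) in Gauss.s h 2 ≡ parity (suc m)
  two m = trans (cong (λ n → Π n f) (sym (ℕP.+-suc m m))) (trans (go (suc m) (ℕP.≤-reflexive (ℕP.+-suc m m))) refl)
    where
    h = suc (m ℕ.+ m)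
    open Gauss h using (σ; p; sgn′)
    f : ℕ → ℤ
    f i = σ (2 ℕ.* suc i)
    rem : ∀ {i} → i ℕ.< h → (2 ℕ.* suc i) % p ≡ 2 ℕ.* suc i
    rem {i} i<h = DM.m<n⇒m%n≡m (s≤s (ℕP.≤-trans (ℕP.*-monoʳ-≤ 2 i<h) (ℕP.≤-reflexive (cong (h ℕ.+_) (ℕP.+-identityʳ h)))))
    f-small : ∀ i → i ℕ.< m → f i ≡ 1ℤ
    f-small i i<m = sgn-yes ((2 ℕ.* suc i) % p ℕ.≤? h) (subst (ℕ._≤ h) (sym (rem (ℕP.≤-trans i<m (ℕP.m≤n⇒m≤1+n (ℕP.m≤m+n m m))))) (ℕP.≤-trans (ℕP.*-monoʳ-≤ 2 i<m) (ℕP.≤-trans (ℕP.≤-reflexive (cong (m ℕ.+_) (ℕP.+-identityʳ m))) (ℕP.n≤1+n _))))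
      where
      sgn-yes : ∀ {ρ} (d : Dec (ρ ℕ.≤ h)) → ρ ℕ.≤ h → sgn′ d ≡ 1ℤ
      sgn-yes (yes _) _ = refl
      sgn-yes (no ¬x) x = ⊥-elim (¬x x)
    f-large : ∀ i → m ℕ.≤ i → i ℕ.< h → f i ≡ -1ℤ
    f-large i m≤i i<h = sgn-no ((2 ℕ.* suc i) % p ℕ.≤? h) (λ le → ℕP.<⇒≱ (ℕP.≤-trans (ℕP.≤-reflexive (eq m)) (ℕP.*-monoʳ-≤ 2 (s≤s m≤i))) (subst (ℕ._≤ h) (rem i<h) le))
      where
      eq : ∀ m → suc (suc (m ℕ.+ m)) ≡ 2 ℕ.* suc m
      eq = ℕR.solve-∀
      sgn-no : ∀ {ρ} (d : Dec (ρ ℕ.≤ h)) → ¬ ρ ℕ.≤ h → sgn′ d ≡ -1ℤ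
      sgn-no (yes x) ¬x = ⊥-elim (¬x x)
      sgn-no (no _)  _  = refl
    go : ∀ n → m ℕ.+ n ℕ.≤ h → Π (m ℕ.+ n) f ≡ parity n
    go zero    _  = trans (cong (λ k → Π k f) (ℕP.+-identityʳ m)) (trans (Product.fold-cong m f-small) (Product.fold-ε m))
    go (suc n) le = trans (cong (λ k → Π k f) (ℕP.+-suc m n)) (trans (cong₂ _*_ (go n (ℕP.≤-trans (ℕP.n≤1+n _) lt)) (f-large (m ℕ.+ n) (ℕP.m≤m+n m n) lt)) (trans (ℤP.*-comm (parity n) -1ℤ) (ℤP.-1*i≡-i (parity n))))
      where
      lt : suc (m ℕ.+ n) ℕ.≤ h
      lt = ℕP.≤-trans (ℕP.≤-reflexive (sym (ℕP.+-suc m n))) le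

-- The Chinese remainder theorem through Bézout relations.

module Crt where
  open Mod
  open import Data.Nat as ℕ using (ℕ)
  import Data.Nat.Properties as ℕP
  open import Data.Nat.Primality using (Prime; prime⇒irreducible)
  open import Data.Nat.Coprimality using (Coprime; coprime-Bézout)
  open import Data.Nat.GCD using (module Bézout)
  open import Data.Integer using (ℤ; +_; 0ℤ; 1ℤ; _+_; _*_; _-_; -_)
  import Data.Integer.Properties as ℤP
  open import Data.Integer.DivMod using (_%ℕ_; _/ℕ_; a≡a%ℕn+[a/ℕn]*n)
  open import Data.Integer.Tactic.RingSolver using (solve-∀)
  open import Data.Product using (_×_; _,_; ∃)
  open import Data.Sum using (inj₁; inj₂)
  open import Data.Empty using (⊥-elim)
  open import Relation.Binary.PropositionalEquality

  data Comaximal (m n : ℕ) : Set where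
    bezout : ∀ u v → u * + m + v * + n ≡ 1ℤ → Comaximal m n

  coprime⇒comaximal : ∀ {m n} → Coprime m n → Comaximal m n
  coprime⇒comaximal {m} {n} c with coprime-Bézout c
  ... | Bézout.+- x y eq = bezout (+ x) (- (+ y)) (trans (cong₂ (λ a b → a + b) (sym (trans (cong +_ eq) (ℤP.pos-* x m))) (trans (sym (ℤP.neg-distribˡ-* (+ y) (+ n))) (cong -_ (sym (ℤP.pos-* y n)))))
        (trans (cong (_- + (y ℕ.* n)) (ℤP.pos-+ 1 (y ℕ.* n))) (cancel (+ (y ℕ.* n)))))
    where
    cancel : ∀ a → 1ℤ + a - a ≡ 1ℤ
    cancel = solve-∀
  ... | Bézout.-+ x y eq = bezout (- (+ x)) (+ y) (trans (cong₂ (λ a b → a + b) (trans (sym (ℤP.neg-distribˡ-* (+ x) (+ m))) (cong -_ (sym (ℤP.pos-* x m)))) (sym (trans (cong +_ eq) (ℤP.pos-* y n))))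
        (trans (cong (λ z → - (+ (x ℕ.* m)) + z) (ℤP.pos-+ 1 (x ℕ.* m))) (cancel (+ (x ℕ.* m)))))
    where
    cancel : ∀ a → - a + (1ℤ + a) ≡ 1ℤ
    cancel = solve-∀

  comaximal-sym : ∀ {m n} → Comaximal m n → Comaximal n m
  comaximal-sym {m} {n} (bezout u v e) = bezout v u (trans (ℤP.+-comm (v * + n) (u * + m)) e)

  comaximal-* : ∀ {m n r} → Comaximal m r → Comaximal n r → Comaximal (m ℕ.* n) r
  comaximal-* {m} {n} {r} (bezout u v e) (bezout u' v' e') = bezout (u * u') (u * + m * v' + v * u' * + n + v * v' * + r)
    (trans (cong (λ z → u * u' * z + (u * + m * v' + v * u' * + n + v * v' * + r) * + r) (ℤP.pos-* m n))
      (trans (lemma u v u' v' (+ m) (+ n) (+ r)) (cong₂ _*_ e e')))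
    where
    lemma : ∀ u v u' v' m n r → u * u' * (m * n) + (u * m * v' + v * u' * n + v * v' * r) * r ≡ (u * m + v * r) * (u' * n + v' * r)
    lemma = solve-∀

  comaximal-1 : ∀ n → Comaximal 1 n
  comaximal-1 n = bezout 1ℤ 0ℤ refl

  distinct-primes : ∀ {p q} → Prime p → Prime q → p ≢ q → Comaximal p q
  distinct-primes {p} {q} pp pq p≢q = coprime⇒comaximal coprime
    where
    coprime : Coprime p q
    coprime {d} (d∣p , d∣q) with prime⇒irreducible pp d∣p | prime⇒irreducible pq d∣q
    ... | inj₁ d≡1 | _ = d≡1
    ... | inj₂ _ | inj₁ d≡1 = d≡1
    ... | inj₂ d≡p | inj₂ d≡q = ⊥-elim (p≢q (trans (sym d≡p) d≡q))

  ≈-weakenˡ : ∀ m n {a b} → a ≈ b [ m ℕ.* n ] → a ≈ b [ m ]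
  ≈-weakenˡ m n {b = b} (mod k e) = mod (k * + n) (trans e (cong (λ z → b + z) (trans (cong (k *_) (ℤP.pos-* m n)) (lemma k (+ m) (+ n)))))
    where
    lemma : ∀ k m n → k * (m * n) ≡ k * n * m
    lemma = solve-∀

  ≈-weakenʳ : ∀ m n {a b} → a ≈ b [ m ℕ.* n ] → a ≈ b [ n ]
  ≈-weakenʳ m n {a} {b} e = ≈-weakenˡ n m (subst (λ k → a ≈ b [ k ]) (ℕP.*-comm m n) e)

  ≈-glue : ∀ {m n a b} → Comaximal m n → a ≈ b [ m ] → a ≈ b [ n ] → a ≈ b [ m ℕ.* n ]
  ≈-glue {m} {n} {a} {b} (bezout u v e) (mod k ek) (mod l el) = mod (l * u + k * v) (begin
    a                                                         ≡⟨ expand a b (u * + m + v * + n) e ⟩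
    b + (a - b) * (u * + m + v * + n)                         ≡⟨ split a b u v (+ m) (+ n) ⟩
    b + ((a - b) * u * + m + (a - b) * v * + n)               ≡⟨ cong₂ (λ x y → b + (x * u * + m + y * v * + n)) (trans (cong (_- b) el) (cancel b (l * + n))) (trans (cong (_- b) ek) (cancel b (k * + m))) ⟩
    b + (l * + n * u * + m + k * + m * v * + n)               ≡⟨ join b l k u v (+ m) (+ n) ⟩
    b + (l * u + k * v) * (+ m * + n)                         ≡⟨ cong (λ z → b + (l * u + k * v) * z) (ℤP.pos-* m n) ⟨
    b + (l * u + k * v) * + (m ℕ.* n)                         ∎)
    where
    open ≡-Reasoning
    expand′ : ∀ a b → a ≡ b + (a - b) * 1ℤ
    expand′ = solve-∀
    expand : ∀ a b t → t ≡ 1ℤ → a ≡ b + (a - b) * t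
    expand a b .1ℤ refl = expand′ a b
    split : ∀ a b u v m n → b + (a - b) * (u * m + v * n) ≡ b + ((a - b) * u * m + (a - b) * v * n)
    split = solve-∀
    cancel : ∀ b x → b + x - b ≡ x
    cancel = solve-∀
    join : ∀ b l k u v m n → b + (l * n * u * m + k * m * v * n) ≡ b + (l * u + k * v) * (m * n)
    join = solve-∀

  crtℤ : ∀ {m n} → Comaximal m n → ∀ a b → ∃ λ x → x ≈ a [ m ] × x ≈ b [ n ]
  crtℤ {m} {n} (bezout u v e) a b = a * (v * + n) + b * (u * + m) ,
    mod (b * u - a * u) (trans (lemma₁ a b u v (+ m) (+ n)) (cong (λ z → a * z + (b * u - a * u) * + m) e) ∙ cong (_+ (b * u - a * u) * + m) (ℤP.*-identityʳ a)) ,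
    mod (a * v - b * v) (trans (lemma₂ a b u v (+ m) (+ n)) (cong (λ z → b * z + (a * v - b * v) * + n) e) ∙ cong (_+ (a * v - b * v) * + n) (ℤP.*-identityʳ b))
    where
    infixr 4 _∙_
    _∙_ : ∀ {x y z : ℤ} → x ≡ y → y ≡ z → x ≡ z
    _∙_ = trans
    lemma₁ : ∀ a b u v m n → a * (v * n) + b * (u * m) ≡ a * (u * m + v * n) + (b * u - a * u) * m
    lemma₁ = solve-∀
    lemma₂ : ∀ a b u v m n → a * (v * n) + b * (u * m) ≡ b * (u * m + v * n) + (a * v - b * v) * n
    lemma₂ = solve-∀

  reduce : ∀ n .{{_ : ℕ.NonZero n}} x → + (x %ℕ n) ≈ x [ n ]
  reduce n x = ≈-sym (mod (x /ℕ n) (a≡a%ℕn+[a/ℕn]*n x n))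

  abstract
    crt : ∀ {m n} .{{_ : ℕ.NonZero m}} .{{_ : ℕ.NonZero n}} → Comaximal m n → ∀ a b → ∃ λ x → + x ≈ + a [ m ] × + x ≈ + b [ n ]
    crt {m} {n} c a b with crtℤ c (+ a) (+ b)
    ... | x , xa , xb = x %ℕ (m ℕ.* n) , ≈-trans (≈-weakenˡ m n (reduce (m ℕ.* n) x)) xa , ≈-trans (≈-weakenʳ m n (reduce (m ℕ.* n) x)) xb
      where
      instance
        mn≢0 : ℕ.NonZero (m ℕ.* n)
        mn≢0 = ℕP.m*n≢0 m n

-- Independent quadratic characters, and primes with prescribed symbols.

module Classes where
  open Smooth
  open Peel
  open Existence
  open Mod
  open FinPerm
  open Residue
  open Reciprocity
  open Crt
  open import Data.Nat as ℕ using (ℕ; zero; suc; z≤n; s≤s)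
  import Data.Nat.Properties as ℕP
  open import Data.Nat.Divisibility as ℕD using (_∣_; _∤_; _∣?_)
  open import Data.Nat.DivMod as DM using (_%_; _/_)
  open import Data.Nat.Primality using (Prime)
  open import Data.Integer as ℤ using (ℤ; +_; -[1+_]; 0ℤ; 1ℤ; -1ℤ; ∣_∣; _+_; _*_; _-_; -_)
  import Data.Integer.Properties as ℤP
  open import Data.Integer.Tactic.RingSolver using (solve-∀)
  open import Data.Bool using (Bool; true; false)
  open import Data.List using (List; []; _∷_)
  open import Data.List.Relation.Unary.All as All using (All; []; _∷_)
  open import Data.List.Relation.Unary.AllPairs using (AllPairs; []; _∷_)
  open import Data.Product using (_×_; _,_; ∃; proj₁; proj₂)
  open import Data.Sum using (_⊎_; inj₁; inj₂)
  open import Data.Empty using (⊥; ⊥-elim)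
  open import Relation.Nullary using (Dec; yes; no)
  open import Relation.Nullary.Decidable using (from-yes)
  open import Relation.Binary.PropositionalEquality

  Periodic : ℕ → (ℕ → ℤ) → Set
  Periodic M f = ∀ x y → + x ≈ + y [ M ] → f x ≡ f y

  Value : ℤ → Set
  Value z = z ≡ 0ℤ ⊎ IsUnit z

  ≈⇒%≡ : ∀ M .{{_ : ℕ.NonZero M}} x y → + x ≈ + y [ M ] → x % M ≡ y % M
  ≈⇒%≡ M x y e = ℤP.+-injective (small⇒≡ (≈-trans (≈-sym (≈-% x)) (≈-trans e (≈-% y))) (bound (x % M) (y % M) (DM.m%n<n x M) (DM.m%n<n y M)))
    where
    bound : ∀ a b → a ℕ.< M → b ℕ.< M → ∣ + a - + b ∣ ℕ.< M
    bound a b a<M b<M with ℕP.≤-total a b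
    ... | inj₁ a≤b = ℕP.≤-<-trans (ℕP.≤-trans (ℕP.≤-reflexive (trans (cong ∣_∣ (ℤP.m-n≡m⊖n a b)) (ℤP.∣⊖∣-≤ a≤b))) (ℕP.m∸n≤m b a)) b<M
    ... | inj₂ b≤a = ℕP.≤-<-trans (ℕP.≤-trans (ℕP.≤-reflexive (cong ∣_∣ (trans (ℤP.m-n≡m⊖n a b) (ℤP.⊖-≥ b≤a)))) (ℕP.m∸n≤m a b)) a<M

  -- The symbols (-1 / n) and (2 / n) on residues modulo 8, extended by 0 to even residues.
  t₄ t₈ : ℕ → ℤ
  t₄ 1 = 1ℤ
  t₄ 3 = -1ℤ
  t₄ 5 = 1ℤ
  t₄ 7 = -1ℤ
  t₄ _ = 0ℤ
  t₈ 1 = 1ℤ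
  t₈ 3 = -1ℤ
  t₈ 5 = -1ℤ
  t₈ 7 = 1ℤ
  t₈ _ = 0ℤ

  fromTable : (t : ℕ → ℤ) → (∀ {a} → a ℕ.< 8 → ∀ {b} → b ℕ.< 8 → t ((a ℕ.* b) % 8) ≡ t a * t b) → t 1 ≡ 1ℤ → t 0 ≡ 0ℤ → Character
  fun  (fromTable t mult t1 t0) n = t (n % 8)
  mul  (fromTable t mult t1 t0) m n = trans (cong t (DM.%-distribˡ-* m n 8)) (mult (DM.m%n<n m 8) (DM.m%n<n n 8))
  one  (fromTable t mult t1 t0) = t1
  null (fromTable t mult t1 t0) = t0

  χ₄ χ₈ : Character
  χ₄ = fromTable t₄ (from-yes (ℕP.allUpTo? (λ a → ℕP.allUpTo? (λ b → t₄ ((a ℕ.* b) % 8) ℤ.≟ t₄ a * t₄ b) 8) 8)) refl refl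
  χ₈ = fromTable t₈ (from-yes (ℕP.allUpTo? (λ a → ℕP.allUpTo? (λ b → t₈ ((a ℕ.* b) % 8) ℤ.≟ t₈ a * t₈ b) 8) 8)) refl refl

  χ₄-values : ∀ n → (fun χ₄ n ≡ 0ℤ × fun χ₈ n ≡ 0ℤ) ⊎ (IsUnit (fun χ₄ n) × IsUnit (fun χ₈ n))
  χ₄-values n = table (n % 8)
    where
    table : ∀ r → (t₄ r ≡ 0ℤ × t₈ r ≡ 0ℤ) ⊎ (IsUnit (t₄ r) × IsUnit (t₈ r))
    table 0 = inj₁ (refl , refl)
    table 1 = inj₂ (inj₁ refl , inj₁ refl)
    table 2 = inj₁ (refl , refl)
    table 3 = inj₂ (inj₂ refl , inj₂ refl)
    table 4 = inj₁ (refl , refl)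
    table 5 = inj₂ (inj₁ refl , inj₂ refl)
    table 6 = inj₁ (refl , refl)
    table 7 = inj₂ (inj₂ refl , inj₁ refl)
    table (suc (suc (suc (suc (suc (suc (suc (suc r)))))))) = inj₁ (refl , refl)

  record OddPrime : Set where
    constructor oddPrime
    field
      half  : ℕ
      prime : Prime (suc (half ℕ.+ half))

  open OddPrime public

  val : OddPrime → ℕ
  val r = suc (half r ℕ.+ half r)

  legendre-value : ∀ r n → Dec (val r ∣ n) → ℤ
  legendre-value r n (yes _) = 0ℤ
  legendre-value r n (no _)  = Gauss.s (half r) n

  legendre-no : ∀ r n (d : Dec (val r ∣ n)) → val r ∤ n → legendre-value r n d ≡ Gauss.s (half r) n
  legendre-no r n (yes d) ¬d = ⊥-elim (¬d d)
  legendre-no r n (no _)  _  = refl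

  legendre-yes : ∀ r n (d : Dec (val r ∣ n)) → val r ∣ n → legendre-value r n d ≡ 0ℤ
  legendre-yes r n (yes _) _ = refl
  legendre-yes r n (no ¬d) d = ⊥-elim (¬d d)

  legendre : OddPrime → Character
  fun  (legendre r) n = legendre-value r n (val r ∣? n)
  mul  (legendre r) m n with val r ∣? m | val r ∣? n
  ... | yes d | _     = legendre-yes r (m ℕ.* n) (val r ∣? m ℕ.* n) (ℕD.∣m⇒∣m*n n d)
  ... | no _  | yes d = trans (legendre-yes r (m ℕ.* n) (val r ∣? m ℕ.* n) (ℕD.∣n⇒∣m*n m d)) (sym (ℤP.*-zeroʳ (Gauss.s (half r) m)))
  ... | no ¬m | no ¬n = trans (legendre-no r (m ℕ.* n) (val r ∣? m ℕ.* n) (Gauss.∤-* (half r) (prime r) ¬m ¬n)) (Gauss.s-* (half r) (prime r) ¬m ¬n)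
  one  (legendre r) = trans (legendre-no r 1 (val r ∣? 1) (Gauss.∤-small (half r) (prime r) (s≤s z≤n) (subst (1 ℕ.≤_) (sym (proj₂ (Gauss.h≢0 (half r) (prime r)))) (s≤s z≤n)))) (Supplement.s-1 (half r) (prime r))
  null (legendre r) = legendre-yes r 0 (val r ∣? 0) (val r ℕD.∣0)

  legendre-values : ∀ r n → Value (fun (legendre r) n)
  legendre-values r n with val r ∣? n
  ... | yes _ = inj₁ refl
  ... | no _  = inj₂ (Gauss.s-unit (half r) n)

  legendre-∤ : ∀ r n → IsUnit (fun (legendre r) n) → val r ∤ n × fun (legendre r) n ≡ Gauss.s (half r) n
  legendre-∤ r n u with val r ∣? n
  ... | no ¬d = ¬d , refl
  legendre-∤ r n (inj₁ ()) | yes d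
  legendre-∤ r n (inj₂ ()) | yes d

  legendre-periodic : ∀ r → Periodic (val r) (fun (legendre r))
  legendre-periodic r x y e with val r ∣? x | val r ∣? y
  ... | yes _ | yes _ = refl
  ... | no ¬x | no ¬y = Gauss.s-periodic (half r) (prime r) ¬x ¬y e
  ... | yes d | no ¬y = ⊥-elim (¬y (≈0⇒∣ {a = + y} (≈-trans (≈-sym e) (∣⇒≈0 {a = + x} d))))
  ... | no ¬x | yes d = ⊥-elim (¬x (≈0⇒∣ {a = + x} (≈-trans e (∣⇒≈0 {a = + y} d))))

  χ₄-periodic : Periodic 8 (fun χ₄)
  χ₄-periodic x y e = cong t₄ (≈⇒%≡ 8 x y e)

  χ₈-periodic : Periodic 8 (fun χ₈)
  χ₈-periodic x y e = cong t₈ (≈⇒%≡ 8 x y e)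

  module Sum = Fold ℤP.+-0-isCommutativeMonoid

  Σ≡fold : ∀ n f → Σ n f ≡ Sum.fold n f
  Σ≡fold zero    f = refl
  Σ≡fold (suc n) f = cong (_+ f n) (Σ≡fold n f)

  data Invertible (a M : ℕ) : Set where
    inverse : ∀ b → + a * + b ≈ 1ℤ [ M ] → Invertible a M

  -- Multiplication by a permutes the residues, so the sum over a period equals minus itself.
  period-sum : ∀ M .{{_ : ℕ.NonZero M}} χ a → Periodic M (fun χ) → Invertible a M → fun χ a ≡ -1ℤ → Σ M (fun χ) ≡ 0ℤ
  period-sum M χ a per (inverse b ab≈1) χa = zero-of (Σ M (fun χ)) (begin
    Σ M (fun χ)                                 ≡⟨ Σ≡fold M (fun χ) ⟩
    Sum.fold M (fun χ)                          ≡⟨ Sum.fold-permute M (λ i → (a ℕ.* i) % M) (λ i _ → DM.m%n<n (a ℕ.* i) M) inj (fun χ) ⟨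
    Sum.fold M (λ i → fun χ ((a ℕ.* i) % M))    ≡⟨ Σ≡fold M _ ⟨
    Σ M (λ i → fun χ ((a ℕ.* i) % M))           ≡⟨ Σ-cong M (λ i _ → trans (per _ _ (≈-sym (≈-% (a ℕ.* i)))) (trans (mul χ a i) (trans (cong (_* fun χ i) χa) (ℤP.-1*i≡-i (fun χ i))))) ⟩
    Σ M (λ i → - fun χ i)                       ≡⟨ Σ-neg M (fun χ) ⟩
    - Σ M (fun χ)                               ∎)
    where
    open ≡-Reasoning
    zero-of : ∀ z → z ≡ - z → z ≡ 0ℤ
    zero-of (+ zero)   _ = refl
    zero-of (+ suc n)  ()
    zero-of (-[1+ n ]) ()
    recover : ∀ i → + i ≈ + b * + (a ℕ.* i) [ M ]
    recover i = ≈-sym (≈-trans (≈-reflexive (trans (cong (+ b *_) (ℤP.pos-* a i)) (assoc (+ a) (+ b) (+ i)))) (≈-trans (≈-* ab≈1 (≈-refl {a = + i})) (≈-reflexive (ℤP.*-identityˡ (+ i)))))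
      where
      assoc : ∀ a b i → b * (a * i) ≡ a * b * i
      assoc = solve-∀
    inj : ∀ i j → i ℕ.< M → j ℕ.< M → (a ℕ.* i) % M ≡ (a ℕ.* j) % M → i ≡ j
    inj i j i<M j<M e = trans (sym (DM.m<n⇒m%n≡m i<M)) (trans (≈⇒%≡ M i j (≈-trans (recover i) (≈-trans (≈-* (≈-refl {a = + b}) same) (≈-sym (recover j))))) (DM.m<n⇒m%n≡m j<M))
      where
      same : + (a ℕ.* i) ≈ + (a ℕ.* j) [ M ]
      same = ≈-trans (≈-% (a ℕ.* i)) (≈-trans (≈-reflexive (cong +_ e)) (≈-sym (≈-% (a ℕ.* j))))

  -- Complete periods cancel, and fewer than `M` terms of absolute value at most 1 remain.
  bounded : ∀ M .{{_ : ℕ.NonZero M}} χ → Periodic M (fun χ) → (∀ n → Value (fun χ n)) → Σ M (fun χ) ≡ 0ℤ → Bounded M χ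
  bounded M χ per val z k = subst (λ i → ∣ i ∣ ℕ.≤ M) (sym eq) (ℕP.≤-trans (small (k % M)) (ℕP.<⇒≤ (DM.m%n<n k M)))
    where
    f = fun χ
    shift : ∀ q i → f (q ℕ.* M ℕ.+ i) ≡ f i
    shift q i = per _ _ (mod (+ q) (trans (ℤP.pos-+ (q ℕ.* M) i) (trans (ℤP.+-comm (+ (q ℕ.* M)) (+ i)) (cong (λ z → + i + z) (ℤP.pos-* q M)))))
    blocks : ∀ q → Σ (q ℕ.* M) f ≡ 0ℤ
    blocks zero    = refl
    blocks (suc q) = trans (cong (λ n → Σ n f) (ℕP.+-comm M (q ℕ.* M))) (trans (Σ-split (q ℕ.* M) M f) (cong₂ _+_ (blocks q) (trans (Σ-cong M (λ i _ → shift q i)) z)))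
    eq : Σ k f ≡ Σ (k % M) f
    eq = trans (cong (λ n → Σ n f) (trans (DM.m≡m%n+[m/n]*n k M) (ℕP.+-comm (k % M) _)))
      (trans (Σ-split (k / M ℕ.* M) (k % M) f) (trans (cong₂ _+_ (blocks (k / M)) (Σ-cong (k % M) (λ i _ → shift (k / M) i))) (ℤP.+-identityˡ _)))
    ∣value∣ : ∀ {z} → Value z → ∣ z ∣ ℕ.≤ 1
    ∣value∣ (inj₁ refl) = z≤n
    ∣value∣ (inj₂ (inj₁ refl)) = s≤s z≤n
    ∣value∣ (inj₂ (inj₂ refl)) = s≤s z≤n
    small : ∀ n → ∣ Σ n f ∣ ℕ.≤ n
    small zero    = z≤n
    small (suc n) = ℕP.≤-trans (ℤP.∣i+j∣≤∣i∣+∣j∣ (Σ n f) (f n)) (ℕP.≤-trans (ℕP.+-mono-≤ (small n) (∣value∣ (val n))) (ℕP.≤-reflexive (ℕP.+-comm n 1)))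

  record Witness (M : ℕ) (χ : Character) (hs : List Character) (z : ℤ) : Set where
    no-eta-equality
    field
      at         : ℕ
      invertible : Invertible at M
      value      : fun χ at ≡ z
      others     : All (λ h → fun h at ≡ 1ℤ) hs

  open Witness

  -- A triangular system: at its witness `h` is -1 while χ and all later characters are 1. The first
  -- member of a non-empty subset of the list then gives a class where the twist of χ by the subset
  -- is -1, so that twist sums to 0 over a period.
  data Independent (M : ℕ) (χ : Character) : List Character → Set where
    []  : Independent M χ []
    _∷_ : ∀ {h hs} → (∃ λ (w : Witness M χ hs 1ℤ) → fun h (at w) ≡ -1ℤ) → Independent M χ hs → Independent M χ (h ∷ hs)

  record System (M : ℕ) (χ : Character) (hs : List Character) : Set where
    no-eta-equality
    field
      periodic₄ : Periodic M (fun χ₄)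
      periodic  : Periodic M (fun χ)
      periodics : All (λ h → Periodic M (fun h)) hs
      values    : ∀ n → Value (fun χ n)
      units     : ∀ n → IsUnit (fun χ n) → IsUnit (fun χ₄ n) × All (λ h → IsUnit (fun h n)) hs
      negative  : ∃ λ (w : Witness M χ [] -1ℤ) → fun χ₄ (at w) ≡ -1ℤ
      indep     : Independent M χ hs

  periodic-· : ∀ {M} χ ψ → Periodic M (fun χ) → Periodic M (fun ψ) → Periodic M (fun (χ · ψ))
  periodic-· χ ψ p q x y e = cong₂ _*_ (p x y e) (q x y e)

  module _ (M : ℕ) .{{_ : ℕ.NonZero M}} where

    leaf : ∀ ψ → Periodic M (fun ψ) → (∀ n → Value (fun ψ n)) → Witness M ψ [] -1ℤ → Bounded M ψ
    leaf ψ per val w = bounded M ψ per val (period-sum M ψ (at w) per (invertible w) (value w))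

    value-· : ∀ χ h → (∀ n → Value (fun χ n)) → (∀ n → IsUnit (fun χ n) → IsUnit (fun h n)) → ∀ n → Value (fun (χ · h) n)
    value-· χ h val un n with val n
    ... | inj₁ e = inj₁ (cong (_* fun h n) e)
    ... | inj₂ u = inj₂ (unit-* u (un n u))

    unit-left : ∀ χ h → (∀ n → Value (fun χ n)) → ∀ n → IsUnit (fun (χ · h) n) → IsUnit (fun χ n)
    unit-left χ h val n u with val n
    ... | inj₂ v = v
    unit-left χ h val n (inj₁ e') | inj₁ e = ⊥-elim (absurd (trans (sym (cong (_* fun h n) e)) e'))
      where
      absurd : 0ℤ ≢ 1ℤ
      absurd ()
    unit-left χ h val n (inj₂ e') | inj₁ e = ⊥-elim (absurd (trans (sym (cong (_* fun h n) e)) e'))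
      where
      absurd : 0ℤ ≢ -1ℤ
      absurd ()

    -- One class where ψ is -1 and all remaining characters are 1 serves every further twist of ψ,
    -- since each of them is still -1 there.
    chosen : ∀ hs ψ → Periodic M (fun ψ) → All (λ h → Periodic M (fun h)) hs → (∀ n → Value (fun ψ n)) →
      (∀ n → IsUnit (fun ψ n) → All (λ h → IsUnit (fun h n)) hs) → Witness M ψ hs -1ℤ → BoundedFamily M hs ψ
    chosen [] ψ per [] val un w = leaf ψ per val w
    chosen (h ∷ hs) ψ per (ph ∷ ps) val un w =
      chosen hs ψ per ps val (λ n u → All.tail (un n u)) (record { at = at w ; invertible = invertible w ; value = value w ; others = All.tail (others w) }) ,
      chosen hs (ψ · h) (periodic-· ψ h per ph) ps (value-· ψ h val (λ n u → All.head (un n u))) (λ n u → All.tail (un n (unit-left ψ h val n u)))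
        (record { at = at w ; invertible = invertible w ; value = cong₂ _*_ (value w) (All.head (others w)) ; others = All.tail (others w) })

    -- The twists are sorted by the first character that occurs in them; its entry in `Independent`
    -- provides the witness, and the empty twist uses `w`.
    family : ∀ hs χ → Periodic M (fun χ) → All (λ h → Periodic M (fun h)) hs → (∀ n → Value (fun χ n)) →
      (∀ n → IsUnit (fun χ n) → All (λ h → IsUnit (fun h n)) hs) → Witness M χ [] -1ℤ → Independent M χ hs → BoundedFamily M hs χ
    family [] χ per [] val un w [] = leaf χ per val w
    family (h ∷ hs) χ per (ph ∷ ps) val un w ((w' , hw') ∷ ind) =
      family hs χ per ps val (λ n u → All.tail (un n u)) w ind ,
      chosen hs (χ · h) (periodic-· χ h per ph) ps (value-· χ h val (λ n u → All.head (un n u))) (λ n u → All.tail (un n (unit-left χ h val n u)))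
        (record { at = at w' ; invertible = invertible w' ; value = cong₂ _*_ (value w') hw' ; others = others w' })

  system⇒family : ∀ M {χ hs} → System (suc (suc M)) χ hs → Family hs χ
  system⇒family M {χ} {hs} S = record
    { modulus = M
    ; period-bound = suc (suc M)
    ; bounded = family (suc (suc M)) hs χ periodic periodics values (λ n u → proj₂ (units n u)) (proj₁ negative) indep
    ; units = λ i → trans (periodic _ _ (mod (+ i) (trans (ℤP.pos-+ 1 _) (cong (λ z → 1ℤ + z) (trans (ℤP.pos-* (suc (suc M)) i) (ℤP.*-comm (+ suc (suc M)) (+ i))))))) (one χ)
    ; values = λ q → vals q (values q)
    }
    where
    open System S
    vals : ∀ q → Value (fun χ q) → fun χ q ≡ 0ℤ ⊎ (IsUnit (fun χ q) × All (λ h → IsUnit (fun h q)) hs)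
    vals q (inj₁ e) = inj₁ e
    vals q (inj₂ u) = inj₂ (u , proj₂ (units q u))

  sign : Bool → ℤ
  sign true  = 1ℤ
  sign false = -1ℤ

  -- Where χ₄ is -1, select b g takes the value 1 exactly when g takes the value sign b.
  select : Bool → Character → Character
  select true  g = g
  select false g = g · χ₄

  select-periodic : ∀ {M} b g → Periodic M (fun χ₄) → Periodic M (fun g) → Periodic M (fun (select b g))
  select-periodic true  g _  p = p
  select-periodic false g p₄ p = periodic-· g χ₄ p p₄

  select-unit : ∀ b g n → IsUnit (fun χ₄ n) → IsUnit (fun g n) → IsUnit (fun (select b g) n)
  select-unit true  g n _  u = u
  select-unit false g n u₄ u = unit-* u u₄

  select-at : ∀ b g n {z} → fun χ₄ n ≡ 1ℤ → fun g n ≡ z → fun (select b g) n ≡ z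
  select-at true  g n _ e = e
  select-at false g n {z} e₄ e = trans (cong₂ _*_ e e₄) (ℤP.*-identityʳ z)

  select-out : ∀ b g n → fun χ₄ n ≡ -1ℤ → fun (select b g) n ≡ 1ℤ → fun g n ≡ sign b
  select-out true  g n _ e = e
  select-out false g n e₄ e = trans (sym (ℤP.neg-involutive (fun g n))) (cong -_ (trans (sym (ℤP.-1*i≡-i (fun g n))) (trans (ℤP.*-comm -1ℤ (fun g n)) (trans (cong (fun g n *_) (sym e₄)) e))))

  base-system : ∀ b → System 8 χ₄ (select b χ₈ ∷ [])
  base-system b = record
    { periodic₄ = χ₄-periodic
    ; periodic  = χ₄-periodic
    ; periodics = select-periodic b χ₈ χ₄-periodic χ₈-periodic ∷ []
    ; values    = λ n → isValue (χ₄-values n)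
    ; units     = λ n u → u , select-unit b χ₈ n u (eight n (χ₄-values n) u) ∷ []
    -- At 3, χ₄ is -1; at 5, χ₄ is 1 and χ₈ is -1. Each is its own inverse modulo 8.
    ; negative  = record { at = 3 ; invertible = inverse 3 (mod 1ℤ refl) ; value = refl ; others = [] } , refl
    ; indep     = (record { at = 5 ; invertible = inverse 5 (mod (+ 3) refl) ; value = refl ; others = [] } , select-at b χ₈ 5 refl refl) ∷ []
    }
    where
    isValue : ∀ {a b} → (a ≡ 0ℤ × b ≡ 0ℤ) ⊎ (IsUnit a × IsUnit b) → Value a
    isValue (inj₁ (e , _)) = inj₁ e
    isValue (inj₂ (u , _)) = inj₂ u
    eight : ∀ n → (fun χ₄ n ≡ 0ℤ × fun χ₈ n ≡ 0ℤ) ⊎ (IsUnit (fun χ₄ n) × IsUnit (fun χ₈ n)) → IsUnit (fun χ₄ n) → IsUnit (fun χ₈ n)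
    eight n (inj₂ (_ , u)) _ = u
    eight n (inj₁ (e , _)) (inj₁ e') = ⊥-elim (absurd (trans (sym e) e'))
      where
      absurd : 0ℤ ≢ 1ℤ
      absurd ()
    eight n (inj₁ (e , _)) (inj₂ e') = ⊥-elim (absurd (trans (sym e) e'))
      where
      absurd : 0ℤ ≢ -1ℤ
      absurd ()

  ∤⇒invertible : ∀ r c → val r ∤ c → Invertible c (val r)
  ∤⇒invertible r c r∤c with coprime⇒comaximal {val r} {c} coprime
    where
    open import Data.Nat.Coprimality using (Coprime)
    open import Data.Nat.Primality using (prime⇒irreducible)
    coprime : Coprime (val r) c
    coprime {d} (d∣r , d∣c) with prime⇒irreducible (prime r) d∣r
    ... | inj₁ e = e
    ... | inj₂ refl = ⊥-elim (r∤c d∣c)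
  ... | bezout u v e = inverse (v %ℕ val r) (≈-trans (≈-* (≈-refl {a = + c}) (reduce (val r) v)) (mod (- u) (trans (lemma (+ c) u v (+ val r)) (cong (_+ - u * + val r) e))))
    where
    open import Data.Integer.DivMod using (_%ℕ_)
    lemma : ∀ c u v r → c * v ≡ u * r + v * c + - u * r
    lemma = solve-∀

  module Extend (M : ℕ) .{{_ : ℕ.NonZero M}} (r : OddPrime) (co : Comaximal M (val r)) where
    M′ = M ℕ.* val r

    periodic-M : ∀ {f} → Periodic M f → Periodic M′ f
    periodic-M p x y e = p x y (≈-weakenˡ M (val r) e)

    periodic-r : ∀ {f} → Periodic (val r) f → Periodic M′ f
    periodic-r p x y e = p x y (≈-weakenʳ M (val r) e)

    invertible′ : ∀ {x a c} → + x ≈ + a [ M ] → + x ≈ + c [ val r ] → Invertible a M → Invertible c (val r) → Invertible x M′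
    invertible′ {x} {a} {c} xa xc (inverse b ab) (inverse d cd) with crt co b d
    ... | y , yb , yd = inverse y (≈-glue co (≈-trans (≈-* xa yb) ab) (≈-trans (≈-* xc yd) cd))

    -- The principal character modulo `r`. Multiplying χ by it makes χ′ vanish wherever the new
    -- Legendre symbol does, as `units` demands of every system.
    χr² : Character
    χr² = legendre r · legendre r

    module _ {χ hs} (S : System M χ hs) (b : Bool) where
      open System S
      h′ = select b (legendre r)
      χ′ = χ · χr²

      at-one : ∀ x → + x ≈ 1ℤ [ val r ] → fun (legendre r) x ≡ 1ℤ
      at-one x e = trans (legendre-periodic r x 1 e) (one (legendre r))

      lift-all : ∀ {gs} → All (λ h → Periodic M (fun h)) gs → ∀ {x a} → + x ≈ + a [ M ] → All (λ h → fun h a ≡ 1ℤ) gs → All (λ h → fun h x ≡ 1ℤ) gs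
      lift-all []       xa []       = []
      lift-all (p ∷ ps) xa (e ∷ es) = trans (p _ _ xa) e ∷ lift-all ps xa es

      record Lifted (gs : List Character) (z : ℤ) (a : ℕ) : Set where
        constructor lifted
        field
          wit  : Witness M′ χ′ gs z
          near : + at wit ≈ + a [ M ]

      open Lifted

      -- A solution of x ≡ a (mod M) and x ≡ 1 (mod r) keeps all old values and makes the new symbol
      -- trivial.
      lift : ∀ {gs z} → All (λ h → Periodic M (fun h)) gs → (w : Witness M χ gs z) → Lifted gs z (at w)
      lift {gs} {z} ps w = from (crt co (at w) 1)
        where
        from : (∃ λ x → + x ≈ + at w [ M ] × + x ≈ + 1 [ val r ]) → Lifted gs z (at w)
        from (x , xa , x1) = lifted (record
          { at = x
          ; invertible = invertible′ xa x1 (invertible w) (inverse 1 (mod 0ℤ refl))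
          ; value = trans (cong₂ _*_ (trans (periodic _ _ xa) (value w)) (cong₂ _*_ (at-one x x1) (at-one x x1))) (ℤP.*-identityʳ z)
          ; others = lift-all ps xa (others w)
          }) xa

      lift-independent : (∀ {gs} → All (λ h → Periodic M (fun h)) gs → (w : Witness M χ gs 1ℤ) → Lifted gs 1ℤ (at w)) →
        ∀ {gs} → All (λ h → Periodic M (fun h)) gs → Independent M χ gs → Independent M′ χ′ gs
      lift-independent l []       [] = []
      lift-independent l {h ∷ gs} (p ∷ ps) ((w , e) ∷ ind) = step (l ps w) ∷ lift-independent l ps ind
        where
        step : Lifted gs 1ℤ (at w) → ∃ λ (w′ : Witness M′ χ′ gs 1ℤ) → fun h (at w′) ≡ -1ℤ
        step (lifted w′ xa) = w′ , trans (p (at w′) (at w) xa) e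

      ones : ∀ gs → All (λ h → fun h 1 ≡ 1ℤ) gs
      ones []       = []
      ones (g ∷ gs) = one g ∷ ones gs

      -- A number that is 1 modulo `M` and a non-residue modulo `r` makes only the new character -1.
      fresh : ∃ λ (w : Witness M′ χ′ hs 1ℤ) → fun h′ (at w) ≡ -1ℤ
      fresh = from (Gauss.nonresidue (half r) (prime r))
       where
       from′ : ∀ c → val r ∤ c → Gauss.s (half r) c ≡ -1ℤ → (∃ λ x → + x ≈ + 1 [ M ] × + x ≈ + c [ val r ]) → ∃ λ (w : Witness M′ χ′ hs 1ℤ) → fun h′ (at w) ≡ -1ℤ
       from : (∃ λ c → val r ∤ c × Gauss.s (half r) c ≡ -1ℤ) → ∃ λ (w : Witness M′ χ′ hs 1ℤ) → fun h′ (at w) ≡ -1ℤ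
       from (c , r∤c , sc) = from′ c r∤c sc (crt co 1 c)
       from′ c r∤c sc (x , x1 , xc) = record
        { at = x
        ; invertible = invertible′ x1 xc (inverse 1 (mod 0ℤ refl)) (∤⇒invertible r c r∤c)
        ; value = cong₂ _*_ (trans (periodic _ _ x1) (one χ)) (cong₂ _*_ leg leg)
        ; others = lift-all periodics x1 (ones hs)
        } , select-at b (legendre r) x (trans (periodic₄ _ _ x1) (one χ₄)) leg
        where
        leg : fun (legendre r) x ≡ -1ℤ
        leg = trans (legendre-periodic r x c xc) (trans (legendre-no r c (val r ∣? c) r∤c) sc)

      χr²-values : ∀ n → Value (fun χr² n)
      χr²-values n with legendre-values r n
      ... | inj₁ e = inj₁ (cong₂ _*_ e e)
      ... | inj₂ u = inj₂ (inj₁ (unit-square u))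

      values′ : ∀ n → Value (fun χ′ n)
      values′ n with values n | χr²-values n
      ... | inj₁ e | _ = inj₁ (cong (_* fun χr² n) e)
      ... | inj₂ _ | inj₁ e = inj₁ (trans (cong (fun χ n *_) e) (ℤP.*-zeroʳ (fun χ n)))
      ... | inj₂ u | inj₂ v = inj₂ (unit-* u v)

      unit-legendre : ∀ n → IsUnit (fun χ′ n) → IsUnit (fun (legendre r) n)
      unit-legendre n u with legendre-values r n
      ... | inj₂ v = v
      ... | inj₁ e = ⊥-elim (absurd u (trans (cong (λ z → fun χ n * (z * z)) e) (ℤP.*-zeroʳ (fun χ n))))
        where
        absurd : ∀ {z} → IsUnit z → z ≡ 0ℤ → ⊥
        absurd (inj₁ refl) ()
        absurd (inj₂ refl) ()

      units′ : ∀ n → IsUnit (fun χ′ n) → IsUnit (fun χ₄ n) × All (λ h → IsUnit (fun h n)) (h′ ∷ hs)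
      units′ n u = u₄ , select-unit b (legendre r) n u₄ (unit-legendre n u) ∷ proj₂ (units n uχ)
        where
        uχ = unit-left M χ χr² values n u
        u₄ = proj₁ (units n uχ)

      negative′ : ∃ λ (w : Witness M′ χ′ [] -1ℤ) → fun χ₄ (at w) ≡ -1ℤ
      negative′ = from (lift [] (proj₁ negative))
        where
        from : Lifted [] -1ℤ (at (proj₁ negative)) → ∃ λ (w : Witness M′ χ′ [] -1ℤ) → fun χ₄ (at w) ≡ -1ℤ
        from (lifted w′ xa) = w′ , trans (periodic₄ _ _ xa) (proj₂ negative)

      extended : System M′ χ′ (h′ ∷ hs)
      extended = record
        { periodic₄ = periodic-M periodic₄
        ; periodic  = periodic-· χ χr² (periodic-M periodic) (periodic-· (legendre r) (legendre r) (periodic-r (legendre-periodic r)) (periodic-r (legendre-periodic r)))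
        ; periodics = select-periodic b (legendre r) (periodic-M periodic₄) (periodic-r (legendre-periodic r)) ∷ All.map periodic-M periodics
        ; values    = values′
        ; units     = units′
        ; negative  = negative′
        ; indep     = fresh ∷ lift-independent lift periodics indep
        }

  Conditions : Set
  Conditions = List (OddPrime × Bool)

  Distinct : Conditions → Set
  Distinct = AllPairs (λ x y → val (proj₁ x) ≢ val (proj₁ y))

  conductor : Conditions → ℕ
  conductor []            = 8
  conductor ((r , _) ∷ c) = conductor c ℕ.* val r

  selected : Bool → Conditions → List Character
  selected b₈ []            = select b₈ χ₈ ∷ []
  selected b₈ ((r , b) ∷ c) = select b (legendre r) ∷ selected b₈ c

  principal : Conditions → Character
  principal []            = χ₄
  principal ((r , _) ∷ c) = principal c · (legendre r · legendre r)

  conductor≢0 : ∀ c → ℕ.NonZero (conductor c)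
  conductor≢0 []            = _
  conductor≢0 ((r , _) ∷ c) = ℕP.m*n≢0 (conductor c) (val r) {{conductor≢0 c}}

  conductor≥2 : ∀ c → 2 ℕ.≤ conductor c
  conductor≥2 []            = s≤s (s≤s z≤n)
  conductor≥2 ((r , _) ∷ c) = ℕP.≤-trans (conductor≥2 c) (ℕP.m≤m*n (conductor c) (val r))

  comaximal-8 : ∀ r → Comaximal 8 (val r)
  comaximal-8 r = comaximal-* {2} {4} with-2 (comaximal-* {2} {2} with-2 with-2)
    where
    with-2 : Comaximal 2 (val r)
    with-2 = bezout (- (+ half r)) 1ℤ (trans (cong (λ z → - (+ half r) * + 2 + 1ℤ * z) (trans (ℤP.pos-+ 1 (half r ℕ.+ half r)) (cong (λ z → 1ℤ + z) (ℤP.pos-+ (half r) (half r))))) (lemma (+ half r)))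
      where
      lemma : ∀ h → - h * + 2 + 1ℤ * (1ℤ + (h + h)) ≡ 1ℤ
      lemma = solve-∀

  comaximal-conductor : ∀ r c → All (λ y → val r ≢ val (proj₁ y)) c → Comaximal (conductor c) (val r)
  comaximal-conductor r []            []       = comaximal-8 r
  comaximal-conductor r ((q , _) ∷ c) (n ∷ ns) = comaximal-* (comaximal-conductor r c ns) (distinct-primes (prime q) (prime r) (λ e → n (sym e)))

  system : ∀ b₈ c → Distinct c → System (conductor c) (principal c) (selected b₈ c)
  system b₈ []            []       = base-system b₈
  system b₈ ((r , b) ∷ c) (n ∷ ds) = Extend.extended (conductor c) {{conductor≢0 c}} r (comaximal-conductor r c n) (system b₈ c ds) b

  -- `prime-exists` delivers one pattern only: χ = -1 and every h = 1. With χ equal to χ₄ away from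
  -- the conditioned primes, this gives a prime 3 modulo 4 different from them, and `select-out`
  -- reads the demanded symbols off the selected characters.
  prime-with-symbols : ∀ b₈ c → Distinct c →
    ∃ λ q → Prime q × fun χ₄ q ≡ -1ℤ × fun χ₈ q ≡ sign b₈ × All (λ x → fun (legendre (proj₁ x)) q ≡ sign (proj₂ x)) c
  prime-with-symbols b₈ c d = from-prime (prime-exists (selected b₈ c) (principal c) (fam (split (conductor c) (conductor≥2 c))))
    where
    split : ∀ n → 2 ℕ.≤ n → ∃ λ m → n ≡ suc (suc m)
    split (suc (suc m)) _ = m , refl
    split (suc zero) (s≤s ())
    fam : (∃ λ m → conductor c ≡ suc (suc m)) → Family (selected b₈ c) (principal c)
    fam (M , eq) = system⇒family M (subst (λ k → System k (principal c) (selected b₈ c)) eq (system b₈ c d))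
    from-prime : (∃ λ q → Prime q × fun (principal c) q ≡ -1ℤ × All (λ h → fun h q ≡ 1ℤ) (selected b₈ c)) →
      ∃ λ q → Prime q × fun χ₄ q ≡ -1ℤ × fun χ₈ q ≡ sign b₈ × All (λ x → fun (legendre (proj₁ x)) q ≡ sign (proj₂ x)) c
    from-prime (q , pr , χq , hq) = q , pr , χ₄q , out₈ c hq , outs c hq
     where
     χ₄-part : ∀ c → fun (principal c) q ≡ fun χ₄ q ⊎ fun (principal c) q ≡ 0ℤ
     χ₄-part [] = inj₁ refl
     χ₄-part ((r , _) ∷ c) with legendre-values r q | χ₄-part c
     ... | inj₁ e | _      = inj₂ (trans (cong (λ z → fun (principal c) q * (z * z)) e) (ℤP.*-zeroʳ (fun (principal c) q)))
     ... | inj₂ u | inj₁ e = inj₁ (trans (cong (fun (principal c) q *_) (unit-square u)) (trans (ℤP.*-identityʳ _) e))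
     ... | inj₂ u | inj₂ e = inj₂ (trans (cong (fun (principal c) q *_) (unit-square u)) (trans (ℤP.*-identityʳ _) e))
     χ₄q : fun χ₄ q ≡ -1ℤ
     χ₄q with χ₄-part c
     ... | inj₁ e = trans (sym e) χq
     ... | inj₂ e = ⊥-elim (absurd (trans (sym e) χq))
       where
       absurd : 0ℤ ≢ -1ℤ
       absurd ()
     out₈ : ∀ c → All (λ h → fun h q ≡ 1ℤ) (selected b₈ c) → fun χ₈ q ≡ sign b₈
     out₈ []      (e ∷ []) = select-out b₈ χ₈ q χ₄q e
     out₈ (_ ∷ c) (_ ∷ es) = out₈ c es
     outs : ∀ c → All (λ h → fun h q ≡ 1ℤ) (selected b₈ c) → All (λ x → fun (legendre (proj₁ x)) q ≡ sign (proj₂ x)) c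
     outs []            _        = []
     outs ((r , b) ∷ c) (e ∷ es) = select-out b (legendre r) q χ₄q e ∷ outs c es

-- Squarefree parts, and square roots modulo squarefree numbers.

module Factor where
  open Mod
  open Crt
  open import Data.Nat as ℕ using (ℕ; zero; suc; z≤n; s≤s)
  import Data.Nat.Properties as ℕP
  open import Data.Nat.Divisibility as ℕD using (_∣_; _∣?_; divides)
  open import Data.Nat.Induction using (<-rec)
  open import Data.Nat.ListAction using (product)
  open import Data.Nat.Primality using (Prime; prime?; prime⇒nonTrivial; prime⇒nonZero)
  open import Data.Nat.Primality.Factorisation using (PrimeFactorisation; factorise)
  open import Data.Integer using (ℤ; +_; 0ℤ; 1ℤ; ∣_∣; _+_; _*_; _-_; -_)
  open import Data.Integer.Tactic.RingSolver using (solve-∀)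
  import Data.Nat.Tactic.RingSolver as ℕR
  import Data.Nat.DivMod as DM
  open import Data.List using (List; []; _∷_)
  open import Data.List.Relation.Unary.All using (All; []; _∷_)
  open import Data.List.Relation.Unary.AllPairs using (AllPairs; []; _∷_)
  open import Data.Product using (_×_; _,_; ∃; ∃₂)
  open import Data.Sum using (_⊎_; inj₁; inj₂)
  open import Data.Empty using (⊥-elim)
  open import Relation.Nullary using (Dec; yes; no; ¬_)
  open import Relation.Nullary.Decidable using (_×-dec_; from-yes)
  open import Relation.Binary.PropositionalEquality

  two-prime : Prime 2
  two-prime = from-yes (prime? 2)

  SquareFree : ℕ → Set
  SquareFree n = ∀ k → k ℕ.* k ∣ n → k ≡ 1

  square-factor? : ∀ n .{{_ : ℕ.NonZero n}} → (∃ λ k → 1 ℕ.< k × k ℕ.* k ∣ n) ⊎ SquareFree n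
  square-factor? n with ℕP.anyUpTo? (λ k → (1 ℕ.<? k) ×-dec (k ℕ.* k ∣? n)) (suc n)
  ... | yes (k , _ , p) = inj₁ (k , p)
  ... | no none = inj₂ free
    where
    free : SquareFree n
    free zero d = ⊥-elim (ℕ.≢-nonZero⁻¹ n (ℕD.0∣⇒≡0 d))
    free (suc zero) d = refl
    free k@(suc (suc _)) d = ⊥-elim (none (k , s≤s (ℕP.≤-trans (ℕP.m≤m*n k k) (ℕD.∣⇒≤ d)) , s≤s (s≤s z≤n) , d))

  squarefree-part : ∀ n → 0 ℕ.< n → ∃₂ λ m g → n ≡ m ℕ.* (g ℕ.* g) × SquareFree m × 0 ℕ.< m × 0 ℕ.< g
  squarefree-part = <-rec _ step
    where
    step : ∀ n → (∀ {k} → k ℕ.< n → 0 ℕ.< k → ∃₂ λ m g → k ≡ m ℕ.* (g ℕ.* g) × SquareFree m × 0 ℕ.< m × 0 ℕ.< g) → 0 ℕ.< n →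
      ∃₂ λ m g → n ≡ m ℕ.* (g ℕ.* g) × SquareFree m × 0 ℕ.< m × 0 ℕ.< g
    step n rec 0<n with square-factor? n {{ℕ.>-nonZero 0<n}}
    ... | inj₂ free = n , 1 , sym (ℕP.*-identityʳ n) , free , 0<n , s≤s z≤n
    ... | inj₁ (k , 1<k , divides zero e) = ⊥-elim (ℕP.<-irrefl (sym e) 0<n)
    ... | inj₁ (k@(suc _) , 1<k , divides q@(suc _) e) with rec (ℕP.<-≤-trans (ℕP.m<m*n q (k ℕ.* k) (ℕP.<-≤-trans 1<k (ℕP.m≤m*n k k))) (ℕP.≤-reflexive (sym e))) (s≤s z≤n)
    ...   | m , g , e' , free , 0<m , 0<g = m , g ℕ.* k , trans e (trans (cong (ℕ._* (k ℕ.* k)) e') (regroup m g k)) , free , 0<m , ℕP.*-mono-≤ {1} {g} {1} {k} 0<g (s≤s z≤n)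
      where
      regroup : ∀ m g k → m ℕ.* (g ℕ.* g) ℕ.* (k ℕ.* k) ≡ m ℕ.* (g ℕ.* k ℕ.* (g ℕ.* k))
      regroup = ℕR.solve-∀

  record Factors (m : ℕ) : Set where
    field
      primes   : List ℕ
      arePrime : All Prime primes
      distinct : AllPairs _≢_ primes
      product≡ : product primes ≡ m

  distinct-primes-of : ∀ qs → All Prime qs → SquareFree (product qs) → AllPairs _≢_ qs
  distinct-primes-of []       []         free = []
  distinct-primes-of (q ∷ qs) (pr ∷ prs) free = fresh qs (λ k d → d) ∷ distinct-primes-of qs prs (λ k d → free k (ℕD.∣n⇒∣m*n q d))
    where
    fresh : ∀ rs → (∀ k → k ∣ product rs → k ∣ product qs) → All (q ≢_) rs
    fresh []       sub = []
    fresh (r ∷ rs) sub = (λ { refl → ℕP.<-irrefl (sym (free q (ℕD.*-monoʳ-∣ q (sub q (ℕD.m∣m*n (product rs)))))) (ℕ.nonTrivial⇒n>1 q {{prime⇒nonTrivial pr}}) })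
      ∷ fresh rs (λ k d → sub k (ℕD.∣n⇒∣m*n r d))

  factors : ∀ {m} → 0 ℕ.< m → SquareFree m → Factors m
  factors {m} 0<m free = record
    { primes   = PrimeFactorisation.factors F
    ; arePrime = PrimeFactorisation.factorsPrime F
    ; distinct = distinct-primes-of (PrimeFactorisation.factors F) (PrimeFactorisation.factorsPrime F) (subst SquareFree (PrimeFactorisation.isFactorisation F) free)
    ; product≡ = sym (PrimeFactorisation.isFactorisation F)
    }
    where
    F = factorise m {{ℕ.>-nonZero 0<m}}

  data Square (n : ℕ) (a : ℤ) : Set where
    root : (x : ℕ) → + x * + x ≈ a [ n ] → Square n a

  square? : ∀ n .{{_ : ℕ.NonZero n}} a → Dec (Square n a)
  square? n a with ℕP.anyUpTo? (λ x → n ∣? ∣ + x * + x - a ∣) n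
  ... | yes (x , _ , d) = yes (root x (-≈0⇒≈ (∣⇒≈0 d)))
  ... | no none = no (λ { (root x e) → none (x ℕ.% n , DM.m%n<n x n , ≈0⇒∣ (≈⇒-≈0 (≈-trans (≈-* (≈-sym (≈-% x)) (≈-sym (≈-% x))) e))) })

  square-1 : ∀ a → Square 1 a
  square-1 a = root 0 (mod (- a) (lemma a))
    where
    lemma : ∀ a → 0ℤ ≡ a + - a * 1ℤ
    lemma = solve-∀

  square-glue : ∀ {m n a} .{{_ : ℕ.NonZero m}} .{{_ : ℕ.NonZero n}} → Comaximal m n → Square m a → Square n a → Square (m ℕ.* n) a
  square-glue {m} {n} {a} co (root x ex) (root y ey) = from (crt co x y)
    where
    from : (∃ λ z → + z ≈ + x [ m ] × + z ≈ + y [ n ]) → Square (m ℕ.* n) a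
    from (z , zx , zy) = root z (≈-glue co (≈-trans (≈-* zx zx) ex) (≈-trans (≈-* zy zy) ey))

  comaximal-product : ∀ q qs → Prime q → All Prime qs → All (q ≢_) qs → Comaximal (product qs) q
  comaximal-product q []       pr []         []       = comaximal-1 q
  comaximal-product q (r ∷ qs) pr (pr' ∷ prs) (n ∷ ns) = comaximal-* (distinct-primes pr' pr (λ e → n (sym e))) (comaximal-product q qs pr prs ns)

  product≢0 : ∀ qs → All Prime qs → ℕ.NonZero (product qs)
  product≢0 []       []         = _
  product≢0 (q ∷ qs) (pr ∷ prs) = ℕP.m*n≢0 q (product qs) {{prime⇒nonZero pr}} {{product≢0 qs prs}}

  square-product : ∀ qs a → All Prime qs → AllPairs _≢_ qs → All (λ q → Square q a) qs → Square (product qs) a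
  square-product []       a []         []         []       = square-1 a
  square-product (q ∷ qs) a (pr ∷ prs) (ns ∷ ds) (s ∷ ss) =
    square-glue {{prime⇒nonZero pr}} {{product≢0 qs prs}} (comaximal-sym (comaximal-product q qs pr prs ns)) s (square-product qs a prs ds ss)

  -- A squarefree `m` is a product of distinct primes, so roots modulo all of them glue to a root
  -- modulo `m`. A prime without root is returned, as the descent recognises ramification by it.
  square-or-obstruction : ∀ {m} → 0 ℕ.< m → SquareFree m → ∀ a → Square m a ⊎ (∃ λ q → Prime q × q ∣ m × ¬ Square q a)
  square-or-obstruction {m} 0<m free a = decide (check primes arePrime (λ d → subst (_ ∣_) product≡ d))
    where
    open Factors (factors 0<m free)
    decide : All (λ q → Square q a) primes ⊎ (∃ λ q → Prime q × q ∣ m × ¬ Square q a) → Square m a ⊎ (∃ λ q → Prime q × q ∣ m × ¬ Square q a)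
    decide (inj₁ all) = inj₁ (subst (λ k → Square k a) product≡ (square-product primes a arePrime distinct all))
    decide (inj₂ o)   = inj₂ o
    check : ∀ qs → All Prime qs → (∀ {k} → k ∣ product qs → k ∣ m) → All (λ q → Square q a) qs ⊎ (∃ λ q → Prime q × q ∣ m × ¬ Square q a)
    check []       []         sub = inj₁ []
    check (q ∷ qs) (pr ∷ prs) sub with square? q {{prime⇒nonZero pr}} a
    ... | no ¬s = inj₂ (q , pr , sub (ℕD.m∣m*n (product qs)) , ¬s)
    ... | yes s with check qs prs (λ d → sub (ℕD.∣n⇒∣m*n q d))
    ...   | inj₁ all = inj₁ (s ∷ all)
    ...   | inj₂ o   = inj₂ o

-- The pigeonhole principle in boxes of lattice points.

module Box where
  open Mod
  open Crt
  open import Data.Nat as ℕ using (ℕ; zero; suc; z≤n; s≤s)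
  import Data.Nat.Properties as ℕP
  open import Data.Integer as ℤ using (ℤ; +_; 0ℤ; ∣_∣; _+_; _*_; _-_; -_)
  import Data.Integer.Properties as ℤP
  open import Data.Integer.DivMod using (n%ℕd<d)
  open import Data.Fin as Fin using (Fin; toℕ; fromℕ<; combine; remQuot)
  import Data.Fin.Properties as FinP
  open import Data.Product using (_×_; _,_; ∃; ∃₂; proj₁; proj₂)
  open import Data.Sum using (_⊎_; inj₁; inj₂)
  open import Relation.Nullary using (yes; no)
  open import Relation.Binary.PropositionalEquality

  isqrt : ∀ n → ∃ λ s → s ℕ.* s ℕ.≤ n × n ℕ.< suc s ℕ.* suc s
  isqrt zero = 0 , z≤n , s≤s z≤n
  isqrt (suc n) with isqrt n
  ... | s , lo , hi with suc s ℕ.* suc s ℕ.≤? suc n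
  ...   | yes le = suc s , le , ℕP.≤-<-trans hi (ℕP.*-mono-< (ℕP.n<1+n (suc s)) (ℕP.n<1+n (suc s)))
  ...   | no ¬le = s , ℕP.m≤n⇒m≤1+n lo , ℕP.≰⇒> ¬le

  -- Four coordinates serve two lattices: that of four squares, and that of Legendre's equation,
  -- where the fourth side of the box is 1.
  Point : Set
  Point = ℕ × ℕ × ℕ × ℕ

  InBox : Point → Point → Set
  InBox (A , B , C , D) (x , y , z , w) = x ℕ.< A × y ℕ.< B × z ℕ.< C × w ℕ.< D

  volume : Point → ℕ
  volume (A , B , C , D) = A ℕ.* (B ℕ.* (C ℕ.* D))

  record Collision (b : Point) (m n : ℕ) (F G : Point → ℤ) : Set where
    field
      p q      : Point
      p∈       : InBox b p
      q∈       : InBox b q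
      distinct : p ≢ q
      F≈       : F p ≈ F q [ m ]
      G≈       : G p ≈ G q [ n ]

  collision : ∀ b m n .{{_ : ℕ.NonZero m}} .{{_ : ℕ.NonZero n}} F G → m ℕ.* n ℕ.< volume b → Collision b m n F G
  collision b@(A , B , C , D) m n F G lt = from (FinP.pigeonhole lt code)
    where
    point : Fin (volume b) → Point
    point i = toℕ (proj₁ i₁) , toℕ (proj₁ i₂) , toℕ (proj₁ i₃) , toℕ (proj₂ i₃)
      where
      i₁ = remQuot {A} (B ℕ.* (C ℕ.* D)) i
      i₂ = remQuot {B} (C ℕ.* D) (proj₂ i₁)
      i₃ = remQuot {C} D (proj₂ i₂)
    point∈ : ∀ i → InBox b (point i)
    point∈ i = FinP.toℕ<n _ , FinP.toℕ<n _ , FinP.toℕ<n _ , FinP.toℕ<n _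
    remQuot-injective : ∀ {k} l (i j : Fin (k ℕ.* l)) → proj₁ (remQuot {k} l i) ≡ proj₁ (remQuot {k} l j) → proj₂ (remQuot {k} l i) ≡ proj₂ (remQuot {k} l j) → i ≡ j
    remQuot-injective {k} l i j e e' = trans (sym (FinP.combine-remQuot {k} l i)) (trans (cong₂ combine e e') (FinP.combine-remQuot {k} l j))
    point-injective : ∀ i j → point i ≡ point j → i ≡ j
    point-injective i j e = remQuot-injective {A} (B ℕ.* (C ℕ.* D)) i j (FinP.toℕ-injective (cong proj₁ e))
      (remQuot-injective {B} (C ℕ.* D) _ _ (FinP.toℕ-injective (cong (λ x → proj₁ (proj₂ x)) e))
        (remQuot-injective {C} D _ _ (FinP.toℕ-injective (cong (λ x → proj₁ (proj₂ (proj₂ x))) e)) (FinP.toℕ-injective (cong (λ x → proj₂ (proj₂ (proj₂ x))) e))))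
    residue : ∀ k .{{_ : ℕ.NonZero k}} → ℤ → Fin k
    residue k x = fromℕ< (n%ℕd<d x k)
    residue-≈ : ∀ k .{{_ : ℕ.NonZero k}} x y → residue k x ≡ residue k y → x ≈ y [ k ]
    residue-≈ k x y e = ≈-trans (≈-sym (reduce k x)) (≈-trans (≈-reflexive (cong +_ (trans (sym (FinP.toℕ-fromℕ< (n%ℕd<d x k))) (trans (cong toℕ e) (FinP.toℕ-fromℕ< (n%ℕd<d y k)))))) (reduce k y))
    code : Fin (volume b) → Fin (m ℕ.* n)
    code i = combine (residue m (F (point i))) (residue n (G (point i)))
    codes : ∀ {i j} → code i ≡ code j → residue m (F (point i)) ≡ residue m (F (point j)) × residue n (G (point i)) ≡ residue n (G (point j))
    codes {i} {j} e = FinP.combine-injective (residue m (F (point i))) (residue n (G (point i))) (residue m (F (point j))) (residue n (G (point j))) e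
    from : (∃₂ λ i j → i Fin.< j × code i ≡ code j) → Collision b m n F G
    from (i , j , i<j , e) = record
      { p = point i ; q = point j ; p∈ = point∈ i ; q∈ = point∈ j
      ; distinct = λ e' → ℕP.<-irrefl (cong toℕ (point-injective i j e')) i<j
      ; F≈ = residue-≈ m _ _ (proj₁ (codes e))
      ; G≈ = residue-≈ n _ _ (proj₂ (codes e))
      }

  ∣∣-square : ∀ x → x * x ≡ + (∣ x ∣ ℕ.* ∣ x ∣)
  ∣∣-square x = trans (square x) (sym (ℤP.pos-* ∣ x ∣ ∣ x ∣))
    where
    square : ∀ x → x * x ≡ + ∣ x ∣ * + ∣ x ∣
    square (+ n)      = refl
    square (ℤ.-[1+ n ]) = refl

  difference-bound : ∀ {x y s} → x ℕ.< suc s → y ℕ.< suc s → ∣ + x - + y ∣ ℕ.≤ s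
  difference-bound {x} {y} (s≤s x≤) (s≤s y≤) = subst (ℕ._≤ _) (sym (cong ∣_∣ (ℤP.m-n≡m⊖n x y))) (go (ℕP.≤-total x y))
    where
    go : x ℕ.≤ y ⊎ y ℕ.≤ x → ∣ x ℤ.⊖ y ∣ ℕ.≤ _
    go (inj₁ x≤y) = ℕP.≤-trans (ℕP.≤-reflexive (ℤP.∣⊖∣-≤ x≤y)) (ℕP.≤-trans (ℕP.m∸n≤m y x) y≤)
    go (inj₂ y≤x) = ℕP.≤-trans (ℕP.≤-reflexive (cong ∣_∣ (ℤP.⊖-≥ y≤x))) (ℕP.≤-trans (ℕP.m∸n≤m x y) x≤)

  difference≡0 : ∀ {x y} → + x - + y ≡ 0ℤ → x ≡ y
  difference≡0 e = ℤP.+-injective (ℤP.i-j≡0⇒i≡j _ _ e)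

-- Legendre's theorem for X² + a Y² = n Z² with a prime.

module Legendre where
  open Mod
  open Crt
  open Factor
  open Box
  open import Data.Nat as ℕ using (ℕ; zero; suc; z≤n; s≤s)
  import Data.Nat.Properties as ℕP
  open import Data.Nat.Divisibility as ℕD using (_∣_; _∤_; divides)
  open import Data.Nat.Primality using (Prime; prime⇒nonZero; prime⇒nonTrivial; euclidsLemma)
  open import Data.Integer using (ℤ; +_; -[1+_]; 0ℤ; 1ℤ; ∣_∣; _+_; _*_; _-_; -_)
  import Data.Integer.Properties as ℤP
  open import Data.Integer.Tactic.RingSolver using (solve-∀)
  import Data.Nat.Tactic.RingSolver as ℕR
  open import Data.Product using (_×_; _,_; ∃)
  open import Data.Sum using (_⊎_; inj₁; inj₂)
  open import Data.Empty using (⊥; ⊥-elim)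
  open import Relation.Binary.PropositionalEquality

  record Solution (a n : ℤ) : Set where
    constructor solution
    field
      X Y Z    : ℤ
      nonzero  : Z ≢ 0ℤ
      equation : X * X + a * (Y * Y) ≡ n * (Z * Z)

  prime∤⇒nonsquare : ∀ {p n} → Prime p → p ∤ n → ∀ u → u ℕ.* u ≢ p ℕ.* n
  prime∤⇒nonsquare {p} {n} pr p∤n u e = p∤n (descend (case (euclidsLemma u u pr (divides n (trans e (ℕP.*-comm p n))))))
    where
    case : (p ∣ u) ⊎ (p ∣ u) → p ∣ u
    case (inj₁ d) = d
    case (inj₂ d) = d
    instance
      p≢0 = prime⇒nonZero pr
    descend : p ∣ u → p ∣ n
    descend (divides q refl) = divides (q ℕ.* q) (sym (ℕP.*-cancelˡ-≡ _ _ p (trans (regroup p q) e)))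
      where
      regroup : ∀ p q → p ℕ.* (q ℕ.* q ℕ.* p) ≡ q ℕ.* p ℕ.* (q ℕ.* p)
      regroup = ℕR.solve-∀

  -- After squaring: A² B² C² exceeds (a n) · n · a = (n a)².
  big-box : ∀ a n A B C → a ℕ.* n ℕ.< A ℕ.* A → n ℕ.< B ℕ.* B → a ℕ.< C ℕ.* C → n ℕ.* a ℕ.< volume (A , B , C , 1)
  big-box a n A B C la lb lc = ℕP.≰⇒> (λ le → ℕP.<⇒≱ (ℕP.*-mono-< la (ℕP.*-mono-< lb lc)) (ℕP.≤-trans (ℕP.≤-reflexive (shape A B C)) (ℕP.≤-trans (ℕP.*-mono-≤ le le) (ℕP.≤-reflexive (shape' a n)))))
    where
    shape : ∀ A B C → A ℕ.* A ℕ.* (B ℕ.* B ℕ.* (C ℕ.* C)) ≡ A ℕ.* (B ℕ.* (C ℕ.* 1)) ℕ.* (A ℕ.* (B ℕ.* (C ℕ.* 1)))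
    shape = ℕR.solve-∀
    shape' : ∀ a n → n ℕ.* a ℕ.* (n ℕ.* a) ≡ a ℕ.* n ℕ.* (n ℕ.* a)
    shape' = ℕR.solve-∀

  value≈0ˡ : ∀ {n} a X Y Z c → X ≈ c * Y [ n ] → c * c ≈ - a [ n ] → X * X + a * (Y * Y) - + n * (Z * Z) ≈ 0ℤ [ n ]
  value≈0ˡ {n} a X Y Z c X≈ c≈ = ≈-trans (≈-- (≈-+ (≈-* X≈ X≈) (≈-refl {a = a * (Y * Y)})) (≈-trans (≈-reflexive (ℤP.*-comm (+ n) (Z * Z))) (n≈0 (Z * Z))))
    (≈-trans (≈-reflexive (regroup a c Y)) (≈-trans (≈-+ (≈-* c≈ (≈-refl {a = Y * Y})) (≈-refl {a = a * (Y * Y)})) (≈-reflexive (cancel a (Y * Y)))))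
    where
    regroup : ∀ a c Y → c * Y * (c * Y) + a * (Y * Y) - 0ℤ ≡ c * c * (Y * Y) + a * (Y * Y)
    regroup = solve-∀
    cancel : ∀ a y → - a * y + a * y ≡ 0ℤ
    cancel = solve-∀

  value≈0ʳ : ∀ {a} n X Y Z e → X ≈ e * Z [ a ] → e * e ≈ n [ a ] → X * X + + a * (Y * Y) - n * (Z * Z) ≈ 0ℤ [ a ]
  value≈0ʳ {a} n X Y Z e X≈ e≈ = ≈-trans (≈-- (≈-+ (≈-* X≈ X≈) (≈-trans (≈-reflexive (ℤP.*-comm (+ a) (Y * Y))) (n≈0 (Y * Y)))) (≈-refl {a = n * (Z * Z)}))
    (≈-trans (≈-reflexive (regroup n e Z)) (≈-trans (≈-- (≈-* e≈ (≈-refl {a = Z * Z})) (≈-refl {a = n * (Z * Z)})) (≈-reflexive (cancel n (Z * Z)))))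
    where
    regroup : ∀ n e Z → e * Z * (e * Z) + 0ℤ - n * (Z * Z) ≡ e * e * (Z * Z) - n * (Z * Z)
    regroup = solve-∀
    cancel : ∀ n y → n * y - n * y ≡ 0ℤ
    cancel = solve-∀

  -- The bounds place the form strictly between -n a and 2 n a.
  quotient-0-1 : ∀ a n U V W .{{_ : ℕ.NonZero a}} .{{_ : ℕ.NonZero n}} → U ℕ.< a ℕ.* n → V ℕ.≤ n → W ℕ.< a → ∀ k →
    + U + + a * + V - + n * + W ≡ k * + (n ℕ.* a) → k ≡ 0ℤ ⊎ k ≡ 1ℤ
  quotient-0-1 a n U V W U< V≤ W< (+ 0) e = inj₁ refl
  quotient-0-1 a n U V W U< V≤ W< (+ 1) e = inj₂ refl
  quotient-0-1 a n U V W U< V≤ W< (+ k@(suc (suc _))) e = ⊥-elim (ℕP.<⇒≱ upper (ℕP.≤-trans (ℕP.*-monoˡ-≤ (n ℕ.* a) {2} {k} (s≤s (s≤s z≤n))) (ℕP.≤-trans (ℕP.m≤m+n (k ℕ.* (n ℕ.* a)) (n ℕ.* W)) (ℕP.≤-reflexive (sym nat)))))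
    where
    nat : U ℕ.+ a ℕ.* V ≡ k ℕ.* (n ℕ.* a) ℕ.+ n ℕ.* W
    nat = ℤP.+-injective (trans (trans (ℤP.pos-+ U _) (cong (λ z → + U + z) (ℤP.pos-* a V))) (trans (move (+ U + + a * + V) (+ n * + W)) (trans (cong (_+ + n * + W) e) (sym (trans (ℤP.pos-+ (k ℕ.* (n ℕ.* a)) (n ℕ.* W)) (cong₂ _+_ (ℤP.pos-* k (n ℕ.* a)) (ℤP.pos-* n W)))))))
      where
      move : ∀ x y → x ≡ x - y + y
      move = solve-∀
    upper : U ℕ.+ a ℕ.* V ℕ.< 2 ℕ.* (n ℕ.* a)
    upper = ℕP.<-≤-trans (ℕP.+-mono-<-≤ U< (ℕP.*-monoʳ-≤ a V≤)) (ℕP.≤-reflexive (shape a n))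
      where
      shape : ∀ a n → a ℕ.* n ℕ.+ a ℕ.* n ≡ 2 ℕ.* (n ℕ.* a)
      shape = ℕR.solve-∀
  quotient-0-1 a n U V W U< V≤ W< -[1+ k ] e = ⊥-elim (ℕP.<⇒≱ (ℕP.*-monoʳ-< n W<) (ℕP.≤-trans (ℕP.m≤m+n (n ℕ.* a) (k ℕ.* (n ℕ.* a))) (ℕP.≤-trans (ℕP.m≤n+m (suc k ℕ.* (n ℕ.* a)) (U ℕ.+ a ℕ.* V)) (ℕP.≤-reflexive nat))))
    where
    nat : U ℕ.+ a ℕ.* V ℕ.+ suc k ℕ.* (n ℕ.* a) ≡ n ℕ.* W
    nat = ℤP.+-injective (trans (ℤP.pos-+ (U ℕ.+ a ℕ.* V) _) (trans (cong₂ _+_ (trans (ℤP.pos-+ U _) (cong (λ z → + U + z) (ℤP.pos-* a V))) (ℤP.pos-* (suc k) (n ℕ.* a)))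
      (trans (move (+ U + + a * + V) (+ n * + W) (+ suc k) (+ (n ℕ.* a))) (trans (cong (λ z → z + + suc k * + (n ℕ.* a) + + n * + W) e) (trans (cancel (+ suc k) (+ (n ℕ.* a)) (+ n * + W)) (sym (ℤP.pos-* n W)))))))
      where
      move : ∀ x y k m → x + k * m ≡ x - y + k * m + y
      move = solve-∀
      cancel : ∀ k m y → - k * m + k * m + y ≡ y
      cancel = solve-∀

  comaximal-∤ : ∀ {n a} → Comaximal n a → a ∤ 1 → a ∤ n
  comaximal-∤ {a = a} (bezout u v eq) a∤1 (divides q refl) = a∤1 (≈0⇒∣ {a} {1ℤ} (mod (u * + q + v) (trans (sym eq) (trans (cong (λ z → u * z + v * + a) (ℤP.pos-* q a)) (shape u v (+ q) (+ a))))))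
    where
    shape : ∀ u v q a → u * (q * a) + v * a ≡ 0ℤ + (u * q + v) * a
    shape = solve-∀

  -- Legendre's theorem by Mordell's pigeonhole argument: a short vector of the lattice x ≡ c y (n), x ≡ e z (a)
  -- has x² + a y² − n z² ∈ {0 , a n}, and the value a n is turned into a zero by multiplicativity of the norm z² + a.
  legendre-equation : ∀ {a n} → Prime a → 0 ℕ.< n → Comaximal n a → Square n (- (+ a)) → Square a (+ n) → Solution (+ a) (+ n)
  legendre-equation {a} {n} pr 0<n co (root c c≈) (root e e≈) = from (isqrt (a ℕ.* n)) (isqrt n) (isqrt a)
    where
    instance
      a≢0 = prime⇒nonZero pr
      n≢0 = ℕ.>-nonZero 0<n
    Root : ℕ → Set
    Root m = ∃ λ s → s ℕ.* s ℕ.≤ m × m ℕ.< suc s ℕ.* suc s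
    1<a : 1 ℕ.< a
    1<a = ℕ.nonTrivial⇒n>1 a {{prime⇒nonTrivial pr}}
    a∤1 : a ∤ 1
    a∤1 d = ℕP.<⇒≱ 1<a (ℕD.∣⇒≤ d)
    a∤n : a ∤ n
    a∤n = comaximal-∤ co a∤1

    finish : ∀ X Y Z → (X ≡ 0ℤ → Y ≡ 0ℤ → Z ≡ 0ℤ → ⊥) → ∀ k → X * X + + a * (Y * Y) - + n * (Z * Z) ≡ k * + (n ℕ.* a) → k ≡ 0ℤ ⊎ k ≡ 1ℤ → Solution (+ a) (+ n)
    finish X Y Z non .0ℤ eq (inj₁ refl) = solution X Y Z Z≢0 eq'
      where
      eq' : X * X + + a * (Y * Y) ≡ + n * (Z * Z)
      eq' = ℤP.i-j≡0⇒i≡j _ _ eq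
      Z≢0 : Z ≢ 0ℤ
      Z≢0 refl = non (zero-of X (ℕP.m+n≡0⇒m≡0 _ sum)) (zero-of Y (case (ℕP.m*n≡0⇒m≡0∨n≡0 a (ℕP.m+n≡0⇒n≡0 (∣ X ∣ ℕ.* ∣ X ∣) sum)))) refl
        where
        sum : ∣ X ∣ ℕ.* ∣ X ∣ ℕ.+ a ℕ.* (∣ Y ∣ ℕ.* ∣ Y ∣) ≡ 0
        sum = ℤP.+-injective (trans (ℤP.pos-+ (∣ X ∣ ℕ.* ∣ X ∣) _) (trans (cong₂ _+_ (sym (∣∣-square X)) (trans (ℤP.pos-* a _) (cong (+ a *_) (sym (∣∣-square Y))))) (trans eq' (ℤP.*-zeroʳ (+ n)))))
        zero-of : ∀ x → ∣ x ∣ ℕ.* ∣ x ∣ ≡ 0 → x ≡ 0ℤ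
        zero-of x e with ℕP.m*n≡0⇒m≡0∨n≡0 ∣ x ∣ e
        ... | inj₁ z = ℤP.∣i∣≡0⇒i≡0 z
        ... | inj₂ z = ℤP.∣i∣≡0⇒i≡0 z
        case : a ≡ 0 ⊎ ∣ Y ∣ ℕ.* ∣ Y ∣ ≡ 0 → ∣ Y ∣ ℕ.* ∣ Y ∣ ≡ 0
        case (inj₁ z) = ⊥-elim (ℕ.≢-nonZero⁻¹ a z)
        case (inj₂ z) = z
    finish X Y Z non .1ℤ eq (inj₂ refl) = solution (X * Z + + a * Y) (Y * Z - X) (Z * Z + + a) W≢0 (begin
      (X * Z + + a * Y) * (X * Z + + a * Y) + + a * ((Y * Z - X) * (Y * Z - X)) ≡⟨ norm X Y Z (+ a) (+ n) ⟩
      (Z * Z + + a) * (X * X + + a * (Y * Y) - + n * (Z * Z) + + n * (Z * Z))    ≡⟨ cong (λ z → (Z * Z + + a) * (z + + n * (Z * Z))) (trans eq (trans (ℤP.*-identityˡ _) (ℤP.pos-* n a))) ⟩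
      (Z * Z + + a) * (+ n * + a + + n * (Z * Z))                                ≡⟨ shape Z (+ a) (+ n) ⟩
      + n * ((Z * Z + + a) * (Z * Z + + a))                                      ∎)
      where
      open ≡-Reasoning
      norm : ∀ X Y Z a n → (X * Z + a * Y) * (X * Z + a * Y) + a * ((Y * Z - X) * (Y * Z - X)) ≡ (Z * Z + a) * (X * X + a * (Y * Y) - n * (Z * Z) + n * (Z * Z))
      norm = solve-∀
      shape : ∀ Z a n → (Z * Z + a) * (n * a + n * (Z * Z)) ≡ n * ((Z * Z + a) * (Z * Z + a))
      shape = solve-∀
      W≢0 : Z * Z + + a ≢ 0ℤ
      W≢0 w = ℕ.≢-nonZero⁻¹ a (ℕP.m+n≡0⇒n≡0 (∣ Z ∣ ℕ.* ∣ Z ∣) (ℤP.+-injective (trans (ℤP.pos-+ (∣ Z ∣ ℕ.* ∣ Z ∣) a) (trans (cong (_+ + a) (sym (∣∣-square Z))) w))))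

    from : Root (a ℕ.* n) → Root n → Root a → Solution (+ a) (+ n)
    from (A , A≤ , A<) (B , B≤ , B<) (C , C≤ , C<) = collide (collision (suc A , suc B , suc C , 1) n a (λ (x , y , z , w) → + x - + c * + y) (λ (x , y , z , w) → + x - + e * + z) (big-box a n (suc A) (suc B) (suc C) A< B< C<))
      where
      collide : Collision (suc A , suc B , suc C , 1) n a (λ (x , y , z , w) → + x - + c * + y) (λ (x , y , z , w) → + x - + e * + z) → Solution (+ a) (+ n)
      collide record { p = x , y , z , 0 ; q = x' , y' , z' , 0 ; p∈ = x< , y< , z< , s≤s z≤n ; q∈ = x'< , y'< , z'< , s≤s z≤n ; distinct = d ; F≈ = F≈ ; G≈ = G≈ } =
        conclude (≈-glue co (value≈0ˡ (+ a) X Y Z (+ c) (linear x x' y y' c F≈) c≈) (value≈0ʳ (+ n) X Y Z (+ e) (linear x x' z z' e G≈) e≈))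
        where
        X = + x - + x'
        Y = + y - + y'
        Z = + z - + z'
        linear : ∀ {m} x x' y y' c → + x - + c * + y ≈ + x' - + c * + y' [ m ] → + x - + x' ≈ + c * (+ y - + y') [ m ]
        linear x x' y y' c eq = ≈-trans (≈-reflexive (shape (+ x) (+ x') (+ y) (+ c))) (≈-trans (≈-+ eq (≈-refl {a = + c * + y - + x'})) (≈-reflexive (shape' (+ x') (+ y) (+ y') (+ c))))
          where
          shape : ∀ x x' y c → x - x' ≡ x - c * y + (c * y - x')
          shape = solve-∀
          shape' : ∀ x' y y' c → x' - c * y' + (c * y - x') ≡ c * (y - y')
          shape' = solve-∀
        square-bound : ∀ {x x' s m} → x ℕ.< suc s → x' ℕ.< suc s → s ℕ.* s ℕ.≤ m → ∣ + x - + x' ∣ ℕ.* ∣ + x - + x' ∣ ℕ.≤ m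
        square-bound l l' b = ℕP.≤-trans (ℕP.*-mono-≤ (difference-bound l l') (difference-bound l l')) b
        conclude : X * X + + a * (Y * Y) - + n * (Z * Z) ≈ 0ℤ [ n ℕ.* a ] → Solution (+ a) (+ n)
        conclude (mod k eq) = finish X Y Z (λ ex ey ez → d (cong₂ _,_ (difference≡0 ex) (cong₂ _,_ (difference≡0 ey) (cong (_, 0) (difference≡0 ez))))) k eq'
          (quotient-0-1 a n (∣ X ∣ ℕ.* ∣ X ∣) (∣ Y ∣ ℕ.* ∣ Y ∣) (∣ Z ∣ ℕ.* ∣ Z ∣)
            -- The integer square roots only give ≤. Strictness for X² and Z² holds because neither
            -- a n nor a is a square, and it is what excludes the quotients 2 and -1.
            (ℕP.≤∧≢⇒< (square-bound x< x'< A≤) (prime∤⇒nonsquare pr a∤n ∣ X ∣)) (square-bound y< y'< B≤) (ℕP.≤∧≢⇒< (square-bound z< z'< C≤) (λ e → prime∤⇒nonsquare pr a∤1 ∣ Z ∣ (trans e (sym (ℕP.*-identityʳ a)))))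
            k (trans (sym (cong₂ _-_ (cong₂ (λ u v → u + + a * v) (∣∣-square X) (∣∣-square Y)) (cong (+ n *_) (∣∣-square Z)))) eq'))
          where
          eq' = trans eq (ℤP.+-identityˡ (k * + (n ℕ.* a)))

-- Odd primes as rational sums of four squares.

module FourSquares where
  open Mod
  open Crt
  open Box
  open Residue
  open Legendre
  open import Data.Nat as ℕ using (ℕ; zero; suc; z≤n; s≤s)
  import Data.Nat.Properties as ℕP
  open import Data.Nat.Divisibility as ℕD using (_∣_; _∤_; divides)
  open import Data.Nat.Primality using (Prime)
  open import Data.Integer using (ℤ; +_; 0ℤ; 1ℤ; ∣_∣; _+_; _*_; _-_; -_)
  import Data.Integer.Properties as ℤP
  open import Data.Integer.DivMod using (n%ℕd<d)
  open import Data.Integer.Tactic.RingSolver using (solve-∀)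
  import Data.Nat.Tactic.RingSolver as ℕR
  open import Data.Fin as Fin using (Fin; toℕ; fromℕ<)
  import Data.Fin.Properties as FinP
  open import Data.Product using (_×_; _,_; ∃; ∃₂; proj₂)
  open import Data.Sum using (_⊎_; inj₁; inj₂)
  open import Data.Empty using (⊥; ⊥-elim)
  open import Relation.Nullary using (Dec; yes; no)
  open import Relation.Binary.PropositionalEquality

  -- The denominator `c` is allowed because a and b only have to be sums of four rational squares;
  -- this spares Lagrange's descent on the multiplier.
  record FourSquare (ℓ : ℤ) : Set where
    constructor fourSquare
    field
      c           : ℤ
      c≢0         : c ≢ 0ℤ
      r₀ r₁ r₂ r₃ : ℤ
      sum         : r₀ * r₀ + r₁ * r₁ + r₂ * r₂ + r₃ * r₃ ≡ ℓ * (c * c)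

  module _ (h : ℕ) (pr : Prime (suc (h ℕ.+ h))) where
    private
      p = suc (h ℕ.+ h)

    squares-distinct : ∀ {i j} → i ℕ.≤ h → j ℕ.≤ h → i ℕ.< j → + i * + i ≈ + j * + j [ p ] → ⊥
    squares-distinct {i} {j} i≤h j≤h i<j e = split (prime-≈0 pr (≈-trans (≈-reflexive (lemma (+ i) (+ j))) (≈⇒-≈0 e)))
      where
      lemma : ∀ i j → (i - j) * (i + j) ≡ i * i - j * j
      lemma = solve-∀
      h<p : h ℕ.< p
      h<p = s≤s (ℕP.m≤m+n h h)
      split : + i - + j ≈ 0ℤ [ p ] ⊎ + i + + j ≈ 0ℤ [ p ] → ⊥
      split (inj₁ z) = ℕP.<-irrefl (ℤP.+-injective (small⇒≡ (-≈0⇒≈ z) (ℕP.≤-<-trans (difference-bound (s≤s i≤h) (s≤s j≤h)) h<p))) i<j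
      split (inj₂ z) = ℕP.<⇒≱ (s≤s (ℕP.+-mono-≤ i≤h j≤h)) (ℕD.∣⇒≤ {{ℕ.>-nonZero (ℕP.≤-trans (ℕP.≤-<-trans z≤n i<j) (ℕP.m≤n+m j i))}} (≈0⇒∣ {a = + (i ℕ.+ j)} (≈-trans (≈-reflexive (ℤP.pos-+ i j)) z)))

    -- Among the values x² and −1 − y² with x, y ≤ h two must agree modulo p.
    minus-one-sum : ∃₂ λ x y → + x * + x + + y * + y + 1ℤ ≈ 0ℤ [ p ]
    minus-one-sum = from (FinP.pigeonhole {suc (h ℕ.+ h)} {suc h ℕ.+ suc h} (ℕP.≤-reflexive (cong suc (sym (ℕP.+-suc h h)))) (λ i → fromℕ< (n%ℕd<d (val (toℕ i)) p)))
      where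
      -- Both lists are run through by one index: the h + 1 indices up to `h` carry the squares, the
      -- h + 1 indices above it carry -1 - y². This makes 2h + 2 values for 2h + 1 residues.
      value : ∀ i → Dec (i ℕ.≤ h) → ℤ
      value i (yes _) = + i * + i
      value i (no _)  = - 1ℤ - + (i ℕ.∸ suc h) * + (i ℕ.∸ suc h)
      val : ℕ → ℤ
      val i = value i (i ℕ.≤? h)
      close : ∀ x y → + x * + x ≈ - 1ℤ - + y * + y [ p ] → + x * + x + + y * + y + 1ℤ ≈ 0ℤ [ p ]
      close x y e = ≈-trans (≈-reflexive (lemma (+ x) (+ y))) (≈⇒-≈0 e)
        where
        lemma : ∀ x y → x * x + y * y + 1ℤ ≡ x * x - (- 1ℤ - y * y)
        lemma = solve-∀
      open-up : ∀ x y → - 1ℤ - + x * + x ≈ - 1ℤ - + y * + y [ p ] → + x * + x ≈ + y * + y [ p ]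
      open-up x y e = ≈-trans (≈-reflexive (lemma (+ x))) (≈-trans (≈-neg (≈-+ (≈-refl {a = 1ℤ}) e)) (≈-reflexive (sym (lemma (+ y)))))
        where
        lemma : ∀ x → x * x ≡ - (1ℤ + (- 1ℤ - x * x))
        lemma = solve-∀
      decide : ∀ {i j} (di : Dec (i ℕ.≤ h)) (dj : Dec (j ℕ.≤ h)) → i ℕ.< j → j ℕ.< suc h ℕ.+ suc h → value i di ≈ value j dj [ p ] → ∃₂ λ x y → + x * + x + + y * + y + 1ℤ ≈ 0ℤ [ p ]
      decide {i} {j} (yes i≤h) (yes j≤h) i<j _ e = ⊥-elim (squares-distinct i≤h j≤h i<j e)
      decide {i} {j} (yes i≤h) (no _) i<j _ e = i , j ℕ.∸ suc h , close i (j ℕ.∸ suc h) e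
      decide {i} {j} (no i≰h) (yes j≤h) i<j _ e = ⊥-elim (i≰h (ℕP.≤-trans (ℕP.<⇒≤ i<j) j≤h))
      decide {i} {j} (no i≰h) (no j≰h) i<j j< e = ⊥-elim (squares-distinct (bound (ℕP.<-trans i<j j<)) (bound j<) (ℕP.∸-monoˡ-< i<j (ℕP.≰⇒> i≰h)) (open-up (i ℕ.∸ suc h) (j ℕ.∸ suc h) e))
        where
        bound : ∀ {i} → i ℕ.< suc h ℕ.+ suc h → i ℕ.∸ suc h ℕ.≤ h
        bound {i} l = ℕP.≤-trans (ℕP.∸-monoˡ-≤ (suc h) (ℕP.≤-pred l)) (ℕP.≤-reflexive (trans (cong (ℕ._∸ suc h) (ℕP.+-comm h (suc h))) (ℕP.m+n∸m≡n (suc h) h)))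
      from : (∃₂ λ i j → i Fin.< j × fromℕ< (n%ℕd<d (val (toℕ i)) p) ≡ fromℕ< (n%ℕd<d (val (toℕ j)) p)) → ∃₂ λ x y → + x * + x + + y * + y + 1ℤ ≈ 0ℤ [ p ]
      from (i , j , i<j , e) = decide (toℕ i ℕ.≤? h) (toℕ j ℕ.≤? h) i<j (FinP.toℕ<n j)
        (≈-trans (≈-sym (reduce p (val (toℕ i)))) (≈-trans (≈-reflexive (cong +_ (FinP.fromℕ<-injective _ _ (n%ℕd<d (val (toℕ i)) p) (n%ℕd<d (val (toℕ j)) p) e))) (reduce p (val (toℕ j)))))

    -- A short vector of the lattice z ≡ u x + v y, w ≡ v x − u y has norm c p with c ≤ 3, and c is itself a sum of four squares.
    four-squares : FourSquare (+ p)
    four-squares = start minus-one-sum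
      where
      Norm : ℤ → ℤ → ℤ → ℤ → ℕ
      Norm X Y Z W = ∣ X ∣ ℕ.* ∣ X ∣ ℕ.+ ∣ Y ∣ ℕ.* ∣ Y ∣ ℕ.+ ∣ Z ∣ ℕ.* ∣ Z ∣ ℕ.+ ∣ W ∣ ℕ.* ∣ W ∣
      norm : ∀ X Y Z W → X * X + Y * Y + Z * Z + W * W ≡ + Norm X Y Z W
      norm X Y Z W = trans (cong₂ _+_ (cong₂ _+_ (cong₂ _+_ (∣∣-square X) (∣∣-square Y)) (∣∣-square Z)) (∣∣-square W)) refl
      finish : ∀ X Y Z W c → 0 ℕ.< c → c ℕ.< 4 → Norm X Y Z W ≡ c ℕ.* p → FourSquare (+ p)
      finish X Y Z W 1 _ _ e = fourSquare 1ℤ (λ ()) X Y Z W (trans (norm X Y Z W) (trans (cong +_ e) (trans (ℤP.pos-* 1 p) (shape (+ p)))))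
        where
        shape : ∀ p → 1ℤ * p ≡ p * (1ℤ * 1ℤ)
        shape = solve-∀
      finish X Y Z W 2 _ _ e = fourSquare (+ 2) (λ ()) (X + Y) (X - Y) (Z + W) (Z - W) (trans (euler X Y Z W) (trans (cong (+ 2 *_) (trans (norm X Y Z W) (trans (cong +_ e) (ℤP.pos-* 2 p)))) (shape (+ p))))
        where
        euler : ∀ X Y Z W → (X + Y) * (X + Y) + (X - Y) * (X - Y) + (Z + W) * (Z + W) + (Z - W) * (Z - W) ≡ + 2 * (X * X + Y * Y + Z * Z + W * W)
        euler = solve-∀
        shape : ∀ p → + 2 * (+ 2 * p) ≡ p * (+ 2 * + 2)
        shape = solve-∀
      finish X Y Z W 3 _ _ e = fourSquare (+ 3) (λ ()) (X + Y + Z) (X - Y + W) (X - Z - W) (Y - Z + W) (trans (euler X Y Z W) (trans (cong (+ 3 *_) (trans (norm X Y Z W) (trans (cong +_ e) (ℤP.pos-* 3 p)))) (shape (+ p))))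
        where
        euler : ∀ X Y Z W → (X + Y + Z) * (X + Y + Z) + (X - Y + W) * (X - Y + W) + (X - Z - W) * (X - Z - W) + (Y - Z + W) * (Y - Z + W) ≡ + 3 * (X * X + Y * Y + Z * Z + W * W)
        euler = solve-∀
        shape : ∀ p → + 3 * (+ 3 * p) ≡ p * (+ 3 * + 3)
        shape = solve-∀
      finish X Y Z W (suc (suc (suc (suc _)))) _ (s≤s (s≤s (s≤s (s≤s ())))) _
      F G : ℕ → ℕ → Point → ℤ
      F u v (x , y , z , w) = + z - (+ u * + x + + v * + y)
      G u v (x , y , z , w) = + w - (+ v * + x - + u * + y)
      start : (∃₂ λ x y → + x * + x + + y * + y + 1ℤ ≈ 0ℤ [ p ]) → FourSquare (+ p)
      start (u , v , uv) = boxed (isqrt p)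
        where
        boxed : (∃ λ s → s ℕ.* s ℕ.≤ p × p ℕ.< suc s ℕ.* suc s) → FourSquare (+ p)
        boxed (s , s≤ , s<) = collide (collision (suc s , suc s , suc s , suc s) p p (F u v) (G u v) (ℕP.<-≤-trans (ℕP.*-mono-< s< s<) (ℕP.≤-reflexive (shape (suc s)))))
          where
          shape : ∀ t → t ℕ.* t ℕ.* (t ℕ.* t) ≡ t ℕ.* (t ℕ.* (t ℕ.* t))
          shape = ℕR.solve-∀
          collide : Collision (suc s , suc s , suc s , suc s) p p (F u v) (G u v) → FourSquare (+ p)
          collide record { p = x , y , z , w ; q = x' , y' , z' , w' ; p∈ = x< , y< , z< , w< ; q∈ = x'< , y'< , z'< , w'< ; distinct = d ; F≈ = F≈ ; G≈ = G≈ } = quotient (≈0⇒∣ {a = + Norm X Y Z W} total)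
            where
            X = + x - + x'
            Y = + y - + y'
            Z = + z - + z'
            W = + w - + w'
            Z≈ : Z ≈ + u * X + + v * Y [ p ]
            Z≈ = ≈-trans (≈-reflexive (before (+ u) (+ v) (+ x) (+ y) (+ z) (+ z'))) (≈-trans (≈-+ F≈ (≈-refl {a = + u * + x + + v * + y - + z'})) (≈-reflexive (after (+ u) (+ v) (+ x) (+ y) (+ x') (+ y') (+ z'))))
              where
              before : ∀ u v x y z z' → z - z' ≡ z - (u * x + v * y) + (u * x + v * y - z')
              before = solve-∀
              after : ∀ u v x y x' y' z' → z' - (u * x' + v * y') + (u * x + v * y - z') ≡ u * (x - x') + v * (y - y')
              after = solve-∀
            W≈ : W ≈ + v * X - + u * Y [ p ]
            W≈ = ≈-trans (≈-reflexive (before (+ u) (+ v) (+ x) (+ y) (+ w) (+ w'))) (≈-trans (≈-+ G≈ (≈-refl {a = + v * + x - + u * + y - + w'})) (≈-reflexive (after (+ u) (+ v) (+ x) (+ y) (+ x') (+ y') (+ w'))))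
              where
              before : ∀ u v x y w w' → w - w' ≡ w - (v * x - u * y) + (v * x - u * y - w')
              before = solve-∀
              after : ∀ u v x y x' y' w' → w' - (v * x' - u * y') + (v * x - u * y - w') ≡ v * (x - x') - u * (y - y')
              after = solve-∀
            total : + Norm X Y Z W ≈ 0ℤ [ p ]
            total = ≈-trans (≈-reflexive (sym (norm X Y Z W))) (≈-trans (≈-+ (≈-+ (≈-refl {a = X * X + Y * Y}) (≈-* Z≈ Z≈)) (≈-* W≈ W≈))
              (≈-trans (≈-reflexive (gather (+ u) (+ v) X Y)) (≈-trans (≈-* uv (≈-refl {a = X * X + Y * Y})) (≈-reflexive refl))))
              where
              gather : ∀ u v X Y → X * X + Y * Y + (u * X + v * Y) * (u * X + v * Y) + (v * X - u * Y) * (v * X - u * Y) ≡ (u * u + v * v + 1ℤ) * (X * X + Y * Y)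
              gather = solve-∀
            square-bound : ∀ {x x'} → x ℕ.< suc s → x' ℕ.< suc s → ∣ + x - + x' ∣ ℕ.* ∣ + x - + x' ∣ ℕ.< p
            square-bound l l' = ℕP.≤-<-trans (ℕP.*-mono-≤ (difference-bound l l') (difference-bound l l')) (ℕP.≤∧≢⇒< s≤ (λ e → prime∤⇒nonsquare pr p∤1 s (trans e (sym (ℕP.*-identityʳ p)))))
              where
              p∤1 : p ∤ 1
              p∤1 = Gauss.∤-small h pr (s≤s z≤n) (subst (1 ℕ.≤_) (sym (proj₂ (Gauss.h≢0 h pr))) (s≤s z≤n))
            bound : Norm X Y Z W ℕ.< 4 ℕ.* p
            bound = ℕP.<-≤-trans (ℕP.+-mono-< (ℕP.+-mono-< (ℕP.+-mono-< (square-bound x< x'<) (square-bound y< y'<)) (square-bound z< z'<)) (square-bound w< w'<)) (ℕP.≤-reflexive (four p))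
              where
              four : ∀ p → p ℕ.+ p ℕ.+ p ℕ.+ p ≡ 4 ℕ.* p
              four = ℕR.solve-∀
            nonzero : Norm X Y Z W ≡ 0 → ⊥
            nonzero e = d (cong₂ _,_ (zero-of X x x' refl (ℕP.m+n≡0⇒m≡0 (sq X) e₂)) (cong₂ _,_ (zero-of Y y y' refl (ℕP.m+n≡0⇒n≡0 (sq X) e₂)) (cong₂ _,_ (zero-of Z z z' refl (ℕP.m+n≡0⇒n≡0 (sq X ℕ.+ sq Y) e₁)) (zero-of W w w' refl (ℕP.m+n≡0⇒n≡0 (sq X ℕ.+ sq Y ℕ.+ sq Z) e)))))
              where
              sq : ℤ → ℕ
              sq X = ∣ X ∣ ℕ.* ∣ X ∣
              e₁ : sq X ℕ.+ sq Y ℕ.+ sq Z ≡ 0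
              e₁ = ℕP.m+n≡0⇒m≡0 (sq X ℕ.+ sq Y ℕ.+ sq Z) e
              e₂ : sq X ℕ.+ sq Y ≡ 0
              e₂ = ℕP.m+n≡0⇒m≡0 (sq X ℕ.+ sq Y) e₁
              zero-of : ∀ X x x' → X ≡ + x - + x' → sq X ≡ 0 → x ≡ x'
              zero-of X x x' refl e with ℕP.m*n≡0⇒m≡0∨n≡0 ∣ X ∣ e
              ... | inj₁ z = difference≡0 (ℤP.∣i∣≡0⇒i≡0 z)
              ... | inj₂ z = difference≡0 (ℤP.∣i∣≡0⇒i≡0 z)
            quotient : (p ∣ Norm X Y Z W) → FourSquare (+ p)
            quotient (divides zero e) = ⊥-elim (nonzero e)
            quotient (divides c@(suc _) e) = finish X Y Z W c (s≤s z≤n) (ℕP.*-cancelʳ-< p c 4 (subst (ℕ._< 4 ℕ.* p) e bound)) e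

-- Auxiliary primes 3 modulo 4 and the equations they solve.

module Symbols where
  open Peel
  open Mod
  open Crt
  open Residue
  open Reciprocity
  open Classes
  open Factor
  open Legendre
  open import Data.Nat as ℕ using (ℕ; suc; z≤n; s≤s)
  import Data.Nat.Properties as ℕP
  open import Data.Nat.Divisibility as ℕD using (_∣_; _∤_; divides)
  open import Data.Nat.DivMod as DM using (_%_; _/_)
  open import Data.Nat.ListAction using (product)
  open import Data.Nat.Primality using (Prime; prime⇒nonTrivial; prime⇒irreducible)
  open import Data.Integer using (+_; 0ℤ; 1ℤ; -1ℤ; ∣_∣; _+_; _*_; _-_; -_)
  import Data.Integer.Properties as ℤP
  open import Data.Integer.DivMod using (_%ℕ_; n%ℕd<d)
  open import Data.Integer.Tactic.RingSolver using (solve-∀)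
  import Data.Nat.Tactic.RingSolver as ℕR
  open import Data.Bool using (Bool; true; false)
  open import Data.List using ([]; _∷_; _++_)
  open import Data.List.Relation.Unary.All as All using (All; []; _∷_)
  import Data.List.Relation.Unary.All.Properties as AllP
  open import Data.List.Relation.Unary.AllPairs using (AllPairs; []; _∷_)
  import Data.List.Relation.Unary.AllPairs.Properties as APP
  open import Data.Product using (_×_; _,_; ∃; proj₁; proj₂)
  open import Data.Sum using (_⊎_; inj₁; inj₂)
  open import Relation.Nullary using (Dec; yes; no)
  open import Relation.Binary.PropositionalEquality

  square-mul : ∀ {n a b} → Square n a → Square n b → Square n (a * b)
  square-mul (root x ex) (root y ey) = root (x ℕ.* y) (≈-trans (≈-reflexive (trans (cong₂ _*_ (ℤP.pos-* x y) (ℤP.pos-* x y)) (shape (+ x) (+ y)))) (≈-* ex ey))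
    where
    shape : ∀ x y → x * y * (x * y) ≡ x * x * (y * y)
    shape = solve-∀

  square-2 : ∀ a → Square 2 a
  square-2 a = from (a %ℕ 2) (n%ℕd<d a 2) (reduce 2 a)
    where
    from : ∀ r → r ℕ.< 2 → + r ≈ a [ 2 ] → Square 2 a
    from 0 _ e = root 0 e
    from 1 _ e = root 1 e
    from (suc (suc _)) (s≤s (s≤s ())) _

  residue⇒square : ∀ r {a} → val r ∤ a → Gauss.s (half r) a ≡ 1ℤ → Square (val r) (+ a)
  residue⇒square r {a} ∤a s≡1 = from (Gauss.residue (half r) (prime r) ∤a s≡1)
    where
    from : (∃ λ x → + (x ℕ.* x) ≈ + a [ val r ]) → Square (val r) (+ a)
    from (x , e) = root x (≈-trans (≈-reflexive (sym (ℤP.pos-* x x))) e)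

  -- The natural number (p - 1) a stands for -a, and its symbol is that of `a` times the symbol of
  -- -1.
  residue⇒square-minus : ∀ r {a} → val r ∤ a → parity (half r) * Gauss.s (half r) a ≡ 1ℤ → Square (val r) (- (+ a))
  residue⇒square-minus r {a} ∤a e = from (residue⇒square r {b} ∤b (trans (Supplement.minus-one (half r) (prime r) ∤b ∤a b≈-a) e))
    where
    b = (half r ℕ.+ half r) ℕ.* a
    total : + b ≡ - (+ a) + + a * + val r
    total = trans (ℤP.pos-* (half r ℕ.+ half r) a) (trans (shape (+ (half r ℕ.+ half r)) (+ a)) (cong (λ z → - (+ a) + + a * z) (sym (ℤP.pos-+ 1 (half r ℕ.+ half r)))))
      where
      shape : ∀ h a → h * a ≡ - a + a * (1ℤ + h)
      shape = solve-∀
    b≈-a : + b ≈ - (+ a) [ val r ]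
    b≈-a = mod (+ a) total
    ∤b : val r ∤ b
    ∤b d = ∤a (subst (val r ∣_) (ℤP.∣-i∣≡∣i∣ (+ a)) (≈0⇒∣ (≈-trans (≈-sym b≈-a) (∣⇒≈0 d))))
    from : Square (val r) (+ b) → Square (val r) (- (+ a))
    from (root x ex) = root x (≈-trans ex b≈-a)

  prime-cases : ∀ {q} → Prime q → q ≡ 2 ⊎ ∃ λ r → val r ≡ q
  prime-cases {q} pr = go (q % 2) (DM.m%n<n q 2) (DM.m≡m%n+[m/n]*n q 2)
    where
    go : ∀ t → t ℕ.< 2 → q ≡ t ℕ.+ q / 2 ℕ.* 2 → q ≡ 2 ⊎ ∃ λ r → val r ≡ q
    go 0 _ e with prime⇒irreducible pr (divides (q / 2) e)
    ... | inj₁ ()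
    ... | inj₂ e' = inj₁ (sym e')
    go 1 _ e = inj₂ (oddPrime (q / 2) (subst Prime e'' pr) , sym e'')
      where
      double : ∀ k → 1 ℕ.+ k ℕ.* 2 ≡ suc (k ℕ.+ k)
      double = ℕR.solve-∀
      e'' = trans e (double (q / 2))
    go (suc (suc _)) (s≤s (s≤s ())) _

  choose : ∀ {u} → IsUnit u → ∀ b → ∃ λ b' → u * sign b' ≡ sign b
  choose (inj₁ refl) b     = b , ℤP.*-identityˡ (sign b)
  choose (inj₂ refl) true  = false , refl
  choose (inj₂ refl) false = true , refl

  -- The bit b for which q ≡ 3 (mod 4) with Legendre symbol (q / r) = sign b satisfies (−q / r) = (r / q) = 1.
  split-bit : OddPrime → Bool
  split-bit r = proj₁ (choose (parity-unit (half r)) true)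

  conditions : ∀ qs → All Prime qs → Conditions
  conditions []       []         = []
  conditions (q ∷ qs) (pr ∷ prs) with prime-cases pr
  ... | inj₁ _       = conditions qs prs
  ... | inj₂ (r , _) = (r , split-bit r) ∷ conditions qs prs

  conditions-fresh : ∀ {x} qs (prs : All Prime qs) → All (x ≢_) qs → All (λ y → x ≢ val (proj₁ y)) (conditions qs prs)
  conditions-fresh []       []         []       = []
  conditions-fresh (q ∷ qs) (pr ∷ prs) (n ∷ ns) with prime-cases pr
  ... | inj₁ _       = conditions-fresh qs prs ns
  ... | inj₂ (r , e) = (λ e' → n (trans e' e)) ∷ conditions-fresh qs prs ns

  conditions-distinct : ∀ qs (prs : All Prime qs) → AllPairs _≢_ qs → Distinct (conditions qs prs)
  conditions-distinct []       []         []       = []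
  conditions-distinct (q ∷ qs) (pr ∷ prs) (n ∷ ns) with prime-cases pr
  ... | inj₁ _       = conditions-distinct qs prs ns
  ... | inj₂ (r , e) = conditions-fresh qs prs (All.map (λ n' e' → n' (trans (sym e) e')) n) ∷ conditions-distinct qs prs ns

  -- The prime 4m + 3, written as 2h + 1 with h = 2m + 1 to match `Gauss` and `two`; by `two`,
  -- `mod8` prescribes the symbol (2 / ℓ).
  record Prime₃ (b₈ : Bool) (c : Conditions) : Set where
    constructor prime₃
    field
      m        : ℕ
      isPrime  : Prime (suc (suc (m ℕ.+ m) ℕ.+ suc (m ℕ.+ m)))
      mod8     : parity (suc m) ≡ sign b₈
      symbols  : All (λ x → fun (legendre (proj₁ x)) (suc (suc (m ℕ.+ m) ℕ.+ suc (m ℕ.+ m))) ≡ sign (proj₂ x)) c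

    odd : OddPrime
    odd = oddPrime (suc (m ℕ.+ m)) isPrime

  open Prime₃ public using (odd)

  prime₃-exists : ∀ b₈ c → Distinct c → Prime₃ b₈ c
  prime₃-exists b₈ c d = from (prime-with-symbols b₈ c d)
    where
    from : (∃ λ q → Prime q × fun χ₄ q ≡ -1ℤ × fun χ₈ q ≡ sign b₈ × All (λ x → fun (legendre (proj₁ x)) q ≡ sign (proj₂ x)) c) → Prime₃ b₈ c
    from (q , pr , e₄ , e₈ , es) = table (q % 8) (DM.m%n<n q 8) (DM.m≡m%n+[m/n]*n q 8) e₄ e₈
      where
      build : ∀ m → q ≡ suc (suc (m ℕ.+ m) ℕ.+ suc (m ℕ.+ m)) → parity (suc m) ≡ sign b₈ → Prime₃ b₈ c
      build m refl par = prime₃ m pr par es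
      k = q / 8
      three : ∀ k → 3 ℕ.+ k ℕ.* 8 ≡ suc (suc (k ℕ.+ k ℕ.+ (k ℕ.+ k)) ℕ.+ suc (k ℕ.+ k ℕ.+ (k ℕ.+ k)))
      three = ℕR.solve-∀
      seven : ∀ k → 7 ℕ.+ k ℕ.* 8 ≡ suc (suc (suc (k ℕ.+ k) ℕ.+ suc (k ℕ.+ k)) ℕ.+ suc (suc (k ℕ.+ k) ℕ.+ suc (k ℕ.+ k)))
      seven = ℕR.solve-∀
      table : ∀ t → t ℕ.< 8 → q ≡ t ℕ.+ k ℕ.* 8 → t₄ t ≡ -1ℤ → t₈ t ≡ sign b₈ → Prime₃ b₈ c
      table 0 _ _ () _
      table 1 _ _ () _
      table 2 _ _ () _
      table 3 _ e _ e₈ = build (k ℕ.+ k) (trans e (three k)) (trans (cong -_ (parity-double k)) e₈)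
      table 4 _ _ () _
      table 5 _ _ () _
      table 6 _ _ () _
      table 7 _ e _ e₈ = build (suc (k ℕ.+ k)) (trans e (seven k)) (trans (cong (λ z → - (- z)) (parity-double k)) e₈)
      table (suc (suc (suc (suc (suc (suc (suc (suc _)))))))) (s≤s (s≤s (s≤s (s≤s (s≤s (s≤s (s≤s (s≤s ())))))))) _ _ _

  parity-3mod4 : ∀ {b c} (ℓ : Prime₃ b c) → parity (half (odd ℓ)) ≡ -1ℤ
  parity-3mod4 ℓ = cong -_ (parity-double (Prime₃.m ℓ))

  distinct-∤ : ∀ {p q} → Prime p → Prime q → p ≢ q → p ∤ q
  distinct-∤ pp pq p≢q d with prime⇒irreducible pq d
  ... | inj₂ e = p≢q e
  ... | inj₁ refl = ℕP.<-irrefl refl (ℕ.nonTrivial⇒n>1 1 {{prime⇒nonTrivial pp}})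

  module _ {b c} (ℓ : Prime₃ b c) (r : OddPrime) where
    symbol-∤ : ∀ {b'} → fun (legendre r) (val (odd ℓ)) ≡ sign b' → val r ∤ val (odd ℓ) × Gauss.s (half r) (val (odd ℓ)) ≡ sign b'
    symbol-∤ {b'} e = proj₁ both , trans (sym (proj₂ both)) e
      where
      unit : ∀ b' → IsUnit (sign b')
      unit true  = inj₁ refl
      unit false = inj₂ refl
      both = legendre-∤ r (val (odd ℓ)) (subst IsUnit (sym e) (unit b'))

    symbol-≢ : val r ∤ val (odd ℓ) → val r ≢ val (odd ℓ)
    symbol-≢ r∤ℓ e = r∤ℓ (ℕD.∣-reflexive e)

    ∤-flip : val r ∤ val (odd ℓ) → val (odd ℓ) ∤ val r
    ∤-flip r∤ℓ = distinct-∤ (prime (odd ℓ)) (prime r) (λ e → symbol-≢ r∤ℓ (sym e))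

    flip-symbol : val r ∤ val (odd ℓ) → Gauss.s (half (odd ℓ)) (val r) ≡ parity (half r) * Gauss.s (half r) (val (odd ℓ))
    flip-symbol r∤ℓ = reciprocity₃ (half r) (half (odd ℓ)) (prime r) (prime (odd ℓ)) r∤ℓ (∤-flip r∤ℓ) (parity-3mod4 ℓ)

    split-squares : fun (legendre r) (val (odd ℓ)) ≡ sign (split-bit r) → val r ≢ val (odd ℓ) × Square (val r) (- (+ val (odd ℓ))) × Square (val (odd ℓ)) (+ val r)
    split-squares e = from (symbol-∤ e)
      where
      from : val r ∤ val (odd ℓ) × Gauss.s (half r) (val (odd ℓ)) ≡ sign (split-bit r) → val r ≢ val (odd ℓ) × Square (val r) (- (+ val (odd ℓ))) × Square (val (odd ℓ)) (+ val r)
      from (r∤ℓ , s≡) = symbol-≢ r∤ℓ , residue⇒square-minus r r∤ℓ one' , residue⇒square (odd ℓ) (∤-flip r∤ℓ) (trans (flip-symbol r∤ℓ) one')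
        where
        one' : parity (half r) * Gauss.s (half r) (val (odd ℓ)) ≡ 1ℤ
        one' = trans (cong (parity (half r) *_) s≡) (proj₂ (choose (parity-unit (half r)) true))

    inert-square : ∀ {b'} → parity (half r) * sign b' ≡ -1ℤ → fun (legendre r) (val (odd ℓ)) ≡ sign b' → Square (val (odd ℓ)) (- (+ val r))
    inert-square {b'} ch e = from (symbol-∤ e)
      where
      from : val r ∤ val (odd ℓ) × Gauss.s (half r) (val (odd ℓ)) ≡ sign b' → Square (val (odd ℓ)) (- (+ val r))
      from (r∤ℓ , s≡) = residue⇒square-minus (odd ℓ) (∤-flip r∤ℓ) (cong₂ _*_ (parity-3mod4 ℓ) (trans (flip-symbol r∤ℓ) (trans (cong (parity (half r) *_) s≡) ch)))

  val≢2 : ∀ r → 2 ≢ val r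
  val≢2 r e = odd≢even (half r) (ℕP.suc-injective e)
    where
    odd≢even : ∀ h → 1 ≢ h ℕ.+ h
    odd≢even (suc h) e with trans (ℕP.suc-injective e) (ℕP.+-suc h h)
    ... | ()

  two-∤ : ∀ r → val r ∤ 2
  two-∤ r d with prime⇒irreducible {2} two-prime d
  ... | inj₂ e = val≢2 r (sym e)
  ... | inj₁ e with trans (sym e) (cong (λ z → suc (z ℕ.+ z)) (proj₂ (Gauss.h≢0 (half r) (prime r))))
  ...   | ()

  two-symbol : ∀ {b c} (ℓ : Prime₃ b c) → Gauss.s (half (odd ℓ)) 2 ≡ sign b
  two-symbol (prime₃ m _ par _) = trans (two m) par

  all-squares : ∀ {b c} (ℓ : Prime₃ b c) qs (prs : All Prime qs) → All (λ q → q ≡ 2 → b ≡ true) qs →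
    All (λ x → fun (legendre (proj₁ x)) (val (odd ℓ)) ≡ sign (proj₂ x)) (conditions qs prs) →
    All (λ q → q ≢ val (odd ℓ) × Square q (- (+ val (odd ℓ))) × Square (val (odd ℓ)) (+ q)) qs
  all-squares ℓ []       []         []       es = []
  all-squares ℓ (q ∷ qs) (pr ∷ prs) (t ∷ ts) es with prime-cases pr
  all-squares ℓ (.2 ∷ qs) (pr ∷ prs) (t ∷ ts) es | inj₁ refl = (val≢2 (odd ℓ) , square-2 _ , residue⇒square (odd ℓ) (two-∤ (odd ℓ)) (trans (two-symbol ℓ) (cong sign (t refl)))) ∷ all-squares ℓ qs prs ts es
  all-squares ℓ (._ ∷ qs) (pr ∷ prs) (t ∷ ts) (e ∷ es) | inj₂ (r , refl) = split-squares ℓ r e ∷ all-squares ℓ qs prs ts es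

  square-products : ∀ {ℓ} qs → All (λ q → Square ℓ (+ q)) qs → Square ℓ (+ product qs)
  square-products []       []       = root 1 ≈-refl
  square-products (q ∷ qs) (s ∷ ss) = subst (Square _) (sym (ℤP.pos-* q (product qs))) (square-mul s (square-products qs ss))

  -- Every odd prime q of `n` receives its `split-bit`, so that -ℓ is a square modulo q and q a
  -- square modulo ℓ. Modulo 2 everything is a square, but 2 is a square modulo ℓ only if (2 / ℓ) =
  -- 1, whence the hypothesis on `b₈`. The roots glue as `n` is squarefree. The extra conditions `c`
  -- concern primes outside `n` and leave room for the second equation.
  auxiliary : ∀ b₈ {n} → 0 ℕ.< n → SquareFree n → (2 ∣ n → b₈ ≡ true) → ∀ c → Distinct c → All (λ x → val (proj₁ x) ∤ n) c →
    ∃ λ (ℓ : Prime₃ b₈ c) → Solution (+ val (odd ℓ)) (+ n)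
  auxiliary b₈ {n} 0<n free even c dc ∤n = from (prime₃-exists b₈ (conditions primes arePrime ++ c) (APP.++⁺ (conditions-distinct primes arePrime distinct) dc cross))
    where
    open Factors (factors 0<n free)
    member : ∀ qs → (∀ {k} → k ∣ product qs → k ∣ n) → All (_∣ n) qs
    member []       sub = []
    member (q ∷ qs) sub = sub (ℕD.m∣m*n (product qs)) ∷ member qs (λ d → sub (ℕD.∣n⇒∣m*n q d))
    divisors : All (_∣ n) primes
    divisors = member primes (λ d → subst (_ ∣_) product≡ d)
    swap : ∀ xs ys → All (λ y → All (λ x → val (proj₁ y) ≢ val (proj₁ x)) xs) ys → All (λ x → All (λ y → val (proj₁ x) ≢ val (proj₁ y)) ys) xs
    swap []       ys _ = []
    swap (x ∷ xs) ys h = All.map (λ { (n ∷ _) e → n (sym e) }) h ∷ swap xs ys (All.map All.tail h)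
    cross : All (λ x → All (λ y → val (proj₁ x) ≢ val (proj₁ y)) c) (conditions primes arePrime)
    cross = swap (conditions primes arePrime) c (All.map (λ {y} y∤n → conditions-fresh primes arePrime (All.map (λ q∣n e → y∤n (subst (_∣ n) (sym e) q∣n)) divisors)) ∤n)
    from : Prime₃ b₈ (conditions primes arePrime ++ c) → ∃ λ (ℓ : Prime₃ b₈ c) → Solution (+ val (odd ℓ)) (+ n)
    from ℓ@(prime₃ m pr par es) = prime₃ m pr par (AllP.++⁻ʳ (conditions primes arePrime) es) , subst (λ k → Solution (+ val (odd ℓ)) (+ k)) product≡
        (legendre-equation pr (subst (0 ℕ.<_) (sym product≡) 0<n)
          (comaximal-product (val (odd ℓ)) primes pr arePrime (All.map (λ x e → proj₁ x (sym e)) sq))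
          (square-product primes _ arePrime distinct (All.map (λ x → proj₁ (proj₂ x)) sq))
          (square-products primes (All.map (λ x → proj₂ (proj₂ x)) sq)))
      where
      sq = all-squares ℓ primes arePrime (All.map (λ { d refl → even d }) divisors) (AllP.++⁻ˡ (conditions primes arePrime) es)

  private
    -- The bit for which ℓ ≡ 3 (mod 4) with (ℓ / r) = `sign b` satisfies (-r / ℓ) = 1: reciprocity
    -- makes (r / ℓ) = -1, and (-1 / ℓ) = -1.
    inert : ∀ r → ∃ λ b → parity (half r) * sign b ≡ -1ℤ
    inert r = choose (parity-unit (half r)) false

  inert-bit : OddPrime → Bool
  inert-bit r = proj₁ (inert r)

  -- -r is a square modulo each of the two primes by the choice of the bit, and their product is a
  -- square modulo `r` because both have the same symbol there. If the primes coincide, the product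
  -- is itself a square.
  pair-solution : ∀ r {b b'} (ℓ₁ : Prime₃ b ((r , inert-bit r) ∷ [])) (ℓ₂ : Prime₃ b' ((r , inert-bit r) ∷ [])) →
    Solution (+ val r) (+ (val (odd ℓ₁) ℕ.* val (odd ℓ₂)))
  pair-solution r ℓ₁@(prime₃ _ pr₁ _ (e₁ ∷ [])) ℓ₂@(prime₃ _ pr₂ _ (e₂ ∷ [])) = decide (q₁ ℕ.≟ q₂)
    where
    q₁ = val (odd ℓ₁)
    q₂ = val (odd ℓ₂)
    decide : Dec (q₁ ≡ q₂) → Solution (+ val r) (+ (q₁ ℕ.* q₂))
    decide (yes e) = solution (+ q₁) 0ℤ 1ℤ (λ ()) (trans (cong (λ z → + q₁ * + q₁ + z) (ℤP.*-zeroʳ (+ val r))) (trans (ℤP.+-identityʳ _) (trans (sym (ℤP.pos-* q₁ q₁)) (trans (cong (λ z → + (q₁ ℕ.* z)) e) (sym (ℤP.*-identityʳ _))))))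
    decide (no ne) = legendre-equation (prime r) (s≤s z≤n) (comaximal-* (distinct-primes pr₁ (prime r) (apart ℓ₁ e₁)) (distinct-primes pr₂ (prime r) (apart ℓ₂ e₂)))
      (square-glue (distinct-primes pr₁ pr₂ ne) (inert-square ℓ₁ r (proj₂ (inert r)) e₁) (inert-square ℓ₂ r (proj₂ (inert r)) e₂))
      (residue⇒square r (Gauss.∤-* (half r) (prime r) (proj₁ s₁) (proj₁ s₂)) (trans (Gauss.s-* (half r) (prime r) (proj₁ s₁) (proj₁ s₂)) (trans (cong₂ _*_ (proj₂ s₁) (proj₂ s₂)) (unit² (inert-bit r)))))
      where
      s₁ = symbol-∤ ℓ₁ r e₁
      s₂ = symbol-∤ ℓ₂ r e₂
      unit² : ∀ b → sign b * sign b ≡ 1ℤ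
      unit² true  = refl
      unit² false = refl
      apart : ∀ {b c} (ℓ : Prime₃ b c) → fun (legendre r) (val (odd ℓ)) ≡ sign (inert-bit r) → val (odd ℓ) ≢ val r
      apart ℓ e e' = symbol-≢ ℓ r (proj₁ (symbol-∤ ℓ r e)) (sym e')

  -- The bit `false` means ℓ ≡ 3 (mod 8), where both -1 and 2 are non-residues, so -2 is a residue.
  two-solution : ∀ {c} (ℓ : Prime₃ false c) → Solution (+ 2) (+ val (odd ℓ))
  two-solution ℓ = legendre-equation two-prime (s≤s z≤n) (distinct-primes (prime (odd ℓ)) two-prime (λ e → val≢2 (odd ℓ) (sym e)))
    (residue⇒square-minus (odd ℓ) (two-∤ (odd ℓ)) (cong₂ _*_ (parity-3mod4 ℓ) (two-symbol ℓ))) (square-2 _)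

-- A zero of f for every t with a prime in its denominator.

module Complete where
  open Mod
  open Peel using (fun)
  open Residue
  open Classes
  open Factor
  open Box
  open Legendre
  open FourSquares
  open Symbols
  open import Data.Nat as ℕ using (ℕ; zero; suc; z≤n; s≤s)
  import Data.Nat.Properties as ℕP
  open import Data.Nat.Divisibility as ℕD using (_∣_; _∤_; _∣?_; divides)
  open import Data.Nat.Primality using (Prime; prime⇒nonTrivial; euclidsLemma)
  open import Data.Integer using (ℤ; +_; 0ℤ; 1ℤ; ∣_∣; _+_; _*_)
  import Data.Integer.Properties as ℤP
  open import Data.Integer.Tactic.RingSolver using (solve-∀)
  import Data.Nat.Tactic.RingSolver as ℕR
  open import Data.Bool using (true; false)
  open import Data.List using ([]; _∷_)
  open import Data.List.Relation.Unary.All using (All; []; _∷_)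
  open import Data.List.Relation.Unary.AllPairs using ([]; _∷_)
  open import Data.Product using (_×_; _,_; ∃; ∃₂; proj₁; proj₂)
  open import Data.Sum using (_⊎_; inj₁; inj₂)
  open import Data.Empty using (⊥; ⊥-elim)
  open import Relation.Nullary using (Dec; yes; no)
  open import Relation.Binary.PropositionalEquality

  -- Clearing denominators in f at t⁵ = μ / ε, a = ℓ / k², b = π / j², where den = (k² + ℓ)(j² + π) ε and (w₁ , w₂ , w₃) = (k T₁ , j T₂ , k j T₃) / (den Ω).
  record Certificate (μ ε : ℤ) : Set where
    constructor certificate
    field
      k j ℓ π Ω T₁ T₂ T₃ : ℤ
      k≢0      : k ≢ 0ℤ
      j≢0      : j ≢ 0ℤ
      Ω≢0      : Ω ≢ 0ℤ
      k²+ℓ≢0   : k * k + ℓ ≢ 0ℤ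
      j²+π≢0   : j * j + π ≢ 0ℤ
      squaresℓ : FourSquare ℓ
      squaresπ : FourSquare π
      equation : (k * k + ℓ) * (j * j + π) * ε * ((k * k + ℓ) * (j * j + π) * ε) * (Ω * Ω) + (ℓ * (T₁ * T₁) + π * (T₂ * T₂) + ℓ * π * (T₃ * T₃))
               ≡ + 1024 * (ℓ * π) * (k * k * (j * j)) * (μ * μ + ε * ε) * (Ω * Ω)

  -- The two norm equations are chained: the second replaces X₂² + p Y₂² by ℓ₁ ℓ₂ Z₂², after which
  -- X₁² + ℓ₂ Y₁² can be factored out and the first applies. The auxiliary ℓ₂ disappears from the
  -- result.
  represent : ∀ p ℓ₁ ℓ₂ n g X₁ Y₁ Z₁ X₂ Y₂ Z₂ → X₁ * X₁ + ℓ₂ * (Y₁ * Y₁) ≡ n * (Z₁ * Z₁) → X₂ * X₂ + p * (Y₂ * Y₂) ≡ ℓ₁ * ℓ₂ * (Z₂ * Z₂) →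
    ℓ₁ * (g * (p * (Y₁ * Y₂)) * (g * (p * (Y₁ * Y₂)))) + p * (g * (ℓ₁ * (Z₂ * X₁)) * (g * (ℓ₁ * (Z₂ * X₁)))) + ℓ₁ * p * (g * (X₂ * Y₁) * (g * (X₂ * Y₁)))
    ≡ p * n * (g * g) * (ℓ₁ * (Z₁ * Z₂) * (ℓ₁ * (Z₁ * Z₂)))
  represent p ℓ₁ ℓ₂ n g X₁ Y₁ Z₁ X₂ Y₂ Z₂ e₁ e₂ =
    trans (shape₁ p ℓ₁ g X₁ Y₁ X₂ Y₂ Z₂) (trans (cong (λ z → g * g * p * ℓ₁ * (Y₁ * Y₁ * z + ℓ₁ * (Z₂ * Z₂) * (X₁ * X₁))) e₂)
      (trans (shape₂ p ℓ₁ ℓ₂ g X₁ Y₁ Z₂) (trans (cong (λ z → g * g * p * ℓ₁ * ℓ₁ * (Z₂ * Z₂) * z) e₁) (shape₃ p ℓ₁ n g Z₁ Z₂))))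
    where
    shape₁ : ∀ p ℓ₁ g X₁ Y₁ X₂ Y₂ Z₂ →
      ℓ₁ * (g * (p * (Y₁ * Y₂)) * (g * (p * (Y₁ * Y₂)))) + p * (g * (ℓ₁ * (Z₂ * X₁)) * (g * (ℓ₁ * (Z₂ * X₁)))) + ℓ₁ * p * (g * (X₂ * Y₁) * (g * (X₂ * Y₁)))
      ≡ g * g * p * ℓ₁ * (Y₁ * Y₁ * (X₂ * X₂ + p * (Y₂ * Y₂)) + ℓ₁ * (Z₂ * Z₂) * (X₁ * X₁))
    shape₁ = solve-∀
    shape₂ : ∀ p ℓ₁ ℓ₂ g X₁ Y₁ Z₂ → g * g * p * ℓ₁ * (Y₁ * Y₁ * (ℓ₁ * ℓ₂ * (Z₂ * Z₂)) + ℓ₁ * (Z₂ * Z₂) * (X₁ * X₁)) ≡ g * g * p * ℓ₁ * ℓ₁ * (Z₂ * Z₂) * (X₁ * X₁ + ℓ₂ * (Y₁ * Y₁))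
    shape₂ = solve-∀
    shape₃ : ∀ p ℓ₁ n g Z₁ Z₂ → g * g * p * ℓ₁ * ℓ₁ * (Z₂ * Z₂) * (n * (Z₁ * Z₁)) ≡ p * n * (g * g) * (ℓ₁ * (Z₁ * Z₂) * (ℓ₁ * (Z₁ * Z₂)))
    shape₃ = solve-∀

  pos≢0 : ∀ {n} → 0 ℕ.< n → + n ≢ 0ℤ
  pos≢0 (s≤s _) ()

  □+pos≢0 : ∀ x {n} → 0 ℕ.< n → x * x + + n ≢ 0ℤ
  □+pos≢0 x {suc n} _ e = ℕP.1+n≢0 (ℕP.m+n≡0⇒n≡0 (∣ x ∣ ℕ.* ∣ x ∣) (ℤP.+-injective (trans (ℤP.pos-+ (∣ x ∣ ℕ.* ∣ x ∣) (suc n)) (trans (cong (_+ + suc n) (sym (∣∣-square x))) e))))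

  build : ∀ {μ ε} k j {p ℓ₁ ℓ₂ n} g → 0 ℕ.< k → 0 ℕ.< j → 0 ℕ.< p → 0 ℕ.< ℓ₁ → FourSquare (+ ℓ₁) → FourSquare (+ p) →
    Solution (+ ℓ₂) (+ n) → Solution (+ p) (+ (ℓ₁ ℕ.* ℓ₂)) →
    (let den = (+ k * + k + + ℓ₁) * (+ j * + j + + p) * ε in den * den + + p * + n * (g * g) ≡ + 1024 * (+ ℓ₁ * + p) * (+ k * + k * (+ j * + j)) * (μ * μ + ε * ε)) →
    Certificate μ ε
  build {μ} {ε} k j {p} {ℓ₁} {ℓ₂} {n} g 0<k 0<j 0<p 0<ℓ₁ sℓ sp (solution X₁ Y₁ Z₁ Z₁≢0 e₁) (solution X₂ Y₂ Z₂ Z₂≢0 e₂) eq =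
    certificate (+ k) (+ j) (+ ℓ₁) (+ p) Ω (g * (+ p * (Y₁ * Y₂))) (g * (+ ℓ₁ * (Z₂ * X₁))) (g * (X₂ * Y₁)) (pos≢0 0<k) (pos≢0 0<j) (*-≢0 (pos≢0 0<ℓ₁) (*-≢0 Z₁≢0 Z₂≢0))
      (□+pos≢0 (+ k) 0<ℓ₁) (□+pos≢0 (+ j) 0<p) sℓ sp
      (trans (cong (λ z → den * den * (Ω * Ω) + z) (represent (+ p) (+ ℓ₁) (+ ℓ₂) (+ n) g X₁ Y₁ Z₁ X₂ Y₂ Z₂ e₁ (trans e₂ (cong (_* (Z₂ * Z₂)) (ℤP.pos-* ℓ₁ ℓ₂)))))
        (trans (sym (ℤP.*-distribʳ-+ (Ω * Ω) (den * den) (+ p * + n * (g * g)))) (cong (_* (Ω * Ω)) eq)))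
    where
    Ω = + ℓ₁ * (Z₁ * Z₂)
    den = (+ k * + k + + ℓ₁) * (+ j * + j + + p) * ε

  -- The constant is 4 + 2 + 4. For a = ℓ / k² in [1/4 , 4] it says (1 + a)² ≤ 10 a; used for a and
  -- b it gives 100, which is below 1024.
  ten-bound : ∀ {x y} → x ℕ.≤ 4 ℕ.* y → y ℕ.≤ 4 ℕ.* x → (x ℕ.+ y) ℕ.* (x ℕ.+ y) ℕ.≤ 10 ℕ.* (x ℕ.* y)
  ten-bound {x} {y} x≤ y≤ = ℕP.≤-trans (ℕP.≤-reflexive (expand x y)) (ℕP.≤-trans (ℕP.+-mono-≤ (ℕP.+-mono-≤ (ℕP.*-monoʳ-≤ x x≤) (ℕP.≤-refl {2 ℕ.* (x ℕ.* y)})) (ℕP.*-monoʳ-≤ y y≤)) (ℕP.≤-reflexive (collect x y)))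
    where
    expand : ∀ x y → (x ℕ.+ y) ℕ.* (x ℕ.+ y) ≡ x ℕ.* x ℕ.+ 2 ℕ.* (x ℕ.* y) ℕ.+ y ℕ.* y
    expand = ℕR.solve-∀
    collect : ∀ x y → x ℕ.* (4 ℕ.* y) ℕ.+ 2 ℕ.* (x ℕ.* y) ℕ.+ y ℕ.* (4 ℕ.* x) ≡ 10 ℕ.* (x ℕ.* y)
    collect = ℕR.solve-∀

  -- The bounds keep ℓ / k² within a factor 4 of 1, for positivity; `∤k` keeps the scaling invisible
  -- at `p`.
  record Scale (p ℓ : ℕ) : Set where
    constructor scale
    field
      k   : ℕ
      0<k : 0 ℕ.< k
      lo  : k ℕ.* k ℕ.≤ 4 ℕ.* ℓ
      hi  : ℓ ℕ.≤ 4 ℕ.* (k ℕ.* k)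
      ∤k  : p ∤ k

  -- Of the two consecutive numbers around the square root of ℓ at least one is prime to `p`, and
  -- both satisfy the bounds.
  scale-exists : ∀ {p ℓ} → 1 ℕ.< p → 0 ℕ.< ℓ → Scale p ℓ
  scale-exists {p} {ℓ} 1<p 0<ℓ = from (isqrt ℓ)
    where
    from : (∃ λ s → s ℕ.* s ℕ.≤ ℓ × ℓ ℕ.< suc s ℕ.* suc s) → Scale p ℓ
    from (zero , _ , ℓ<1) = ⊥-elim (ℕP.<⇒≱ ℓ<1 0<ℓ)
    from (s@(suc s') , lo , hi) = decide (p ∣? s)
      where
      double : suc s ℕ.* suc s ℕ.≤ 4 ℕ.* (s ℕ.* s)
      double = ℕP.≤-trans (ℕP.*-mono-≤ le le) (ℕP.≤-reflexive (shape s))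
        where
        le : suc s ℕ.≤ s ℕ.+ s
        le = s≤s (ℕP.m≤n+m s s')
        shape : ∀ s → (s ℕ.+ s) ℕ.* (s ℕ.+ s) ≡ 4 ℕ.* (s ℕ.* s)
        shape = ℕR.solve-∀
      decide : Dec (p ∣ s) → Scale p ℓ
      decide (no p∤s) = scale s (s≤s z≤n) (ℕP.≤-trans lo (ℕP.m≤n*m ℓ 4)) (ℕP.≤-trans (ℕP.<⇒≤ hi) double) p∤s
      decide (yes p∣s) = scale (suc s) (s≤s z≤n) (ℕP.≤-trans double (ℕP.*-monoʳ-≤ 4 lo)) (ℕP.≤-trans (ℕP.<⇒≤ hi) (ℕP.m≤n*m _ 4))
        (λ d → ℕP.<⇒≱ 1<p (ℕD.∣⇒≤ (ℕD.∣m+n∣m⇒∣n (subst (p ∣_) (ℕP.+-comm 1 s) d) p∣s)))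

  module OddCase (r : OddPrime) (μ ε′ : ℕ) (0<ε′ : 0 ℕ.< ε′) (p∤μ : val r ∤ μ) where
    p = val r
    pr = prime r
    ε = p ℕ.* ε′
    c : Conditions
    c = (r , inert-bit r) ∷ []

    1<p : 1 ℕ.< p
    1<p = ℕ.nonTrivial⇒n>1 p {{prime⇒nonTrivial pr}}

    p∤1 : p ∤ 1
    p∤1 d = ℕP.<⇒≱ 1<p (ℕD.∣⇒≤ d)

    p∤* : ∀ {a b} → p ∤ a → p ∤ b → p ∤ a ℕ.* b
    p∤* = Gauss.∤-* (half r) pr

    module _ (ℓ₁ : Prime₃ true c) (κ : Scale p (val (odd ℓ₁))) (λ′ : Scale p p) where
      open Scale κ
      open Scale λ′ renaming (k to j; 0<k to 0<j; lo to lo′; hi to hi′; ∤k to ∤j)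
      ℓ = val (odd ℓ₁)
      -- As ε = p ε′, the denominator of the certificate is p S and its right side is p R (each up
      -- to Ω). The ternary form therefore has to represent p R - p² S² = p M.
      S = (k ℕ.* k ℕ.+ ℓ) ℕ.* (j ℕ.* j ℕ.+ p) ℕ.* ε′
      R = 1024 ℕ.* (ℓ ℕ.* (k ℕ.* k ℕ.* (j ℕ.* j))) ℕ.* (μ ℕ.* μ ℕ.+ ε ℕ.* ε)

      positive : p ℕ.* (S ℕ.* S) ℕ.< R
      positive = ℕP.≤-<-trans (ℕP.≤-trans (ℕP.≤-reflexive (shape₁ (k ℕ.* k ℕ.+ ℓ) (j ℕ.* j ℕ.+ p) ε′ p)) (ℕP.≤-trans (ℕP.*-monoˡ-≤ (p ℕ.* (ε′ ℕ.* ε′)) (ℕP.*-mono-≤ (ten-bound lo hi) (ten-bound lo′ hi′))) (ℕP.≤-reflexive (shape₂ (k ℕ.* k) (j ℕ.* j) ℓ p ε′))))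
        (ℕP.<-≤-trans (ℕP.*-monoʳ-< 100 less) (ℕP.≤-trans (ℕP.*-monoˡ-≤ (X ℕ.* (μ ℕ.* μ ℕ.+ ε ℕ.* ε)) {100} {1024} (ℕP.m≤m+n 100 924)) (ℕP.≤-reflexive (sym (ℕP.*-assoc 1024 X (μ ℕ.* μ ℕ.+ ε ℕ.* ε))))))
        where
        X = ℓ ℕ.* (k ℕ.* k ℕ.* (j ℕ.* j))
        shape₁ : ∀ a b e p → p ℕ.* (a ℕ.* b ℕ.* e ℕ.* (a ℕ.* b ℕ.* e)) ≡ a ℕ.* a ℕ.* (b ℕ.* b) ℕ.* (p ℕ.* (e ℕ.* e))
        shape₁ = ℕR.solve-∀
        shape₂ : ∀ k j ℓ p e → 10 ℕ.* (k ℕ.* ℓ) ℕ.* (10 ℕ.* (j ℕ.* p)) ℕ.* (p ℕ.* (e ℕ.* e)) ≡ 100 ℕ.* (ℓ ℕ.* (k ℕ.* j) ℕ.* (p ℕ.* e ℕ.* (p ℕ.* e)))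
        shape₂ = ℕR.solve-∀
        0<μ : 0 ℕ.< μ
        0<μ = ℕP.n≢0⇒n>0 (λ e → p∤μ (subst (p ∣_) (sym e) (p ℕD.∣0)))
        0<X : 0 ℕ.< X
        0<X = ℕP.*-mono-< {0} {ℓ} {0} (s≤s z≤n) (ℕP.*-mono-< {0} {k ℕ.* k} {0} (ℕP.*-mono-< {0} {k} {0} 0<k 0<k) (ℕP.*-mono-< {0} {j} {0} 0<j 0<j))
        less : X ℕ.* (ε ℕ.* ε) ℕ.< X ℕ.* (μ ℕ.* μ ℕ.+ ε ℕ.* ε)
        less = ℕP.*-monoʳ-< X {{ℕ.>-nonZero 0<X}} (ℕP.m<n+m (ε ℕ.* ε) {μ ℕ.* μ} (ℕP.*-mono-< {0} {μ} {0} 0<μ 0<μ))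

      M = R ℕ.∸ p ℕ.* (S ℕ.* S)

      M≡ : p ℕ.* (S ℕ.* S) ℕ.+ M ≡ R
      M≡ = ℕP.m+[n∸m]≡n (ℕP.<⇒≤ positive)

      0<M : 0 ℕ.< M
      0<M = ℕP.m<n⇒0<n∸m positive

      p∤ℓ : p ∤ ℓ
      p∤ℓ = symb (Prime₃.symbols ℓ₁)
        where
        symb : All (λ x → fun (legendre (proj₁ x)) ℓ ≡ sign (proj₂ x)) c → p ∤ ℓ
        symb (e ∷ []) = proj₁ (symbol-∤ ℓ₁ r e)

      -- Modulo p, M is R = 2¹⁰ ℓ k² j² (μ² + ε²), with p dividing ε but none of the other factors.
      -- The form value p M is thus exactly divisible by p, and the squarefree part of M is prime to
      -- p as `auxiliary` requires.
      p∤M : p ∤ M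
      p∤M d = p∤R (subst (p ∣_) M≡ (ℕD.∣m∣n⇒∣m+n (ℕD.m∣m*n (S ℕ.* S)) d))
        where
        p∤2 = two-∤ r
        p∤32 : p ∤ 32
        p∤32 = p∤* {2} {16} p∤2 (p∤* {2} {8} p∤2 (p∤* {2} {4} p∤2 (p∤* {2} {2} p∤2 p∤2)))
        p∤R : p ∤ R
        p∤R = p∤* (p∤* {1024} (p∤* {32} {32} p∤32 p∤32) (p∤* p∤ℓ (p∤* (p∤* ∤k ∤k) (p∤* ∤j ∤j))))
          (λ d → p∤* p∤μ p∤μ (ℕD.∣m+n∣m⇒∣n (subst (p ∣_) (ℕP.+-comm (μ ℕ.* μ) (ε ℕ.* ε)) d) (ℕD.∣m⇒∣m*n ε (ℕD.m∣m*n ε′))))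

      conclude : Certificate (+ μ) (+ ε)
      conclude = from (squarefree-part M 0<M)
        where
        from : (∃₂ λ n g → M ≡ n ℕ.* (g ℕ.* g) × SquareFree n × 0 ℕ.< n × 0 ℕ.< g) → Certificate (+ μ) (+ ε)
        from (n , g , M≡ng² , free , 0<n , 0<g) = use (auxiliary true 0<n free (λ _ → refl) c ([] ∷ []) ((λ d → p∤M (subst (p ∣_) (sym M≡ng²) (ℕD.∣m⇒∣m*n (g ℕ.* g) d))) ∷ []))
          where
          equation : (+ k * + k + + ℓ) * (+ j * + j + + p) * + ε * ((+ k * + k + + ℓ) * (+ j * + j + + p) * + ε) + + p * + n * (+ g * + g) ≡ + 1024 * (+ ℓ * + p) * (+ k * + k * (+ j * + j)) * (+ μ * + μ + + ε * + ε)
          equation = begin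
            (+ k * + k + + ℓ) * (+ j * + j + + p) * + ε * ((+ k * + k + + ℓ) * (+ j * + j + + p) * + ε) + + p * + n * (+ g * + g)
              ≡⟨ cong (λ e → (+ k * + k + + ℓ) * (+ j * + j + + p) * e * ((+ k * + k + + ℓ) * (+ j * + j + + p) * e) + + p * + n * (+ g * + g)) (ℤP.pos-* p ε′) ⟩
            (+ k * + k + + ℓ) * (+ j * + j + + p) * (+ p * + ε′) * ((+ k * + k + + ℓ) * (+ j * + j + + p) * (+ p * + ε′)) + + p * + n * (+ g * + g)
              ≡⟨ shape (+ k * + k + + ℓ) (+ j * + j + + p) (+ p) (+ ε′) (+ n) (+ g) ⟩
            + p * (+ p * ((+ k * + k + + ℓ) * (+ j * + j + + p) * + ε′ * ((+ k * + k + + ℓ) * (+ j * + j + + p) * + ε′)) + + n * (+ g * + g))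
              ≡⟨ cong₂ (λ s m → + p * (+ p * (s * s) + m)) S≡ (trans (cong (+ n *_) (sym (ℤP.pos-* g g))) (trans (sym (ℤP.pos-* n (g ℕ.* g))) (cong +_ (sym M≡ng²)))) ⟩
            + p * (+ p * (+ S * + S) + + M)
              ≡⟨ cong (λ z → + p * z) (trans (cong (_+ + M) (trans (cong (+ p *_) (sym (ℤP.pos-* S S))) (sym (ℤP.pos-* p (S ℕ.* S))))) (trans (sym (ℤP.pos-+ (p ℕ.* (S ℕ.* S)) M)) (cong +_ M≡))) ⟩
            + p * + R
              ≡⟨ cong (+ p *_) R≡ ⟩
            + p * (+ 1024 * (+ ℓ * (+ k * + k * (+ j * + j))) * (+ μ * + μ + + ε * + ε))
              ≡⟨ shape′ (+ 1024) (+ p) (+ ℓ) (+ k * + k * (+ j * + j)) (+ μ * + μ + + ε * + ε) ⟩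
            + 1024 * (+ ℓ * + p) * (+ k * + k * (+ j * + j)) * (+ μ * + μ + + ε * + ε) ∎
            where
            open ≡-Reasoning
            shape : ∀ a b p e n g → a * b * (p * e) * (a * b * (p * e)) + p * n * (g * g) ≡ p * (p * (a * b * e * (a * b * e)) + n * (g * g))
            shape = solve-∀
            shape′ : ∀ c p l k m → p * (c * (l * k) * m) ≡ c * (l * p) * k * m
            shape′ = solve-∀
            □ : ∀ a b → + (a ℕ.* a ℕ.+ b) ≡ + a * + a + + b
            □ a b = trans (ℤP.pos-+ (a ℕ.* a) b) (cong (_+ + b) (ℤP.pos-* a a))
            S≡ : (+ k * + k + + ℓ) * (+ j * + j + + p) * + ε′ ≡ + S
            S≡ = sym (trans (ℤP.pos-* ((k ℕ.* k ℕ.+ ℓ) ℕ.* (j ℕ.* j ℕ.+ p)) ε′) (cong (_* + ε′) (trans (ℤP.pos-* (k ℕ.* k ℕ.+ ℓ) (j ℕ.* j ℕ.+ p)) (cong₂ _*_ (□ k ℓ) (□ j p)))))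
            R≡ : + R ≡ + 1024 * (+ ℓ * (+ k * + k * (+ j * + j))) * (+ μ * + μ + + ε * + ε)
            R≡ = trans (ℤP.pos-* (1024 ℕ.* (ℓ ℕ.* (k ℕ.* k ℕ.* (j ℕ.* j)))) (μ ℕ.* μ ℕ.+ ε ℕ.* ε))
              (cong₂ _*_ (trans (ℤP.pos-* 1024 (ℓ ℕ.* (k ℕ.* k ℕ.* (j ℕ.* j)))) (cong (+ 1024 *_) (trans (ℤP.pos-* ℓ (k ℕ.* k ℕ.* (j ℕ.* j))) (cong (+ ℓ *_) (trans (ℤP.pos-* (k ℕ.* k) (j ℕ.* j)) (cong₂ _*_ (ℤP.pos-* k k) (ℤP.pos-* j j)))))))
                (trans (ℤP.pos-+ (μ ℕ.* μ) (ε ℕ.* ε)) (cong₂ _+_ (ℤP.pos-* μ μ) (ℤP.pos-* ε ε))))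
          use : (∃ λ (ℓ₂ : Prime₃ true c) → Solution (+ val (odd ℓ₂)) (+ n)) → Certificate (+ μ) (+ ε)
          use (ℓ₂ , sol) = build k j (+ g) 0<k 0<j (s≤s z≤n) (s≤s z≤n) (four-squares (half (odd ℓ₁)) (prime (odd ℓ₁))) (four-squares (half r) pr) sol (pair-solution r ℓ₁ ℓ₂) equation

    odd-certificate : Certificate (+ μ) (+ ε)
    -- With n = 1 the squarefree part imposes no symbols, so this call only asks for a prime ℓ₁
    -- meeting the condition at p.
    odd-certificate = from (auxiliary true {1} (s≤s z≤n) (λ k d → ℕD.∣1⇒≡1 (ℕD.∣-trans (ℕD.m∣m*n k) d)) (λ _ → refl) c ([] ∷ []) (p∤1 ∷ []))
      where
      from : (∃ λ (ℓ₁ : Prime₃ true c) → Solution (+ val (odd ℓ₁)) (+ 1)) → Certificate (+ μ) (+ ε)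
      from (ℓ₁ , _) = conclude ℓ₁ (scale-exists 1<p (s≤s z≤n)) (scale-exists 1<p (s≤s z≤n))

  even-certificate : ∀ μ ε′ → 2 ∤ μ → Certificate (+ μ) (+ (32 ℕ.* ε′))
  even-certificate μ ε′ 2∤μ = from (squarefree-part M 0<M)
    where
    -- For a = 1 , b = 2 and ε = 32 ε′ the certificate reads 36 ε² + 2 n (32 g)² = 2 · 1024 (μ² +
    -- ε²). Division by 2 · 1024 leaves n g² = μ² + (1024 - 18) ε′², which is odd; the 2¹⁰ has been
    -- absorbed by ε².
    M = μ ℕ.* μ ℕ.+ 1006 ℕ.* (ε′ ℕ.* ε′)
    0<μ : 0 ℕ.< μ
    0<μ = ℕP.n≢0⇒n>0 (λ e → 2∤μ (subst (2 ∣_) (sym e) (2 ℕD.∣0)))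
    0<M : 0 ℕ.< M
    0<M = ℕP.≤-trans (ℕP.*-mono-< {0} {μ} {0} 0<μ 0<μ) (ℕP.m≤m+n (μ ℕ.* μ) _)
    2∤M : 2 ∤ M
    2∤M d = both (euclidsLemma μ μ two-prime (ℕD.∣m+n∣m⇒∣n {2} {N} {μ ℕ.* μ} (subst (2 ∣_) (ℕP.+-comm (μ ℕ.* μ) N) d) 2∣N))
      where
      N = 1006 ℕ.* (ε′ ℕ.* ε′)
      2∣N : 2 ∣ N
      2∣N = ℕD.∣m⇒∣m*n {2} {1006} (ε′ ℕ.* ε′) (divides 503 refl)
      both : (2 ∣ μ) ⊎ (2 ∣ μ) → ⊥
      both (inj₁ d) = 2∤μ d
      both (inj₂ d) = 2∤μ d
    ε = 32 ℕ.* ε′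
    from : (∃₂ λ n g → M ≡ n ℕ.* (g ℕ.* g) × SquareFree n × 0 ℕ.< n × 0 ℕ.< g) → Certificate (+ μ) (+ ε)
    from (n , g , M≡ng² , free , 0<n , 0<g) = use (auxiliary false 0<n free (λ d → ⊥-elim (2∤M (subst (2 ∣_) (sym M≡ng²) (ℕD.∣m⇒∣m*n (g ℕ.* g) d)))) [] [] [])
      where
      equation : (+ 1 * + 1 + + 1) * (+ 1 * + 1 + + 2) * + ε * ((+ 1 * + 1 + + 1) * (+ 1 * + 1 + + 2) * + ε) + + 2 * + n * (+ 32 * + g * (+ 32 * + g)) ≡ + 1024 * (+ 1 * + 2) * (+ 1 * + 1 * (+ 1 * + 1)) * (+ μ * + μ + + ε * + ε)
      equation = begin
        + 2 * + 3 * + ε * (+ 2 * + 3 * + ε) + + 2 * + n * (+ 32 * + g * (+ 32 * + g))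
          ≡⟨ cong (λ e → + 2 * + 3 * e * (+ 2 * + 3 * e) + + 2 * + n * (+ 32 * + g * (+ 32 * + g))) (ℤP.pos-* 32 ε′) ⟩
        + 2 * + 3 * (+ 32 * + ε′) * (+ 2 * + 3 * (+ 32 * + ε′)) + + 2 * + n * (+ 32 * + g * (+ 32 * + g))
          ≡⟨ shape (+ 32) (+ ε′) (+ n) (+ g) ⟩
        + 36 * (+ 1024 * (+ ε′ * + ε′)) + + 2 * (+ 1024 * (+ n * (+ g * + g)))
          ≡⟨ cong (λ z → + 36 * (+ 1024 * (+ ε′ * + ε′)) + + 2 * (+ 1024 * z)) M′ ⟩
        + 36 * (+ 1024 * (+ ε′ * + ε′)) + + 2 * (+ 1024 * (+ μ * + μ + + 1006 * (+ ε′ * + ε′)))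
          ≡⟨ shape′ (+ 1024) (+ 1006) (+ ε′) (+ μ) ⟩
        + 1024 * + 2 * + 1 * (+ μ * + μ + + 1024 * (+ ε′ * + ε′))
          ≡⟨ cong (λ e → + 1024 * + 2 * + 1 * (+ μ * + μ + e)) (trans (cong₂ _*_ (ℤP.pos-* 32 ε′) (ℤP.pos-* 32 ε′)) (shape″ (+ 32) (+ ε′))) ⟨
        + 1024 * + 2 * + 1 * (+ μ * + μ + + ε * + ε) ∎
        where
        open ≡-Reasoning
        shape : ∀ c e n g → + 2 * + 3 * (c * e) * (+ 2 * + 3 * (c * e)) + + 2 * n * (c * g * (c * g)) ≡ + 36 * (c * c * (e * e)) + + 2 * (c * c * (n * (g * g)))
        shape = solve-∀
        shape′ : ∀ c d e m → + 36 * (c * (e * e)) + + 2 * (c * (m * m + d * (e * e))) ≡ c * + 2 * + 1 * (m * m + (+ 18 + d) * (e * e))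
        shape′ = solve-∀
        shape″ : ∀ c e → c * e * (c * e) ≡ c * c * (e * e)
        shape″ = solve-∀
        M′ : + n * (+ g * + g) ≡ + μ * + μ + + 1006 * (+ ε′ * + ε′)
        M′ = trans (cong (+ n *_) (sym (ℤP.pos-* g g))) (trans (sym (ℤP.pos-* n (g ℕ.* g))) (trans (cong +_ (sym M≡ng²)) (trans (ℤP.pos-+ (μ ℕ.* μ) (1006 ℕ.* (ε′ ℕ.* ε′))) (cong₂ _+_ (ℤP.pos-* μ μ) (trans (ℤP.pos-* 1006 (ε′ ℕ.* ε′)) (cong (+ 1006 *_) (ℤP.pos-* ε′ ε′)))))))
      use : (∃ λ (ℓ₂ : Prime₃ false []) → Solution (+ val (odd ℓ₂)) (+ n)) → Certificate (+ μ) (+ ε)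
      use (ℓ₂ , sol) = build 1 1 {2} {1} (+ 32 * + g) (s≤s z≤n) (s≤s z≤n) (s≤s z≤n) (s≤s z≤n) (fourSquare 1ℤ (λ ()) 1ℤ 0ℤ 0ℤ 0ℤ refl) (fourSquare 1ℤ (λ ()) 1ℤ 1ℤ 0ℤ 0ℤ refl) sol
        (subst (λ q → Solution (+ 2) (+ q)) (sym (ℕP.*-identityˡ (val (odd ℓ₂)))) (two-solution ℓ₂)) equation

  -- The fifth power matters at p = 2, where e = 2 q gives e⁵ = 32 q⁵; at odd p a single factor p of
  -- e⁵ is split off.
  certificate-exists : ∀ {p} → Prime p → ∀ μ e → p ∤ μ → 0 ℕ.< e → p ∣ e → Certificate (+ μ) (+ (e ℕ.^ 5))
  certificate-exists {p} pr μ .(q ℕ.* p) p∤μ 0<e (divides q refl) = from (prime-cases pr)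
    where
    from : p ≡ 2 ⊎ (∃ λ r → val r ≡ p) → Certificate (+ μ) (+ ((q ℕ.* p) ℕ.^ 5))
    from (inj₁ refl) = subst (λ z → Certificate (+ μ) (+ z)) (shape q) (even-certificate μ (q ℕ.^ 5) p∤μ)
      where
      shape : ∀ q → 32 ℕ.* (q ℕ.* (q ℕ.* (q ℕ.* (q ℕ.* (q ℕ.* 1))))) ≡ q ℕ.* 2 ℕ.* (q ℕ.* 2 ℕ.* (q ℕ.* 2 ℕ.* (q ℕ.* 2 ℕ.* (q ℕ.* 2 ℕ.* 1))))
      shape = ℕR.solve-∀
    from (inj₂ (r , refl)) = subst (λ z → Certificate (+ μ) (+ z)) (shape q (val r)) (OddCase.odd-certificate r μ (q ℕ.* (q ℕ.* val r) ℕ.^ 4) (ℕP.n≢0⇒n>0 nonzero) p∤μ)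
      where
      shape : ∀ q p → p ℕ.* (q ℕ.* (q ℕ.* p ℕ.* (q ℕ.* p ℕ.* (q ℕ.* p ℕ.* (q ℕ.* p ℕ.* 1))))) ≡ q ℕ.* p ℕ.* (q ℕ.* p ℕ.* (q ℕ.* p ℕ.* (q ℕ.* p ℕ.* (q ℕ.* p ℕ.* 1))))
      shape = ℕR.solve-∀
      q≢0 : q ≢ 0
      q≢0 refl = ℕP.<-irrefl refl 0<e
      nonzero : q ℕ.* (q ℕ.* val r) ℕ.^ 4 ≢ 0
      nonzero = ℕ.≢-nonZero⁻¹ _ {{ℕP.m*n≢0 q _ {{ℕ.≢-nonZero q≢0}} {{ℕP.m^n≢0 (q ℕ.* val r) 4 {{ℕ.>-nonZero 0<e}}}}}}

-- The quaternionic relation and its symmetries.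

module Sound where
  open Mod
  open import Data.Nat as ℕ using (ℕ; z≤n; s≤s)
  import Data.Nat.Properties as ℕP
  open import Data.Nat.Divisibility using (_∣_; _∣?_)
  open import Data.Nat.Induction using (<-rec)
  open import Data.Integer as ℤ using (ℤ; +_; 0ℤ; 1ℤ; ∣_∣; _+_; _*_; _-_; -_)
  import Data.Integer.Properties as ℤP
  open import Data.Integer.Tactic.RingSolver using (solve-∀)
  open import Data.Product using (_×_; _,_; ∃)
  open import Data.Empty using (⊥)
  open import Relation.Nullary using (Dec; yes; no)
  open import Relation.Nullary.Decidable using (_×-dec_)
  open import Relation.Binary.PropositionalEquality

  record Quaternion : Set where
    constructor quat
    field
      c₀ c₁ c₂ c₃ : ℤ

  open Quaternion public

  -- Polar form of the norm form of the quaternion algebra (−a , −b) on pure quaternions.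
  polar : ℤ → ℤ → Quaternion → Quaternion → ℤ
  polar a b u v = a * (c₁ u * c₁ v) + b * (c₂ u * c₂ v) + a * b * (c₃ u * c₃ v)

  norm : ℤ → ℤ → Quaternion → ℤ
  norm a b u = c₀ u * c₀ u + polar a b u u

  gram : ℤ → ℤ → Quaternion → Quaternion → ℤ
  gram a b u v = polar a b u u * polar a b v v - polar a b u v * polar a b u v

  -- Homogeneous in `u`, `v` and `w` separately: of degrees 4, 4 and 2. Each of the three may
  -- therefore be made primitive independently of the others.
  data Relation (σ a b : ℤ) (u v w : Quaternion) : Set where
    relation : norm a b w * (norm a b u * norm a b u) * (norm a b v * norm a b v)
             ≡ σ * (c₀ w * c₀ w * (c₀ u * c₀ u) * (c₀ v * c₀ v)) * gram a b u v → Relation σ a b u v w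

  record Bad (σ a b : ℤ) : Set where
    constructor bad
    field
      u v w    : Quaternion
      u₀≢0     : c₀ u ≢ 0ℤ
      v₀≢0     : c₀ v ≢ 0ℤ
      w₀≢0     : c₀ w ≢ 0ℤ
      related  : Relation σ a b u v w

  *-cancel : ∀ {k x y} → k ≢ 0ℤ → k * x ≡ k * y → x ≡ y
  *-cancel {k} {x} {y} k≢0 e = ℤP.*-cancelˡ-≡ k x y {{ℤ.≢-nonZero k≢0}} e

  -- The relation is homogeneous, so similitudes transport it.
  transport : ∀ {σ a b a′ b′} s (φ : Quaternion → Quaternion) → s ≢ 0ℤ → (∀ x → c₀ (φ x) ≡ s * c₀ x) →
    (∀ x y → polar a′ b′ (φ x) (φ y) ≡ s * s * polar a b x y) → Bad σ a b → Bad σ a′ b′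
  transport {σ} {a} {b} {a′} {b′} s φ s≢0 head pol (bad u v w u₀ v₀ w₀ (relation e)) =
    bad (φ u) (φ v) (φ w) (≢0 u u₀) (≢0 v v₀) (≢0 w w₀) (relation (begin
      norm a′ b′ (φ w) * (norm a′ b′ (φ u) * norm a′ b′ (φ u)) * (norm a′ b′ (φ v) * norm a′ b′ (φ v))
        ≡⟨ cong₂ _*_ (cong₂ _*_ (norm-φ w) (cong₂ _*_ (norm-φ u) (norm-φ u))) (cong₂ _*_ (norm-φ v) (norm-φ v)) ⟩
      s * s * norm a b w * (s * s * norm a b u * (s * s * norm a b u)) * (s * s * norm a b v * (s * s * norm a b v))
        ≡⟨ shape₁ s (norm a b w) (norm a b u) (norm a b v) ⟩
      s * s * (s * s) * (s * s) * (s * s) * (s * s) * (norm a b w * (norm a b u * norm a b u) * (norm a b v * norm a b v))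
        ≡⟨ cong (s * s * (s * s) * (s * s) * (s * s) * (s * s) *_) e ⟩
      s * s * (s * s) * (s * s) * (s * s) * (s * s) * (σ * (c₀ w * c₀ w * (c₀ u * c₀ u) * (c₀ v * c₀ v)) * gram a b u v)
        ≡⟨ shape₂ s σ (c₀ w) (c₀ u) (c₀ v) (gram a b u v) ⟩
      σ * (s * c₀ w * (s * c₀ w) * (s * c₀ u * (s * c₀ u)) * (s * c₀ v * (s * c₀ v))) * (s * s * (s * s) * gram a b u v)
        ≡⟨ cong₂ (λ x y → σ * x * y) (sym (cong₂ _*_ (cong₂ _*_ (cong₂ _*_ (head w) (head w)) (cong₂ _*_ (head u) (head u))) (cong₂ _*_ (head v) (head v)))) (sym gram-φ) ⟩
      σ * (c₀ (φ w) * c₀ (φ w) * (c₀ (φ u) * c₀ (φ u)) * (c₀ (φ v) * c₀ (φ v))) * gram a′ b′ (φ u) (φ v) ∎))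
    where
    open ≡-Reasoning
    ≢0 : ∀ x → c₀ x ≢ 0ℤ → c₀ (φ x) ≢ 0ℤ
    ≢0 x nx z = *-≢0 s≢0 nx (trans (sym (head x)) z)
    norm-φ : ∀ x → norm a′ b′ (φ x) ≡ s * s * norm a b x
    norm-φ x = trans (cong₂ _+_ (cong₂ _*_ (head x) (head x)) (pol x x)) (shape s (c₀ x) (polar a b x x))
      where
      shape : ∀ s x p → s * x * (s * x) + s * s * p ≡ s * s * (x * x + p)
      shape = solve-∀
    gram-φ : gram a′ b′ (φ u) (φ v) ≡ s * s * (s * s) * gram a b u v
    gram-φ = trans (cong₂ _-_ (cong₂ _*_ (pol u u) (pol v v)) (cong₂ _*_ (pol u v) (pol u v))) (shape s (polar a b u u) (polar a b v v) (polar a b u v))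
      where
      shape : ∀ s p q r → s * s * p * (s * s * q) - s * s * r * (s * s * r) ≡ s * s * (s * s) * (p * q - r * r)
      shape = solve-∀
    shape₁ : ∀ s w u v → s * s * w * (s * s * u * (s * s * u)) * (s * s * v * (s * s * v)) ≡ s * s * (s * s) * (s * s) * (s * s) * (s * s) * (w * (u * u) * (v * v))
    shape₁ = solve-∀
    shape₂ : ∀ s σ w u v g → s * s * (s * s) * (s * s) * (s * s) * (s * s) * (σ * (w * w * (u * u) * (v * v)) * g) ≡ σ * (s * w * (s * w) * (s * u * (s * u)) * (s * v * (s * v))) * (s * s * (s * s) * g)
    shape₂ = solve-∀

  swap : ∀ {σ a b} → Bad σ a b → Bad σ b a
  swap {σ} {a} {b} = transport 1ℤ (λ x → quat (c₀ x) (c₂ x) (c₁ x) (c₃ x)) (λ ()) (λ x → sym (ℤP.*-identityˡ (c₀ x)))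
    (λ x y → shape a b (c₁ x * c₁ y) (c₂ x * c₂ y) (c₃ x * c₃ y))
    where
    shape : ∀ a b x y z → b * y + a * x + b * a * z ≡ 1ℤ * (a * x + b * y + a * b * z)
    shape = solve-∀

  extract-square : ∀ {σ a b} k → Bad σ a (b * (k * k)) → Bad σ a b
  extract-square {σ} {a} {b} k = transport 1ℤ (λ x → quat (c₀ x) (c₁ x) (k * c₂ x) (k * c₃ x)) (λ ()) (λ x → sym (ℤP.*-identityˡ (c₀ x)))
    (λ x y → shape a b k (c₁ x * c₁ y) (c₂ x) (c₂ y) (c₃ x) (c₃ y))
    where
    shape : ∀ a b k p x x' y y' → a * p + b * (k * x * (k * x')) + a * b * (k * y * (k * y')) ≡ 1ℤ * (a * p + b * (k * k) * (x * x') + a * (b * (k * k)) * (y * y'))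
    shape = solve-∀

  -- The algebras (−a , −b) and (−a , −b′) agree when b b′ is a norm from ℚ(√−a).
  reduce-norm : ∀ {σ a b} b′ c → b′ ≢ 0ℤ → b * b′ ≡ c * c + a → Bad σ a b → Bad σ a b′
  reduce-norm {σ} {a} {b} b′ c b′≢0 e = transport b′ (λ x → quat (b′ * c₀ x) (b′ * c₁ x) (c * c₂ x - a * c₃ x) (c₂ x + c * c₃ x)) b′≢0 (λ x → refl)
    (λ x y → trans (shape₁ a b′ c (c₁ x) (c₁ y) (c₂ x) (c₂ y) (c₃ x) (c₃ y))
      (trans (cong (λ z → b′ * b′ * (a * (c₁ x * c₁ y)) + b′ * (z * (c₂ x * c₂ y + a * (c₃ x * c₃ y)))) (sym e)) (shape₂ a b b′ (c₁ x * c₁ y) (c₂ x * c₂ y) (c₃ x * c₃ y))))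
    where
    shape₁ : ∀ a b′ c p p' x x' y y' → a * (b′ * p * (b′ * p')) + b′ * ((c * x - a * y) * (c * x' - a * y')) + a * b′ * ((x + c * y) * (x' + c * y'))
           ≡ b′ * b′ * (a * (p * p')) + b′ * ((c * c + a) * (x * x' + a * (y * y')))
    shape₁ = solve-∀
    shape₂ : ∀ a b b′ p x y → b′ * b′ * (a * p) + b′ * (b * b′ * (x + a * y)) ≡ b′ * b′ * (a * p + b * x + a * b * y)
    shape₂ = solve-∀

  infixr 7 _∙_
  _∙_ : ℤ → Quaternion → Quaternion
  k ∙ x = quat (k * c₀ x) (k * c₁ x) (k * c₂ x) (k * c₃ x)

  polar-∙ : ∀ a b k x y → polar a b (k ∙ x) y ≡ k * polar a b x y
  polar-∙ a b k x y = shape a b k (c₁ x) (c₁ y) (c₂ x) (c₂ y) (c₃ x) (c₃ y)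
    where
    shape : ∀ a b k p p' x x' y y' → a * (k * p * p') + b * (k * x * x') + a * b * (k * y * y') ≡ k * (a * (p * p') + b * (x * x') + a * b * (y * y'))
    shape = solve-∀

  polar-sym : ∀ a b x y → polar a b x y ≡ polar a b y x
  polar-sym a b x y = shape a b (c₁ x) (c₁ y) (c₂ x) (c₂ y) (c₃ x) (c₃ y)
    where
    shape : ∀ a b p p' x x' y y' → a * (p * p') + b * (x * x') + a * b * (y * y') ≡ a * (p' * p) + b * (x' * x) + a * b * (y' * y)
    shape = solve-∀

  polar-∙∙ : ∀ a b k x → polar a b (k ∙ x) (k ∙ x) ≡ k * k * polar a b x x
  polar-∙∙ a b k x = trans (polar-∙ a b k x (k ∙ x)) (trans (cong (k *_) (trans (polar-sym a b x (k ∙ x)) (polar-∙ a b k x x))) (sym (ℤP.*-assoc k k _)))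

  norm-∙ : ∀ a b k x → norm a b (k ∙ x) ≡ k * k * norm a b x
  norm-∙ a b k x = trans (cong (λ z → k * c₀ x * (k * c₀ x) + z) (polar-∙∙ a b k x)) (shape k (c₀ x) (polar a b x x))
    where
    shape : ∀ k x p → k * x * (k * x) + k * k * p ≡ k * k * (x * x + p)
    shape = solve-∀

  gram-∙ : ∀ a b k u v → gram a b (k ∙ u) v ≡ k * k * gram a b u v
  gram-∙ a b k u v = trans (cong₂ _-_ (cong (_* polar a b v v) (polar-∙∙ a b k u)) (cong₂ _*_ (polar-∙ a b k u v) (polar-∙ a b k u v))) (shape k (polar a b u u) (polar a b v v) (polar a b u v))
    where
    shape : ∀ k p q r → k * k * p * q - k * r * (k * r) ≡ k * k * (p * q - r * r)
    shape = solve-∀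

  gram-sym : ∀ a b u v → gram a b u v ≡ gram a b v u
  gram-sym a b u v = cong₂ _-_ (ℤP.*-comm (polar a b u u) (polar a b v v)) (cong₂ _*_ (polar-sym a b u v) (polar-sym a b u v))

  exchange : ∀ {σ a b u v w} → Relation σ a b u v w → Relation σ a b v u w
  exchange {σ} {a} {b} {u} {v} {w} (relation e) = relation (trans (shape₁ (norm a b w) (norm a b u) (norm a b v)) (trans e (trans (shape₂ σ (c₀ w) (c₀ u) (c₀ v) (gram a b u v)) (cong (σ * (c₀ w * c₀ w * (c₀ v * c₀ v) * (c₀ u * c₀ u)) *_) (gram-sym a b u v)))))
    where
    shape₁ : ∀ w u v → w * (v * v) * (u * u) ≡ w * (u * u) * (v * v)
    shape₁ = solve-∀
    shape₂ : ∀ s w u v g → s * (w * w * (u * u) * (v * v)) * g ≡ s * (w * w * (v * v) * (u * u)) * g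
    shape₂ = solve-∀

  cancel-u : ∀ {σ a b k u v w} → k ≢ 0ℤ → Relation σ a b (k ∙ u) v w → Relation σ a b u v w
  cancel-u {σ} {a} {b} {k} {u} {v} {w} k≢0 (relation e) = relation (*-cancel (*-≢0 (*-≢0 k≢0 k≢0) (*-≢0 k≢0 k≢0)) (begin
    k * k * (k * k) * (norm a b w * (norm a b u * norm a b u) * (norm a b v * norm a b v))   ≡⟨ shape₁ k (norm a b w) (norm a b u) (norm a b v) ⟩
    norm a b w * (k * k * norm a b u * (k * k * norm a b u)) * (norm a b v * norm a b v)     ≡⟨ cong (λ n → norm a b w * (n * n) * (norm a b v * norm a b v)) (norm-∙ a b k u) ⟨
    norm a b w * (norm a b (k ∙ u) * norm a b (k ∙ u)) * (norm a b v * norm a b v)           ≡⟨ e ⟩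
    σ * (c₀ w * c₀ w * (k * c₀ u * (k * c₀ u)) * (c₀ v * c₀ v)) * gram a b (k ∙ u) v         ≡⟨ cong (σ * (c₀ w * c₀ w * (k * c₀ u * (k * c₀ u)) * (c₀ v * c₀ v)) *_) (gram-∙ a b k u v) ⟩
    σ * (c₀ w * c₀ w * (k * c₀ u * (k * c₀ u)) * (c₀ v * c₀ v)) * (k * k * gram a b u v)     ≡⟨ shape₂ k σ (c₀ w) (c₀ u) (c₀ v) (gram a b u v) ⟩
    k * k * (k * k) * (σ * (c₀ w * c₀ w * (c₀ u * c₀ u) * (c₀ v * c₀ v)) * gram a b u v)     ∎))
    where
    open ≡-Reasoning
    shape₁ : ∀ k w u v → k * k * (k * k) * (w * (u * u) * (v * v)) ≡ w * (k * k * u * (k * k * u)) * (v * v)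
    shape₁ = solve-∀
    shape₂ : ∀ k s w u v g → s * (w * w * (k * u * (k * u)) * (v * v)) * (k * k * g) ≡ k * k * (k * k) * (s * (w * w * (u * u) * (v * v)) * g)
    shape₂ = solve-∀

  cancel-w : ∀ {σ a b k u v w} → k ≢ 0ℤ → Relation σ a b u v (k ∙ w) → Relation σ a b u v w
  cancel-w {σ} {a} {b} {k} {u} {v} {w} k≢0 (relation e) = relation (*-cancel (*-≢0 k≢0 k≢0)
    (trans (shape₁ (k * k) (norm a b w) (norm a b u * norm a b u) (norm a b v * norm a b v)) (trans (cong (λ n → n * (norm a b u * norm a b u) * (norm a b v * norm a b v)) (sym (norm-∙ a b k w)))
      (trans e (shape₂ k σ (c₀ w) (c₀ u * c₀ u) (c₀ v * c₀ v) (gram a b u v))))))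
    where
    shape₁ : ∀ k w u v → k * (w * u * v) ≡ k * w * u * v
    shape₁ = solve-∀
    shape₂ : ∀ k s w u v g → s * (k * w * (k * w) * u * v) * g ≡ k * k * (s * (w * w * u * v) * g)
    shape₂ = solve-∀

  record Primitive (q : ℕ) (x : Quaternion) : Set where
    constructor prim
    field
      isPrimitive : c₀ x ≈ 0ℤ [ q ] → c₁ x ≈ 0ℤ [ q ] → c₂ x ≈ 0ℤ [ q ] → c₃ x ≈ 0ℤ [ q ] → ⊥

  data PrimitivePart (q : ℕ) : Quaternion → Set where
    part : ∀ {k} x → k ≢ 0ℤ → c₀ x ≢ 0ℤ → Primitive q x → PrimitivePart q (k ∙ x)

  ≈0? : ∀ q .{{_ : ℕ.NonZero q}} x → Dec (x ≈ 0ℤ [ q ])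
  ≈0? q x with q ∣? ∣ x ∣
  ... | yes d = yes (∣⇒≈0 d)
  ... | no ¬d = no (λ e → ¬d (≈0⇒∣ e))

  multiple : ∀ {q x} → x ≈ 0ℤ [ q ] → ∃ λ y → x ≡ + q * y
  multiple {q} (mod k e) = k , trans e (trans (ℤP.+-identityˡ (k * + q)) (ℤP.*-comm k (+ q)))

  -- Each division by `q` lowers the absolute value of the scalar part, which is not 0, so the
  -- process stops.
  primitive-part : ∀ {q} → 1 ℕ.< q → ∀ x → c₀ x ≢ 0ℤ → PrimitivePart q x
  primitive-part {q} 1<q x x₀ = <-rec (λ n → ∀ x → ∣ c₀ x ∣ ≡ n → c₀ x ≢ 0ℤ → PrimitivePart q x) step ∣ c₀ x ∣ x refl x₀
    where
    instance
      q≢0 = ℕ.>-nonZero (ℕP.<-trans (s≤s z≤n) 1<q)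
    +q≢0 : + q ≢ 0ℤ
    +q≢0 e = ℕ.≢-nonZero⁻¹ q (ℤP.+-injective e)
    step : ∀ n → (∀ {m} → m ℕ.< n → ∀ x → ∣ c₀ x ∣ ≡ m → c₀ x ≢ 0ℤ → PrimitivePart q x) → ∀ x → ∣ c₀ x ∣ ≡ n → c₀ x ≢ 0ℤ → PrimitivePart q x
    step n rec x@(quat a b c d) refl a≢0 = decide (≈0? q a ×-dec (≈0? q b ×-dec (≈0? q c ×-dec ≈0? q d)))
      where
      decide : Dec (a ≈ 0ℤ [ q ] × b ≈ 0ℤ [ q ] × c ≈ 0ℤ [ q ] × d ≈ 0ℤ [ q ]) → PrimitivePart q x
      decide (no ¬all) = subst (PrimitivePart q) unit (part {k = 1ℤ} x (λ ()) a≢0 (prim (λ p₀ p₁ p₂ p₃ → ¬all (p₀ , p₁ , p₂ , p₃))))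
        where
        unit : 1ℤ ∙ x ≡ x
        unit rewrite ℤP.*-identityˡ a | ℤP.*-identityˡ b | ℤP.*-identityˡ c | ℤP.*-identityˡ d = refl
      decide (yes (p₀ , p₁ , p₂ , p₃)) = divide (multiple p₀) (multiple p₁) (multiple p₂) (multiple p₃)
        where
        divide : (∃ λ y → a ≡ + q * y) → (∃ λ y → b ≡ + q * y) → (∃ λ y → c ≡ + q * y) → (∃ λ y → d ≡ + q * y) → PrimitivePart q x
        divide (a' , refl) (b' , refl) (c' , refl) (d' , refl) = again (rec smaller (quat a' b' c' d') refl a'≢0)
          where
          a'≢0 : a' ≢ 0ℤ
          a'≢0 refl = a≢0 (ℤP.*-zeroʳ (+ q))
          smaller : ∣ a' ∣ ℕ.< ∣ + q * a' ∣
          smaller = ℕP.<-≤-trans (ℕP.m<m*n ∣ a' ∣ q {{ℕ.≢-nonZero (λ z → a'≢0 (ℤP.∣i∣≡0⇒i≡0 z))}} 1<q) (ℕP.≤-reflexive (trans (ℕP.*-comm ∣ a' ∣ q) (sym (ℤP.abs-* (+ q) a'))))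
          again : ∀ {y} → PrimitivePart q y → PrimitivePart q (+ q ∙ y)
          again (part {k = k} z k≢0 z₀ pz) = subst (PrimitivePart q) assoc (part {k = + q * k} z (*-≢0 +q≢0 k≢0) z₀ pz)
            where
            assoc : (+ q * k) ∙ z ≡ + q ∙ (k ∙ z)
            assoc rewrite ℤP.*-assoc (+ q) k (c₀ z) | ℤP.*-assoc (+ q) k (c₁ z) | ℤP.*-assoc (+ q) k (c₂ z) | ℤP.*-assoc (+ q) k (c₃ z) = refl

  record PrimitiveTriple (q : ℕ) (σ a b : ℤ) : Set where
    constructor triple
    field
      {u v w} : Quaternion
      pu      : Primitive q u
      pv      : Primitive q v
      pw      : Primitive q w
      related : Relation σ a b u v w

  make-primitive : ∀ {q σ a b} → 1 ℕ.< q → Bad σ a b → PrimitiveTriple q σ a b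
  make-primitive {q} {σ} {a} {b} 1<q (bad u v w u₀ v₀ w₀ rel) = go (primitive-part 1<q u u₀) (primitive-part 1<q v v₀) (primitive-part 1<q w w₀) rel
    where
    go : ∀ {u v w} → PrimitivePart q u → PrimitivePart q v → PrimitivePart q w → Relation σ a b u v w → PrimitiveTriple q σ a b
    go (part u ku _ pu) (part v kv _ pv) (part w kw _ pw) rel = triple pu pv pw (exchange (cancel-u kv (exchange (cancel-u ku (cancel-w kw rel)))))

-- Contradictions at ramified primes, and the descent leading to them.

module Descent where
  open Mod
  open Crt
  open Factor
  open Box
  open Sound
  open import Data.Nat as ℕ using (ℕ; zero; suc; z≤n; s≤s)
  import Data.Nat.Properties as ℕP
  open import Data.Nat.Divisibility as ℕD using (_∣_; divides)
  open import Data.Nat.DivMod as DM using (_%_)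
  open import Data.Nat.Induction using (<-rec)
  open import Data.Nat.Coprimality using (Coprime)
  open import Data.Nat.Primality using (Prime; prime⇒nonZero; prime⇒nonTrivial; prime⇒irreducible)
  open import Data.Integer as ℤ using (ℤ; +_; 0ℤ; 1ℤ; ∣_∣; _+_; _*_; _-_; -_)
  import Data.Integer.Properties as ℤP
  open import Data.Integer.DivMod using (_%ℕ_; _/ℕ_; n%ℕd<d; a≡a%ℕn+[a/ℕn]*n)
  open import Data.Integer.Tactic.RingSolver using (solve-∀)
  import Data.Nat.Tactic.RingSolver as ℕR
  open import Data.Product using (_×_; _,_; ∃; proj₁; proj₂)
  open import Data.Sum using (_⊎_; inj₁; inj₂)
  open import Data.Empty using (⊥; ⊥-elim)
  open import Relation.Nullary using (Dec; yes; no; ¬_)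
  open import Relation.Binary.PropositionalEquality

  -- Lagrange's identity for the diagonal form: the Gram determinant is a combination of squares of
  -- 2 × 2 minors. In this form it is visibly divisible by `b`.
  gram-minors : ∀ a b u v → gram a b u v ≡
    b * (a * ((c₁ u * c₂ v - c₂ u * c₁ v) * (c₁ u * c₂ v - c₂ u * c₁ v)) + a * a * ((c₁ u * c₃ v - c₃ u * c₁ v) * (c₁ u * c₃ v - c₃ u * c₁ v)) + a * b * ((c₂ u * c₃ v - c₃ u * c₂ v) * (c₂ u * c₃ v - c₃ u * c₂ v)))
  gram-minors a b u v = shape a b (c₁ u) (c₂ u) (c₃ u) (c₁ v) (c₂ v) (c₃ v)
    where
    shape : ∀ a b x y z x' y' z' → (a * (x * x) + b * (y * y) + a * b * (z * z)) * (a * (x' * x') + b * (y' * y') + a * b * (z' * z')) - (a * (x * x') + b * (y * y') + a * b * (z * z')) * (a * (x * x') + b * (y * y') + a * b * (z * z'))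
      ≡ b * (a * ((x * y' - y * x') * (x * y' - y * x')) + a * a * ((x * z' - z * x') * (x * z' - z * x')) + a * b * ((y * z' - z * y') * (y * z' - z * y')))
    shape = solve-∀

  module Ramified (q : ℕ) (pr : Prime q) (σ a b : ℤ) (q∣b : b ≈ 0ℤ [ q ]) (q²∤b : ∀ c → b ≡ + q * c → ¬ c ≈ 0ℤ [ q ]) (nonsquare : ¬ Square q (- a)) where
    instance
      q≢0 = prime⇒nonZero pr

    1<q : 1 ℕ.< q
    1<q = ℕ.nonTrivial⇒n>1 q {{prime⇒nonTrivial pr}}

    +q≢0 : + q ≢ 0ℤ
    +q≢0 e = ℕ.≢-nonZero⁻¹ q (ℤP.+-injective e)

    inverse : ∀ {y} → ¬ y ≈ 0ℤ [ q ] → ∃ λ z → y * z ≈ 1ℤ [ q ]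
    inverse {y} ¬y = from (coprime⇒comaximal coprime)
      where
      coprime : Coprime q ∣ y ∣
      coprime {d} (d∣q , d∣y) with prime⇒irreducible pr d∣q
      ... | inj₁ e = e
      ... | inj₂ refl = ⊥-elim (¬y (∣⇒≈0 d∣y))
      sgn : ∀ y → ∃ λ s → + ∣ y ∣ ≡ y * s
      sgn (+ n)        = 1ℤ , sym (ℤP.*-identityʳ (+ n))
      sgn ℤ.-[1+ n ]   = - 1ℤ , cong (λ k → + suc k) (sym (ℕP.*-identityʳ n))
      from : Comaximal q ∣ y ∣ → ∃ λ z → y * z ≈ 1ℤ [ q ]
      from (bezout u v e) = proj₁ (sgn y) * v , mod (- u) (trans (sym (ℤP.*-assoc y (proj₁ (sgn y)) v)) (trans (cong (_* v) (sym (proj₂ (sgn y)))) (trans (shape u v (+ q) (+ ∣ y ∣)) (cong (λ z → z + - u * + q) e))))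
        where
        shape : ∀ u v q y → y * v ≡ u * q + v * y + - u * q
        shape = solve-∀

    -- Otherwise x / y would be a square root of -a modulo `q`. The norm form is (c₀² + a c₁²) + b
    -- (c₂² + a c₃²), and `localise` applies this to one half after the other.
    anisotropic : ∀ {x y} → x * x + a * (y * y) ≈ 0ℤ [ q ] → x ≈ 0ℤ [ q ] × y ≈ 0ℤ [ q ]
    anisotropic {x} {y} e = decide (≈0? q y)
      where
      decide : Dec (y ≈ 0ℤ [ q ]) → x ≈ 0ℤ [ q ] × y ≈ 0ℤ [ q ]
      decide (yes y≈0) = prime-□≈0 pr (≈-trans (≈-reflexive (shape a x y)) (≈-trans (≈-- e (≈-* (≈-refl {a = a}) (≈-* y≈0 y≈0))) (≈-reflexive (cong (λ z → 0ℤ - z) (ℤP.*-zeroʳ a))))) , y≈0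
        where
        shape : ∀ a x y → x * x ≡ x * x + a * (y * y) - a * (y * y)
        shape = solve-∀
      decide (no ¬y) = ⊥-elim (invert (inverse ¬y))
        where
        invert : (∃ λ z → y * z ≈ 1ℤ [ q ]) → ⊥
        invert (z , yz) = nonsquare (root ((x * z) %ℕ q) (≈-trans (≈-* (reduce q (x * z)) (reduce q (x * z))) (≈-trans (≈-reflexive (shape a x y z))
          (≈-trans (≈-- (≈-* e (≈-refl {a = z * z})) (≈-* (≈-refl {a = a}) (≈-* yz yz))) (≈-reflexive (finish a))))))
          where
          shape : ∀ a x y z → x * z * (x * z) ≡ (x * x + a * (y * y)) * (z * z) - a * (y * z * (y * z))
          shape = solve-∀
          finish : ∀ a → 0ℤ - a * 1ℤ ≡ - a
          finish = solve-∀

    -- The factor κ carries the whole `q`-part of the norm and divides the scalar part as well; this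
    -- divisibility is the valuation estimate. `localise` finds κ = 1 or κ = q: if `q` divides the
    -- norm of a primitive x, it divides c₀ and c₁, and then only once the norm, because `q` divides
    -- `b` exactly once.
    data Local (x : Quaternion) : Set where
      local : ∀ κ ν ξ → κ ≢ 0ℤ → norm a b x ≡ κ * ν → c₀ x ≡ κ * ξ → ¬ ν ≈ 0ℤ [ q ] → Local x

    localise : ∀ {x} → Primitive q x → Local x
    localise {x} (prim px) = decide (≈0? q (norm a b x))
      where
      decide : Dec (norm a b x ≈ 0ℤ [ q ]) → Local x
      decide (no ¬n) = local 1ℤ (norm a b x) (c₀ x) (λ ()) (sym (ℤP.*-identityˡ _)) (sym (ℤP.*-identityˡ _)) ¬n
      decide (yes n≈0) = from (anisotropic front) (multiple q∣b)
        where
        front : c₀ x * c₀ x + a * (c₁ x * c₁ x) ≈ 0ℤ [ q ]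
        front = ≈-trans (≈-reflexive (shape a b (c₀ x) (c₁ x) (c₂ x) (c₃ x))) (≈-trans (≈-- n≈0 (≈-* q∣b (≈-refl {a = c₂ x * c₂ x + a * (c₃ x * c₃ x)}))) (≈-reflexive refl))
          where
          shape : ∀ a b w x y z → w * w + a * (x * x) ≡ w * w + (a * (x * x) + b * (y * y) + a * b * (z * z)) - b * (y * y + a * (z * z))
          shape = solve-∀
        from : c₀ x ≈ 0ℤ [ q ] × c₁ x ≈ 0ℤ [ q ] → (∃ λ c → b ≡ + q * c) → Local x
        from (x₀ , x₁) (c , b≡qc) = divide (multiple x₀) (multiple x₁)
          where
          rest = c₂ x * c₂ x + a * (c₃ x * c₃ x)
          divide : (∃ λ y → c₀ x ≡ + q * y) → (∃ λ y → c₁ x ≡ + q * y) → Local x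
          divide (y₀ , e₀) (y₁ , e₁) = local (+ q) ν y₀ +q≢0 eq e₀ unit
            where
            ν = c * rest + (y₀ * y₀ + a * (y₁ * y₁)) * + q
            eq : norm a b x ≡ + q * ν
            eq = trans (cong₂ (λ X Y → X * X + (a * (Y * Y) + b * (c₂ x * c₂ x) + a * b * (c₃ x * c₃ x))) e₀ e₁)
              (trans (cong (λ B → + q * y₀ * (+ q * y₀) + (a * (+ q * y₁ * (+ q * y₁)) + B * (c₂ x * c₂ x) + a * B * (c₃ x * c₃ x))) b≡qc) (shape a c (+ q) y₀ y₁ (c₂ x) (c₃ x)))
              where
              shape : ∀ a c q w x y z → q * w * (q * w) + (a * (q * x * (q * x)) + q * c * (y * y) + a * (q * c) * (z * z)) ≡ q * (c * (y * y + a * (z * z)) + (w * w + a * (x * x)) * q)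
              shape = solve-∀
            unit : ¬ ν ≈ 0ℤ [ q ]
            unit ν≈0 = both (prime-≈0 pr (≈-trans (≈-sym (mod (y₀ * y₀ + a * (y₁ * y₁)) refl)) ν≈0))
              where
              both : c ≈ 0ℤ [ q ] ⊎ rest ≈ 0ℤ [ q ] → ⊥
              both (inj₁ c≈0) = q²∤b c b≡qc c≈0
              both (inj₂ r≈0) = px x₀ x₁ (proj₁ (anisotropic {c₂ x} {c₃ x} r≈0)) (proj₂ (anisotropic {c₂ x} {c₃ x} r≈0))

    -- The scalar parts on the right contain enough κ to cancel those of the norms on the left. What
    -- remains is a product of units modulo `q` equal to a multiple of `b`.
    absurd : Bad σ a b → ⊥
    absurd B = from (make-primitive 1<q B)
      where
      from : PrimitiveTriple q σ a b → ⊥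
      from (triple {u} {v} {w} pu pv pw (relation e)) = go (localise pu) (localise pv) (localise pw)
        where
        minors = a * ((c₁ u * c₂ v - c₂ u * c₁ v) * (c₁ u * c₂ v - c₂ u * c₁ v)) + a * a * ((c₁ u * c₃ v - c₃ u * c₁ v) * (c₁ u * c₃ v - c₃ u * c₁ v)) + a * b * ((c₂ u * c₃ v - c₃ u * c₂ v) * (c₂ u * c₃ v - c₃ u * c₂ v))
        go : Local u → Local v → Local w → ⊥
        go (local κu νu ξu κu≢0 nu hu ¬νu) (local κv νv ξv κv≢0 nv hv ¬νv) (local κw νw ξw κw≢0 nw hw ¬νw) = contra
          where
          r = σ * (κw * (ξw * ξw) * (ξu * ξu) * (ξv * ξv))
          cancelled : νw * (νu * νu) * (νv * νv) ≡ r * (b * minors)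
          cancelled = *-cancel (*-≢0 κw≢0 (*-≢0 (*-≢0 κu≢0 κu≢0) (*-≢0 κv≢0 κv≢0))) (begin
            κw * (κu * κu * (κv * κv)) * (νw * (νu * νu) * (νv * νv))
              ≡⟨ shape₁ κw κu κv νw νu νv ⟩
            κw * νw * (κu * νu * (κu * νu)) * (κv * νv * (κv * νv))
              ≡⟨ cong₂ (λ x y → x * y) (cong₂ (λ x y → x * (y * y)) nw nu) (cong₂ _*_ nv nv) ⟨
            norm a b w * (norm a b u * norm a b u) * (norm a b v * norm a b v)
              ≡⟨ e ⟩
            σ * (c₀ w * c₀ w * (c₀ u * c₀ u) * (c₀ v * c₀ v)) * gram a b u v
              ≡⟨ cong₂ (λ x y → σ * x * y) (cong₂ (λ x y → x * y) (cong₂ (λ x y → x * x * (y * y)) hw hu) (cong₂ _*_ hv hv)) (gram-minors a b u v) ⟩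
            σ * (κw * ξw * (κw * ξw) * (κu * ξu * (κu * ξu)) * (κv * ξv * (κv * ξv))) * (b * minors)
              ≡⟨ shape₂ κw κu κv ξw ξu ξv σ (b * minors) ⟩
            κw * (κu * κu * (κv * κv)) * (r * (b * minors)) ∎)
            where
            open ≡-Reasoning
            shape₁ : ∀ k l m w u v → k * (l * l * (m * m)) * (w * (u * u) * (v * v)) ≡ k * w * (l * u * (l * u)) * (m * v * (m * v))
            shape₁ = solve-∀
            shape₂ : ∀ k l m w u v s g → s * (k * w * (k * w) * (l * u * (l * u)) * (m * v * (m * v))) * g ≡ k * (l * l * (m * m)) * (s * (k * (w * w) * (u * u) * (v * v)) * g)
            shape₂ = solve-∀
          zero-mod : νw * (νu * νu) * (νv * νv) ≈ 0ℤ [ q ]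
          zero-mod = ≈-trans (≈-reflexive cancelled) (≈-trans (≈-* (≈-refl {a = r}) (≈-* q∣b (≈-refl {a = minors}))) (≈-reflexive (ℤP.*-zeroʳ r)))
          contra : ⊥
          contra with prime-≈0 pr zero-mod
          ... | inj₂ z = ¬νv (prime-□≈0 pr z)
          ... | inj₁ z with prime-≈0 pr z
          ...   | inj₁ z' = ¬νw z'
          ...   | inj₂ z' = ¬νu (prime-□≈0 pr z')

  data Odd (x : ℤ) : Set where
    odd : ∀ y → x ≡ 1ℤ + + 2 * y → Odd x

  data ParityOf (x : ℤ) : Set where
    even : ∀ y → x ≡ + 2 * y → ParityOf x
    odd  : ∀ y → x ≡ 1ℤ + + 2 * y → ParityOf x

  parity-of : ∀ x → ParityOf x
  parity-of x = from (x %ℕ 2) (n%ℕd<d x 2) (a≡a%ℕn+[a/ℕn]*n x 2)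
    where
    from : ∀ r → r ℕ.< 2 → x ≡ + r + x /ℕ 2 * + 2 → ParityOf x
    from 0 _ e = even (x /ℕ 2) (trans e (trans (ℤP.+-identityˡ _) (ℤP.*-comm (x /ℕ 2) (+ 2))))
    from 1 _ e = odd (x /ℕ 2) (trans e (cong (λ z → 1ℤ + z) (ℤP.*-comm (x /ℕ 2) (+ 2))))
    from (suc (suc _)) (s≤s (s≤s ())) _

  even≈0 : ∀ {x y} → x ≡ + 2 * y → x ≈ 0ℤ [ 2 ]
  even≈0 {x} {y} e = mod y (trans e (trans (ℤP.*-comm (+ 2) y) (sym (ℤP.+-identityˡ _))))

  odd≉0 : ∀ {x} y → x ≡ 1ℤ + + 2 * y → ¬ x ≈ 0ℤ [ 2 ]
  odd≉0 {x} y e x≈0 with ℕD.∣1⇒≡1 (≈0⇒∣ {2} {1ℤ} (≈-trans (mod (- y) (shape y)) (≈-trans (≈-reflexive (sym e)) x≈0)))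
    where
    shape : ∀ y → 1ℤ ≡ 1ℤ + + 2 * y + - y * + 2
    shape = solve-∀
  ... | ()

  odd-square : ∀ {x} y → x ≡ 1ℤ + + 2 * y → ∃ λ s → x * x ≡ 1ℤ + + 8 * s
  odd-square y refl = from (parity-of y)
    where
    from : ParityOf y → ∃ λ s → (1ℤ + + 2 * y) * (1ℤ + + 2 * y) ≡ 1ℤ + + 8 * s
    from (even k refl) = k * (+ 2 * k + 1ℤ) , shape k
      where
      shape : ∀ k → (1ℤ + + 2 * (+ 2 * k)) * (1ℤ + + 2 * (+ 2 * k)) ≡ 1ℤ + + 8 * (k * (+ 2 * k + 1ℤ))
      shape = solve-∀
    from (odd k refl) = (+ 2 * k + 1ℤ) * (k + 1ℤ) , shape k
      where
      shape : ∀ k → (1ℤ + + 2 * (1ℤ + + 2 * k)) * (1ℤ + + 2 * (1ℤ + + 2 * k)) ≡ 1ℤ + + 8 * ((+ 2 * k + 1ℤ) * (k + 1ℤ))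
      shape = solve-∀

  data SumOfTwo (x y : ℤ) : Set where
    both-even : ∀ s → x ≈ 0ℤ [ 2 ] → y ≈ 0ℤ [ 2 ] → x * x + y * y ≡ + 4 * s → SumOfTwo x y
    mixed     : ∀ s → x * x + y * y ≡ 1ℤ + + 4 * s → SumOfTwo x y
    both-odd  : ∀ s → Odd x → Odd y → x * x + y * y ≡ + 2 + + 8 * s → SumOfTwo x y

  sum-of-two : ∀ x y → SumOfTwo x y
  sum-of-two x y = from (parity-of x) (parity-of y)
    where
    from : ParityOf x → ParityOf y → SumOfTwo x y
    from (even k e) (even l e') = both-even (k * k + l * l) (even≈0 e) (even≈0 e') (trans (cong₂ (λ X Y → X * X + Y * Y) e e') (shape k l))
      where
      shape : ∀ k l → + 2 * k * (+ 2 * k) + + 2 * l * (+ 2 * l) ≡ + 4 * (k * k + l * l)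
      shape = solve-∀
    from (even k e) (odd l e') = with-square (odd-square l e')
      where
      shape : ∀ k s → + 2 * k * (+ 2 * k) + (1ℤ + + 8 * s) ≡ 1ℤ + + 4 * (k * k + + 2 * s)
      shape = solve-∀
      with-square : (∃ λ s → y * y ≡ 1ℤ + + 8 * s) → SumOfTwo x y
      with-square (s , es) = mixed (k * k + + 2 * s) (trans (cong₂ (λ X Y → X * X + Y) e es) (shape k s))
    from (odd k e) (even l e') = with-square (odd-square k e)
      where
      shape : ∀ l s → 1ℤ + + 8 * s + + 2 * l * (+ 2 * l) ≡ 1ℤ + + 4 * (l * l + + 2 * s)
      shape = solve-∀
      with-square : (∃ λ s → x * x ≡ 1ℤ + + 8 * s) → SumOfTwo x y
      with-square (s , es) = mixed (l * l + + 2 * s) (trans (cong₂ (λ X Y → X + Y * Y) es e') (shape l s))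
    from (odd k e) (odd l e') = with-square (odd-square k e) (odd-square l e')
      where
      shape : ∀ s t → 1ℤ + + 8 * s + (1ℤ + + 8 * t) ≡ + 2 + + 8 * (s + t)
      shape = solve-∀
      with-square : (∃ λ s → x * x ≡ 1ℤ + + 8 * s) → (∃ λ s → y * y ≡ 1ℤ + + 8 * s) → SumOfTwo x y
      with-square (s , es) (t , et) = both-odd (s + t) (odd k e) (odd l e') (trans (cong₂ _+_ es et) (shape s t))

  2^ : ℕ → ℤ
  2^ zero    = 1ℤ
  2^ (suc n) = + 2 * 2^ n

  2^-+ : ∀ m n → 2^ (m ℕ.+ n) ≡ 2^ m * 2^ n
  2^-+ zero    n = sym (ℤP.*-identityˡ (2^ n))
  2^-+ (suc m) n = trans (cong (+ 2 *_) (2^-+ m n)) (sym (ℤP.*-assoc (+ 2) (2^ m) (2^ n)))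

  2^-divides : ∀ e d {ν Y} → 2^ e * ν ≡ 2^ (e ℕ.+ suc d) * Y → ν ≈ 0ℤ [ 2 ]
  2^-divides zero d {ν} {Y} eq = mod (2^ d * Y) (trans (sym (ℤP.*-identityˡ ν)) (trans eq (shape (2^ d) Y)))
    where
    shape : ∀ d Y → + 2 * d * Y ≡ 0ℤ + d * Y * + 2
    shape = solve-∀
  2^-divides (suc e) d {ν} {Y} eq = 2^-divides e d (*-cancel {+ 2} (λ ()) (trans (sym (ℤP.*-assoc (+ 2) (2^ e) ν)) (trans eq (ℤP.*-assoc (+ 2) (2^ (e ℕ.+ suc d)) Y))))

  2^-divides-< : ∀ e E {ν Y} → e ℕ.< E → 2^ e * ν ≡ 2^ E * Y → ν ≈ 0ℤ [ 2 ]
  2^-divides-< e E {ν} {Y} e<E eq = from (ℕP.m≤n⇒∃[o]m+o≡n e<E)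
    where
    from : (∃ λ d → suc e ℕ.+ d ≡ E) → ν ≈ 0ℤ [ 2 ]
    from (d , e′) = 2^-divides e d (trans eq (cong (λ k → 2^ k * Y) (trans (sym e′) (sym (ℕP.+-suc e d)))))

  -- For (-1 , -1) the norm of a primitive integral quaternion has 2-adic valuation `i` at most 2,
  -- and the extreme value occurs only if all coordinates are odd.
  data Dyadic (x : Quaternion) : Set where
    dyadic : ∀ i ν → i ℕ.≤ 2 → norm 1ℤ 1ℤ x ≡ 2^ i * ν → ¬ ν ≈ 0ℤ [ 2 ] → (i ≡ 2 → Odd (c₁ x) × Odd (c₂ x) × Odd (c₃ x)) → Dyadic x

  dyadic-norm : ∀ {x} → Primitive 2 x → Dyadic x
  dyadic-norm {x} (prim px) = from (sum-of-two (c₀ x) (c₁ x)) (sum-of-two (c₂ x) (c₃ x))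
    where
    split : norm 1ℤ 1ℤ x ≡ c₀ x * c₀ x + c₁ x * c₁ x + (c₂ x * c₂ x + c₃ x * c₃ x)
    split = shape (c₀ x) (c₁ x) (c₂ x) (c₃ x)
      where
      shape : ∀ w x y z → w * w + (1ℤ * (x * x) + 1ℤ * (y * y) + 1ℤ * 1ℤ * (z * z)) ≡ w * w + x * x + (y * y + z * z)
      shape = solve-∀
    norm≡ : ∀ {p q} → c₀ x * c₀ x + c₁ x * c₁ x ≡ p → c₂ x * c₂ x + c₃ x * c₃ x ≡ q → norm 1ℤ 1ℤ x ≡ p + q
    norm≡ e e' = trans split (cong₂ _+_ e e')
    unit : ∀ {N} s → N ≡ 1ℤ + + 2 * s → norm 1ℤ 1ℤ x ≡ N → Dyadic x
    unit {N} s e eN = dyadic 0 N z≤n (trans eN (sym (ℤP.*-identityˡ N))) (odd≉0 s e) (λ ())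
    twice : ∀ {N} s → N ≡ + 2 * (1ℤ + + 2 * s) → norm 1ℤ 1ℤ x ≡ N → Dyadic x
    twice s e eN = dyadic 1 (1ℤ + + 2 * s) (s≤s z≤n) (trans eN e) (odd≉0 s refl) (λ ())
    from : SumOfTwo (c₀ x) (c₁ x) → SumOfTwo (c₂ x) (c₃ x) → Dyadic x
    from (both-even s x₀ x₁ e) (both-even t x₂ x₃ e') = ⊥-elim (px x₀ x₁ x₂ x₃)
    from (both-even s _ _ e) (mixed t e') = unit (+ 2 * (s + t)) (shape s t) (norm≡ e e')
      where
      shape : ∀ s t → + 4 * s + (1ℤ + + 4 * t) ≡ 1ℤ + + 2 * (+ 2 * (s + t))
      shape = solve-∀
    from (both-even s _ _ e) (both-odd t _ _ e') = twice (s + + 2 * t) (shape s t) (norm≡ e e')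
      where
      shape : ∀ s t → + 4 * s + (+ 2 + + 8 * t) ≡ + 2 * (1ℤ + + 2 * (s + + 2 * t))
      shape = solve-∀
    from (mixed s e) (both-even t _ _ e') = unit (+ 2 * (s + t)) (shape s t) (norm≡ e e')
      where
      shape : ∀ s t → 1ℤ + + 4 * s + + 4 * t ≡ 1ℤ + + 2 * (+ 2 * (s + t))
      shape = solve-∀
    from (mixed s e) (mixed t e') = twice (s + t) (shape s t) (norm≡ e e')
      where
      shape : ∀ s t → 1ℤ + + 4 * s + (1ℤ + + 4 * t) ≡ + 2 * (1ℤ + + 2 * (s + t))
      shape = solve-∀
    from (mixed s e) (both-odd t _ _ e') = unit (1ℤ + + 2 * s + + 4 * t) (shape s t) (norm≡ e e')
      where
      shape : ∀ s t → 1ℤ + + 4 * s + (+ 2 + + 8 * t) ≡ 1ℤ + + 2 * (1ℤ + + 2 * s + + 4 * t)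
      shape = solve-∀
    from (both-odd s _ _ e) (both-even t _ _ e') = twice (+ 2 * s + t) (shape s t) (norm≡ e e')
      where
      shape : ∀ s t → + 2 + + 8 * s + + 4 * t ≡ + 2 * (1ℤ + + 2 * (+ 2 * s + t))
      shape = solve-∀
    from (both-odd s _ _ e) (mixed t e') = unit (1ℤ + + 4 * s + + 2 * t) (shape s t) (norm≡ e e')
      where
      shape : ∀ s t → + 2 + + 8 * s + (1ℤ + + 4 * t) ≡ 1ℤ + + 2 * (1ℤ + + 4 * s + + 2 * t)
      shape = solve-∀
    from (both-odd s _ o₁ e) (both-odd t o₂ o₃ e') = dyadic 2 (1ℤ + + 2 * (s + t)) (s≤s (s≤s z≤n)) (trans (norm≡ e e') (shape s t)) (odd≉0 (s + t) refl) (λ _ → o₁ , o₂ , o₃)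
      where
      shape : ∀ s t → + 2 + + 8 * s + (+ 2 + + 8 * t) ≡ + 2 * (+ 2 * 1ℤ) * (1ℤ + + 2 * (s + t))
      shape = solve-∀

  minor-even : ∀ {x y x' y'} → Odd x → Odd y → Odd x' → Odd y' → ∃ λ m → x * y' - y * x' ≡ + 2 * m
  minor-even (odd p refl) (odd q refl) (odd r refl) (odd s refl) = _ , shape p q r s
    where
    shape : ∀ p q r s → (1ℤ + + 2 * p) * (1ℤ + + 2 * s) - (1ℤ + + 2 * q) * (1ℤ + + 2 * r) ≡ + 2 * (p + s - q - r + + 2 * (p * s - q * r))
    shape = solve-∀

  -- The 2 × 2 minors of odd vectors are even, so their squares bring a factor 4.
  gram-4 : ∀ {u v} → Odd (c₁ u) × Odd (c₂ u) × Odd (c₃ u) → Odd (c₁ v) × Odd (c₂ v) × Odd (c₃ v) → ∃ λ z → gram 1ℤ 1ℤ u v ≡ + 4 * z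
  gram-4 {u} {v} (u₁ , u₂ , u₃) (v₁ , v₂ , v₃) = from (minor-even u₁ u₂ v₁ v₂) (minor-even u₁ u₃ v₁ v₃) (minor-even u₂ u₃ v₂ v₃)
    where
    from : (∃ λ m → c₁ u * c₂ v - c₂ u * c₁ v ≡ + 2 * m) → (∃ λ m → c₁ u * c₃ v - c₃ u * c₁ v ≡ + 2 * m) → (∃ λ m → c₂ u * c₃ v - c₃ u * c₂ v ≡ + 2 * m) → ∃ λ z → gram 1ℤ 1ℤ u v ≡ + 4 * z
    from (k , ek) (l , el) (m , em) = k * k + l * l + m * m , trans (gram-minors 1ℤ 1ℤ u v)
      (trans (cong₂ (λ x y → 1ℤ * (x + y)) (cong₂ (λ x y → 1ℤ * (x * x) + 1ℤ * 1ℤ * (y * y)) ek el) (cong (λ x → 1ℤ * 1ℤ * (x * x)) em)) (shape k l m))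
      where
      shape : ∀ k l m → 1ℤ * (1ℤ * (+ 2 * k * (+ 2 * k)) + 1ℤ * 1ℤ * (+ 2 * l * (+ 2 * l)) + 1ℤ * 1ℤ * (+ 2 * m * (+ 2 * m))) ≡ + 4 * (k * k + l * l + m * m)
      shape = solve-∀

  -- The bound 2¹⁰ is what makes Hamilton's quaternions, ramified at 2, contribute no solutions.
  hamilton : ∀ τ → Bad (2^ 10 * τ) 1ℤ 1ℤ → ⊥
  hamilton τ B = from (make-primitive (s≤s (s≤s z≤n)) B)
    where
    from : PrimitiveTriple 2 (2^ 10 * τ) 1ℤ 1ℤ → ⊥
    from (triple {u} {v} {w} pu pv pw (relation e)) = go (dyadic-norm pu) (dyadic-norm pv) (dyadic-norm pw)
      where
      heads = c₀ w * c₀ w * (c₀ u * c₀ u) * (c₀ v * c₀ v)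
      go : Dyadic u → Dyadic v → Dyadic w → ⊥
      go (dyadic i νu i≤2 nu ¬νu ou) (dyadic j νv j≤2 nv ¬νv ov) (dyadic k νw k≤2 nw ¬νw _) = decide (i ℕ.≟ 2) (j ℕ.≟ 2)
        where
        exponent = k ℕ.+ (i ℕ.+ i ℕ.+ (j ℕ.+ j))
        ν = νw * (νu * νu) * (νv * νv)
        left : 2^ exponent * ν ≡ 2^ 10 * τ * heads * gram 1ℤ 1ℤ u v
        left = trans (cong (_* ν) (trans (2^-+ k _) (cong (2^ k *_) (trans (2^-+ (i ℕ.+ i) (j ℕ.+ j)) (cong₂ _*_ (2^-+ i i) (2^-+ j j))))))
          (trans (shape (2^ k) (2^ i) (2^ j) νw νu νv) (trans (sym (cong₂ (λ x y → x * y) (cong₂ (λ x y → x * (y * y)) nw nu) (cong₂ _*_ nv nv))) e))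
          where
          shape : ∀ k l m w u v → k * (l * l * (m * m)) * (w * (u * u) * (v * v)) ≡ k * w * (l * u * (l * u)) * (m * v * (m * v))
          shape = solve-∀
        units : ν ≈ 0ℤ [ 2 ] → ⊥
        units z with prime-≈0 two-prime z
        ... | inj₂ z' = ¬νv (prime-□≈0 two-prime z')
        ... | inj₁ z' with prime-≈0 two-prime z'
        ...   | inj₁ z″ = ¬νw z″
        ...   | inj₂ z″ = ¬νu (prime-□≈0 two-prime z″)
        -- If i or j is at most 1, the left side has valuation k + 2 i + 2 j ≤ 2 + 6, below the 10
        -- of the factor 2¹⁰.
        small : i ℕ.+ i ℕ.+ (j ℕ.+ j) ℕ.≤ 6 → ⊥
        small le = units (2^-divides-< exponent 10 (s≤s (ℕP.≤-trans (ℕP.+-mono-≤ k≤2 le) (ℕP.n≤1+n 8))) (trans left (shape (2^ 10) τ heads (gram 1ℤ 1ℤ u v))))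
          where
          shape : ∀ c t h g → c * t * h * g ≡ c * (t * h * g)
          shape = solve-∀
        -- For i = j = 2 the left side may reach valuation 10, but the Gram determinant then
        -- contributes 2 more on the right, making 12.
        large : i ≡ 2 → j ≡ 2 → (∃ λ z → gram 1ℤ 1ℤ u v ≡ + 4 * z) → ⊥
        large refl refl (z , ez) = units (2^-divides-< exponent 12 (s≤s (ℕP.≤-trans (ℕP.+-monoˡ-≤ 8 k≤2) (ℕP.n≤1+n 10))) (trans left (trans (cong (2^ 10 * τ * heads *_) ez) (shape (2^ 10) τ heads z))))
          where
          shape : ∀ c t h z → c * t * h * (+ 4 * z) ≡ + 2 * (+ 2 * c) * (t * h * z)
          shape = solve-∀
        decide : Dec (i ≡ 2) → Dec (j ≡ 2) → ⊥
        decide (yes i≡2) (yes j≡2) = large i≡2 j≡2 (gram-4 {u} {v} (ou i≡2) (ov j≡2))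
        decide (no i≢2) _ = small (ℕP.+-mono-≤ (ℕP.+-mono-≤ i≤1 i≤1) (ℕP.+-mono-≤ j≤2 j≤2))
          where i≤1 = ℕP.≤-pred (ℕP.≤∧≢⇒< i≤2 i≢2)
        decide (yes _) (no j≢2) = small (ℕP.+-mono-≤ (ℕP.+-mono-≤ i≤2 i≤2) (ℕP.+-mono-≤ j≤1 j≤1))
          where j≤1 = ℕP.≤-pred (ℕP.≤∧≢⇒< j≤2 j≢2)

  small-root : ∀ {b a} .{{_ : ℕ.NonZero b}} → Square b a → ∃ λ c → 2 ℕ.* c ℕ.≤ b × + c * + c ≈ a [ b ]
  small-root {b} {a} (root x e) = decide (2 ℕ.* r ℕ.≤? b)
    where
    r = x % b
    e′ : + r * + r ≈ a [ b ]
    e′ = ≈-trans (≈-* (≈-sym (≈-% x)) (≈-sym (≈-% x))) e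
    decide : Dec (2 ℕ.* r ℕ.≤ b) → ∃ λ c → 2 ℕ.* c ℕ.≤ b × + c * + c ≈ a [ b ]
    decide (yes le) = r , le , e′
    decide (no ¬le) = b ℕ.∸ r , le , ≈-trans (≈-* opposite opposite) (≈-trans (≈-reflexive (shape (+ r))) e′)
      where
      r≤b : r ℕ.≤ b
      r≤b = ℕP.<⇒≤ (DM.m%n<n x b)
      shape : ∀ r → - r * - r ≡ r * r
      shape = solve-∀
      opposite : + (b ℕ.∸ r) ≈ - (+ r) [ b ]
      opposite = mod 1ℤ (trans (sym (trans (ℤP.m-n≡m⊖n b r) (ℤP.⊖-≥ r≤b))) (trans (ℤP.+-comm (+ b) (- (+ r))) (cong (λ z → - (+ r) + z) (sym (ℤP.*-identityˡ (+ b))))))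
      le : 2 ℕ.* (b ℕ.∸ r) ℕ.≤ b
      le = ℕP.+-cancelʳ-≤ (2 ℕ.* r) (2 ℕ.* (b ℕ.∸ r)) b (ℕP.≤-trans (ℕP.≤-reflexive (trans (sym (ℕP.*-distribˡ-+ 2 (b ℕ.∸ r) r)) (trans (cong (2 ℕ.*_) (ℕP.m∸n+n≡m r≤b)) (cong (b ℕ.+_) (ℕP.+-identityʳ b))))) (ℕP.+-monoʳ-≤ b (ℕP.<⇒≤ (ℕP.≰⇒> ¬le))))

  -- The bound on the root is what makes the descent fall: c² + a ≤ b² / 4 + b, which is less than
  -- b² for b ≥ 2.
  quotient-smaller : ∀ {a b b′ c} → 2 ℕ.≤ b → a ℕ.≤ b → 2 ℕ.* c ℕ.≤ b → c ℕ.* c ℕ.+ a ≡ b′ ℕ.* b → b′ ℕ.< b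
  quotient-smaller {a} {b} {b′} {c} 2≤b a≤b 2c≤b e = ℕP.≰⇒> (λ b≤b′ → ℕP.<⇒≱ (bound 2≤b) (ℕP.≤-trans (ℕP.*-monoʳ-≤ 4 (ℕP.*-monoˡ-≤ b b≤b′)) (ℕP.≤-trans (ℕP.≤-reflexive (trans (cong (4 ℕ.*_) (sym e)) (shape a c))) (ℕP.+-mono-≤ (ℕP.*-mono-≤ 2c≤b 2c≤b) (ℕP.*-monoʳ-≤ 4 a≤b)))))
    where
    shape : ∀ a c → 4 ℕ.* (c ℕ.* c ℕ.+ a) ≡ 2 ℕ.* c ℕ.* (2 ℕ.* c) ℕ.+ 4 ℕ.* a
    shape = ℕR.solve-∀
    bound : ∀ {b} → 2 ℕ.≤ b → b ℕ.* b ℕ.+ 4 ℕ.* b ℕ.< 4 ℕ.* (b ℕ.* b)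
    bound {suc (suc k)} (s≤s (s≤s z≤n)) = ℕP.≤-trans (ℕP.m≤m+n _ (3 ℕ.+ (8 ℕ.* k ℕ.+ 3 ℕ.* (k ℕ.* k)))) (ℕP.≤-reflexive (shape′ k))
      where
      shape′ : ∀ k → suc ((2 ℕ.+ k) ℕ.* (2 ℕ.+ k) ℕ.+ 4 ℕ.* (2 ℕ.+ k)) ℕ.+ (3 ℕ.+ (8 ℕ.* k ℕ.+ 3 ℕ.* (k ℕ.* k))) ≡ 4 ℕ.* ((2 ℕ.+ k) ℕ.* (2 ℕ.+ k))
      shape′ = ℕR.solve-∀

  -- Descent on a + b to Hamilton's quaternions; it stops early only at an odd prime where the algebra ramifies.
  no-bad : ∀ τ a b → 0 ℕ.< a → 0 ℕ.< b → Bad (2^ 10 * τ) (+ a) (+ b) → ⊥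
  no-bad τ a b 0<a 0<b B = <-rec (λ n → ∀ a b → a ℕ.+ b ≡ n → 0 ℕ.< a → 0 ℕ.< b → Bad (2^ 10 * τ) (+ a) (+ b) → ⊥) step (a ℕ.+ b) a b refl 0<a 0<b B
    where
    step : ∀ n → (∀ {m} → m ℕ.< n → ∀ a b → a ℕ.+ b ≡ m → 0 ℕ.< a → 0 ℕ.< b → Bad (2^ 10 * τ) (+ a) (+ b) → ⊥) → ∀ a b → a ℕ.+ b ≡ n → 0 ℕ.< a → 0 ℕ.< b → Bad (2^ 10 * τ) (+ a) (+ b) → ⊥
    step .(a ℕ.+ b) rec a b refl 0<a 0<b B = order (ℕP.≤-total a b)
      where
      reduce-b : ∀ a b → (∀ b′ → 0 ℕ.< b′ → b′ ℕ.< b → Bad (2^ 10 * τ) (+ a) (+ b′) → ⊥) → 0 ℕ.< a → 0 ℕ.< b → a ℕ.≤ b → Bad (2^ 10 * τ) (+ a) (+ b) → ⊥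
      reduce-b 1 1 _ _ _ _ B = hamilton τ B
      reduce-b (suc (suc _)) 1 _ _ _ (s≤s ()) _
      reduce-b a b@(suc (suc _)) rec 0<a _ a≤b B = square (square-factor? b)
        where
        square : (∃ λ k → 1 ℕ.< k × k ℕ.* k ∣ b) ⊎ SquareFree b → ⊥
        square (inj₁ (k , 1<k , divides zero ()))
        square (inj₁ (k , 1<k , divides b′@(suc _) e)) = rec b′ (s≤s z≤n) (ℕP.<-≤-trans (ℕP.m<m*n b′ (k ℕ.* k) (ℕP.<-≤-trans 1<k (ℕP.m≤m*n k k {{ℕ.>-nonZero (ℕP.<-trans (s≤s z≤n) 1<k)}}))) (ℕP.≤-reflexive (sym e)))
          (extract-square (+ k) (subst (Bad (2^ 10 * τ) (+ a)) (trans (cong +_ e) (trans (ℤP.pos-* b′ (k ℕ.* k)) (cong (+ b′ *_) (ℤP.pos-* k k)))) B))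
        square (inj₂ free) = obstruct (square-or-obstruction (s≤s z≤n) free (- (+ a)))
          where
          obstruct : Square b (- (+ a)) ⊎ (∃ λ q → Prime q × q ∣ b × ¬ Square q (- (+ a))) → ⊥
          -- Squarefreeness of `b` was arranged first so that `q` divides it exactly once, as
          -- `Ramified` requires.
          obstruct (inj₂ (q , pr , q∣b , ¬sq)) = Ramified.absurd q pr (2^ 10 * τ) (+ a) (+ b) (∣⇒≈0 q∣b) q²∤b ¬sq B
            where
            q²∤b : ∀ c → + b ≡ + q * c → ¬ c ≈ 0ℤ [ q ]
            q²∤b c e c≈0 = ℕP.<-irrefl (sym (free q (from (≈0⇒∣ c≈0)))) (ℕ.nonTrivial⇒n>1 q {{prime⇒nonTrivial pr}})
              where
              from : q ∣ ∣ c ∣ → q ℕ.* q ∣ b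
              from d = subst (q ℕ.* q ∣_) (sym (trans (cong ∣_∣ e) (ℤP.abs-* (+ q) c))) (ℕD.*-monoʳ-∣ q d)
          obstruct (inj₁ sq) = descend (small-root sq)
            where
            descend : (∃ λ c → 2 ℕ.* c ℕ.≤ b × + c * + c ≈ - (+ a) [ b ]) → ⊥
            descend (c , 2c≤b , c≈) = from (≈0⇒∣ {b} {+ (c ℕ.* c ℕ.+ a)} (≈-trans (≈-reflexive sum) (≈-trans (≈-+ c≈ (≈-refl {a = + a})) (≈-reflexive (ℤP.+-inverseˡ (+ a))))))
              where
              sum : + (c ℕ.* c ℕ.+ a) ≡ + c * + c + + a
              sum = trans (ℤP.pos-+ (c ℕ.* c) a) (cong (_+ + a) (ℤP.pos-* c c))
              from : b ∣ c ℕ.* c ℕ.+ a → ⊥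
              from (divides zero e) = ℕP.<-irrefl (sym (ℕP.m+n≡0⇒n≡0 (c ℕ.* c) e)) 0<a
              from (divides b′@(suc _) e) = rec b′ (s≤s z≤n) (quotient-smaller {a} {b} {b′} {c} (s≤s (s≤s z≤n)) a≤b 2c≤b e)
                (reduce-norm (+ b′) (+ c) (λ ()) (trans (ℤP.*-comm (+ b) (+ b′)) (trans (sym (ℤP.pos-* b′ b)) (trans (cong +_ (sym e)) sum))) B)
      order : a ℕ.≤ b ⊎ b ℕ.≤ a → ⊥
      order (inj₁ a≤b) = reduce-b a b (λ b′ 0<b′ b′<b → rec (ℕP.+-monoʳ-< a b′<b) a b′ refl 0<a 0<b′) 0<a 0<b a≤b B
      order (inj₂ b≤a) = reduce-b b a (λ a′ 0<a′ a′<a → rec (ℕP.<-≤-trans (ℕP.+-monoʳ-< b a′<a) (ℕP.≤-reflexive (ℕP.+-comm b a))) b a′ refl 0<b 0<a′) 0<b 0<a b≤a (swap B)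

-- Reduced integer polynomials built from expressions.

module Polynomial where
  open import Data.Nat as ℕ using (ℕ; zero; suc; _⊔_; z≤n)
  import Data.Nat.Properties as ℕP
  import Data.Nat.Tactic.RingSolver as ℕR
  open import Data.Integer as ℤ using (ℤ; +_)
  import Data.Integer.Properties as ℤP
  open import Data.Rational as ℚ using (ℚ; 0ℚ; 1ℚ; toℚᵘ)
  import Data.Rational.Properties as ℚP
  import Data.Rational.Unnormalised as ℚᵘ
  import Data.Rational.Unnormalised.Properties as ℚᵘP
  open import Tactic.RingSolver using (solve-∀)
  open import Tactic.RingSolver.Core.AlmostCommutativeRing using (AlmostCommutativeRing; fromCommutativeRing)
  open import Data.Fin using (Fin; zero; suc)
  open import Data.Vec as Vec using (Vec; []; _∷_; lookup; zipWith; replicate)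
  import Data.Vec.Properties as VecP
  open import Data.List using ([]; _∷_; _++_; map)
  open import Data.List.Relation.Unary.All as All using (All; []; _∷_)
  open import Data.List.Relation.Unary.AllPairs using ([]; _∷_)
  open import Data.Product using (_,_; proj₁; proj₂)
  open import Relation.Nullary using (Dec; yes; no)
  open import Relation.Nullary.Decidable using (dec⇒maybe)
  open import Relation.Binary.PropositionalEquality

  ℚ-ring : AlmostCommutativeRing _ _
  ℚ-ring = fromCommutativeRing ℚP.+-*-commutativeRing (λ x → dec⇒maybe (0ℚ ℚP.≟ x))

  toℚᵘ-ℤ : ∀ z → toℚᵘ (ℤ→ℚ z) ℚᵘ.≃ ℚᵘ.mkℚᵘ z 0
  toℚᵘ-ℤ z = ℚP.toℚᵘ-fromℚᵘ (ℚᵘ.mkℚᵘ z 0)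

  ℤ→ℚ-+ : ∀ a b → ℤ→ℚ (a ℤ.+ b) ≡ ℤ→ℚ a ℚ.+ ℤ→ℚ b
  ℤ→ℚ-+ a b = ℚP.toℚᵘ-injective (ℚᵘP.≃-trans (toℚᵘ-ℤ (a ℤ.+ b)) (ℚᵘP.≃-trans (ℚᵘ.*≡* (shape a b)) (ℚᵘP.≃-sym (ℚᵘP.≃-trans (ℚP.toℚᵘ-homo-+ (ℤ→ℚ a) (ℤ→ℚ b)) (ℚᵘP.+-cong (toℚᵘ-ℤ a) (toℚᵘ-ℤ b))))))
    where
    open import Data.Integer.Tactic.RingSolver renaming (solve-∀ to solveℤ-∀)
    shape : ∀ a b → (a ℤ.+ b) ℤ.* + 1 ≡ (a ℤ.* + 1 ℤ.+ b ℤ.* + 1) ℤ.* + 1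
    shape = solveℤ-∀

  ℤ→ℚ-* : ∀ a b → ℤ→ℚ (a ℤ.* b) ≡ ℤ→ℚ a ℚ.* ℤ→ℚ b
  ℤ→ℚ-* a b = ℚP.toℚᵘ-injective (ℚᵘP.≃-trans (toℚᵘ-ℤ (a ℤ.* b)) (ℚᵘP.≃-sym (ℚᵘP.≃-trans (ℚP.toℚᵘ-homo-* (ℤ→ℚ a) (ℤ→ℚ b)) (ℚᵘP.*-cong (toℚᵘ-ℤ a) (toℚᵘ-ℤ b)))))

  ℤ→ℚ-injective : ∀ {a b} → ℤ→ℚ a ≡ ℤ→ℚ b → a ≡ b
  ℤ→ℚ-injective {a} {b} e with ℚᵘP.≃-trans (ℚᵘP.≃-sym (toℚᵘ-ℤ a)) (ℚᵘP.≃-trans (ℚP.toℚᵘ-cong e) (toℚᵘ-ℤ b))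
  ... | ℚᵘ.*≡* eq = ℤP.*-cancelʳ-≡ a b (+ 1) eq

  evalExp : ∀ {n} → Vec ℚ n → Vec ℕ n → ℚ
  evalExp v e = Vec.foldr _ ℚ._*_ 1ℚ (zipWith _^ℚ_ v e)

  ^ℚ-+ : ∀ q m n → q ^ℚ (m ℕ.+ n) ≡ (q ^ℚ m) ℚ.* (q ^ℚ n)
  ^ℚ-+ q zero    n = sym (ℚP.*-identityˡ (q ^ℚ n))
  ^ℚ-+ q (suc m) n = trans (cong (q ℚ.*_) (^ℚ-+ q m n)) (sym (ℚP.*-assoc q (q ^ℚ m) (q ^ℚ n)))

  evalExp-+ : ∀ {n} (v : Vec ℚ n) e e' → evalExp v (zipWith ℕ._+_ e e') ≡ evalExp v e ℚ.* evalExp v e'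
  evalExp-+ []      []      []        = refl
  evalExp-+ (q ∷ v) (m ∷ e) (m' ∷ e') = trans (cong₂ ℚ._*_ (^ℚ-+ q m m') (evalExp-+ v e e')) (shape (q ^ℚ m) (q ^ℚ m') (evalExp v e) (evalExp v e'))
    where
    shape : ∀ a b c d → a ℚ.* b ℚ.* (c ℚ.* d) ≡ a ℚ.* c ℚ.* (b ℚ.* d)
    shape = solve-∀ ℚ-ring

  evalExp-0 : ∀ {n} (v : Vec ℚ n) → evalExp v (replicate n 0) ≡ 1ℚ
  evalExp-0 []      = refl
  evalExp-0 (q ∷ v) = trans (ℚP.*-identityˡ _) (evalExp-0 v)

  unit : ∀ {n} → Fin n → Vec ℕ n
  unit {suc n} zero    = 1 ∷ replicate n 0
  unit {suc n} (suc i) = 0 ∷ unit i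

  evalExp-unit : ∀ {n} (v : Vec ℚ n) i → evalExp v (unit i) ≡ lookup v i
  evalExp-unit (q ∷ v) zero    = trans (cong₂ ℚ._*_ (ℚP.*-identityʳ q) (evalExp-0 v)) (ℚP.*-identityʳ q)
  evalExp-unit (q ∷ v) (suc i) = trans (ℚP.*-identityˡ _) (evalExp-unit v i)

  -- Degrees and the absence of a variable are bounded on the expression tree, so that the monomials
  -- of f² never have to be computed.
  data Expr (n : ℕ) : Set where
    con     : ℤ → Expr n
    var     : Fin n → Expr n
    _⊕_ _⊗_ : Expr n → Expr n → Expr n

  infixl 6 _⊕_
  infixl 7 _⊗_

  ⟦_⟧ : ∀ {n} → Expr n → Vec ℚ n → ℚ
  ⟦ con c ⟧ v = ℤ→ℚ c
  ⟦ var i ⟧ v = lookup v i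
  ⟦ e ⊕ f ⟧ v = ⟦ e ⟧ v ℚ.+ ⟦ f ⟧ v
  ⟦ e ⊗ f ⟧ v = ⟦ e ⟧ v ℚ.* ⟦ f ⟧ v

  module _ {n : ℕ} where
    scaleBy : Monomial n → Poly n → Poly n
    scaleBy (c , e) = map (λ (d , f) → c ℤ.* d , zipWith ℕ._+_ e f)

    mulP : Poly n → Poly n → Poly n
    mulP []      q = []
    mulP (m ∷ p) q = scaleBy m q ++ mulP p q

    expand : Expr n → Poly n
    expand (con c) = (c , replicate n 0) ∷ []
    expand (var i) = (+ 1 , unit i) ∷ []
    expand (e ⊕ f) = expand e ++ expand f
    expand (e ⊗ f) = mulP (expand e) (expand f)

    insert : Monomial n → Poly n → Poly n
    -- The decision and the recursive result are arguments, which lets each later proof split on the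
    -- decision through an auxiliary function of its own.
    insert-≟ : ∀ (m m' : Monomial n) → Dec (proj₂ m ≡ proj₂ m') → Poly n → Poly n → Poly n
    keep : (m : Monomial n) → Dec (proj₁ m ≡ + 0) → Poly n → Poly n

    keep m (yes _) p = p
    keep m (no _)  p = m ∷ p

    insert (c , e) []              = keep (c , e) (c ℤ.≟ + 0) []
    insert m       (m' ∷ p) = insert-≟ m m' (VecP.≡-dec ℕ._≟_ (proj₂ m) (proj₂ m')) p (insert m p)

    insert-≟ (c , e) (c' , e') (yes _) p r = keep (c ℤ.+ c' , e') (c ℤ.+ c' ℤ.≟ + 0) p
    insert-≟ (c , e) (c' , e') (no _)  p r = (c' , e') ∷ r

    normalise : Poly n → Poly n
    normalise []      = []
    normalise (m ∷ p) = insert m (normalise p)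

    module _ (v : Vec ℚ n) where
      eval-++ : ∀ p q → eval (p ++ q) v ≡ eval p v ℚ.+ eval q v
      eval-++ []      q = sym (ℚP.+-identityˡ (eval q v))
      eval-++ (m ∷ p) q = trans (cong (evalMono m v ℚ.+_) (eval-++ p q)) (sym (ℚP.+-assoc (evalMono m v) (eval p v) (eval q v)))

      eval-scaleBy : ∀ m q → eval (scaleBy m q) v ≡ evalMono m v ℚ.* eval q v
      eval-scaleBy m       []            = sym (ℚP.*-zeroʳ (evalMono m v))
      eval-scaleBy (c , e) ((d , f) ∷ q) = trans (cong₂ ℚ._+_ (cong₂ ℚ._*_ (ℤ→ℚ-* c d) (evalExp-+ v e f)) (eval-scaleBy (c , e) q))
        (shape (ℤ→ℚ c) (ℤ→ℚ d) (evalExp v e) (evalExp v f) (eval q v))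
        where
        shape : ∀ c d e f q → c ℚ.* d ℚ.* (e ℚ.* f) ℚ.+ c ℚ.* e ℚ.* q ≡ c ℚ.* e ℚ.* (d ℚ.* f ℚ.+ q)
        shape = solve-∀ ℚ-ring

      eval-mulP : ∀ p q → eval (mulP p q) v ≡ eval p v ℚ.* eval q v
      eval-mulP []      q = sym (ℚP.*-zeroˡ (eval q v))
      eval-mulP (m ∷ p) q = trans (eval-++ (scaleBy m q) (mulP p q)) (trans (cong₂ ℚ._+_ (eval-scaleBy m q) (eval-mulP p q)) (sym (ℚP.*-distribʳ-+ (eval q v) (evalMono m v) (eval p v))))

      eval-expand : ∀ e → eval (expand e) v ≡ ⟦ e ⟧ v
      eval-expand (con c) = trans (ℚP.+-identityʳ _) (trans (cong (ℤ→ℚ c ℚ.*_) (evalExp-0 v)) (ℚP.*-identityʳ (ℤ→ℚ c)))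
      eval-expand (var i) = trans (ℚP.+-identityʳ _) (trans (ℚP.*-identityˡ _) (evalExp-unit v i))
      eval-expand (e ⊕ f) = trans (eval-++ (expand e) (expand f)) (cong₂ ℚ._+_ (eval-expand e) (eval-expand f))
      eval-expand (e ⊗ f) = trans (eval-mulP (expand e) (expand f)) (cong₂ ℚ._*_ (eval-expand e) (eval-expand f))

      eval-keep : ∀ m d p → eval (keep m d p) v ≡ evalMono m v ℚ.+ eval p v
      eval-keep (c , e) (yes refl) p = sym (trans (cong (ℚ._+ eval p v) (ℚP.*-zeroˡ (evalExp v e))) (ℚP.+-identityˡ (eval p v)))
      eval-keep m       (no _)     p = refl

      eval-insert : ∀ m p → eval (insert m p) v ≡ evalMono m v ℚ.+ eval p v
      eval-insert (c , e) []              = eval-keep (c , e) (c ℤ.≟ + 0) []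
      eval-insert m       (m' ∷ p) = decided m m' (VecP.≡-dec ℕ._≟_ (proj₂ m) (proj₂ m'))
        where
        decided : ∀ m m' d → eval (insert-≟ m m' d p (insert m p)) v ≡ evalMono m v ℚ.+ (evalMono m' v ℚ.+ eval p v)
        decided (c , e) (c' , .e) (yes refl) = trans (eval-keep (c ℤ.+ c' , e) (c ℤ.+ c' ℤ.≟ + 0) p) (trans (cong (λ z → z ℚ.* evalExp v e ℚ.+ eval p v) (ℤ→ℚ-+ c c')) (shape (ℤ→ℚ c) (ℤ→ℚ c') (evalExp v e) (eval p v)))
          where
          shape : ∀ c d e p → (c ℚ.+ d) ℚ.* e ℚ.+ p ≡ c ℚ.* e ℚ.+ (d ℚ.* e ℚ.+ p)
          shape = solve-∀ ℚ-ring
        decided m m' (no _) = trans (cong (evalMono m' v ℚ.+_) (eval-insert m p)) (shape (evalMono m v) (evalMono m' v) (eval p v))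
          where
          shape : ∀ a b c → b ℚ.+ (a ℚ.+ c) ≡ a ℚ.+ (b ℚ.+ c)
          shape = solve-∀ ℚ-ring

      eval-normalise : ∀ p → eval (normalise p) v ≡ eval p v
      eval-normalise []      = refl
      eval-normalise (m ∷ p) = trans (eval-insert m (normalise p)) (cong (evalMono m v ℚ.+_) (eval-normalise p))

    module _ {P : Vec ℕ n → Set} where
      All-keep : ∀ m d {p} → P (proj₂ m) → All P (map proj₂ p) → All P (map proj₂ (keep m d p))
      All-keep m (yes _) Pm Pp = Pp
      All-keep m (no _)  Pm Pp = Pm ∷ Pp

      All-insert : ∀ m p → P (proj₂ m) → All P (map proj₂ p) → All P (map proj₂ (insert m p))
      All-insert (c , e) []       Pm []        = All-keep (c , e) (c ℤ.≟ + 0) Pm []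
      All-insert m       (m' ∷ p) Pm (Pm' ∷ Pp) = decided m m' (VecP.≡-dec ℕ._≟_ (proj₂ m) (proj₂ m')) Pm Pm'
        where
        decided : ∀ m m' d → P (proj₂ m) → P (proj₂ m') → All P (map proj₂ (insert-≟ m m' d p (insert m p)))
        decided (c , e) (c' , e') (yes _) Pm Pm' = All-keep (c ℤ.+ c' , e') (c ℤ.+ c' ℤ.≟ + 0) Pm' Pp
        decided m       m'        (no _)  Pm Pm' = Pm' ∷ All-insert m p Pm Pp

      All-normalise : ∀ p → All P (map proj₂ p) → All P (map proj₂ (normalise p))
      All-normalise []      []        = []
      All-normalise (m ∷ p) (Pm ∷ Pp) = All-insert m (normalise p) Pm (All-normalise p Pp)

    reduced-keep : ∀ m d {p} → All (proj₂ m ≢_) (map proj₂ p) → IsReduced p → IsReduced (keep m d p)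
    reduced-keep m (yes _) fresh r         = r
    reduced-keep m (no c≢0) fresh (nz , un) = c≢0 ∷ nz , fresh ∷ un

    reduced-insert : ∀ m p → IsReduced p → IsReduced (insert m p)
    reduced-insert (c , e) []       r = reduced-keep (c , e) (c ℤ.≟ + 0) [] r
    reduced-insert m       (m' ∷ p) (nz' ∷ nz , fresh ∷ un) = decided m m' (VecP.≡-dec ℕ._≟_ (proj₂ m) (proj₂ m')) nz' fresh
      where
      decided : ∀ m m' d → proj₁ m' ≢ + 0 → All (proj₂ m' ≢_) (map proj₂ p) → IsReduced (insert-≟ m m' d p (insert m p))
      decided (c , e) (c' , e') (yes _)  nz' fresh = reduced-keep (c ℤ.+ c' , e') (c ℤ.+ c' ℤ.≟ + 0) fresh (nz , un)
      decided m       m'        (no e≢e') nz' fresh = nz' ∷ proj₁ rec , All-insert m p (λ e → e≢e' (sym e)) fresh ∷ proj₂ rec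
        where
        rec = reduced-insert m p (nz , un)

    reduced-normalise : ∀ p → IsReduced (normalise p)
    reduced-normalise []      = [] , []
    reduced-normalise (m ∷ p) = reduced-insert m (normalise p) (reduced-normalise p)

    -- Any additive weight on exponents gives such a bound; the instances are the total degree and
    -- the exponent of a single variable.
    module Weight (w : Vec ℕ n → ℕ) (w-0 : w (replicate n 0) ≡ 0) (w-+ : ∀ e f → w (zipWith ℕ._+_ e f) ≡ w e ℕ.+ w f) where
      weight : Expr n → ℕ
      weight (con _) = 0
      weight (var i) = w (unit i)
      weight (e ⊕ f) = weight e ⊔ weight f
      weight (e ⊗ f) = weight e ℕ.+ weight f

      Bounded : ℕ → Poly n → Set
      Bounded d p = All (λ e → w e ℕ.≤ d) (map proj₂ p)

      bounded-++ : ∀ {d} p {q} → Bounded d p → Bounded d q → Bounded d (p ++ q)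
      bounded-++ []      []       bq = bq
      bounded-++ (m ∷ p) (b ∷ bs) bq = b ∷ bounded-++ p bs bq

      bounded-scaleBy : ∀ {d d'} m q → w (proj₂ m) ℕ.≤ d → Bounded d' q → Bounded (d ℕ.+ d') (scaleBy m q)
      bounded-scaleBy m       []            b []       = []
      bounded-scaleBy (c , e) ((_ , f) ∷ q) b (b' ∷ bs) = subst (ℕ._≤ _) (sym (w-+ e f)) (ℕP.+-mono-≤ b b') ∷ bounded-scaleBy (c , e) q b bs

      bounded-mulP : ∀ {d d'} p q → Bounded d p → Bounded d' q → Bounded (d ℕ.+ d') (mulP p q)
      bounded-mulP []      q []       bq = []
      bounded-mulP (m ∷ p) q (b ∷ bs) bq = bounded-++ (scaleBy m q) (bounded-scaleBy m q b bq) (bounded-mulP p q bs bq)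

      bounded-weaken : ∀ {d d'} p → d ℕ.≤ d' → Bounded d p → Bounded d' p
      bounded-weaken p le = All.map (λ b → ℕP.≤-trans b le)

      bounded-expand : ∀ e → Bounded (weight e) (expand e)
      bounded-expand (con c) = ℕP.≤-reflexive w-0 ∷ []
      bounded-expand (var i) = ℕP.≤-refl ∷ []
      bounded-expand (e ⊕ f) = bounded-++ (expand e) (bounded-weaken (expand e) (ℕP.m≤m⊔n (weight e) (weight f)) (bounded-expand e)) (bounded-weaken (expand f) (ℕP.m≤n⊔m (weight e) (weight f)) (bounded-expand f))
      bounded-expand (e ⊗ f) = bounded-mulP (expand e) (expand f) (bounded-expand e) (bounded-expand f)

  monoDeg-0 : ∀ n → monoDeg (replicate n 0) ≡ 0
  monoDeg-0 zero    = refl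
  monoDeg-0 (suc n) = monoDeg-0 n

  monoDeg-+ : ∀ {n} (e f : Vec ℕ n) → monoDeg (zipWith ℕ._+_ e f) ≡ monoDeg e ℕ.+ monoDeg f
  monoDeg-+ []      []      = refl
  monoDeg-+ (a ∷ e) (b ∷ f) = trans (cong (a ℕ.+ b ℕ.+_) (monoDeg-+ e f)) (shape a b (monoDeg e) (monoDeg f))
    where
    shape : ∀ a b c d → a ℕ.+ b ℕ.+ (c ℕ.+ d) ≡ a ℕ.+ c ℕ.+ (b ℕ.+ d)
    shape = ℕR.solve-∀

  module Degree {n} = Weight {n} monoDeg (monoDeg-0 n) monoDeg-+
  module Partial {n} (i : Fin n) = Weight {n} (λ e → lookup e i) (VecP.lookup-replicate i 0) (λ e f → VecP.lookup-zipWith ℕ._+_ i e f)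

  totalDegree≤ : ∀ {n d} (p : Poly n) → Degree.Bounded d p → totalDegree p ℕ.≤ d
  totalDegree≤ []      []       = z≤n
  totalDegree≤ (m ∷ p) (b ∷ bs) = ℕP.⊔-lub b (totalDegree≤ p bs)

  record Realisation {n} (d : ℕ) (F : Expr (suc (suc n))) : Set where
    field
      poly    : Poly (suc (suc n))
      reduced : IsReduced poly
      degree  : totalDegree poly ≡ d
      value   : ∀ t y xs → eval poly (t ∷ y ∷ xs) ≡ (y ^ℚ d) ℚ.+ ⟦ F ⟧ (t ∷ y ∷ xs)

  -- Adding the d-th power of a variable y absent from F makes the degree visible without expanding F.
  realise : ∀ {n} d (F : Expr (suc (suc n))) → 0 ℕ.< d → Degree.weight F ℕ.≤ d → Partial.weight (suc zero) F ≡ 0 → Realisation d F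
  realise {n} d F 0<d deg noY = record
    { poly    = (+ 1 , top) ∷ body
    ; reduced = (λ ()) ∷ proj₁ bodyReduced , fresh ∷ proj₂ bodyReduced
    ; degree  = trans (cong (_⊔ totalDegree body) top-degree) (ℕP.m≥n⇒m⊔n≡m (totalDegree≤ body (All-normalise (expand F) (Degree.bounded-weaken (expand F) deg (Degree.bounded-expand F)))))
    ; value   = λ t y xs → cong₂ ℚ._+_ (top-value t y xs) (trans (eval-normalise (t ∷ y ∷ xs) (expand F)) (eval-expand (t ∷ y ∷ xs) F))
    }
    where
    top : Vec ℕ (suc (suc n))
    top = 0 ∷ d ∷ replicate n 0
    body = normalise (expand F)
    bodyReduced = reduced-normalise (expand F)
    top-degree : monoDeg top ≡ d
    top-degree = trans (cong (d ℕ.+_) (monoDeg-0 n)) (ℕP.+-identityʳ d)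
    fresh : All (top ≢_) (map proj₂ body)
    fresh = All.map (λ { {e} b refl → ℕP.<⇒≱ 0<d (subst (d ℕ.≤_) noY b) }) (All-normalise (expand F) (Partial.bounded-expand (suc zero) F))
    top-value : ∀ t y xs → evalMono (+ 1 , top) (t ∷ y ∷ xs) ≡ y ^ℚ d
    top-value t y xs = trans (ℚP.*-identityˡ _) (trans (ℚP.*-identityˡ _) (trans (cong ((y ^ℚ d) ℚ.*_) (evalExp-0 xs)) (ℚP.*-identityʳ (y ^ℚ d))))

-- Clearing denominators, in both directions.

module Rational where
  open Polynomial
  open Mod
  open Box
  open FourSquares
  open Complete
  open Sound
  open Descent
  open import Data.Nat as ℕ using (ℕ)
  import Data.Nat.Properties as ℕP
  open import Data.Integer as ℤ using (ℤ; +_; 0ℤ; 1ℤ; ∣_∣)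
  import Data.Integer.Properties as ℤP
  open import Data.Integer.Tactic.RingSolver renaming (solve-∀ to solveℤ-∀)
  open import Data.Rational as ℚ using (ℚ; 0ℚ; 1ℚ; _+_; _*_; -_; toℚᵘ; ↥_; ↧_)
  import Data.Rational.Properties as ℚP
  import Data.Rational.Unnormalised as ℚᵘ
  import Data.Rational.Unnormalised.Properties as ℚᵘP
  open import Tactic.RingSolver using (solve-∀)
  open import Data.Vec using (Vec; []; _∷_)
  open import Data.Vec.Relation.Binary.Pointwise.Inductive using (Pointwise; []; _∷_)
  open import Data.Product using (_,_; ∃; proj₁; proj₂)
  open import Data.Sum using (_⊎_; inj₁; inj₂)
  open import Data.Empty using (⊥; ⊥-elim)
  open import Relation.Nullary using (yes; no)
  open import Relation.Binary.PropositionalEquality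

  infixl 7 _⊛_
  infixl 6 _⊞_

  -- Pairs an integer with the rational number it represents, so that a long expression is
  -- transferred between ℤ and ℚ by writing it once with `_⊛_` and `_⊞_`.
  data Image (z : ℤ) (x : ℚ) : Set where
    image : ℤ→ℚ z ≡ x → Image z x

  value-of : ∀ {z x} → Image z x → ℤ→ℚ z ≡ x
  value-of (image e) = e

  _⊛_ : ∀ {a b x y} → Image a x → Image b y → Image (a ℤ.* b) (x * y)
  _⊛_ {a} {b} (image ex) (image ey) = image (trans (ℤ→ℚ-* a b) (cong₂ _*_ ex ey))

  _⊞_ : ∀ {a b x y} → Image a x → Image b y → Image (a ℤ.+ b) (x + y)
  _⊞_ {a} {b} (image ex) (image ey) = image (trans (ℤ→ℚ-+ a b) (cong₂ _+_ ex ey))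

  at : ∀ a → Image a (ℤ→ℚ a)
  at a = image refl

  image-≡ : ∀ {a b x} → Image a x → Image b x → a ≡ b
  image-≡ (image e) (image e') = ℤ→ℚ-injective (trans e (sym e'))

  recast : ∀ {a x y} → x ≡ y → Image a x → Image a y
  recast refl i = i

  ℤ→ℚ≢0 : ∀ {z} → z ≢ 0ℤ → ℤ→ℚ z ≢ 0ℚ
  ℤ→ℚ≢0 z≢0 e = z≢0 (ℤ→ℚ-injective e)

  numerator : ∀ x → x * ℤ→ℚ (↧ x) ≡ ℤ→ℚ (↥ x)
  numerator x@record{} = ℚP.toℚᵘ-injective (ℚᵘP.≃-trans (ℚP.toℚᵘ-homo-* x (ℤ→ℚ (↧ x))) (ℚᵘP.≃-trans (ℚᵘP.*-cong (ℚᵘP.≃-refl {toℚᵘ x}) (toℚᵘ-ℤ (↧ x))) (ℚᵘP.≃-trans (ℚᵘ.*≡* (shape (↥ x) (↧ x) refl)) (ℚᵘP.≃-sym (toℚᵘ-ℤ (↥ x))))))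
    where
    shape : ∀ n d {m} → + m ≡ d ℤ.* + 1 → n ℤ.* d ℤ.* + 1 ≡ n ℤ.* + m
    shape n d e = trans (ℤP.*-assoc n d (+ 1)) (cong (n ℤ.*_) (sym e))

  quotient : ∀ n {d} → d ≢ 0ℤ → ∃ λ x → Image n (x * ℤ→ℚ d)
  quotient n {d} d≢0 = ℤ→ℚ n * ℚ.1/ ℤ→ℚ d , image (sym (trans (ℚP.*-assoc (ℤ→ℚ n) (ℚ.1/ ℤ→ℚ d) (ℤ→ℚ d)) (trans (cong (ℤ→ℚ n *_) (ℚP.*-inverseˡ (ℤ→ℚ d))) (ℚP.*-identityʳ (ℤ→ℚ n)))))
    where
    instance
      nz : ℚ.NonZero (ℤ→ℚ d)
      nz = ℚ.≢-nonZero (ℤ→ℚ≢0 d≢0)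

  *-cancelʳ-0 : ∀ {x y} → y ≢ 0ℚ → x * y ≡ 0ℚ → x ≡ 0ℚ
  *-cancelʳ-0 {x} {y} y≢0 e = trans (sym (ℚP.*-identityʳ x)) (trans (cong (x *_) (sym (ℚP.*-inverseʳ y))) (trans (sym (ℚP.*-assoc x y (ℚ.1/ y))) (trans (cong (_* ℚ.1/ y) e) (ℚP.*-zeroˡ (ℚ.1/ y)))))
    where
    instance
      nz : ℚ.NonZero y
      nz = ℚ.≢-nonZero y≢0

  *-cancelʳ : ∀ {x x' y} → y ≢ 0ℚ → x * y ≡ x' * y → x ≡ x'
  *-cancelʳ {x} {x'} {y} y≢0 e = trans (shape x x') (trans (cong (_+ x') (*-cancelʳ-0 {x + - x'} {y} y≢0 (trans (distr x x' y) (trans (cong (_+ - (x' * y)) e) (ℚP.+-inverseʳ (x' * y)))))) (ℚP.+-identityˡ x'))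
    where
    shape : ∀ x x' → x ≡ x + - x' + x'
    shape = solve-∀ ℚ-ring
    distr : ∀ x x' y → (x + - x') * y ≡ x * y + - (x' * y)
    distr = solve-∀ ℚ-ring

  *≢0 : ∀ {x y} → x ≢ 0ℚ → y ≢ 0ℚ → x * y ≢ 0ℚ
  *≢0 x≢0 y≢0 e = x≢0 (*-cancelʳ-0 y≢0 e)

  square-nonneg : ∀ x → 0ℚ ℚ.≤ x * x
  square-nonneg x = (from (ℚP.≤-total 0ℚ x))
    where
    from : 0ℚ ℚ.≤ x ⊎ x ℚ.≤ 0ℚ → 0ℚ ℚ.≤ x * x
    from (inj₁ 0≤x) = subst (ℚ._≤ x * x) (ℚP.*-zeroˡ x) (ℚP.*-monoʳ-≤-nonNeg x {{ℚ.nonNegative 0≤x}} 0≤x)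
    from (inj₂ x≤0) = subst (ℚ._≤ x * x) (ℚP.*-zeroˡ x) (ℚP.*-monoʳ-≤-nonPos x {{ℚ.nonPositive x≤0}} x≤0)

  sum-of-squares : ∀ {x y} → x * x + y * y ≡ 0ℚ → y ≡ 0ℚ
  sum-of-squares {x} {y} e = root (ℚP.≤-antisym (ℚP.≤-trans (subst (ℚ._≤ x * x + y * y) (ℚP.+-identityˡ (y * y)) (ℚP.+-monoˡ-≤ (y * y) (square-nonneg x))) (ℚP.≤-reflexive e)) (square-nonneg y))
    where
    root : y * y ≡ 0ℚ → y ≡ 0ℚ
    root e with y ℚP.≟ 0ℚ
    ... | yes z = z
    ... | no ¬z = ⊥-elim (*≢0 ¬z ¬z e)

  data Cleared {k} (v : Vec ℚ k) : Set where
    cleared : ∀ D (N : Vec ℤ k) → D ≢ 0ℤ → Pointwise (λ x n → Image n (x * ℤ→ℚ D)) v N → Cleared v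

  clear : ∀ {k} (v : Vec ℚ k) → Cleared v
  clear []      = cleared 1ℤ [] (λ ()) []
  clear (x ∷ v) = from (clear v)
    where
    d = ↧ x
    scaled : ∀ {k} D {v : Vec ℚ k} {N : Vec ℤ k} → Pointwise (λ x n → Image n (x * ℤ→ℚ D)) v N → Pointwise (λ x n → Image n (x * ℤ→ℚ (d ℤ.* D))) v (Data.Vec.map (d ℤ.*_) N)
    scaled D [] = []
    scaled D (_∷_ {x = x} {y = n} i is) = recast (trans (shape x (ℤ→ℚ d) (ℤ→ℚ D)) (cong (x *_) (sym (ℤ→ℚ-* d D)))) (at d ⊛ i) ∷ scaled D is
      where
      shape : ∀ x d D → d * (x * D) ≡ x * (d * D)
      shape = solve-∀ ℚ-ring
    from : Cleared v → Cleared (x ∷ v)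
    from (cleared D N D≢0 es) = cleared (d ℤ.* D) (↥ x ℤ.* D ∷ Data.Vec.map (d ℤ.*_) N) (*-≢0 {d} {D} (λ ()) D≢0)
      (recast (trans (ℚP.*-assoc x (ℤ→ℚ d) (ℤ→ℚ D)) (cong (x *_) (sym (ℤ→ℚ-* d D)))) (image {↥ x} (sym (numerator x)) ⊛ at D) ∷ scaled D es)

  quadric : ℚ → ℚ → ℚ → ℚ → ℚ → ℚ
  quadric a b w₁ w₂ w₃ = 1ℚ + a * (w₁ * w₁) + b * (w₂ * w₂) + a * b * (w₃ * w₃)

  target : ℚ → ℚ → ℚ → ℚ → ℚ → ℚ → ℚ → ℚ
  target c s a b w₁ w₂ w₃ = quadric a b w₁ w₂ w₃ * ((1ℚ + a) * (1ℚ + a)) * ((1ℚ + b) * (1ℚ + b)) + c * (a * b) * (1ℚ + s * s)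

  sum₄ : ℚ → ℚ → ℚ → ℚ → ℚ
  sum₄ x₀ x₁ x₂ x₃ = x₀ * x₀ + x₁ * x₁ + x₂ * x₂ + x₃ * x₃

  sum₄-scaled : ∀ x₀ x₁ x₂ x₃ {n₀ n₁ n₂ n₃} δ → Image n₀ (x₀ * δ) → Image n₁ (x₁ * δ) → Image n₂ (x₂ * δ) → Image n₃ (x₃ * δ) →
    Image (n₀ ℤ.* n₀ ℤ.+ n₁ ℤ.* n₁ ℤ.+ n₂ ℤ.* n₂ ℤ.+ n₃ ℤ.* n₃) (sum₄ x₀ x₁ x₂ x₃ * (δ * δ))
  sum₄-scaled x₀ x₁ x₂ x₃ δ i₀ i₁ i₂ i₃ = recast (shape x₀ x₁ x₂ x₃ δ) (i₀ ⊛ i₀ ⊞ i₁ ⊛ i₁ ⊞ i₂ ⊛ i₂ ⊞ i₃ ⊛ i₃)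
    where
    shape : ∀ x y z w d → x * d * (x * d) + y * d * (y * d) + z * d * (z * d) + w * d * (w * d) ≡ (x * x + y * y + z * z + w * w) * (d * d)
    shape = solve-∀ ℚ-ring

  1024+-1024 : ℤ→ℚ (+ 1024) + ℤ→ℚ (ℤ.- (+ 1024)) ≡ 0ℚ
  1024+-1024 = sym (ℤ→ℚ-+ (+ 1024) (ℤ.- (+ 1024)))

  -- With A = a D², B = b D² and W = w D, the coordinates D³ , D W₁ , D W₂ , W₃ give every term of
  -- the norm the same factor D⁶; the factors (D² + A)² and (D² + B)² add D⁴ each.
  record Integral (s : ℤ) (A B D : ℤ) : Set where
    field
      w₁ w₂ w₃ : ℤ
      equation : norm A B (quat (D ℤ.* D ℤ.* D) (D ℤ.* w₁) (D ℤ.* w₂) w₃) ℤ.* ((D ℤ.* D ℤ.+ A) ℤ.* (D ℤ.* D ℤ.+ A)) ℤ.* ((D ℤ.* D ℤ.+ B) ℤ.* (D ℤ.* D ℤ.+ B))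
               ≡ + 1024 ℤ.* (1ℤ ℤ.+ s ℤ.* s) ℤ.* (A ℤ.* B) ℤ.* (D ℤ.* D ℤ.* D ℤ.* (D ℤ.* D ℤ.* D) ℤ.* (D ℤ.* D) ℤ.* (D ℤ.* D))

  integral : ∀ s a b w₁ w₂ w₃ {A B W₁ W₂ W₃} D → Image A (a * (ℤ→ℚ D * ℤ→ℚ D)) → Image B (b * (ℤ→ℚ D * ℤ→ℚ D)) →
    Image W₁ (w₁ * ℤ→ℚ D) → Image W₂ (w₂ * ℤ→ℚ D) → Image W₃ (w₃ * ℤ→ℚ D) → target (ℤ→ℚ (ℤ.- (+ 1024))) (ℤ→ℚ s) a b w₁ w₂ w₃ ≡ 0ℚ → Integral s A B D
  integral s a b w₁ w₂ w₃ {A} {B} {W₁} {W₂} {W₃} D ia ib i₁ i₂ i₃ zero′ = record { w₁ = W₁ ; w₂ = W₂ ; w₃ = W₃ ; equation = image-≡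
      (recast (trans (shape₁ a b w₁ w₂ w₃ δ) (trans (cong (_* δ¹⁴) solved) (shape₂ K S a b δ)))
        ((iD ⊛ iD ⊛ iD ⊛ (iD ⊛ iD ⊛ iD) ⊞ (ia ⊛ (iD ⊛ i₁ ⊛ (iD ⊛ i₁)) ⊞ ib ⊛ (iD ⊛ i₂ ⊛ (iD ⊛ i₂)) ⊞ ia ⊛ ib ⊛ (i₃ ⊛ i₃)))
          ⊛ ((iD ⊛ iD ⊞ ia) ⊛ (iD ⊛ iD ⊞ ia)) ⊛ ((iD ⊛ iD ⊞ ib) ⊛ (iD ⊛ iD ⊞ ib))))
      (at (+ 1024) ⊛ (at 1ℤ ⊞ at s ⊛ at s) ⊛ (ia ⊛ ib) ⊛ (iD ⊛ iD ⊛ iD ⊛ (iD ⊛ iD ⊛ iD) ⊛ (iD ⊛ iD) ⊛ (iD ⊛ iD))) }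
    where
    iD = at D
    δ = ℤ→ℚ D
    S = ℤ→ℚ s
    K = ℤ→ℚ (+ 1024)
    K′ = ℤ→ℚ (ℤ.- (+ 1024))
    δ¹⁴ = δ * δ * δ * (δ * δ * δ) * (δ * δ * (δ * δ)) * (δ * δ * (δ * δ))
    X = quadric a b w₁ w₂ w₃ * ((1ℚ + a) * (1ℚ + a)) * ((1ℚ + b) * (1ℚ + b))
    solved : X ≡ K * (a * b) * (1ℚ + S * S)
    solved = trans (split X K K′ (a * b) (1ℚ + S * S)) (trans (cong₂ (λ p q → p + K * (a * b) * (1ℚ + S * S) + - (q * ((a * b) * (1ℚ + S * S)))) zero′ 1024+-1024) (finish (K * (a * b) * (1ℚ + S * S)) ((a * b) * (1ℚ + S * S))))
      where
      split : ∀ X K K′ p q → X ≡ X + K′ * p * q + K * p * q + - ((K + K′) * (p * q))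
      split = solve-∀ ℚ-ring
      finish : ∀ x y → 0ℚ + x + - (0ℚ * y) ≡ x
      finish = solve-∀ ℚ-ring
    shape₁ : ∀ a b w₁ w₂ w₃ d → (d * d * d * (d * d * d) + (a * (d * d) * (d * (w₁ * d) * (d * (w₁ * d))) + b * (d * d) * (d * (w₂ * d) * (d * (w₂ * d))) + a * (d * d) * (b * (d * d)) * (w₃ * d * (w₃ * d))))
        * ((d * d + a * (d * d)) * (d * d + a * (d * d))) * ((d * d + b * (d * d)) * (d * d + b * (d * d)))
        ≡ (1ℚ + a * (w₁ * w₁) + b * (w₂ * w₂) + a * b * (w₃ * w₃)) * ((1ℚ + a) * (1ℚ + a)) * ((1ℚ + b) * (1ℚ + b)) * (d * d * d * (d * d * d) * (d * d * (d * d)) * (d * d * (d * d)))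
    shape₁ a b w₁ w₂ w₃ d = trans (cong₂ _*_ (cong₂ _*_ (first a b w₁ w₂ w₃ d) (second a d)) (second b d)) (regroup (1ℚ + a * (w₁ * w₁) + b * (w₂ * w₂) + a * b * (w₃ * w₃)) (d * d * d * (d * d * d)) ((1ℚ + a) * (1ℚ + a)) ((1ℚ + b) * (1ℚ + b)) (d * d * (d * d)))
      where
      first : ∀ a b w₁ w₂ w₃ d → d * d * d * (d * d * d) + (a * (d * d) * (d * (w₁ * d) * (d * (w₁ * d))) + b * (d * d) * (d * (w₂ * d) * (d * (w₂ * d))) + a * (d * d) * (b * (d * d)) * (w₃ * d * (w₃ * d)))
        ≡ (1ℚ + a * (w₁ * w₁) + b * (w₂ * w₂) + a * b * (w₃ * w₃)) * (d * d * d * (d * d * d))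
      first = solve-∀ ℚ-ring
      second : ∀ a d → (d * d + a * (d * d)) * (d * d + a * (d * d)) ≡ (1ℚ + a) * (1ℚ + a) * (d * d * (d * d))
      second = solve-∀ ℚ-ring
      regroup : ∀ n e p q d → n * e * (p * d) * (q * d) ≡ n * p * q * (e * d * d)
      regroup = solve-∀ ℚ-ring
    shape₂ : ∀ K S a b d → K * (a * b) * (1ℚ + S * S) * (d * d * d * (d * d * d) * (d * d * (d * d)) * (d * d * (d * d))) ≡ K * (1ℚ + S * S) * (a * (d * d) * (b * (d * d))) * (d * d * d * (d * d * d) * (d * d) * (d * d))
    shape₂ K S a b d = regroup K (1ℚ + S * S) a b (d * d) (d * d * d * (d * d * d))
      where
      regroup : ∀ k s a b d e → k * (a * b) * s * (e * (d * d) * (d * d)) ≡ k * s * (a * d * (b * d)) * (e * d * d)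
      regroup = solve-∀ ℚ-ring

  nonneg : ∀ n₀ n₁ n₂ n₃ → ∃ λ N → n₀ ℤ.* n₀ ℤ.+ n₁ ℤ.* n₁ ℤ.+ n₂ ℤ.* n₂ ℤ.+ n₃ ℤ.* n₃ ≡ + N
  nonneg n₀ n₁ n₂ n₃ = _ , cong₂ ℤ._+_ (cong₂ ℤ._+_ (cong₂ ℤ._+_ (∣∣-square n₀) (∣∣-square n₁)) (∣∣-square n₂)) (∣∣-square n₃)

  norm≢0 : ∀ A B x → c₀ x ≢ 0ℤ → norm (+ A) (+ B) x ≢ 0ℤ
  norm≢0 A B x x₀≢0 e = □≢0 (ℕP.m+n≡0⇒m≡0 □₀ (ℤP.+-injective (trans (sym natural) e)))
    where
    □₀ = ∣ c₀ x ∣ ℕ.* ∣ c₀ x ∣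
    □₁ = ∣ c₁ x ∣ ℕ.* ∣ c₁ x ∣
    □₂ = ∣ c₂ x ∣ ℕ.* ∣ c₂ x ∣
    □₃ = ∣ c₃ x ∣ ℕ.* ∣ c₃ x ∣
    □≢0 : □₀ ≢ 0
    □≢0 z with ℕP.m*n≡0⇒m≡0∨n≡0 ∣ c₀ x ∣ z
    ... | inj₁ z' = x₀≢0 (ℤP.∣i∣≡0⇒i≡0 z')
    ... | inj₂ z' = x₀≢0 (ℤP.∣i∣≡0⇒i≡0 z')
    natural : norm (+ A) (+ B) x ≡ + (□₀ ℕ.+ (A ℕ.* □₁ ℕ.+ B ℕ.* □₂ ℕ.+ A ℕ.* B ℕ.* □₃))
    natural = cong₂ ℤ._+_ (∣∣-square (c₀ x)) (cong₂ ℤ._+_ (cong₂ ℤ._+_ (scaled A (c₁ x)) (scaled B (c₂ x))) (trans (cong (ℤ._* (c₃ x ℤ.* c₃ x)) (sym (ℤP.pos-* A B))) (scaled (A ℕ.* B) (c₃ x))))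
      where
      scaled : ∀ n y → + n ℤ.* (y ℤ.* y) ≡ + (n ℕ.* (∣ y ∣ ℕ.* ∣ y ∣))
      scaled n y = trans (cong (+ n ℤ.*_) (∣∣-square y)) (sym (ℤP.pos-* n (∣ y ∣ ℕ.* ∣ y ∣)))

  -- The integral equation is the relation for the quaternions with scalar part `D` and vector part
  -- i, respectively j: their norms are D² + A and D² + B, and their Gram determinant is A B.
  -- Neither A nor B is 0, since otherwise the right side would vanish while the left is a product
  -- of positive norms.
  no-integral : ∀ s A B D → D ≢ 0ℤ → Integral s (+ A) (+ B) D → ⊥
  no-integral s A B D D≢0 I = no-bad (1ℤ ℤ.+ s ℤ.* s) A B (ℕP.n≢0⇒n>0 A≢0) (ℕP.n≢0⇒n>0 B≢0)
      (bad U V W D≢0 D≢0 D³≢0 (relation (trans (cong₂ (λ p q → norm (+ A) (+ B) W ℤ.* (p ℤ.* p) ℤ.* (q ℤ.* q)) normU normV) (trans equation (trans (shape (+ 1024) (1ℤ ℤ.+ s ℤ.* s) (+ A ℤ.* + B) D³ D) (cong (+ 1024 ℤ.* (1ℤ ℤ.+ s ℤ.* s) ℤ.* (D³ ℤ.* D³ ℤ.* (D ℤ.* D) ℤ.* (D ℤ.* D)) ℤ.*_) (sym gramUV)))))))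
    where
    open Integral I
    D³ = D ℤ.* D ℤ.* D
    U = quat D 1ℤ 0ℤ 0ℤ
    V = quat D 0ℤ 1ℤ 0ℤ
    W = quat D³ (D ℤ.* w₁) (D ℤ.* w₂) w₃
    D³≢0 : D³ ≢ 0ℤ
    D³≢0 = *-≢0 (*-≢0 D≢0 D≢0) D≢0
    normU : norm (+ A) (+ B) U ≡ D ℤ.* D ℤ.+ + A
    normU = go D (+ A) (+ B)
      where
      go : ∀ D A B → D ℤ.* D ℤ.+ (A ℤ.* (1ℤ ℤ.* 1ℤ) ℤ.+ B ℤ.* (0ℤ ℤ.* 0ℤ) ℤ.+ A ℤ.* B ℤ.* (0ℤ ℤ.* 0ℤ)) ≡ D ℤ.* D ℤ.+ A
      go = solveℤ-∀
    normV : norm (+ A) (+ B) V ≡ D ℤ.* D ℤ.+ + B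
    normV = go D (+ A) (+ B)
      where
      go : ∀ D A B → D ℤ.* D ℤ.+ (A ℤ.* (0ℤ ℤ.* 0ℤ) ℤ.+ B ℤ.* (1ℤ ℤ.* 1ℤ) ℤ.+ A ℤ.* B ℤ.* (0ℤ ℤ.* 0ℤ)) ≡ D ℤ.* D ℤ.+ B
      go = solveℤ-∀
    gramUV : gram (+ A) (+ B) U V ≡ + A ℤ.* + B
    gramUV = trans (gram-minors (+ A) (+ B) U V) (go (+ A) (+ B))
      where
      go : ∀ A B → B ℤ.* (A ℤ.* ((1ℤ ℤ.* 1ℤ ℤ.- 0ℤ ℤ.* 0ℤ) ℤ.* (1ℤ ℤ.* 1ℤ ℤ.- 0ℤ ℤ.* 0ℤ)) ℤ.+ A ℤ.* A ℤ.* ((1ℤ ℤ.* 0ℤ ℤ.- 0ℤ ℤ.* 0ℤ) ℤ.* (1ℤ ℤ.* 0ℤ ℤ.- 0ℤ ℤ.* 0ℤ)) ℤ.+ A ℤ.* B ℤ.* ((0ℤ ℤ.* 0ℤ ℤ.- 0ℤ ℤ.* 1ℤ) ℤ.* (0ℤ ℤ.* 0ℤ ℤ.- 0ℤ ℤ.* 1ℤ))) ≡ A ℤ.* B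
      go = solveℤ-∀
    shape : ∀ c s g e D → c ℤ.* s ℤ.* g ℤ.* (e ℤ.* e ℤ.* (D ℤ.* D) ℤ.* (D ℤ.* D)) ≡ c ℤ.* s ℤ.* (e ℤ.* e ℤ.* (D ℤ.* D) ℤ.* (D ℤ.* D)) ℤ.* g
    shape = solveℤ-∀
    left≢0 : norm (+ A) (+ B) W ℤ.* ((D ℤ.* D ℤ.+ + A) ℤ.* (D ℤ.* D ℤ.+ + A)) ℤ.* ((D ℤ.* D ℤ.+ + B) ℤ.* (D ℤ.* D ℤ.+ + B)) ≢ 0ℤ
    left≢0 = *-≢0 (*-≢0 (norm≢0 A B W D³≢0) (*-≢0 nU nU)) (*-≢0 nV nV)
      where
      nU = subst (_≢ 0ℤ) normU (norm≢0 A B U D≢0)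
      nV = subst (_≢ 0ℤ) normV (norm≢0 A B V D≢0)
    AB≢0 : + A ℤ.* + B ≢ 0ℤ
    AB≢0 z = left≢0 (trans equation (trans (cong (λ g → + 1024 ℤ.* (1ℤ ℤ.+ s ℤ.* s) ℤ.* g ℤ.* E) z) (trans (cong (ℤ._* E) (ℤP.*-zeroʳ (+ 1024 ℤ.* (1ℤ ℤ.+ s ℤ.* s)))) (ℤP.*-zeroˡ E))))
      where
      E = D³ ℤ.* D³ ℤ.* (D ℤ.* D) ℤ.* (D ℤ.* D)
    A≢0 : A ≢ 0
    A≢0 refl = AB≢0 refl
    B≢0 : B ≢ 0
    B≢0 refl = AB≢0 (ℤP.*-zeroʳ (+ A))

  sound : ∀ s {a₀ a₁ a₂ a₃ b₀ b₁ b₂ b₃ w₁ w₂ w₃} → target (ℤ→ℚ (ℤ.- (+ 1024))) (ℤ→ℚ s) (sum₄ a₀ a₁ a₂ a₃) (sum₄ b₀ b₁ b₂ b₃) w₁ w₂ w₃ ≢ 0ℚ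
  sound s {a₀} {a₁} {a₂} {a₃} {b₀} {b₁} {b₂} {b₃} {w₁} {w₂} {w₃} e = from (clear (a₀ ∷ a₁ ∷ a₂ ∷ a₃ ∷ b₀ ∷ b₁ ∷ b₂ ∷ b₃ ∷ w₁ ∷ w₂ ∷ w₃ ∷ []))
    where
    from : Cleared (a₀ ∷ a₁ ∷ a₂ ∷ a₃ ∷ b₀ ∷ b₁ ∷ b₂ ∷ b₃ ∷ w₁ ∷ w₂ ∷ w₃ ∷ []) → ⊥
    from (cleared D (A₀ ∷ A₁ ∷ A₂ ∷ A₃ ∷ B₀ ∷ B₁ ∷ B₂ ∷ B₃ ∷ _) D≢0 (i₀ ∷ i₁ ∷ i₂ ∷ i₃ ∷ j₀ ∷ j₁ ∷ j₂ ∷ j₃ ∷ k₁ ∷ k₂ ∷ k₃ ∷ [])) =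
      no-integral s (proj₁ A) (proj₁ B) D D≢0 (subst₂ (λ A B → Integral s A B D) (proj₂ A) (proj₂ B) (integral s (sum₄ a₀ a₁ a₂ a₃) (sum₄ b₀ b₁ b₂ b₃) w₁ w₂ w₃ D (sum₄-scaled a₀ a₁ a₂ a₃ (ℤ→ℚ D) i₀ i₁ i₂ i₃) (sum₄-scaled b₀ b₁ b₂ b₃ (ℤ→ℚ D) j₀ j₁ j₂ j₃) k₁ k₂ k₃ e))
      where
      A = nonneg A₀ A₁ A₂ A₃
      B = nonneg B₀ B₁ B₂ B₃

  record Root (c s : ℚ) : Set where
    constructor rootAt
    field
      a₀ a₁ a₂ a₃ b₀ b₁ b₂ b₃ w₁ w₂ w₃ : ℚ
      vanishes : target c s (sum₄ a₀ a₁ a₂ a₃) (sum₄ b₀ b₁ b₂ b₃) w₁ w₂ w₃ ≡ 0ℚ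

  data RationalSquares (ℓ k : ℤ) : Set where
    squares : ∀ x₀ x₁ x₂ x₃ → sum₄ x₀ x₁ x₂ x₃ * (ℤ→ℚ k * ℤ→ℚ k) ≡ ℤ→ℚ ℓ → RationalSquares ℓ k

  rational-squares : ∀ {ℓ k} → k ≢ 0ℤ → FourSquare ℓ → RationalSquares ℓ k
  rational-squares {ℓ} {k} k≢0 (fourSquare c c≢0 r₀ r₁ r₂ r₃ e) = from (quotient r₀ ck≢0) (quotient r₁ ck≢0) (quotient r₂ ck≢0) (quotient r₃ ck≢0)
    where
    ck≢0 : c ℤ.* k ≢ 0ℤ
    ck≢0 = *-≢0 c≢0 k≢0
    Q : ℤ → Set
    Q r = ∃ λ x → Image r (x * ℤ→ℚ (c ℤ.* k))
    from : Q r₀ → Q r₁ → Q r₂ → Q r₃ → RationalSquares ℓ k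
    from (x₀ , i₀) (x₁ , i₁) (x₂ , i₂) (x₃ , i₃) = squares x₀ x₁ x₂ x₃ (*-cancelʳ (*≢0 (ℤ→ℚ≢0 c≢0) (ℤ→ℚ≢0 c≢0)) (trans (shape (sum₄ x₀ x₁ x₂ x₃) (ℤ→ℚ k) (ℤ→ℚ c))
        (trans (cong (λ z → sum₄ x₀ x₁ x₂ x₃ * (z * z)) (sym (ℤ→ℚ-* c k))) (trans (sym (value-of (sum₄-scaled x₀ x₁ x₂ x₃ (ℤ→ℚ (c ℤ.* k)) i₀ i₁ i₂ i₃))) (trans (cong ℤ→ℚ e) (value-of (at ℓ ⊛ (at c ⊛ at c))))))))
      where
      shape : ∀ s k c → s * (k * k) * (c * c) ≡ s * (c * k * (c * k))
      shape = solve-∀ ℚ-ring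

  certified-root : ∀ {μ ε s} → ε ≢ 0ℤ → s * s * (ℤ→ℚ ε * ℤ→ℚ ε) ≡ ℤ→ℚ μ * ℤ→ℚ μ → Certificate μ ε → Root (ℤ→ℚ (ℤ.- (+ 1024))) s
  certified-root {μ} {ε} {s} ε≢0 hs (certificate k j ℓ π Ω T₁ T₂ T₃ k≢0 j≢0 Ω≢0 P≢0 R≢0 sℓ sπ eq) =
    from (rational-squares k≢0 sℓ) (rational-squares j≢0 sπ) (quotient (k ℤ.* T₁) G≢0) (quotient (j ℤ.* T₂) G≢0) (quotient (k ℤ.* j ℤ.* T₃) G≢0)
    where
    P = k ℤ.* k ℤ.+ ℓ
    R = j ℤ.* j ℤ.+ π
    G = P ℤ.* R ℤ.* ε ℤ.* Ω
    G≢0 : G ≢ 0ℤ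
    G≢0 = *-≢0 (*-≢0 (*-≢0 P≢0 R≢0) ε≢0) Ω≢0
    Q : ℤ → Set
    Q r = ∃ λ x → Image r (x * ℤ→ℚ G)
    K = ℤ→ℚ (+ 1024)
    K′ = ℤ→ℚ (ℤ.- (+ 1024))
    κ = ℤ→ℚ k
    ι = ℤ→ℚ j
    l = ℤ→ℚ ℓ
    p = ℤ→ℚ π
    γ = ℤ→ℚ G
    t₁ = ℤ→ℚ T₁
    t₂ = ℤ→ℚ T₂
    t₃ = ℤ→ℚ T₃
    ω = ℤ→ℚ Ω
    e = ℤ→ℚ ε
    m = ℤ→ℚ μ
    from : RationalSquares ℓ k → RationalSquares π j → Q (k ℤ.* T₁) → Q (j ℤ.* T₂) → Q (k ℤ.* j ℤ.* T₃) → Root K′ s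
    from (squares a₀ a₁ a₂ a₃ ha) (squares b₀ b₁ b₂ b₃ hb) (w₁ , i₁) (w₂ , i₂) (w₃ , i₃) = rootAt a₀ a₁ a₂ a₃ b₀ b₁ b₂ b₃ w₁ w₂ w₃ (*-cancelʳ-0 X≢0 total)
      where
      a = sum₄ a₀ a₁ a₂ a₃
      b = sum₄ b₀ b₁ b₂ b₃
      -- The factor γ² clears the quadric, κ⁴ and ι⁴ clear (1 + a)² and (1 + b)².
      X = γ * γ * (κ * κ * (κ * κ)) * (ι * ι * (ι * ι))
      X≢0 : X ≢ 0ℚ
      X≢0 = *≢0 (*≢0 (*≢0 (ℤ→ℚ≢0 G≢0) (ℤ→ℚ≢0 G≢0)) (*≢0 (*≢0 κ≢0 κ≢0) (*≢0 κ≢0 κ≢0))) (*≢0 (*≢0 ι≢0 ι≢0) (*≢0 ι≢0 ι≢0))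
        where
        κ≢0 = ℤ→ℚ≢0 k≢0
        ι≢0 = ℤ→ℚ≢0 j≢0
      h₁ : w₁ * γ ≡ κ * t₁
      h₁ = trans (sym (value-of i₁)) (value-of (at k ⊛ at T₁))
      h₂ : w₂ * γ ≡ ι * t₂
      h₂ = trans (sym (value-of i₂)) (value-of (at j ⊛ at T₂))
      h₃ : w₃ * γ ≡ κ * ι * t₃
      h₃ = trans (sym (value-of i₃)) (value-of (at k ⊛ at j ⊛ at T₃))
      hP : (1ℚ + a) * (κ * κ) ≡ ℤ→ℚ P
      hP = trans (distr a (κ * κ)) (trans (cong (λ z → κ * κ + z) ha) (sym (value-of (at k ⊛ at k ⊞ at ℓ))))
        where
        distr : ∀ a k → (1ℚ + a) * k ≡ k + a * k
        distr = solve-∀ ℚ-ring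
      hR : (1ℚ + b) * (ι * ι) ≡ ℤ→ℚ R
      hR = trans (distr b (ι * ι)) (trans (cong (λ z → ι * ι + z) hb) (sym (value-of (at j ⊛ at j ⊞ at π))))
        where
        distr : ∀ a k → (1ℚ + a) * k ≡ k + a * k
        distr = solve-∀ ℚ-ring
      hγ : γ ≡ ℤ→ℚ P * ℤ→ℚ R * e * ω
      hγ = value-of (at P ⊛ at R ⊛ at ε ⊛ at Ω)
      U = ℤ→ℚ P
      V = ℤ→ℚ R
      quadric-γ : quadric a b w₁ w₂ w₃ * (γ * γ) ≡ K * (l * p) * (κ * κ * (ι * ι)) * (m * m + e * e) * (ω * ω)
      quadric-γ = trans (shape a b w₁ w₂ w₃ γ) (trans (cong₂ (λ x y → γ * γ + x + a * b * (y * y)) (cong₂ (λ x y → a * (x * x) + b * (y * y)) h₁ h₂) h₃)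
        (trans (shape′ a b κ ι t₁ t₂ t₃ γ) (trans (cong₂ (λ x y → γ * γ + (x * (t₁ * t₁) + y * (t₂ * t₂) + x * y * (t₃ * t₃))) ha hb)
          (trans (cong (λ g → g * g + (l * (t₁ * t₁) + p * (t₂ * t₂) + l * p * (t₃ * t₃))) hγ) (trans (shape″ (U * V * e) ω (l * (t₁ * t₁) + p * (t₂ * t₂) + l * p * (t₃ * t₃)))
            (trans (sym (value-of (at P ⊛ at R ⊛ at ε ⊛ (at P ⊛ at R ⊛ at ε) ⊛ (at Ω ⊛ at Ω) ⊞ (at ℓ ⊛ (at T₁ ⊛ at T₁) ⊞ at π ⊛ (at T₂ ⊛ at T₂) ⊞ at ℓ ⊛ at π ⊛ (at T₃ ⊛ at T₃)))))
              (trans (cong ℤ→ℚ eq) (value-of (at (+ 1024) ⊛ (at ℓ ⊛ at π) ⊛ (at k ⊛ at k ⊛ (at j ⊛ at j)) ⊛ (at μ ⊛ at μ ⊞ at ε ⊛ at ε) ⊛ (at Ω ⊛ at Ω))))))))))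
        where
        shape : ∀ a b x y z g → (1ℚ + a * (x * x) + b * (y * y) + a * b * (z * z)) * (g * g) ≡ g * g + (a * (x * g * (x * g)) + b * (y * g * (y * g))) + a * b * (z * g * (z * g))
        shape = solve-∀ ℚ-ring
        shape′ : ∀ a b k j x y z g → g * g + (a * (k * x * (k * x)) + b * (j * y * (j * y))) + a * b * (k * j * z * (k * j * z)) ≡ g * g + (a * (k * k) * (x * x) + b * (j * j) * (y * y) + a * (k * k) * (b * (j * j)) * (z * z))
        shape′ = solve-∀ ℚ-ring
        shape″ : ∀ d w r → d * w * (d * w) + r ≡ d * d * (w * w) + r
        shape″ = solve-∀ ℚ-ring
      total : target K′ s a b w₁ w₂ w₃ * X ≡ 0ℚ
      total = trans (shape (quadric a b w₁ w₂ w₃) K′ s a b γ κ ι) (trans (cong₂ _+_ (cong₂ _*_ (cong₂ (λ q x → q * (x * x)) quadric-γ hP) (cong (λ x → x * x) hR))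
        (trans (cong₂ (λ x y → K′ * (x * y) * (κ * κ * (ι * ι)) * ((1ℚ + s * s) * (γ * γ))) ha hb) (cong (K′ * (l * p) * (κ * κ * (ι * ι)) *_) last-factor)))
        (trans (shape′ K K′ (l * p) (κ * κ * (ι * ι)) (m * m + e * e) ω U V) (trans (cong (_* (l * p * (κ * κ * (ι * ι)) * (m * m + e * e) * (ω * ω) * (U * U) * (V * V))) 1024+-1024) (ℚP.*-zeroˡ (l * p * (κ * κ * (ι * ι)) * (m * m + e * e) * (ω * ω) * (U * U) * (V * V))))))
        where
        last-factor : (1ℚ + s * s) * (γ * γ) ≡ (m * m + e * e) * (ω * ω) * (U * U) * (V * V)
        last-factor = trans (cong (λ g → (1ℚ + s * s) * (g * g)) hγ) (trans (expand′ s U V e ω) (trans (cong (λ z → (z + e * e) * (ω * ω) * (U * U) * (V * V)) hs) refl))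
          where
          expand′ : ∀ s u v e w → (1ℚ + s * s) * (u * v * e * w * (u * v * e * w)) ≡ (s * s * (e * e) + e * e) * (w * w) * (u * u) * (v * v)
          expand′ = solve-∀ ℚ-ring
        shape : ∀ q c s a b g k j → (q * ((1ℚ + a) * (1ℚ + a)) * ((1ℚ + b) * (1ℚ + b)) + c * (a * b) * (1ℚ + s * s)) * (g * g * (k * k * (k * k)) * (j * j * (j * j)))
          ≡ q * (g * g) * ((1ℚ + a) * (k * k) * ((1ℚ + a) * (k * k))) * ((1ℚ + b) * (j * j) * ((1ℚ + b) * (j * j))) + c * (a * (k * k) * (b * (j * j))) * (k * k * (j * j)) * ((1ℚ + s * s) * (g * g))
        shape q c s a b g k j = regroup q c (1ℚ + s * s) (1ℚ + a) (1ℚ + b) a b (g * g) (k * k) (j * j)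
          where
          regroup : ∀ q c s a' b' a b g k j → (q * (a' * a') * (b' * b') + c * (a * b) * s) * (g * (k * k) * (j * j)) ≡ q * g * (a' * k * (a' * k)) * (b' * j * (b' * j)) + c * (a * k * (b * j)) * (k * j) * (s * g)
          regroup = solve-∀ ℚ-ring
        shape′ : ∀ K K′ x y z w u v → K * x * y * z * (w * w) * (u * u) * (v * v) + K′ * x * y * (z * (w * w) * (u * u) * (v * v)) ≡ (K + K′) * (x * y * z * (w * w) * (u * u) * (v * v))
        shape′ = solve-∀ ℚ-ring

-- The polynomial g and the two implications.

open Polynomial
open Box
open Complete
open Rational
open import Data.Nat as ℕ using (ℕ; zero; suc; z≤n; s≤s)
import Data.Nat.Properties as ℕP
open import Data.Nat.Divisibility as ℕD using (_∣_; _∤_)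
open import Data.Nat.Coprimality using (recompute)
open import Data.Nat.ListAction using (product)
open import Data.Nat.Primality using (Prime; euclidsLemma; prime⇒nonTrivial)
open import Data.Nat.Primality.Factorisation using (PrimeFactorisation; factorise)
open import Data.Integer as ℤ using (ℤ; +_; ∣_∣)
import Data.Integer.Properties as ℤP
open import Data.Rational using (ℚ; 0ℚ; mkℚ; _+_; _*_; ↥_; ↧ₙ_)
import Data.Rational.Properties as ℚP
open import Tactic.RingSolver using (solve-∀)
open import Data.Fin using (#_)
open import Data.List using ([]; _∷_)
open import Data.List.Relation.Unary.All using (All; []; _∷_)
open import Data.Vec using (Vec; []; _∷_; replicate)
open import Data.Product using (Σ; _×_; _,_; ∃)
open import Data.Sum using (inj₁; inj₂)
open import Data.Unit using (tt)
open import Data.Empty using (⊥; ⊥-elim)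
open import Function.Bundles using (_⇔_; mk⇔)
open import Relation.Nullary using (yes; no)
open import Relation.Binary.PropositionalEquality

-- Variable 0 is t and variable 1 is the y of `realise`.
f : Expr 419
f = (con (+ 1) ⊕ a ⊗ (var (# 10) ⊗ var (# 10)) ⊕ b ⊗ (var (# 11) ⊗ var (# 11)) ⊕ a ⊗ b ⊗ (var (# 12) ⊗ var (# 12)))
      ⊗ ((con (+ 1) ⊕ a) ⊗ (con (+ 1) ⊕ a)) ⊗ ((con (+ 1) ⊕ b) ⊗ (con (+ 1) ⊕ b))
    ⊕ con (ℤ.- (+ 1024)) ⊗ (a ⊗ b) ⊗ (con (+ 1) ⊕ t⁵ ⊗ t⁵)
  where
  a b t⁵ : Expr 419
  a  = var (# 2) ⊗ var (# 2) ⊕ var (# 3) ⊗ var (# 3) ⊕ var (# 4) ⊗ var (# 4) ⊕ var (# 5) ⊗ var (# 5)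
  b  = var (# 6) ⊗ var (# 6) ⊕ var (# 7) ⊗ var (# 7) ⊕ var (# 8) ⊗ var (# 8) ⊕ var (# 9) ⊗ var (# 9)
  t⁵ = var (# 0) ⊗ var (# 0) ⊗ var (# 0) ⊗ var (# 0) ⊗ var (# 0)

abstract
  realisation : Realisation 28 (f ⊗ f)
  -- The bound 28 = 2 · 14 and the weight 0 of the variable y are evaluated on the expression tree;
  -- sealing the result keeps the expansion of f² from being unfolded later.
  realisation = realise 28 (f ⊗ f) (s≤s z≤n) (ℕP.≤ᵇ⇒≤ _ _ tt) refl

open Realisation realisation

fifth : ℚ → ℚ
fifth t = t * t * t * t * t

integer⇒no-root : ∀ {t} → IsInteger t → ∀ xs → eval poly (t ∷ xs) ≢ 0ℚ
-- y²⁸ is read as the square of y¹⁴, so g = 0 is a vanishing sum of two rational squares and f must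
-- vanish.
integer⇒no-root {t} (z , refl) (y ∷ xs) e = f≢0 xs (sum-of-squares {y ^ℚ 14} {⟦ f ⟧ (t ∷ y ∷ xs)} (trans (cong (_+ ⟦ f ⟧ (t ∷ y ∷ xs) * ⟦ f ⟧ (t ∷ y ∷ xs)) (sym (^ℚ-+ y 14 14))) (trans (sym (value t y xs)) e)))
  where
  f≢0 : ∀ xs → ⟦ f ⟧ (t ∷ y ∷ xs) ≢ 0ℚ
  f≢0 (a₀ ∷ a₁ ∷ a₂ ∷ a₃ ∷ b₀ ∷ b₁ ∷ b₂ ∷ b₃ ∷ w₁ ∷ w₂ ∷ w₃ ∷ rest) e = sound (z ℤ.* z ℤ.* z ℤ.* z ℤ.* z) {a₀} {a₁} {a₂} {a₃} {b₀} {b₁} {b₂} {b₃} {w₁} {w₂} {w₃}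
    (trans (cong (λ s → target (ℤ→ℚ (ℤ.- (+ 1024))) s (sum₄ a₀ a₁ a₂ a₃) (sum₄ b₀ b₁ b₂ b₃) w₁ w₂ w₃) (value-of (at z ⊛ at z ⊛ at z ⊛ at z ⊛ at z))) e)

prime-factor : ∀ n → 0 ℕ.< n → n ≢ 1 → ∃ λ p → Prime p × p ∣ n
prime-factor n 0<n n≢1 = from factors factorsPrime isFactorisation
  where
  open PrimeFactorisation (factorise n {{ℕ.>-nonZero 0<n}})
  from : ∀ ps → All Prime ps → n ≡ product ps → ∃ λ p → Prime p × p ∣ n
  from []       []         e = ⊥-elim (n≢1 e)
  from (p ∷ ps) (pr ∷ prs) e = p , pr , subst (p ∣_) (sym e) (ℕD.m∣m*n (product ps))

prime-∤-^ : ∀ {p} → Prime p → ∀ {m} → p ∤ m → ∀ k → p ∤ m ℕ.^ k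
prime-∤-^ pr p∤m zero    d = ℕP.<⇒≱ (ℕ.nonTrivial⇒n>1 _ {{prime⇒nonTrivial pr}}) (ℕD.∣⇒≤ d)
prime-∤-^ pr {m} p∤m (suc k) d with euclidsLemma m (m ℕ.^ k) pr d
... | inj₁ d' = p∤m d'
... | inj₂ d' = prime-∤-^ pr p∤m k d'

pos-^5 : ∀ e → + (e ℕ.^ 5) ≡ + e ℤ.* (+ e ℤ.* (+ e ℤ.* (+ e ℤ.* + e)))
pos-^5 e = trans (cong +_ (cong (λ z → e ℕ.* (e ℕ.* (e ℕ.* (e ℕ.* z)))) (ℕP.*-identityʳ e)))
  (trans (ℤP.pos-* e _) (cong (+ e ℤ.*_) (trans (ℤP.pos-* e _) (cong (+ e ℤ.*_) (trans (ℤP.pos-* e _) (cong (+ e ℤ.*_) (ℤP.pos-* e e)))))))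

-- Only the even power t¹⁰ enters, so the absolute value of the numerator may replace the numerator
-- and the certificate can be built from natural numbers.
fifth-equation : ∀ t n e → Image n (t * ℤ→ℚ (+ e)) → fifth t * fifth t * (ℤ→ℚ (+ (e ℕ.^ 5)) * ℤ→ℚ (+ (e ℕ.^ 5))) ≡ ℤ→ℚ (+ (∣ n ∣ ℕ.^ 5)) * ℤ→ℚ (+ (∣ n ∣ ℕ.^ 5))
fifth-equation t n e i = trans (cong (λ z → fifth t * fifth t * (z * z)) (trans (cong ℤ→ℚ (pos-^5 e)) (value-of (at (+ e) ⊛ (at (+ e) ⊛ (at (+ e) ⊛ (at (+ e) ⊛ at (+ e))))))))
  (trans (shape t (ℤ→ℚ (+ e))) (trans (sym (value-of (i ⊛ i ⊛ i ⊛ i ⊛ i ⊛ (i ⊛ i ⊛ i ⊛ i ⊛ i)))) (trans (cong ℤ→ℚ absolute) (value-of (at (+ (∣ n ∣ ℕ.^ 5)) ⊛ at (+ (∣ n ∣ ℕ.^ 5)))))))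
  where
  shape : ∀ t e → t * t * t * t * t * (t * t * t * t * t) * (e * (e * (e * (e * e))) * (e * (e * (e * (e * e))))) ≡ t * e * (t * e) * (t * e) * (t * e) * (t * e) * (t * e * (t * e) * (t * e) * (t * e) * (t * e))
  shape = solve-∀ ℚ-ring
  n⁵ = n ℤ.* n ℤ.* n ℤ.* n ℤ.* n
  abs⁵ : ∣ n⁵ ∣ ≡ ∣ n ∣ ℕ.^ 5
  abs⁵ = trans (trans (ℤP.abs-* (n ℤ.* n ℤ.* n ℤ.* n) n) (cong (ℕ._* ∣ n ∣) (trans (ℤP.abs-* (n ℤ.* n ℤ.* n) n) (cong (ℕ._* ∣ n ∣) (trans (ℤP.abs-* (n ℤ.* n) n) (cong (ℕ._* ∣ n ∣) (ℤP.abs-* n n))))))) (shapeℕ ∣ n ∣)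
    where
    import Data.Nat.Tactic.RingSolver as ℕR
    shapeℕ : ∀ n → n ℕ.* n ℕ.* n ℕ.* n ℕ.* n ≡ n ℕ.* (n ℕ.* (n ℕ.* (n ℕ.* (n ℕ.* 1))))
    shapeℕ = ℕR.solve-∀
  absolute : n⁵ ℤ.* n⁵ ≡ + (∣ n ∣ ℕ.^ 5) ℤ.* + (∣ n ∣ ℕ.^ 5)
  absolute = trans (∣∣-square n⁵) (trans (ℤP.pos-* ∣ n⁵ ∣ ∣ n⁵ ∣) (cong₂ ℤ._*_ (cong +_ abs⁵) (cong +_ abs⁵)))

nonintegral⇒root : ∀ t → ↧ₙ t ≢ 1 → Root (ℤ→ℚ (ℤ.- (+ 1024))) (fifth t)
nonintegral⇒root t@(mkℚ n d-1 coprime) e≢1 = from (prime-factor e (s≤s z≤n) e≢1)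
  where
  e = suc d-1
  from : (∃ λ p → Prime p × p ∣ e) → Root (ℤ→ℚ (ℤ.- (+ 1024))) (fifth t)
  from (p , pr , p∣e) = certified-root (λ z → ℕ.≢-nonZero⁻¹ (e ℕ.^ 5) {{ℕP.m^n≢0 e 5}} (ℤP.+-injective z)) (fifth-equation t n e (image (sym (numerator t))))
      (certificate-exists pr (∣ n ∣ ℕ.^ 5) e (prime-∤-^ pr p∤n 5) (s≤s z≤n) p∣e)
    where
    p∤n : p ∤ ∣ n ∣
    p∤n p∣n = ℕP.<-irrefl (sym (recompute coprime (p∣n , p∣e))) (ℕ.nonTrivial⇒n>1 p {{prime⇒nonTrivial pr}})

no-root⇒integer : ∀ t → (∀ xs → eval poly (t ∷ xs) ≢ 0ℚ) → IsInteger t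
no-root⇒integer t never with ↧ₙ t ℕ.≟ 1
... | yes e≡1 = ↥ t , trans (sym (ℚP.*-identityʳ t)) (trans (cong (λ e → t * ℤ→ℚ (+ e)) (sym e≡1)) (numerator t))
... | no e≢1 = ⊥-elim (from (nonintegral⇒root t e≢1))
  where
  from : Root (ℤ→ℚ (ℤ.- (+ 1024))) (fifth t) → ⊥
  -- At a zero of f the choice y = 0 makes both squares vanish.
  from (rootAt a₀ a₁ a₂ a₃ b₀ b₁ b₂ b₃ w₁ w₂ w₃ e) = never (0ℚ ∷ xs) (trans (value t 0ℚ xs) (cong (λ z → (0ℚ ^ℚ 28) + z * z) e))
    where
    xs : Vec ℚ 417
    xs = a₀ ∷ a₁ ∷ a₂ ∷ a₃ ∷ b₀ ∷ b₁ ∷ b₂ ∷ b₃ ∷ w₁ ∷ w₂ ∷ w₃ ∷ replicate 406 0ℚ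

theorem1 : Σ (Poly 419) (λ g → IsReduced g × totalDegree g ≡ 28 × ((t : ℚ) → (IsInteger t ⇔ ((xs : Vec ℚ 418) → eval g (t ∷ xs) ≢ 0ℚ))))
theorem1 = poly , reduced , degree , λ t → mk⇔ integer⇒no-root (no-root⇒integer t)
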